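{- Let $\mathbb{K}$ be a commutative semiring (with $0\ne1$) and let $S:\Delta^*\to\mathbb{K}$ be a formal power series. The following are equivalent: (1) $S$ is an algebraic formal power series; (2) $S=\pi(R)$ for some regular nested word series $R:\mathrm{NW}(\Delta)\to\mathbb{K}$; (3) there is a sentence $\varphi\in\mathrm{sRFO}(\mathbb{K})$ over the signature of nested words such that $[\![\exists\nu.\varphi]\!]^{\mathrm{nest}}=S$.
   Context: $\mathbb{K}$ is a commutative semiring with $0\ne 1$. $\Delta$ finite alphabet, $\Delta^*$ free monoid with empty word $\varepsilon$. A formal power series is $S:\Delta^*\to\mathbb K$; Cauchy product $(S_1S_2,w)=\sum_{w_1w_2=w}(S_1,w_1)(S_2,w_2)$; a word $u$ is identified with its characteristic series. For a set $\mathcal X$ of variables disjoint from $\Delta$, a polynomial is $P:(\Delta\cup\mathcal X)^*\to\mathbb K$ with finite support. An algebraic system is a family $(P_X)_{X\in\mathcal X}$ of polynomials; $(S_X)_{X\in\mathcal X}$ ($S_X:\Delta^*\to\mathbb K$) is a solution if $S_X=\sum_{u_1X_1\dots u_kX_ku_{k+1}\in\mathrm{supp}(P_X)}(P_X,u_1X_1\dots u_kX_ku_{k+1})\,u_1S_{X_1}\cdots u_kS_{X_k}u_{k+1}$ for all $X$ ($u_i\in\Delta^*$, $X_i\in\mathcal X$). The system is proper if $(P_X,Y)=(P_X,\varepsilon)=0$ for all $X,Y\in\mathcal X$; a proper system has exactly one quasiregular solution (i.e. with $(S_X,\varepsilon)=0$ for all $X$). $S$ is algebraic if it is a component of the quasiregular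 solution of a proper algebraic system. Nested words: a nesting relation of width $n$ is a binary relation $\nu$ on $[n]$ with: $\nu(i,j)\Rightarrow i<j$; $\nu(i,j),\nu(i,j')\Rightarrow j=j'$ and $\nu(i,j),\nu(i',j)\Rightarrow i=i'$; $\nu(i,j),\nu(i',j'),i<i'\Rightarrow j<i'$ or $j'<j$. $\mathrm{Nest}_n$ is the set of these. A nested word is $(w,\nu)$, $w=a_1\dots a_n\in\Delta^+$, $\nu\in\mathrm{Nest}_n$; $(i,j)\in\nu$ makes $i$ a call and $j$ a return position, others are internal; $\mathrm{NW}(\Delta)$ is their set. The projection is $\pi(w,\nu)=w$, and for $R:\mathrm{NW}(\Delta)\to\mathbb K$, $(\pi(R),w)=\sum_{nw\in\mathrm{NW}(\Delta),\pi(nw)=w}(R,nw)$. Regular: $R$ is regular if $R=\|\mathcal A\|$ for a WNWA $\mathcal A=(Q,\iota,(\delta_{call},\delta_{int},\delta_{ret}),\kappa)$: $Q$ finite, $\delta_{call},\delta_{int}:Q\times\Delta\times Q\to\mathbb K$, $\delta_{ret}:Q\times Q\times\Delta\times Q\to\mathbb K$, $\iota,\kappa:Q\to\mathbb K$; a run on $(a_1\dots a_n,\nu)$ is $(q_0,\dots,q_n)\in Q^{n+1}$ with weight $\prod_j$ of $\delta_{call}(q_{j-1},a_j,q_j)$ ($j$ call), $\delta_{int}(q_{j-1},a_j,q_j)$ ($j$ internal), $\delta_{ret}(q_{j-1},q_{i-1},a_j,q_j)$ ($(i,j)\in\nu$); $(\|\mathcal A\|,nw)=\sum_{q_0,q_n}\iota(q_0)\sum_{\text{runs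 }q_0\to q_n}\mathrm{weight}\cdot\kappa(q_n)$. Logic: a nested word is the structure on $[n]$ with $\mathrm{Lab}_a$ ($a\in\Delta$), natural order $\le$ and $\nu$. Weighted formulas: $\varphi::=k\mid\alpha\mid\neg\alpha\mid\varphi\vee\varphi\mid\varphi\wedge\varphi\mid\exists x.\varphi\mid\exists X.\varphi\mid\forall x.\varphi\mid\forall X.\varphi$, $k\in\mathbb K$, $\alpha$ atomic ($x=y$, $\mathrm{Lab}_a(x)$, $x\le y$, $\nu(x,y)$, $x\in X$); semantics: constants give $k$, (negated) atomic formulas give $1$/$0$, $\vee\mapsto+$, $\wedge\mapsto\cdot$, $\exists\mapsto$ sum over positions/sets, $\forall\mapsto$ product. For classical MSO $\varphi$: atomic $\varphi^+=\varphi,\varphi^-=\neg\varphi$; $(\neg\psi)^\pm=\psi^\mp$; $(\psi\vee\psi')^+=\psi^+\vee(\psi^-\wedge\psi'^+)$, $(\psi\vee\psi')^-=\psi^-\wedge\psi'^-$; $(\exists x.\psi(x))^+=\exists x.\psi(x)^+\wedge\forall y.(y<x\wedge\psi(y))^-$, $(\exists x.\psi)^-=\forall x.\psi^-$; $(\exists X.\psi(X))^+=\exists X.\psi(X)^+\wedge\forall Y.(Y<X\wedge\psi(Y))^-$, $(\exists X.\psi)^-=\forall X.\psi^-$ ($Y<X$ the lexicographic order on sets: $\exists y.(y\in X\wedge\neg y\in Y\wedge\forall z.(z<y\to(z\in Y\leftrightarrow z\in X)))$). These $\varphi^\pm$ are syntactically unambiguous. $\mathrm{aUMSO}(\mathbb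 K)$: smallest set with all constants and syntactically unambiguous formulas closed under $\wedge,\vee$. $\mathrm{sRFO}(\mathbb K)$: weighted formulas without set quantifiers such that for every subformula $\forall x.\psi$, $\psi\in\mathrm{aUMSO}(\mathbb K)$. For a sentence $\varphi$: $([\![\exists\nu.\varphi]\!]^{\mathrm{nest}},w)=\sum_{nw\in\mathrm{NW}(\Delta),\ \pi(nw)=w}([\![\varphi]\!],nw)=\sum_{\nu\in\mathrm{Nest}_{|w|}}[\![\varphi]\!](w,\nu)$ for $w\ne\varepsilon$, and $0$ for $w=\varepsilon$. -}

module Defs where

open import Level using (_⊔_)
open import Algebra.Bundles using (CommutativeSemiring)
open import Data.Nat using (ℕ; zero; suc)
open import Data.Fin using (Fin; zero; suc; inject₁; _≟_; _<?_; _≤?_)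
open import Data.Bool using (Bool; true; false; T; not; _∧_; _∨_; if_then_else_)
open import Data.List using (List; []; _∷_; length; null; map; foldr; concatMap; lookup)
open import Data.Bool.ListAction using (all; any)
open import Data.List.Properties using (≡-dec)
open import Data.List.Membership.Propositional using (_∉_)
open import Data.List.Relation.Unary.Unique.Propositional using (Unique)
open import Data.Vec using (Vec; []; _∷_)
import Data.Vec as V
open import Data.Maybe using (Maybe; just; nothing)
open import Data.Sum using (_⊎_; inj₁; inj₂)
open import Data.Product using (Σ; _×_; _,_; proj₁; proj₂)
open import Data.Unit using (tt)
open import Relation.Nullary.Decidable using (⌊_⌋; yes; no)
open import Relation.Binary.PropositionalEquality using (_≡_)

allFin : (n : ℕ) → List (Fin n)
allFin zero = []
allFin (suc n) = zero ∷ map suc (allFin n)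

allVecs : ∀ {a} {A : Set a} → List A → (n : ℕ) → List (Vec A n)
allVecs xs zero = [] ∷ []
allVecs xs (suc n) = concatMap (λ x → map (x ∷_) (allVecs xs n)) xs

bools : List Bool
bools = true ∷ false ∷ []

splits : ∀ {a} {A : Set a} → List A → List (List A × List A)
splits [] = ([] , []) ∷ []
splits (x ∷ xs) = ([] , x ∷ xs) ∷ map (λ p → (x ∷ proj₁ p , proj₂ p)) (splits xs)

findFirst : ∀ {a} {A : Set a} → (A → Bool) → List A → Maybe A
findFirst p [] = nothing
findFirst p (x ∷ xs) = if p x then just x else findFirst p xs

_⇒ᵇ_ : Bool → Bool → Bool
a ⇒ᵇ b = not a ∨ b

-- Nesting relations of width n, as Boolean n×n matrices
-- (ν i j = entry (i , j)); positions are 0-based Fin n.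

Rel : ℕ → Set
Rel n = Vec (Vec Bool n) n

rel : ∀ {n} → Rel n → Fin n → Fin n → Bool
rel M i j = V.lookup (V.lookup M i) j

_<ᵇ_ : ∀ {n} → Fin n → Fin n → Bool
i <ᵇ j = ⌊ i <? j ⌋

_≡ᵇ_ : ∀ {n} → Fin n → Fin n → Bool
i ≡ᵇ j = ⌊ i ≟ j ⌋

isNestᵇ : ∀ {n} → Rel n → Bool
isNestᵇ {n} M =
  all (λ i → all (λ j → rel M i j ⇒ᵇ (i <ᵇ j)) (allFin n)) (allFin n)
  ∧ all (λ i → all (λ j → all (λ j' → (rel M i j ∧ rel M i j') ⇒ᵇ (j ≡ᵇ j')) (allFin n)) (allFin n)) (allFin n)
  ∧ all (λ i → all (λ i' → all (λ j → (rel M i j ∧ rel M i' j) ⇒ᵇ (i ≡ᵇ i')) (allFin n)) (allFin n)) (allFin n)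
  ∧ all (λ i → all (λ j → all (λ i' → all (λ j' →
        (rel M i j ∧ rel M i' j' ∧ (i <ᵇ i')) ⇒ᵇ ((j <ᵇ i') ∨ (j' <ᵇ j)))
        (allFin n)) (allFin n)) (allFin n)) (allFin n)

guard : ∀ {c} {C : Set c} → C → (b : Bool) → (T b → C) → C
guard z true g = g tt
guard z false g = z

module _ {c ℓ} (K : CommutativeSemiring c ℓ) (m : ℕ) where
  open CommutativeSemiring K using (Carrier; _≈_; _+_; _*_; 0#; 1#)

  Δ : Set
  Δ = Fin m

  Word : Set
  Word = List Δ

  sumL : List Carrier → Carrier
  sumL = foldr _+_ 0#

  prodL : List Carrier → Carrier
  prodL = foldr _*_ 1#

  Series : Set c
  Series = Word → Carrier

  charS : Word → Series
  charS u w with ≡-dec _≟_ u w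
  ... | yes _ = 1#
  ... | no _ = 0#

  _·ˢ_ : Series → Series → Series
  (S₁ ·ˢ S₂) w = sumL (map (λ p → S₁ (proj₁ p) * S₂ (proj₂ p)) (splits w))

  record Polynomial (N : ℕ) : Set (c ⊔ ℓ) where
    field
      coeff : List (Δ ⊎ Fin N) → Carrier
      supp : List (List (Δ ⊎ Fin N))
      supp-unique : Unique supp
      supp-covers : ∀ u → u ∉ supp → coeff u ≈ 0#

  evalMon : ∀ {N} → (Fin N → Series) → List (Δ ⊎ Fin N) → Series
  evalMon Sol [] = charS []
  evalMon Sol (inj₁ a ∷ u) = charS (a ∷ []) ·ˢ evalMon Sol u
  evalMon Sol (inj₂ X ∷ u) = Sol X ·ˢ evalMon Sol u

  evalPoly : ∀ {N} → Polynomial N → (Fin N → Series) → Series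
  evalPoly P Sol w = sumL (map (λ u → Polynomial.coeff P u * evalMon Sol u w) (Polynomial.supp P))

  Proper : ∀ {N} → (Fin N → Polynomial N) → Set ℓ
  Proper {N} P = ∀ X → (Polynomial.coeff (P X) [] ≈ 0#)
                     × (∀ Y → Polynomial.coeff (P X) (inj₂ Y ∷ []) ≈ 0#)

  IsSolution : ∀ {N} → (Fin N → Polynomial N) → (Fin N → Series) → Set ℓ
  IsSolution P Sol = ∀ X w → Sol X w ≈ evalPoly (P X) Sol w

  QuasiRegular : ∀ {N} → (Fin N → Series) → Set ℓ
  QuasiRegular Sol = ∀ X → Sol X [] ≈ 0#

  -- S is a component of the (unique) quasiregular solution of a proper system
  Algebraic : Series → Set (c ⊔ ℓ)
  Algebraic S =
    Σ ℕ λ N → Σ (Fin N → Polynomial N) λ P → Proper P ×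
    Σ (Fin N → Series) λ Sol → IsSolution P Sol × QuasiRegular Sol ×
    Σ (Fin N) λ X → ∀ w → S w ≈ Sol X w

  record NestedWord : Set where
    constructor mkNW
    field
      word : Word
      nonEmpty : T (not (null word))
      nest : Rel (length word)
      isNest : T (isNestᵇ nest)

  NWSeries : Set c
  NWSeries = NestedWord → Carrier

  proj : NWSeries → Series
  proj R [] = 0#
  proj R (a ∷ as) =
    sumL (map (λ M → guard 0# (isNestᵇ M) (λ p → R (mkNW (a ∷ as) tt M p)))
              (allVecs (allVecs bools (length (a ∷ as))) (length (a ∷ as))))

  record WNWA (q : ℕ) : Set c where
    field
      ι κ : Fin q → Carrier
      δcall δint : Fin q → Δ → Fin q → Carrier
      δret : Fin q → Fin q → Δ → Fin q → Carrier

  -- weight of a run (q₀,…,qₙ); position p (0-based) reads letter p,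
  -- goes from state q_p to q_{p+1}.
  runWeight : ∀ {q} → WNWA q → (nw : NestedWord) →
              Vec (Fin q) (suc (length (NestedWord.word nw))) → Carrier
  runWeight A nw r = prodL (map posW (allFin n))
    where
      open NestedWord nw
      n = length word
      posW : Fin n → Carrier
      posW p with any (λ j → rel nest p j) (allFin n)
                | findFirst (λ i → rel nest i p) (allFin n)
      ... | true  | _ = WNWA.δcall A (V.lookup r (inject₁ p)) (lookup word p) (V.lookup r (suc p))
      ... | false | just i = WNWA.δret A (V.lookup r (inject₁ p)) (V.lookup r (inject₁ i))
                                        (lookup word p) (V.lookup r (suc p))
      ... | false | nothing = WNWA.δint A (V.lookup r (inject₁ p)) (lookup word p) (V.lookup r (suc p))

  behaviour : ∀ {q} → WNWA q → NWSeries
  behaviour {q} A nw =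
    sumL (map (λ r → WNWA.ι A (V.head r) * runWeight A nw r * WNWA.κ A (V.last r))
              (allVecs (allFin q) (suc (length (NestedWord.word nw)))))

  Regular : NWSeries → Set (c ⊔ ℓ)
  Regular R = Σ ℕ λ q → Σ (WNWA q) λ A → ∀ nw → R nw ≈ behaviour A nw

  -- Weighted MSO over nested words (de Bruijn: f first-order and
  -- s second-order free variables)

  data Atom (f s : ℕ) : Set where
    eq   : Fin f → Fin f → Atom f s
    lab  : Δ → Fin f → Atom f s
    le   : Fin f → Fin f → Atom f s
    nu   : Fin f → Fin f → Atom f s
    mem  : Fin f → Fin s → Atom f s

  data WF : ℕ → ℕ → Set c where
    const : ∀ {f s} → Carrier → WF f s
    atom  : ∀ {f s} → Atom f s → WF f s
    natom : ∀ {f s} → Atom f s → WF f s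
    _∨ʷ_  : ∀ {f s} → WF f s → WF f s → WF f s
    _∧ʷ_  : ∀ {f s} → WF f s → WF f s → WF f s
    ∃₁    : ∀ {f s} → WF (suc f) s → WF f s
    ∃₂    : ∀ {f s} → WF f (suc s) → WF f s
    ∀₁    : ∀ {f s} → WF (suc f) s → WF f s
    ∀₂    : ∀ {f s} → WF f (suc s) → WF f s

  data MSO : ℕ → ℕ → Set where
    atom : ∀ {f s} → Atom f s → MSO f s
    ¬ᶜ   : ∀ {f s} → MSO f s → MSO f s
    _∨ᶜ_ : ∀ {f s} → MSO f s → MSO f s → MSO f s
    ∃₁   : ∀ {f s} → MSO (suc f) s → MSO f s
    ∃₂   : ∀ {f s} → MSO f (suc s) → MSO f s

  ext : ∀ {a} {A : Set a} {k} → A → (Fin k → A) → Fin (suc k) → A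
  ext x ρ zero = x
  ext x ρ (suc i) = ρ i

  atomᵇ : ∀ {f s} (nw : NestedWord) → Atom f s →
          (Fin f → Fin (length (NestedWord.word nw))) →
          (Fin s → Vec Bool (length (NestedWord.word nw))) → Bool
  atomᵇ nw (eq x y) ρ σ = ρ x ≡ᵇ ρ y
  atomᵇ nw (lab a x) ρ σ = ⌊ a ≟ lookup (NestedWord.word nw) (ρ x) ⌋
  atomᵇ nw (le x y) ρ σ = ⌊ ρ x ≤? ρ y ⌋
  atomᵇ nw (nu x y) ρ σ = rel (NestedWord.nest nw) (ρ x) (ρ y)
  atomᵇ nw (mem x X) ρ σ = V.lookup (σ X) (ρ x)

  𝟙 : Bool → Carrier
  𝟙 true = 1#
  𝟙 false = 0#

  ⟦_⟧ : ∀ {f s} → WF f s → (nw : NestedWord) →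
        (Fin f → Fin (length (NestedWord.word nw))) →
        (Fin s → Vec Bool (length (NestedWord.word nw))) → Carrier
  ⟦ const k ⟧ nw ρ σ = k
  ⟦ atom α ⟧ nw ρ σ = 𝟙 (atomᵇ nw α ρ σ)
  ⟦ natom α ⟧ nw ρ σ = 𝟙 (not (atomᵇ nw α ρ σ))
  ⟦ φ ∨ʷ ψ ⟧ nw ρ σ = ⟦ φ ⟧ nw ρ σ + ⟦ ψ ⟧ nw ρ σ
  ⟦ φ ∧ʷ ψ ⟧ nw ρ σ = ⟦ φ ⟧ nw ρ σ * ⟦ ψ ⟧ nw ρ σ
  ⟦ ∃₁ φ ⟧ nw ρ σ = sumL (map (λ i → ⟦ φ ⟧ nw (ext i ρ) σ) (allFin (length (NestedWord.word nw))))
  ⟦ ∃₂ φ ⟧ nw ρ σ = sumL (map (λ X → ⟦ φ ⟧ nw ρ (ext X σ)) (allVecs bools (length (NestedWord.word nw))))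
  ⟦ ∀₁ φ ⟧ nw ρ σ = prodL (map (λ i → ⟦ φ ⟧ nw (ext i ρ) σ) (allFin (length (NestedWord.word nw))))
  ⟦ ∀₂ φ ⟧ nw ρ σ = prodL (map (λ X → ⟦ φ ⟧ nw ρ (ext X σ)) (allVecs bools (length (NestedWord.word nw))))

  ⟦_⟧ˢ : WF 0 0 → NWSeries
  ⟦ φ ⟧ˢ nw = ⟦ φ ⟧ nw (λ ()) (λ ())

  existsNest : WF 0 0 → Series
  existsNest φ = proj ⟦ φ ⟧ˢ

  lift : ∀ {k k'} → (Fin k → Fin k') → Fin (suc k) → Fin (suc k')
  lift ρ zero = zero
  lift ρ (suc i) = suc (ρ i)

  renAtom : ∀ {f f' s s'} → (Fin f → Fin f') → (Fin s → Fin s') → Atom f s → Atom f' s'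
  renAtom ρ σ (eq x y) = eq (ρ x) (ρ y)
  renAtom ρ σ (lab a x) = lab a (ρ x)
  renAtom ρ σ (le x y) = le (ρ x) (ρ y)
  renAtom ρ σ (nu x y) = nu (ρ x) (ρ y)
  renAtom ρ σ (mem x X) = mem (ρ x) (σ X)

  ren : ∀ {f f' s s'} → (Fin f → Fin f') → (Fin s → Fin s') → WF f s → WF f' s'
  ren ρ σ (const k) = const k
  ren ρ σ (atom α) = atom (renAtom ρ σ α)
  ren ρ σ (natom α) = natom (renAtom ρ σ α)
  ren ρ σ (φ ∨ʷ ψ) = ren ρ σ φ ∨ʷ ren ρ σ ψ
  ren ρ σ (φ ∧ʷ ψ) = ren ρ σ φ ∧ʷ ren ρ σ ψ
  ren ρ σ (∃₁ φ) = ∃₁ (ren (lift ρ) σ φ)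
  ren ρ σ (∃₂ φ) = ∃₂ (ren ρ (lift σ) φ)
  ren ρ σ (∀₁ φ) = ∀₁ (ren (lift ρ) σ φ)
  ren ρ σ (∀₂ φ) = ∀₂ (ren ρ (lift σ) φ)

  -- ψ(x) ↦ ψ(y) in a context with a fresh variable y (index 0) in front
  -- of the old bound variable x (index 1):  0 ↦ 0, k+1 ↦ k+2
  shiftUnder : ∀ {k} → Fin (suc k) → Fin (suc (suc k))
  shiftUnder zero = zero
  shiftUnder (suc i) = suc (suc i)

  Pair : ℕ → ℕ → Set c
  Pair f s = WF f s × WF f s

  atomP : ∀ {f s} → Atom f s → Pair f s
  atomP α = atom α , natom α

  notP : ∀ {f s} → Pair f s → Pair f s
  notP (p , n) = n , p

  orP : ∀ {f s} → Pair f s → Pair f s → Pair f s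
  orP (p , n) (p' , n') = (p ∨ʷ (n ∧ʷ p')) , (n ∧ʷ n')

  andP : ∀ {f s} → Pair f s → Pair f s → Pair f s
  andP a b = notP (orP (notP a) (notP b))

  _∧ᶜ_ : ∀ {f s} → MSO f s → MSO f s → MSO f s
  φ ∧ᶜ ψ = ¬ᶜ (¬ᶜ φ ∨ᶜ ¬ᶜ ψ)

  _→ᶜ_ : ∀ {f s} → MSO f s → MSO f s → MSO f s
  φ →ᶜ ψ = ¬ᶜ φ ∨ᶜ ψ

  _↔ᶜ_ : ∀ {f s} → MSO f s → MSO f s → MSO f s
  φ ↔ᶜ ψ = (φ →ᶜ ψ) ∧ᶜ (ψ →ᶜ φ)

  ∀ᶜ : ∀ {f s} → MSO (suc f) s → MSO f s
  ∀ᶜ φ = ¬ᶜ (∃₁ (¬ᶜ φ))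

  _<ᶜ_ : ∀ {f s} → Fin f → Fin f → MSO f s
  x <ᶜ y = ¬ᶜ (atom (le y x))

  -- Y < X (lexicographic), with X = set variable 1 and Y = set variable 0:
  -- ∃y.(y ∈ X ∧ ¬ y ∈ Y ∧ ∀z.(z < y → (z ∈ Y ↔ z ∈ X)))
  ltSet : ∀ {f s} → MSO f (suc (suc s))
  ltSet = ∃₁ (atom (mem zero (suc zero)) ∧ᶜ (¬ᶜ (atom (mem zero zero)) ∧ᶜ
            ∀ᶜ ((zero <ᶜ suc zero) →ᶜ (atom (mem zero zero) ↔ᶜ atom (mem zero (suc zero))))))

  renP : ∀ {f f' s s'} → (Fin f → Fin f') → (Fin s → Fin s') → Pair f s → Pair f' s'
  renP ρ σ (p , n) = ren ρ σ p , ren ρ σ n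

  -- translation, parameterised by the translation of ltSet (needed
  -- only to make the recursion structural; see pm below)
  pmWith : (∀ {f s} → Pair f (suc (suc s))) → ∀ {f s} → MSO f s → Pair f s
  pmWith lt (atom α) = atomP α
  pmWith lt (¬ᶜ φ) = notP (pmWith lt φ)
  pmWith lt (φ ∨ᶜ ψ) = orP (pmWith lt φ) (pmWith lt ψ)
  pmWith lt (∃₁ φ) =
    let r = pmWith lt φ in
    ∃₁ (proj₁ r ∧ʷ ∀₁ (proj₂ (andP (notP (atomP (le (suc zero) zero)))   -- (y < x)
                                    (renP shiftUnder (λ X → X) r))))     -- ψ(y)
    , ∀₁ (proj₂ r)
  pmWith lt (∃₂ φ) =
    let r = pmWith lt φ in
    ∃₂ (proj₁ r ∧ʷ ∀₂ (proj₂ (andP lt (renP (λ x → x) shiftUnder r))))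
    , ∀₂ (proj₂ r)

  -- ltSet contains no set quantifier, so the dummy argument is never used
  pm : ∀ {f s} → MSO f s → Pair f s
  pm = pmWith (λ {f} {s} → pmWith (const 0# , const 0#) (ltSet {f} {s}))

  _⁺ _⁻ : ∀ {f s} → MSO f s → WF f s
  φ ⁺ = proj₁ (pm φ)
  φ ⁻ = proj₂ (pm φ)

  SyntUnamb : ∀ {f s} → WF f s → Set c
  SyntUnamb {f} {s} φ = Σ (MSO f s) λ ψ → (φ ≡ ψ ⁺) ⊎ (φ ≡ ψ ⁻)

  data aUMSO {f s : ℕ} : WF f s → Set c where
    const : ∀ k → aUMSO (const k)
    su    : ∀ {φ} → SyntUnamb φ → aUMSO φ
    _∧ᵘ_  : ∀ {φ ψ} → aUMSO φ → aUMSO ψ → aUMSO (φ ∧ʷ ψ)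
    _∨ᵘ_  : ∀ {φ ψ} → aUMSO φ → aUMSO ψ → aUMSO (φ ∨ʷ ψ)

  data sRFO : ∀ {f s} → WF f s → Set c where
    const : ∀ {f s} k → sRFO {f} {s} (const k)
    atom  : ∀ {f s} (α : Atom f s) → sRFO (atom α)
    natom : ∀ {f s} (α : Atom f s) → sRFO (natom α)
    _∨ʳ_  : ∀ {f s} {φ ψ : WF f s} → sRFO φ → sRFO ψ → sRFO (φ ∨ʷ ψ)
    _∧ʳ_  : ∀ {f s} {φ ψ : WF f s} → sRFO φ → sRFO ψ → sRFO (φ ∧ʷ ψ)
    ∃₁    : ∀ {f s} {φ : WF (suc f) s} → sRFO φ → sRFO (∃₁ φ)
    ∀₁    : ∀ {f s} {φ : WF (suc f) s} → aUMSO φ → sRFO φ → sRFO (∀₁ φ)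

  Cond1 : Series → Set (c ⊔ ℓ)
  Cond1 S = Algebraic S

  Cond2 : Series → Set (c ⊔ ℓ)
  Cond2 S = Σ NWSeries λ R → Regular R × (∀ w → S w ≈ proj R w)

  Cond3 : Series → Set (c ⊔ ℓ)
  Cond3 S = Σ (WF 0 0) λ φ → sRFO φ × (∀ w → existsNest φ w ≈ S w)

{-# OPTIONS --safe #-}
module Submission where

-- A nesting of the positions of a word is a tree whose nodes are spans, so nested word series are series over
-- trees, and weighted tree automata are the common form of both sides. Their state sums are the weights of
-- nested word automata; they satisfy an algebraic system with one variable for each pair of states; and every
-- sRFO sentence is recognized by one, since an unambiguous formula takes the values 0 and 1 and is decided by
-- a finite tree algebra.
--
-- Conversely, an algebraic system is brought to a form in which each monomial with a variable begins with many
-- letters, more than there are variables, and ends with a letter (stars of the corner matrices, as in the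
-- Greibach normal form of Rosenkrantz). The factor derived from the i-th variable is then spanned by an arc,
-- and the i is marked by an additional arc around nothing, placed between the leading letters. The nesting
-- thus determines the derivation, and its weight is a product of local weights that are first-order definable.

open import Algebra.Bundles using (Semiring; CommutativeSemiring)
open import Data.Bool as Bool using (Bool; true; false; not; _∧_; _∨_)
import Data.Bool.Properties as Boolₚ
open import Data.Empty using (⊥; ⊥-elim)
open import Data.Fin using (Fin; zero; suc; inject₁; toℕ; fromℕ)
import Data.Fin.Properties as Finₚ
open import Data.List using (List; []; _∷_)
import Data.List.Membership.DecPropositional as DecMem
open import Data.List.Membership.Propositional using (_∈_)
import Data.List.Properties as Listₚ
import Data.List.Relation.Unary.All as All
import Data.List.Relation.Unary.All.Properties as Allₚ
import Data.List.Relation.Unary.AllPairs as AllPairs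
import Data.List.Relation.Unary.AllPairs.Properties as AllPairsₚ
open import Data.List.Relation.Unary.Any using (here; there)
import Data.List.Relation.Unary.Unique.DecPropositional.Properties as UniqDec
open import Data.List.Relation.Unary.Unique.Propositional using (Unique)
import Data.List.Relation.Unary.Unique.Propositional.Properties as Uniq
open import Data.Maybe as Maybe using (Maybe; just; nothing)
import Data.Maybe.Properties as Maybeₚ
open import Data.Nat as ℕ using (ℕ; zero; suc)
import Data.Nat.Properties as ℕₚ
open import Data.Product using (_×_; _,_; proj₁; proj₂; Σ; ∃)
import Data.Product.Properties as Prodₚ
open import Data.Sum using (_⊎_; inj₁; inj₂)
import Data.Sum.Properties as Sumₚ
open import Data.Unit using (⊤; tt)
open import Data.Vec as V using (Vec)
import Data.Vec.Properties as Vecₚ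
open import Function using (_∘_)
open import Function.Bundles using (_⇔_; mk⇔)
open import Relation.Binary.PropositionalEquality as ≡ using (_≡_; _≢_)
open import Relation.Nullary using (Dec; yes; no; does; ¬_)
open import Relation.Nullary.Decidable using (⌊_⌋)
import Defs

-- What shapes the way from systems to formulas is that `sRFO` has no set quantifiers: a formula
-- cannot guess the variables of a derivation, so they must be legible in the nesting. To name
-- variable i, the mark is put after i letters and uses up two more, hence the number of leading
-- letters required grows with the number of variables. This is not circular, because the passage to
-- corner matrices fixes that number at N + 2N², and the later substitutions lengthen monomials
-- without adding variables. Words of letters alone may stay too short for a mark; they are
-- substituted into the occurrences of their variable. Systems are compared on one fixed word at a
-- time. There a series becomes the matrix of its coefficients at the factors of the word, the
-- Cauchy product becomes the product of matrices, and quasiregular series become strictly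
-- triangular matrices. These are nilpotent, so stars are finite sums over any semiring, and a
-- system whose monomials begin with letters has only one triangular solution.

-- Boolean reflection.

module Booleans where
  open import Data.Bool.ListAction using (all; any)
  open import Relation.Binary.PropositionalEquality using (refl; sym; cong₂)

  absurd : ∀ {a} {A : Set a} {b} → b ≡ true → b ≡ false → A
  absurd refl ()

  bool-ext : ∀ {a b} → (a ≡ true → b ≡ true) → (b ≡ true → a ≡ true) → a ≡ b
  bool-ext {true} f g = sym (f refl)
  bool-ext {false} {true} f g = g refl
  bool-ext {false} {false} f g = refl

  ∧⁻ : ∀ {a b} → a ∧ b ≡ true → a ≡ true × b ≡ true
  ∧⁻ {true} e = refl , e

  ∧⁺ : ∀ {a b} → a ≡ true → b ≡ true → a ∧ b ≡ true
  ∧⁺ refl refl = refl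

  ∨⁻ : ∀ {a b} → a ∨ b ≡ true → a ≡ true ⊎ b ≡ true
  ∨⁻ {true} _ = inj₁ refl
  ∨⁻ {false} e = inj₂ e

  ∨⁺ : ∀ {a b} → a ≡ true ⊎ b ≡ true → a ∨ b ≡ true
  ∨⁺ {true} _ = refl
  ∨⁺ {false} (inj₂ e) = e

  ⌊⌋-true : ∀ {p} {P : Set p} (d : Dec P) → P → ⌊ d ⌋ ≡ true
  ⌊⌋-true (yes _) _ = refl
  ⌊⌋-true (no ¬p) p = ⊥-elim (¬p p)

  ⌊⌋-false : ∀ {p} {P : Set p} (d : Dec P) → ¬ P → ⌊ d ⌋ ≡ false
  ⌊⌋-false (yes p) ¬p = ⊥-elim (¬p p)
  ⌊⌋-false (no _) _ = refl

  ⌊⌋-true⁻ : ∀ {p} {P : Set p} (d : Dec P) → ⌊ d ⌋ ≡ true → P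
  ⌊⌋-true⁻ (yes p) _ = p

  ⌊⌋-false⁻ : ∀ {p} {P : Set p} (d : Dec P) → ⌊ d ⌋ ≡ false → ¬ P
  ⌊⌋-false⁻ (no ¬p) _ = ¬p

  module _ {A : Set} where
    any-cong : ∀ {f g : A → Bool} xs → (∀ x → f x ≡ g x) → any f xs ≡ any g xs
    any-cong [] e = refl
    any-cong (x ∷ xs) e = cong₂ _∨_ (e x) (any-cong xs e)

    any-false : ∀ {f : A → Bool} xs → (∀ x → f x ≡ false) → any f xs ≡ false
    any-false [] h = refl
    any-false (x ∷ xs) h rewrite h x = any-false xs h

    not-any : ∀ (f : A → Bool) xs → not (any f xs) ≡ all (not ∘ f) xs
    not-any f [] = refl
    not-any f (x ∷ xs) with f x
    ... | true = refl
    ... | false = not-any f xs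

    any⁻ : ∀ (f : A → Bool) xs → any f xs ≡ true → ∃ λ x → x ∈ xs × f x ≡ true
    any⁻ f (x ∷ xs) e with f x in eq
    ... | true = x , here refl , eq
    ... | false = let (y , k , e′) = any⁻ f xs e in y , there k , e′

    any⁺ : ∀ {f : A → Bool} {xs x} → x ∈ xs → f x ≡ true → any f xs ≡ true
    any⁺ (here refl) e rewrite e = refl
    any⁺ {f = f} {x ∷ xs} (there k) e rewrite any⁺ {f = f} k e = Boolₚ.∨-zeroʳ (f x)

    all⁺ : ∀ {f : A → Bool} xs → (∀ x → f x ≡ true) → all f xs ≡ true
    all⁺ [] h = refl
    all⁺ (x ∷ xs) h rewrite h x = all⁺ xs h

    all⁻ : ∀ {f : A → Bool} {xs x} → all f xs ≡ true → x ∈ xs → f x ≡ true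
    all⁻ {f} {x ∷ xs} h k with f x in eq
    all⁻ h (here refl) | true = eq
    all⁻ h (there k) | true = all⁻ h k

    all-cong : ∀ {f g : A → Bool} xs → (∀ x → f x ≡ g x) → all f xs ≡ all g xs
    all-cong [] e = refl
    all-cong (x ∷ xs) e = cong₂ _∧_ (e x) (all-cong xs e)

-- Finite types and sums over them.

module FiniteSum where
  open import Algebra.Bundles using (CommutativeMonoid)
  open import Data.List using (map; foldr; concatMap; _++_; cartesianProduct)
  import Data.List as L
  open import Data.List.Membership.Propositional using (find)
  open import Data.List.Membership.Propositional.Properties
    using (∈-map⁺; ∈-map⁻; ∈-++⁺ˡ; ∈-++⁺ʳ; ∈-concatMap⁻; ∈-cartesianProduct⁺)
  open import Data.List.Membership.Propositional.Properties.WithK using (unique∧set⇒bag)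
  open import Data.List.Relation.Binary.BagAndSetEquality using (∼bag⇒↭)
  open import Data.List.Relation.Binary.Permutation.Propositional using (_↭_; refl; prep; swap; trans)
  open import Data.List.Relation.Unary.All using (All; []; _∷_)
  open import Data.List.Relation.Unary.AllPairs using ([]; _∷_)
  open import Data.List.Relation.Unary.Any using (index)
  open import Data.List.Relation.Unary.Any.Properties using (lookup-index)
  open import Data.Vec using ([]; _∷_)
  open import Function using (mk⇔)
  open import Relation.Binary.Definitions using (DecidableEquality)
  open import Level using (Level)
  open import Defs using (allFin; allVecs)

  private variable
    a b : Level
    A : Set a
    B : Set b

  -- The list has no repetitions, so that a sum over `en` counts every element once, and decidable
  -- equality supplies the Kronecker deltas by which such sums collapse.
  record FT {a} (A : Set a) : Set a where
    field
      en   : List A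
      dec  : DecidableEquality A
      mem  : ∀ x → x ∈ en
      uniq : Unique en

  allFin-mem : ∀ {n} (i : Fin n) → i ∈ allFin n
  allFin-mem zero = here ≡.refl
  allFin-mem (suc i) = there (∈-map⁺ suc (allFin-mem i))

  allFin-uniq : ∀ n → Unique (allFin n)
  allFin-uniq zero = []
  allFin-uniq (suc n) = Allₚ.map⁺ (All.universal (λ _ ()) _) ∷ Uniq.map⁺ Finₚ.suc-injective (allFin-uniq n)

  allVecs-mem : ∀ {xs : List A} → (∀ x → x ∈ xs) → ∀ {n} (v : Vec A n) → v ∈ allVecs xs n
  allVecs-mem m [] = here ≡.refl
  allVecs-mem {xs = xs} m {suc n} (x ∷ v) = go xs (m x)
    where
    go : ∀ ys → x ∈ ys → (x ∷ v) ∈ concatMap (λ y → map (y ∷_) (allVecs xs n)) ys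
    go (y ∷ ys) (here ≡.refl) = ∈-++⁺ˡ (∈-map⁺ (x ∷_) (allVecs-mem m v))
    go (y ∷ ys) (there p) = ∈-++⁺ʳ (map (y ∷_) (allVecs xs n)) (go ys p)

  ∈-concatMap⁻′ : ∀ {f : A → List B} xs {y} → y ∈ concatMap f xs → ∃ λ x → x ∈ xs × y ∈ f x
  ∈-concatMap⁻′ {f = f} xs p = find (∈-concatMap⁻ f {xs = xs} p)

  concatMap-uniq : ∀ {f : A → List B} {xs} → Unique xs → (∀ x → Unique (f x)) →
    (∀ {x x' y} → y ∈ f x → y ∈ f x' → x ≡ x') → Unique (concatMap f xs)
  concatMap-uniq [] u d = []
  concatMap-uniq {f = f} {x ∷ xs} (x∉ ∷ uxs) u d =
    Uniq.++⁺ (u x) (concatMap-uniq uxs u d)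
      λ { (p , q) → let (x' , m , r) = ∈-concatMap⁻′ xs q in All.lookup x∉ m (d p r) }

  allVecs-uniq : ∀ {xs : List A} → Unique xs → ∀ n → Unique (allVecs xs n)
  allVecs-uniq u zero = [] ∷ []
  allVecs-uniq {xs = xs} u (suc n) =
    concatMap-uniq u (λ x → Uniq.map⁺ (λ e → Vecₚ.∷-injectiveʳ e) (allVecs-uniq u n))
      λ {x} {x'} p q → let (_ , _ , e) = ∈-map⁻ (x ∷_) p ; (_ , _ , e') = ∈-map⁻ (x' ∷_) q
                       in Vecₚ.∷-injectiveˡ (≡.trans (≡.sym e) e')

  ft-Fin : ∀ n → FT (Fin n)
  ft-Fin n = record { en = allFin n ; dec = Finₚ._≟_ ; mem = allFin-mem ; uniq = allFin-uniq n }

  ft-Bool : FT Bool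
  ft-Bool = record { en = true ∷ false ∷ [] ; dec = Boolₚ._≟_
                   ; mem = λ { true → here ≡.refl ; false → there (here ≡.refl) }
                   ; uniq = ((λ ()) ∷ []) ∷ ([] ∷ []) }

  ft-Maybe : FT A → FT (Maybe A)
  ft-Maybe F = record { en = nothing ∷ map just en ; dec = Maybeₚ.≡-dec dec
                      ; mem = λ { nothing → here ≡.refl ; (just x) → there (∈-map⁺ just (mem x)) }
                      ; uniq = Allₚ.map⁺ (All.universal (λ _ ()) _) ∷ Uniq.map⁺ Maybeₚ.just-injective uniq }
    where open FT F

  ft-× : FT A → FT B → FT (A × B)
  ft-× F G = record { en = cartesianProduct F.en G.en ; dec = Prodₚ.≡-dec F.dec G.dec
                    ; mem = λ { (x , y) → ∈-cartesianProduct⁺ (F.mem x) (G.mem y) }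
                    ; uniq = Uniq.cartesianProduct⁺ F.uniq G.uniq }
    where module F = FT F
          module G = FT G

  ft-⊎ : FT A → FT B → FT (A ⊎ B)
  ft-⊎ F G = record { en = map inj₁ F.en ++ map inj₂ G.en ; dec = Sumₚ.≡-dec F.dec G.dec
                    ; mem = λ { (inj₁ x) → ∈-++⁺ˡ (∈-map⁺ inj₁ (F.mem x))
                              ; (inj₂ y) → ∈-++⁺ʳ _ (∈-map⁺ inj₂ (G.mem y)) }
                    ; uniq = Uniq.++⁺ (Uniq.map⁺ Sumₚ.inj₁-injective F.uniq)
                                      (Uniq.map⁺ Sumₚ.inj₂-injective G.uniq)
                                      λ { (p , q) → disj (∈-map⁻ inj₁ p) (∈-map⁻ inj₂ q) } }
    where module F = FT F
          module G = FT G
          disj : ∀ {x} → ∃ (λ y → y ∈ F.en × x ≡ inj₁ y) → ∃ (λ y → y ∈ G.en × x ≡ inj₂ y) → ⊥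
          disj (_ , _ , ≡.refl) (_ , _ , ())

  ft-Vec : FT A → ∀ n → FT (Vec A n)
  ft-Vec F n = record { en = allVecs en n ; dec = Vecₚ.≡-dec dec
                      ; mem = allVecs-mem mem ; uniq = allVecs-uniq uniq n }
    where open FT F

  -- Functions on a finite type, coded by their value vectors so that they form a finite type again.
  module Table {a} {A : Set a} (F : FT A) where
    open FT F
    Table : ∀ {b} → Set b → Set b
    Table B = Vec B (L.length en)

    tab : (A → B) → Table B
    tab f = V.tabulate (f ∘ L.lookup en)

    app : Table B → A → B
    app v x = V.lookup v (index (mem x))

    app-tab : ∀ (f : A → B) x → app (tab f) x ≡ f x
    app-tab f x = ≡.trans (Vecₚ.lookup∘tabulate (f ∘ L.lookup en) (index (mem x)))
                          (≡.cong f (≡.sym (lookup-index (mem x))))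

  module Fold {c ℓ} (M : CommutativeMonoid c ℓ) where
    open CommutativeMonoid M
      using (_≈_; _∙_; ε; ∙-cong; ∙-congˡ; ∙-congʳ; assoc; comm; identityˡ; identityʳ; commutativeSemigroup)
      renaming (Carrier to C; refl to ≈-refl; sym to ≈-sym; trans to ≈-trans)
    open import Algebra.Properties.CommutativeSemigroup commutativeSemigroup using (interchange)

    fold : List A → (A → C) → C
    fold xs f = foldr _∙_ ε (map f xs)

    fold-cong∈ : ∀ (xs : List A) {f g : A → C} → (∀ {x} → x ∈ xs → f x ≈ g x) → fold xs f ≈ fold xs g
    fold-cong∈ [] e = ≈-refl
    fold-cong∈ (x ∷ xs) e = ∙-cong (e (here ≡.refl)) (fold-cong∈ xs (e ∘ there))

    fold-cong : ∀ (xs : List A) {f g : A → C} → (∀ x → f x ≈ g x) → fold xs f ≈ fold xs g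
    fold-cong xs e = fold-cong∈ xs λ {x} _ → e x

    fold-ε : ∀ (xs : List A) {f : A → C} → (∀ x → f x ≈ ε) → fold xs f ≈ ε
    fold-ε [] e = ≈-refl
    fold-ε (x ∷ xs) e = ≈-trans (∙-cong (e x) (fold-ε xs e)) (identityˡ ε)

    fold-∙ : ∀ (xs : List A) f g → fold xs (λ x → f x ∙ g x) ≈ fold xs f ∙ fold xs g
    fold-∙ [] f g = ≈-sym (identityˡ ε)
    fold-∙ (x ∷ xs) f g = ≈-trans (∙-congˡ (fold-∙ xs f g)) (interchange _ _ _ _)

    fold-++ : ∀ (xs ys : List A) f → fold (xs ++ ys) f ≈ fold xs f ∙ fold ys f
    fold-++ [] ys f = ≈-sym (identityˡ _)
    fold-++ (x ∷ xs) ys f = ≈-trans (∙-congˡ (fold-++ xs ys f)) (≈-sym (assoc _ _ _))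

    fold-map : ∀ (g : A → B) xs (f : B → C) → fold (map g xs) f ≡ fold xs (f ∘ g)
    fold-map g [] f = ≡.refl
    fold-map g (x ∷ xs) f = ≡.cong (_ ∙_) (fold-map g xs f)

    fold-concatMap : ∀ (g : A → List B) xs f → fold (concatMap g xs) f ≈ fold xs (λ x → fold (g x) f)
    fold-concatMap g [] f = ≈-refl
    fold-concatMap g (x ∷ xs) f = ≈-trans (fold-++ (g x) _ f) (∙-congˡ (fold-concatMap g xs f))

    fold-swap : ∀ (xs : List A) (ys : List B) (f : A → B → C) →
      fold xs (λ x → fold ys (f x)) ≈ fold ys (λ y → fold xs (λ x → f x y))
    fold-swap [] ys f = ≈-sym (fold-ε ys λ _ → ≈-refl)
    fold-swap (x ∷ xs) ys f = ≈-trans (∙-congˡ (fold-swap xs ys f)) (≈-sym (fold-∙ ys _ _))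

    fold-cartesian : ∀ (xs : List A) (ys : List B) (f : A × B → C) →
      fold (cartesianProduct xs ys) f ≈ fold xs (λ x → fold ys (λ y → f (x , y)))
    fold-cartesian [] ys f = ≈-refl
    fold-cartesian (x ∷ xs) ys f = ≈-trans (fold-++ (map (x ,_) ys) _ f)
      (∙-cong (CommutativeMonoid.reflexive M (fold-map (x ,_) ys f)) (fold-cartesian xs ys f))

    fold-↭ : ∀ {xs ys : List A} f → xs ↭ ys → fold xs f ≈ fold ys f
    fold-↭ f _↭_.refl = ≈-refl
    fold-↭ f (prep x p) = ∙-congˡ (fold-↭ f p)
    fold-↭ f (swap x y p) = ≈-trans (∙-congˡ (∙-congˡ (fold-↭ f p)))
      (≈-trans (≈-sym (assoc _ _ _)) (≈-trans (∙-congʳ (comm _ _)) (assoc _ _ _)))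
    fold-↭ f (_↭_.trans p q) = ≈-trans (fold-↭ f p) (fold-↭ f q)

    -- Lists without repetitions that have the same elements are permutations of each other. This is
    -- the reindexing principle behind the change of fuel for trees and the passage from nesting
    -- matrices to trees.
    fold-same : ∀ {xs ys : List A} (f : A → C) → Unique xs → Unique ys →
      (∀ {x} → x ∈ xs → x ∈ ys) → (∀ {x} → x ∈ ys → x ∈ xs) → fold xs f ≈ fold ys f
    fold-same f u u' i i' = fold-↭ f (∼bag⇒↭ (unique∧set⇒bag u u' (mk⇔ i i')))

  module Sums {c ℓ} (R : Semiring c ℓ) where
    open Semiring R hiding (zero) renaming (Carrier to C; refl to ≈-refl; sym to ≈-sym; trans to ≈-trans)
    open Fold +-commutativeMonoid public using () renaming
      ( fold to ∑; fold-cong∈ to ∑-cong∈; fold-cong to ∑-cong; fold-ε to ∑-0; fold-∙ to ∑-+; fold-++ to ∑-++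
      ; fold-map to ∑-map; fold-concatMap to ∑-concatMap; fold-swap to ∑-swap; fold-cartesian to ∑-cartesian
      ; fold-same to ∑-same )

    ∑-*ˡ : ∀ (xs : List A) c f → c * ∑ xs f ≈ ∑ xs (λ x → c * f x)
    ∑-*ˡ [] c f = zeroʳ c
    ∑-*ˡ (x ∷ xs) c f = ≈-trans (distribˡ _ _ _) (+-congˡ (∑-*ˡ xs c f))

    ∑-*ʳ : ∀ (xs : List A) c f → ∑ xs f * c ≈ ∑ xs (λ x → f x * c)
    ∑-*ʳ [] c f = zeroˡ c
    ∑-*ʳ (x ∷ xs) c f = ≈-trans (distribʳ _ _ _) (+-congˡ (∑-*ʳ xs c f))

    ∑-*-∑ : ∀ (xs : List A) (ys : List B) (f : A → C) (g : B → C) → ∑ xs (λ x → ∑ ys λ y → f x * g y) ≈ ∑ xs f * ∑ ys g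
    ∑-*-∑ xs ys f g = ≈-sym (≈-trans (∑-*ʳ xs _ f) (∑-cong xs λ x → ∑-*ˡ ys (f x) g))

    ind : Bool → C
    ind true = 1#
    ind false = 0#

    [_] : ∀ {p} {P : Set p} → Dec P → C
    [ d ] = ind (does d)

    []-iff : ∀ {p q} {P : Set p} {Q : Set q} (d : Dec P) (e : Dec Q) → (P → Q) → (Q → P) → [ d ] ≡ [ e ]
    []-iff (yes p) (yes q) f g = ≡.refl
    []-iff (yes p) (no q) f g = ⊥-elim (q (f p))
    []-iff (no p) (yes q) f g = ⊥-elim (p (g q))
    []-iff (no p) (no q) f g = ≡.refl

    []-yes : ∀ {p} {P : Set p} (d : Dec P) → P → [ d ] ≡ 1#
    []-yes (yes _) _ = ≡.refl
    []-yes (no q) p = ⊥-elim (q p)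

    []-no : ∀ {p} {P : Set p} (d : Dec P) → (P → ⊥) → [ d ] ≡ 0#
    []-no (yes p) q = ⊥-elim (q p)
    []-no (no _) _ = ≡.refl

    []-*-cong : ∀ {p} {P : Set p} (d : Dec P) {x y} → (P → x ≈ y) → [ d ] * x ≈ [ d ] * y
    []-*-cong (yes p) e = *-congˡ (e p)
    []-*-cong (no _) e = ≈-trans (zeroˡ _) (≈-sym (zeroˡ _))

    ∑-0∈ : ∀ (xs : List A) {f : A → C} → (∀ {x} → x ∈ xs → f x ≈ 0#) → ∑ xs f ≈ 0#
    ∑-0∈ xs z = ≈-trans (∑-cong∈ xs z) (∑-0 xs λ _ → ≈-refl)

    ∑-only : ∀ {xs : List A} → Unique xs → ∀ {x} → x ∈ xs → ∀ (f : A → C) → (∀ y → x ≢ y → f y ≈ 0#) → ∑ xs f ≈ f x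
    ∑-only (y∉ ∷ u) (here ≡.refl) f z = ≈-trans (+-congˡ (∑-0∈ _ λ m → z _ (All.lookup y∉ m))) (+-identityʳ _)
    ∑-only (y∉ ∷ u) (there m) f z =
      ≈-trans (+-cong (z _ λ e → All.lookup y∉ m (≡.sym e)) (∑-only u m f z)) (+-identityˡ _)

    module _ {a} {A : Set a} (F : FT A) where
      open FT F

      ∑-δ : ∀ x (f : A → C) → ∑ en (λ y → [ dec x y ] * f y) ≈ f x
      ∑-δ x f = ≈-trans (∑-only uniq (mem x) _ λ y ne → ≈-trans (*-congʳ (reflexive ([]-no (dec x y) ne))) (zeroˡ _))
        (≈-trans (*-congʳ (reflexive ([]-yes (dec x x) ≡.refl))) (*-identityˡ _))

      ∑-δ′ : ∀ x (f : A → C) → ∑ en (λ y → [ dec y x ] * f y) ≈ f x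
      ∑-δ′ x f = ≈-trans (∑-cong en λ y → *-congʳ (reflexive ([]-iff (dec y x) (dec x y) ≡.sym ≡.sym))) (∑-δ x f)

      ∑-δʳ : ∀ x (f : A → C) → ∑ en (λ y → f y * [ dec y x ]) ≈ f x
      ∑-δʳ x f = ≈-trans (∑-only uniq (mem x) _ λ y ne → ≈-trans (*-congˡ (reflexive ([]-no (dec y x) (ne ∘ ≡.sym)))) (zeroʳ _))
        (≈-trans (*-congˡ (reflexive ([]-yes (dec x x) ≡.refl))) (*-identityʳ _))

-- Matrices, stars of nilpotent elements, and the matrix of a series on a word.

module Matrix where
  import Data.Fin as F
  open import Data.List using (length; lookup)
  open import Data.Nat using (s≤s)
  open import Defs using (allFin; splits; charS; _·ˢ_)
  open FiniteSum

  -- The entries may lie in a noncommutative semiring, so the construction can be iterated: `Blocks`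
  -- uses matrices whose entries are matrices.
  mat : ∀ {c ℓ} (R : Semiring c ℓ) {I : Set} → FT I → Semiring c ℓ
  mat R {I} F = record
    { Carrier = I → I → C
    ; _≈_ = λ M N → ∀ i j → M i j ≈ N i j
    ; _+_ = λ M N i j → M i j + N i j
    ; _*_ = λ M N i j → ∑ en (λ k → M i k * N k j)
    ; 0# = λ i j → 0#
    ; 1# = λ i j → [ dec i j ]
    ; isSemiring = record
      { isSemiringWithoutAnnihilatingZero = record
        { +-isCommutativeMonoid = record
          { isMonoid = record
            { isSemigroup = record
              { isMagma = record
                { isEquivalence = record
                  { refl = λ i j → ≈-refl
                  ; sym = λ e i j → ≈-sym (e i j)
                  ; trans = λ e f i j → ≈-trans (e i j) (f i j) }
                ; ∙-cong = λ e f i j → +-cong (e i j) (f i j) }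
              ; assoc = λ _ _ _ i j → +-assoc _ _ _ }
            ; identity = (λ _ i j → +-identityˡ _) , (λ _ i j → +-identityʳ _) }
          ; comm = λ _ _ i j → +-comm _ _ }
        ; *-cong = λ e f i j → ∑-cong en λ k → *-cong (e i k) (f k j)
        ; *-assoc = λ L M N i j → ≈-trans
            (∑-cong en λ k → ≈-trans (∑-*ʳ en _ _) (∑-cong en λ x → *-assoc _ _ _))
            (≈-trans (∑-swap en en _) (∑-cong en λ x → ≈-sym (∑-*ˡ en _ _)))
        ; *-identity = (λ M i j → ∑-δ F i (λ k → M k j)) , (λ M i j → ∑-δʳ F j (M i))
        ; distrib = (λ L M N i j → ≈-trans (∑-cong en λ k → distribˡ _ _ _) (∑-+ en _ _))
                  , (λ L M N i j → ≈-trans (∑-cong en λ k → distribʳ _ _ _) (∑-+ en _ _)) }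
      ; zero = (λ M i j → ∑-0 en λ k → zeroˡ _) , (λ M i j → ∑-0 en λ k → zeroʳ _) } }
    where
    open Semiring R hiding (zero) renaming (Carrier to C; refl to ≈-refl; sym to ≈-sym; trans to ≈-trans)
    open Sums R
    open FT F

  module Star {c ℓ} (R : Semiring c ℓ) where
    open Semiring R hiding (zero) renaming (Carrier to C)
    open import Relation.Binary.Reasoning.Setoid setoid

    -- `plus a k` is a + a² + ... + a^k. It plays the part of the proper star of `a`, which is a
    -- finite sum because the elements in question are nilpotent.
    pow plus : C → ℕ → C
    pow a zero = 1#
    pow a (suc k) = a * pow a k
    plus a zero = 0#
    plus a (suc k) = a + a * plus a k

    pow-comm : ∀ a k → pow a k * a ≈ a * pow a k
    pow-comm a zero = trans (*-identityˡ a) (sym (*-identityʳ a))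
    pow-comm a (suc k) = trans (*-assoc _ _ _) (*-congˡ (pow-comm a k))

    plus-pow : ∀ a k → plus a (suc k) ≈ plus a k + pow a (suc k)
    plus-pow a zero = trans (+-congˡ (zeroʳ a)) (trans (+-comm _ _) (+-congˡ (sym (*-identityʳ a))))
    plus-pow a (suc k) = begin
      a + a * plus a (suc k)                       ≈⟨ +-congˡ (*-congˡ (plus-pow a k)) ⟩
      a + a * (plus a k + pow a (suc k))           ≈⟨ +-congˡ (distribˡ _ _ _) ⟩
      a + (a * plus a k + a * pow a (suc k))       ≈⟨ sym (+-assoc _ _ _) ⟩
      plus a (suc k) + pow a (suc (suc k)) ∎

    plus-right : ∀ a k → plus a (suc k) ≈ a + plus a k * a
    plus-right a zero = +-congˡ (trans (zeroʳ a) (sym (zeroˡ a)))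
    plus-right a (suc k) = +-congˡ (begin
      a * plus a (suc k)        ≈⟨ *-congˡ (plus-right a k) ⟩
      a * (a + plus a k * a)    ≈⟨ distribˡ _ _ _ ⟩
      a * a + a * (plus a k * a) ≈⟨ +-congˡ (sym (*-assoc _ _ _)) ⟩
      a * a + (a * plus a k) * a ≈⟨ sym (distribʳ _ _ _) ⟩
      plus a (suc k) * a ∎)

    -- Substituting the equation into itself k times leaves the remainder s a^(k+1). For nilpotent
    -- `a` it vanishes, and the equation is solved without subtraction.
    unrollʳ : ∀ {a l s} → s ≈ l + s * a → ∀ k → s ≈ (l + l * plus a k) + s * pow a (suc k)
    unrollʳ {a} {l} {s} e zero = begin
      s                               ≈⟨ e ⟩
      l + s * a                       ≈⟨ +-cong (sym (trans (+-congˡ (zeroʳ l)) (+-identityʳ l))) (*-congˡ (sym (*-identityʳ a))) ⟩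
      (l + l * 0#) + s * (a * 1#) ∎
    unrollʳ {a} {l} {s} e (suc k) = begin
      s                                                              ≈⟨ e ⟩
      l + s * a                                                      ≈⟨ +-congˡ (*-congʳ (unrollʳ e k)) ⟩
      l + ((l + l * plus a k) + s * pow a (suc k)) * a               ≈⟨ +-congˡ (distribʳ _ _ _) ⟩
      l + ((l + l * plus a k) * a + s * pow a (suc k) * a)           ≈⟨ sym (+-assoc _ _ _) ⟩
      (l + (l + l * plus a k) * a) + s * pow a (suc k) * a           ≈⟨ +-cong (+-congˡ lem) (trans (*-assoc _ _ _) (*-congˡ (pow-comm a (suc k)))) ⟩
      (l + l * plus a (suc k)) + s * pow a (suc (suc k)) ∎
      where
      lem : (l + l * plus a k) * a ≈ l * plus a (suc k)
      lem = begin
        (l + l * plus a k) * a         ≈⟨ distribʳ _ _ _ ⟩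
        l * a + l * plus a k * a       ≈⟨ +-congˡ (*-assoc _ _ _) ⟩
        l * a + l * (plus a k * a)     ≈⟨ sym (distribˡ _ _ _) ⟩
        l * (a + plus a k * a)         ≈⟨ *-congˡ (sym (plus-right a k)) ⟩
        l * plus a (suc k) ∎

    unrollˡ : ∀ {a l s} → s ≈ l + a * s → ∀ k → s ≈ (l + plus a k * l) + pow a (suc k) * s
    unrollˡ {a} {l} {s} e zero = begin
      s                               ≈⟨ e ⟩
      l + a * s                       ≈⟨ +-cong (sym (trans (+-congˡ (zeroˡ l)) (+-identityʳ l))) (*-congʳ (sym (*-identityʳ a))) ⟩
      (l + 0# * l) + (a * 1#) * s ∎
    unrollˡ {a} {l} {s} e (suc k) = begin
      s                                                              ≈⟨ e ⟩
      l + a * s                                                      ≈⟨ +-congˡ (*-congˡ (unrollˡ e k)) ⟩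
      l + a * ((l + plus a k * l) + pow a (suc k) * s)               ≈⟨ +-congˡ (distribˡ _ _ _) ⟩
      l + (a * (l + plus a k * l) + a * (pow a (suc k) * s))         ≈⟨ sym (+-assoc _ _ _) ⟩
      (l + a * (l + plus a k * l)) + a * (pow a (suc k) * s)         ≈⟨ +-cong (+-congˡ lem) (sym (*-assoc _ _ _)) ⟩
      (l + plus a (suc k) * l) + pow a (suc (suc k)) * s ∎
      where
      lem : a * (l + plus a k * l) ≈ plus a (suc k) * l
      lem = begin
        a * (l + plus a k * l)         ≈⟨ distribˡ _ _ _ ⟩
        a * l + a * (plus a k * l)     ≈⟨ +-congˡ (sym (*-assoc _ _ _)) ⟩
        a * l + a * plus a k * l       ≈⟨ sym (distribʳ _ _ _) ⟩
        (a + a * plus a k) * l ∎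

    module _ {a M} (nil : pow a (suc M) ≈ 0#) where
      plus-fixˡ : plus a M ≈ a + a * plus a M
      plus-fixˡ = sym (trans (plus-pow a M) (trans (+-congˡ nil) (+-identityʳ _)))

      plus-fixʳ : plus a M ≈ a + plus a M * a
      plus-fixʳ = trans plus-fixˡ (plus-right a M)

      solveʳ : ∀ {l s} → s ≈ l + s * a → s ≈ l + l * plus a M
      solveʳ e = trans (unrollʳ e M) (trans (+-congˡ (trans (*-congˡ nil) (zeroʳ _))) (+-identityʳ _))

      solveˡ : ∀ {l s} → s ≈ l + a * s → s ≈ l + plus a M * l
      solveˡ e = trans (unrollˡ e M) (trans (+-congˡ (trans (*-congʳ nil) (zeroˡ _))) (+-identityʳ _))

  -- Matrices indexed by the points 0, …, n between the letters of a word of length n.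
  module Points {c ℓ} (K : CommutativeSemiring c ℓ) where
    open CommutativeSemiring K hiding (zero) renaming (Carrier to C; refl to ≈-refl; sym to ≈-sym; trans to ≈-trans)
    open Sums semiring

    𝕄 : ℕ → Semiring c ℓ
    𝕄 n = mat semiring (ft-Fin (suc n))

    Mat : ℕ → Set c
    Mat n = Semiring.Carrier (𝕄 n)

    infix 4 _≋_
    _≋_ : ∀ {n} → Mat n → Mat n → Set ℓ
    _≋_ {n} = Semiring._≈_ (𝕄 n)

    infixl 7 _⊛_
    _⊛_ : ∀ {n} → Mat n → Mat n → Mat n
    _⊛_ {n} = Semiring._*_ (𝕄 n)

    infixr 8 _•_
    _•_ : ∀ {n} → C → Mat n → Mat n
    (x • M) i j = x * M i j

    •-⊛ˡ : ∀ {n} x (M N : Mat n) → x • (M ⊛ N) ≋ (x • M) ⊛ N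
    •-⊛ˡ {n} x M N i j = ≈-trans (∑-*ˡ (allFin (suc n)) x _) (∑-cong (allFin (suc n)) λ k → ≈-sym (*-assoc _ _ _))

    •-⊛ʳ : ∀ {n} x (M N : Mat n) → M ⊛ (x • N) ≋ x • (M ⊛ N)
    •-⊛ʳ {n} x M N i j = ≈-sym (≈-trans (∑-*ˡ (allFin (suc n)) x _) (∑-cong (allFin (suc n)) λ k →
      ≈-trans (≈-sym (*-assoc _ _ _)) (≈-trans (*-congʳ (*-comm _ _)) (*-assoc _ _ _))))

    -- The shape of the matrix of a series whose words have at least k letters: for k = 0 it is
    -- upper triangular, for k = 1 strictly so. Widths add up in products, and a width above n
    -- leaves only zero; this is the source of nilpotency.
    Band : ∀ {n} → ℕ → Mat n → Set ℓ
    Band k M = ∀ i j → toℕ j ℕ.< k ℕ.+ toℕ i → M i j ≈ 0#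

    Band-⊛ : ∀ {n k l} {M N : Mat n} → Band k M → Band l N → Band (k ℕ.+ l) (M ⊛ N)
    Band-⊛ {n} {k} {l} {M} {N} bM bN i j lt = ∑-0 (allFin (suc n)) λ x → go x
      where
      go : ∀ x → M i x * N x j ≈ 0#
      go x with toℕ x ℕ.<? k ℕ.+ toℕ i
      ... | yes p = ≈-trans (*-congʳ (bM i x p)) (zeroˡ _)
      ... | no q = ≈-trans (*-congˡ (bN x j (ℕₚ.<-≤-trans lt
            (≡.subst (ℕ._≤ l ℕ.+ toℕ x) (≡.trans (≡.sym (ℕₚ.+-assoc l k _)) (≡.cong (ℕ._+ toℕ i) (ℕₚ.+-comm l k)))
              (ℕₚ.+-monoʳ-≤ l (ℕₚ.≮⇒≥ q)))))) (zeroʳ _)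

    Band-weaken : ∀ {n k l} {M : Mat n} → l ℕ.≤ k → Band k M → Band l M
    Band-weaken le b i j lt = b i j (ℕₚ.<-≤-trans lt (ℕₚ.+-monoˡ-≤ _ le))

    Band-1 : ∀ {n} → Band 0 (Semiring.1# (𝕄 n))
    Band-1 i j lt = reflexive ([]-no (i Finₚ.≟ j) λ { ≡.refl → ℕₚ.<-irrefl ≡.refl lt })

    Band-all : ∀ {n} {M : Mat n} → Band (suc n) M → M ≋ Semiring.0# (𝕄 n)
    Band-all {n} b i j = b i j (ℕₚ.<-≤-trans (Finₚ.toℕ<n j) (ℕₚ.m≤m+n _ _))

    -- The matrix of the letter a, nonzero only just above the diagonal. As a sum over positions it
    -- turns a product into the choice of the position that is read (`Λ-⊛`).
    Λ : ∀ {n m} → (Fin n → Fin m) → Fin m → Mat n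
    Λ {n} ℓ a i j = ∑ (allFin n) λ p → [ inject₁ p Finₚ.≟ i ] * ([ ℓ p Finₚ.≟ a ] * [ suc p Finₚ.≟ j ])

    Λ-⊛ : ∀ {n m} (ℓ : Fin n → Fin m) a (M : Mat n) i j →
      (Λ ℓ a ⊛ M) i j ≈ ∑ (allFin n) λ p → [ inject₁ p Finₚ.≟ i ] * ([ ℓ p Finₚ.≟ a ] * M (suc p) j)
    Λ-⊛ {n} ℓ a M i j = ≈-trans (∑-cong (allFin (suc n)) λ k → ∑-*ʳ (allFin n) _ _)
      (≈-trans (∑-swap (allFin (suc n)) (allFin n) _) (∑-cong (allFin n) λ p →
        ≈-trans (∑-cong (allFin (suc n)) λ k → ≈-trans (*-assoc _ _ _) (*-congˡ (*-assoc _ _ _)))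
        (≈-trans (≈-sym (∑-*ˡ (allFin (suc n)) _ _)) (*-congˡ
          (≈-trans (≈-sym (∑-*ˡ (allFin (suc n)) _ _)) (*-congˡ (∑-δ (ft-Fin (suc n)) (suc p) λ k → M k j)))))))

    Λ-Band : ∀ {n m} (ℓ : Fin n → Fin m) a → Band 1 (Λ ℓ a)
    Λ-Band {n} ℓ a i j lt = ∑-0 (allFin n) λ p → go p
      where
      go : ∀ p → [ inject₁ p Finₚ.≟ i ] * ([ ℓ p Finₚ.≟ a ] * [ suc p Finₚ.≟ j ]) ≈ 0#
      go p with inject₁ p Finₚ.≟ i | suc p Finₚ.≟ j
      ... | no _ | _ = zeroˡ _
      ... | yes _ | no _ = ≈-trans (*-congˡ (zeroʳ _)) (zeroʳ _)
      ... | yes ≡.refl | yes ≡.refl = ⊥-elim (ℕₚ.<-irrefl (≡.cong suc (≡.sym (Finₚ.toℕ-inject₁ p))) lt)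

  module Hat {c ℓ} (K : CommutativeSemiring c ℓ) (m : ℕ) where
    open CommutativeSemiring K hiding (zero) renaming (Carrier to C; refl to ≈-refl; sym to ≈-sym; trans to ≈-trans)
    open Sums semiring
    open Points K

    -- hat S w i j is the coefficient of S at the factor of w between the points i and j (0 if j < i).
    hat : (List (Fin m) → C) → (w : List (Fin m)) → Mat (length w)
    hat S [] zero zero = S []
    hat S (a ∷ w) zero zero = S []
    hat S (a ∷ w) zero (suc j) = hat (λ u → S (a ∷ u)) w zero j
    hat S (a ∷ w) (suc i) zero = 0#
    hat S (a ∷ w) (suc i) (suc j) = hat S w i j

    hat-full : ∀ S w → hat S w zero (fromℕ (length w)) ≡ S w
    hat-full S [] = ≡.refl
    hat-full S (a ∷ w) = hat-full (λ u → S (a ∷ u)) w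

    hat-cong : ∀ {S T} → (∀ u → S u ≈ T u) → ∀ w → hat S w ≋ hat T w
    hat-cong e [] zero zero = e []
    hat-cong e (a ∷ w) zero zero = e []
    hat-cong e (a ∷ w) zero (suc j) = hat-cong (λ u → e (a ∷ u)) w zero j
    hat-cong e (a ∷ w) (suc i) zero = ≈-refl
    hat-cong e (a ∷ w) (suc i) (suc j) = hat-cong e w i j

    hat-diag : ∀ S w i → hat S w i i ≡ S []
    hat-diag S [] zero = ≡.refl
    hat-diag S (a ∷ w) zero = ≡.refl
    hat-diag S (a ∷ w) (suc i) = hat-diag S w i

    hat-Band0 : ∀ S w → Band 0 (hat S w)
    hat-Band0 S (a ∷ w) (suc i) zero lt = ≈-refl
    hat-Band0 S (a ∷ w) (suc i) (suc j) (s≤s lt) = hat-Band0 S w i j lt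

    hat-Band1 : ∀ S w → S [] ≈ 0# → Band 1 (hat S w)
    hat-Band1 S w z i j (s≤s le) with i Finₚ.≟ j
    ... | yes ≡.refl = ≈-trans (reflexive (hat-diag S w i)) z
    ... | no ne = hat-Band0 S w i j (ℕₚ.≤∧≢⇒< le (ne ∘ ≡.sym ∘ Finₚ.toℕ-injective))

    hat-+ : ∀ S T w → hat (λ u → S u + T u) w ≋ (λ i j → hat S w i j + hat T w i j)
    hat-+ S T [] zero zero = ≈-refl
    hat-+ S T (a ∷ w) zero zero = ≈-refl
    hat-+ S T (a ∷ w) zero (suc j) = hat-+ _ _ w zero j
    hat-+ S T (a ∷ w) (suc i) zero = ≈-sym (+-identityˡ _)
    hat-+ S T (a ∷ w) (suc i) (suc j) = hat-+ S T w i j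

    hat-• : ∀ x S w → hat (λ u → x * S u) w ≋ x • hat S w
    hat-• x S [] zero zero = ≈-refl
    hat-• x S (a ∷ w) zero zero = ≈-refl
    hat-• x S (a ∷ w) zero (suc j) = hat-• x _ w zero j
    hat-• x S (a ∷ w) (suc i) zero = ≈-sym (zeroʳ _)
    hat-• x S (a ∷ w) (suc i) (suc j) = hat-• x S w i j

    hat-0 : ∀ w → hat (λ _ → 0#) w ≋ (λ _ _ → 0#)
    hat-0 [] zero zero = ≈-refl
    hat-0 (a ∷ w) zero zero = ≈-refl
    hat-0 (a ∷ w) zero (suc j) = hat-0 w zero j
    hat-0 (a ∷ w) (suc i) zero = ≈-refl
    hat-0 (a ∷ w) (suc i) (suc j) = hat-0 w i j

    private
      Word : Set
      Word = List (Fin m)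

    infixl 7 _⋆_
    _⋆_ : (S T : List (Fin m) → C) → List (Fin m) → C
    _⋆_ = _·ˢ_ K m

    -- The product rule for the left quotient by a letter: the letter belongs to the second factor
    -- only if the first one is empty. The induction of `hat-⋆` runs on it.
    ⋆-∷ : ∀ S T a u → (S ⋆ T) (a ∷ u) ≈ S [] * T (a ∷ u) + ((λ v → S (a ∷ v)) ⋆ T) u
    ⋆-∷ S T a u = +-congˡ (reflexive (∑-map {A = Word × Word} {B = Word × Word} (λ p → (a ∷ proj₁ p , proj₂ p)) (splits u) (λ p → S (proj₁ p) * T (proj₂ p))))

    ⋆-[] : ∀ S T → (S ⋆ T) [] ≈ S [] * T []
    ⋆-[] S T = +-identityʳ _

    -- A splitting of the factor between i and j is a point between them; for every other point one
    -- of the two entries is 0. In row 0 the induction replaces S by its quotient by the first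
    -- letter, so S must be arbitrary.
    hat-⋆ : ∀ S T w → hat (S ⋆ T) w ≋ hat S w ⊛ hat T w
    hat-⋆ S T [] zero zero = ≈-refl
    hat-⋆ S T (a ∷ w) zero zero = +-congˡ (≈-sym (≈-trans (reflexive (∑-map suc (allFin (suc (length w))) _))
      (∑-0 (allFin (suc (length w))) λ k → zeroʳ _)))
    hat-⋆ S T (a ∷ w) zero (suc j) = ≈-trans (hat-cong (⋆-∷ S T a) w zero j)
      (≈-trans (hat-+ _ _ w zero j) (+-cong (hat-• (S []) _ w zero j)
        (≈-trans (hat-⋆ _ T w zero j) (reflexive (≡.sym (∑-map suc (allFin (suc (length w))) _))))))
    hat-⋆ S T (a ∷ w) (suc i) zero = ≈-sym (≈-trans (+-cong (zeroˡ _)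
      (≈-trans (reflexive (∑-map suc (allFin (suc (length w))) _)) (∑-0 (allFin (suc (length w))) λ k → zeroʳ _))) (+-identityˡ _))
    hat-⋆ S T (a ∷ w) (suc i) (suc j) = ≈-trans (hat-⋆ S T w i j) (≈-sym (≈-trans (+-cong (zeroˡ _)
      (reflexive (∑-map suc (allFin (suc (length w))) _))) (+-identityˡ _)))

    hat-ε : ∀ {S} → S [] ≈ 1# → (∀ a u → S (a ∷ u) ≈ 0#) → ∀ w → hat S w ≋ Semiring.1# (𝕄 (length w))
    hat-ε e z [] zero zero = e
    hat-ε e z (a ∷ w) zero zero = e
    hat-ε e z (a ∷ w) zero (suc j) = ≈-trans (hat-cong (z a) w zero j) (hat-0 w zero j)
    hat-ε e z (a ∷ w) (suc i) zero = ≈-refl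
    hat-ε e z (a ∷ w) (suc i) (suc j) = hat-ε e z w i j

    hat-charS[] : ∀ w → hat (charS K m []) w ≋ Semiring.1# (𝕄 (length w))
    hat-charS[] = hat-ε ≈-refl λ _ _ → ≈-refl

    charS-∷ : ∀ a b u → charS K m (a ∷ []) (b ∷ u) ≈ [ b Finₚ.≟ a ] * charS K m [] u
    charS-∷ a b u with Listₚ.≡-dec F._≟_ (a ∷ []) (b ∷ u) | b Finₚ.≟ a
    charS-∷ a b [] | yes p | yes q = ≈-sym (*-identityˡ _)
    charS-∷ a b (_ ∷ _) | yes () | yes q
    charS-∷ a b u | yes ≡.refl | no q = ⊥-elim (q ≡.refl)
    charS-∷ a b [] | no p | yes ≡.refl = ⊥-elim (p ≡.refl)
    charS-∷ a b (_ ∷ _) | no p | yes q = ≈-sym (zeroʳ _)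
    charS-∷ a b u | no p | no q = ≈-sym (zeroˡ _)

    hat-charS : ∀ a w → hat (charS K m (a ∷ [])) w ≋ Λ (lookup w) a
    hat-charS a [] zero zero = ≈-refl
    hat-charS a (b ∷ w) zero zero = ≈-sym (∑-0 (allFin (suc (length w))) λ p → ≈-trans (*-congˡ (zeroʳ _)) (zeroʳ _))
    hat-charS a (b ∷ w) zero (suc j) = ≈-trans (hat-cong (charS-∷ a b) w zero j) (≈-trans (hat-• _ _ w zero j)
      (≈-trans (*-congˡ (≈-trans (hat-charS[] w zero j) (reflexive ([]-iff (zero Finₚ.≟ j) (suc zero Finₚ.≟ suc j) (≡.cong suc) Finₚ.suc-injective))))
      (≈-trans (≈-sym (*-identityˡ _)) (≈-sym (≈-trans (+-congˡ (≈-trans (reflexive (∑-map suc (allFin (length w)) _))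
        (∑-0 (allFin (length w)) λ p → zeroˡ _))) (+-identityʳ _))))))
    hat-charS a (b ∷ w) (suc i) zero = ≈-sym (∑-0 (allFin (suc (length w))) λ p → ≈-trans (*-congˡ (zeroʳ _)) (zeroʳ _))
    hat-charS a (b ∷ w) (suc i) (suc j) = ≈-trans (hat-charS a w i j) (≈-sym (≈-trans (+-cong (zeroˡ _)
      (≈-trans (reflexive (∑-map suc (allFin (length w)) _)) (∑-cong (allFin (length w)) λ p →
        *-cong (reflexive ([]-iff (suc (inject₁ p) Finₚ.≟ suc i) (inject₁ p Finₚ.≟ i) Finₚ.suc-injective (≡.cong suc)))
          (*-congˡ (reflexive ([]-iff (suc (suc p) Finₚ.≟ suc j) (suc p Finₚ.≟ j) Finₚ.suc-injective (≡.cong suc))))))) (+-identityˡ _)))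

-- Polynomial expressions, their values on a word, and the systems they form.

module Expression {c ℓ} (K : CommutativeSemiring c ℓ) (m : ℕ) where
  open import Data.Nat using (s≤s; z≤n)

  open import Data.List using (map; length; lookup; concatMap; _++_; deduplicate)
  open import Data.List.Membership.Propositional.Properties using (∈-deduplicate⁺; ∈-map⁺)
  open import Data.List.Relation.Unary.All using (All; []; _∷_)
  open import Relation.Binary.Definitions using (DecidableEquality)
  open import Defs using (allFin; charS; evalMon; evalPoly; Polynomial; Algebraic)
  open FiniteSum
  open Matrix

  open CommutativeSemiring K hiding (zero) renaming (Carrier to C; refl to ≈-refl; sym to ≈-sym; trans to ≈-trans)
  open Sums semiring
  open Points K
  open Hat K m

  private variable
    V V′ : Set

  Mono : Set → Set
  Mono V = List (Fin m ⊎ V)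

  -- Monomials may be repeated, which makes products and substitutions plain list operations; only
  -- `toPoly` collects equal monomials.
  Expr : Set → Set c
  Expr V = List (C × Mono V)

  AllE : ∀ {p} → (Mono V → Set p) → Expr V → Set _
  AllE P = All (P ∘ proj₂)

  scale : C → Expr V → Expr V
  scale x = map λ (y , u) → x * y , u

  infixl 7 _⊗_
  _⊗_ : Expr V → Expr V → Expr V
  E ⊗ F = concatMap (λ (x , u) → map (λ (y , v) → x * y , u ++ v) F) E

  prep : Fin m → Expr V → Expr V
  prep a = map λ (y , u) → y , inj₁ a ∷ u

  subM : (V → Expr V′) → Mono V → Expr V′
  subM σ [] = (1# , []) ∷ []
  subM σ (inj₁ a ∷ u) = prep a (subM σ u)
  subM σ (inj₂ X ∷ u) = σ X ⊗ subM σ u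

  sub : (V → Expr V′) → Expr V → Expr V′
  sub σ = concatMap λ (x , u) → scale x (subM σ u)

  AllE-⊗ : ∀ {p q r} {P : Mono V → Set p} {Q : Mono V → Set q} {R : Mono V → Set r} →
    (∀ {u v} → P u → Q v → R (u ++ v)) → ∀ {E F} → AllE P E → AllE Q F → AllE R (E ⊗ F)
  AllE-⊗ f {E} {F} aE aF = Allₚ.concat⁺ (Allₚ.map⁺ (All.map (λ p → Allₚ.map⁺ (All.map (f p) aF)) aE))

  AllE-sub : ∀ {p q} {P : Mono V → Set p} {Q : Mono V′ → Set q} (σ : V → Expr V′) →
    (∀ {u} → P u → AllE Q (subM σ u)) → ∀ {E} → AllE P E → AllE Q (sub σ E)
  AllE-sub σ f aE = Allₚ.concat⁺ (Allₚ.map⁺ (All.map (λ p → Allₚ.map⁺ (f p)) aE))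

  -- Expressions are evaluated on a fixed word, given by the letter at each position; the variables
  -- receive matrices over its points.
  module Val {n : ℕ} (letter : Fin n → Fin m) where
    module 𝕄ₙ = Semiring (𝕄 n)

    mon : (V → Mat n) → Mono V → Mat n
    mon τ [] = 𝕄ₙ.1#
    mon τ (inj₁ a ∷ u) = Λ letter a ⊛ mon τ u
    mon τ (inj₂ X ∷ u) = τ X ⊛ mon τ u

    val : (V → Mat n) → Expr V → Mat n
    val τ E i j = ∑ E λ (x , u) → x * mon τ u i j

    mon-++ : ∀ (τ : V → Mat n) u v → mon τ (u ++ v) ≋ mon τ u ⊛ mon τ v
    mon-++ τ [] v = 𝕄ₙ.sym (𝕄ₙ.*-identityˡ (mon τ v))
    mon-++ τ (inj₁ a ∷ u) v = 𝕄ₙ.trans (𝕄ₙ.*-congˡ {Λ letter a} (mon-++ τ u v)) (𝕄ₙ.sym (𝕄ₙ.*-assoc (Λ letter a) (mon τ u) (mon τ v)))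
    mon-++ τ (inj₂ X ∷ u) v = 𝕄ₙ.trans (𝕄ₙ.*-congˡ {τ X} (mon-++ τ u v)) (𝕄ₙ.sym (𝕄ₙ.*-assoc (τ X) (mon τ u) (mon τ v)))

    mon-cong : ∀ {τ τ′ : V → Mat n} → (∀ X → τ X ≋ τ′ X) → ∀ u → mon τ u ≋ mon τ′ u
    mon-cong e [] = 𝕄ₙ.refl {𝕄ₙ.1#}
    mon-cong e (inj₁ a ∷ u) = 𝕄ₙ.*-congˡ {Λ letter a} (mon-cong e u)
    mon-cong e (inj₂ X ∷ u) = 𝕄ₙ.*-cong (e X) (mon-cong e u)

    val-scale : ∀ (τ : V → Mat n) x E → val τ (scale x E) ≋ x • val τ E
    val-scale τ x E i j = ≈-trans (reflexive (∑-map _ E _)) (≈-trans (∑-cong E λ _ → *-assoc _ _ _) (≈-sym (∑-*ˡ E x _)))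

    val-++ : ∀ (τ : V → Mat n) E F → val τ (E ++ F) ≋ (λ i j → val τ E i j + val τ F i j)
    val-++ τ E F i j = ∑-++ E F _

    val-concatMap : ∀ {a} {A : Set a} (τ : V → Mat n) (f : A → Expr V) xs i j →
      val τ (concatMap f xs) i j ≈ ∑ xs λ x → val τ (f x) i j
    val-concatMap τ f xs i j = ∑-concatMap f xs _

    val-one : ∀ (τ : V → Mat n) u → val τ ((1# , u) ∷ []) ≋ mon τ u
    val-one τ u i j = ≈-trans (+-identityʳ _) (*-identityˡ _)

    val-⊛ʳ : ∀ (τ : V → Mat n) E M i j → (val τ E ⊛ M) i j ≈ ∑ E λ (x , u) → x * (mon τ u ⊛ M) i j
    val-⊛ʳ τ E M i j = ≈-trans (∑-cong (allFin (suc n)) λ k → ≈-trans (∑-*ʳ E _ _) (∑-cong E λ _ → *-assoc _ _ _))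
      (≈-trans (∑-swap (allFin (suc n)) E _) (∑-cong E λ _ → ≈-sym (∑-*ˡ (allFin (suc n)) _ _)))

    val-⊛ˡ : ∀ (τ : V → Mat n) E M i j → (M ⊛ val τ E) i j ≈ ∑ E λ (x , u) → x * (M ⊛ mon τ u) i j
    val-⊛ˡ τ E M i j = ≈-trans (∑-cong (allFin (suc n)) λ k → ≈-trans (∑-*ˡ E _ _) (∑-cong E λ _ →
        ≈-trans (≈-sym (*-assoc _ _ _)) (≈-trans (*-congʳ (*-comm _ _)) (*-assoc _ _ _))))
      (≈-trans (∑-swap (allFin (suc n)) E _) (∑-cong E λ _ → ≈-sym (∑-*ˡ (allFin (suc n)) _ _)))

    val-⊗ : ∀ (τ : V → Mat n) E F → val τ (E ⊗ F) ≋ val τ E ⊛ val τ F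
    val-⊗ τ E F i j = ≈-trans (val-concatMap τ _ E i j) (≈-trans (∑-cong E λ (x , u) →
        ≈-trans (reflexive (∑-map _ F _)) (≈-trans (∑-cong F λ (y , v) → ≈-trans (*-congˡ (mon-++ τ u v i j)) (*-assoc _ _ _))
        (≈-trans (≈-sym (∑-*ˡ F x _)) (*-congˡ (≈-sym (val-⊛ˡ τ F (mon τ u) i j))))))
      (≈-sym (val-⊛ʳ τ E (val τ F) i j)))

    val-prep : ∀ (τ : V → Mat n) a E → val τ (prep a E) ≋ Λ letter a ⊛ val τ E
    val-prep τ a E i j = ≈-trans (reflexive (∑-map _ E _)) (≈-sym (val-⊛ˡ τ E (Λ letter a) i j))

    module _ {τ : V → Mat n} {τ′ : V′ → Mat n} (σ : V → Expr V′) (e : ∀ X → val τ′ (σ X) ≋ τ X) where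
      val-subM : ∀ u → val τ′ (subM σ u) ≋ mon τ u
      val-subM [] = val-one τ′ []
      val-subM (inj₁ a ∷ u) = 𝕄ₙ.trans (val-prep τ′ a (subM σ u)) (𝕄ₙ.*-congˡ {Λ letter a} (val-subM u))
      val-subM (inj₂ X ∷ u) = 𝕄ₙ.trans (val-⊗ τ′ (σ X) (subM σ u)) (𝕄ₙ.*-cong (e X) (val-subM u))

      -- The invariance on which the transformations of systems rest: unfolding variables by their
      -- own equations preserves a solution.
      val-sub : ∀ E → val τ′ (sub σ E) ≋ val τ E
      val-sub E i j = ≈-trans (val-concatMap τ′ _ E i j) (∑-cong E λ (x , u) →
        ≈-trans (val-scale τ′ x (subM σ u) i j) (*-congˡ (val-subM u i j)))

    mon-Band : ∀ {τ : V → Mat n} → (∀ X → Band 0 (τ X)) → ∀ u → Band 0 (mon τ u)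
    mon-Band b [] = Band-1
    mon-Band {τ = τ} b (inj₁ a ∷ u) = Band-⊛ {k = 0} {0} {Λ letter a} {mon τ u} (Band-weaken {k = 1} {M = Λ letter a} z≤n (Λ-Band letter a)) (mon-Band b u)
    mon-Band {τ = τ} b (inj₂ X ∷ u) = Band-⊛ {k = 0} {0} {τ X} {mon τ u} (b X) (mon-Band b u)

    Band-val : ∀ {τ : V → Mat n} E → (∀ X → Band 0 (τ X)) → Band 0 (val τ E)
    Band-val E b i j lt = ∑-0 E λ (x , u) → ≈-trans (*-congˡ (mon-Band b u i j lt)) (zeroʳ _)

  -- Guardedness: it makes a system proper and, since the letter uses up a position, determines its
  -- solution.
  data Start {V : Set} : Mono V → Set where
    start : ∀ {a u} → Start (inj₁ a ∷ u)

  module _ {n : ℕ} (letter : Fin n → Fin m) where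
    open Val letter

    private
      -- Upper triangular matrices never lead back to an earlier point, so the rows from r on of a
      -- product depend only on such rows of its factors.
      mon-agree : ∀ {T G : V → Mat n} → (∀ X → Band 0 (T X)) → (∀ X → Band 0 (G X)) → ∀ {r} →
        (∀ X i j → r ℕ.≤ toℕ i → T X i j ≈ G X i j) → ∀ u i j → r ℕ.≤ toℕ i → mon T u i j ≈ mon G u i j
      mon-agree bT bG e [] i j le = ≈-refl
      mon-agree {T = T} {G} bT bG {r} e (inj₁ a ∷ u) i j le = ∑-cong (allFin (suc n)) λ k → go k
        where
        go : ∀ k → Λ letter a i k * mon T u k j ≈ Λ letter a i k * mon G u k j
        go k with toℕ k ℕ.<? toℕ i
        ... | yes lt = let z = Band-weaken {l = 0} z≤n (Λ-Band letter a) i k lt in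
                       ≈-trans (*-congʳ z) (≈-trans (zeroˡ _) (≈-sym (≈-trans (*-congʳ z) (zeroˡ _))))
        ... | no nlt = *-congˡ (mon-agree bT bG e u k j (ℕₚ.≤-trans le (ℕₚ.≮⇒≥ nlt)))
      mon-agree {T = T} {G} bT bG {r} e (inj₂ X ∷ u) i j le = ∑-cong (allFin (suc n)) λ k → go k
        where
        go : ∀ k → T X i k * mon T u k j ≈ G X i k * mon G u k j
        go k with toℕ k ℕ.<? toℕ i
        ... | yes lt = ≈-trans (*-congʳ (bT X i k lt)) (≈-trans (zeroˡ _) (≈-sym (≈-trans (*-congʳ (bG X i k lt)) (zeroˡ _))))
        ... | no nlt = *-cong (e X i k le) (mon-agree bT bG e u k j (ℕₚ.≤-trans le (ℕₚ.≮⇒≥ nlt)))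

    -- The leading letter goes from the point i to i + 1, so row i of a solution is determined by
    -- the rows below it. The induction runs from the last row upwards, with d bounding how many
    -- rows remain.
    solution-unique : ∀ (E : V → Expr V) → (∀ X → AllE Start (E X)) →
      ∀ {T G : V → Mat n} → (∀ X → Band 0 (T X)) → (∀ X → Band 0 (G X)) →
      (∀ X → T X ≋ val T (E X)) → (∀ X → G X ≋ val G (E X)) → ∀ X → T X ≋ G X
    solution-unique E aE {T} {G} bT bG eT eG X i j = go (suc n) X i j (ℕₚ.m≤n⇒m≤o+n (toℕ i) ℕₚ.≤-refl)
      where
      go : ∀ d X i j → n ℕ.< toℕ i ℕ.+ d → T X i j ≈ G X i j
      go zero X i j lt = ⊥-elim (ℕₚ.<-irrefl ≡.refl (ℕₚ.<-≤-trans (≡.subst (n ℕ.<_) (ℕₚ.+-identityʳ _) lt) (ℕ.s≤s⁻¹ (Finₚ.toℕ<n i))))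
      go (suc d) X i j lt = ≈-trans (eT X i j) (≈-trans (terms (E X) (aE X)) (≈-sym (eG X i j)))
        where
        terms : ∀ F → AllE Start F → val T F i j ≈ val G F i j
        terms [] [] = ≈-refl
        terms ((x , inj₁ a ∷ u) ∷ F) (start ∷ s) = +-cong (*-congˡ (≈-trans (Λ-⊛ letter a (mon T u) i j)
            (≈-trans (∑-cong (allFin n) λ p → []-*-cong (inject₁ p Finₚ.≟ i) λ { ≡.refl → *-congˡ
              (mon-agree bT bG {suc (toℕ p)} (λ Y k l le → go d Y k l (ℕₚ.<-≤-trans (lem p lt) (ℕₚ.+-monoˡ-≤ d le))) u (suc p) j ℕₚ.≤-refl) })
            (≈-sym (Λ-⊛ letter a (mon G u) i j))))) (terms F s)
          where
          lem : ∀ p → n ℕ.< toℕ (inject₁ p) ℕ.+ suc d → n ℕ.< suc (toℕ p) ℕ.+ d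
          lem p l = ≡.subst (n ℕ.<_) (≡.trans (ℕₚ.+-suc _ d) (≡.cong (λ x → suc (x ℕ.+ d)) (Finₚ.toℕ-inject₁ p))) l

  module _ {N : ℕ} where
    private
      _≟ᵐ_ : DecidableEquality (Mono (Fin N))
      _≟ᵐ_ = Listₚ.≡-dec (Sumₚ.≡-dec Finₚ._≟_ Finₚ._≟_)

      ft-words : (E : Expr (Fin N)) → List (Mono (Fin N))
      ft-words E = deduplicate _≟ᵐ_ (map proj₂ E)

    toPoly : Expr (Fin N) → Polynomial K m N
    toPoly E = record
      { coeff = λ u → ∑ E λ (x , v) → [ u ≟ᵐ v ] * x
      ; supp = ft-words E
      ; supp-unique = UniqDec.deduplicate-! _≟ᵐ_ (map proj₂ E)
      ; supp-covers = λ u u∉ → ∑-0∈ E λ {(x , v)} xv∈ → ≈-trans (*-congʳ (reflexive ([]-no (u ≟ᵐ v) λ { ≡.refl →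
          u∉ (∈-deduplicate⁺ _≟ᵐ_ (∈-map⁺ proj₂ xv∈)) }))) (zeroˡ _) }

    valS : (Fin N → List (Fin m) → C) → Expr (Fin N) → List (Fin m) → C
    valS S E w = ∑ E λ (x , u) → x * evalMon K m S u w

    evalPoly-toPoly : ∀ E S w → evalPoly K m (toPoly E) S w ≈ valS S E w
    evalPoly-toPoly E S w = ≈-trans (∑-cong (ft-words E) λ u → ∑-*ʳ E _ _)
      (≈-trans (∑-swap (ft-words E) E _) (∑-cong∈ E λ {(x , v)} xv∈ →
        ≈-trans (∑-only (UniqDec.deduplicate-! _≟ᵐ_ (map proj₂ E)) (∈-deduplicate⁺ _≟ᵐ_ (∈-map⁺ proj₂ xv∈)) _
          λ u ne → ≈-trans (*-congʳ (≈-trans (*-congʳ (reflexive ([]-no (u ≟ᵐ v) (ne ∘ ≡.sym)))) (zeroˡ _))) (zeroˡ _))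
        (*-congʳ (≈-trans (*-congʳ (reflexive ([]-yes (v ≟ᵐ v) ≡.refl))) (*-identityˡ _)))))

    toPoly-coeff : ∀ E u → (∀ {v} → Start v → u ≢ v) → AllE Start E → Polynomial.coeff (toPoly E) u ≈ 0#
    toPoly-coeff E u d aE = ∑-0∈ E λ {(x , v)} xv∈ → ≈-trans (*-congʳ (reflexive ([]-no (u ≟ᵐ v) (d (All.lookup aE xv∈))))) (zeroˡ _)

    hat-mon : ∀ (S : Fin N → List (Fin m) → C) u w →
      hat (evalMon K m S u) w ≋ Val.mon (lookup w) (λ X → hat (S X) w) u
    hat-mon S [] w = hat-charS[] w
    hat-mon S (inj₁ a ∷ u) w = 𝕄w.trans (hat-⋆ _ (evalMon K m S u) w) (𝕄w.*-cong (hat-charS a w) (hat-mon S u w))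
      where module 𝕄w = Semiring (𝕄 (length w))
    hat-mon S (inj₂ X ∷ u) w = 𝕄w.trans (hat-⋆ (S X) (evalMon K m S u) w) (𝕄w.*-congˡ {hat (S X) w} (hat-mon S u w))
      where module 𝕄w = Semiring (𝕄 (length w))

    hat-val : ∀ (S : Fin N → List (Fin m) → C) E w → hat (valS S E) w ≋ Val.val (lookup w) (λ X → hat (S X) w) E
    hat-val S [] w = hat-0 w
    hat-val S ((x , u) ∷ E) w i j = ≈-trans (hat-+ _ (valS S E) w i j)
      (+-cong (≈-trans (hat-• x _ w i j) (*-congˡ (hat-mon S u w i j))) (hat-val S E w i j))

    private
      ⋆-cong≤ : ∀ {S S′ T T′} w → (∀ v → length v ℕ.≤ length w → S v ≈ S′ v) → (∀ v → length v ℕ.≤ length w → T v ≈ T′ v) →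
        (S ⋆ T) w ≈ (S′ ⋆ T′) w
      ⋆-cong≤ [] eS eT = +-congʳ (*-cong (eS [] z≤n) (eT [] z≤n))
      ⋆-cong≤ {S} {S′} {T} {T′} (a ∷ w) eS eT = ≈-trans (⋆-∷ S T a w) (≈-trans (+-cong (*-cong (eS [] z≤n) (eT _ ℕₚ.≤-refl))
        (⋆-cong≤ w (λ v le → eS (a ∷ v) (s≤s le)) (λ v le → eT v (ℕₚ.m≤n⇒m≤1+n le)))) (≈-sym (⋆-∷ S′ T′ a w)))

      mon-cong≤ : ∀ {S S′ : Fin N → List (Fin m) → C} u w → (∀ X v → length v ℕ.≤ length w → S X v ≈ S′ X v) →
        evalMon K m S u w ≈ evalMon K m S′ u w
      mon-cong≤ [] w e = ≈-refl
      mon-cong≤ (inj₁ a ∷ u) w e = ⋆-cong≤ w (λ _ _ → ≈-refl) λ v le → mon-cong≤ u v λ X v′ le′ → e X v′ (ℕₚ.≤-trans le′ le)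
      mon-cong≤ (inj₂ X ∷ u) w e = ⋆-cong≤ w (e X) λ v le → mon-cong≤ u v λ X v′ le′ → e X v′ (ℕₚ.≤-trans le′ le)

      charS⋆-[] : ∀ a T → (charS K m (a ∷ []) ⋆ T) [] ≈ 0#
      charS⋆-[] a T = ≈-trans (⋆-[] (charS K m (a ∷ [])) T) (zeroˡ _)

      ε⋆ : ∀ x {S} T → S [] ≈ x → (∀ a u → S (a ∷ u) ≈ 0#) → ∀ w → (S ⋆ T) w ≈ x * T w
      0⋆ : ∀ {S} T → (∀ u → S u ≈ 0#) → ∀ w → (S ⋆ T) w ≈ 0#
      0⋆ {S} T z [] = ≈-trans (⋆-[] S T) (≈-trans (*-congʳ (z [])) (zeroˡ _))
      0⋆ T z (a ∷ w) = ≈-trans (⋆-∷ _ T a w) (≈-trans (+-cong (≈-trans (*-congʳ (z [])) (zeroˡ _)) (0⋆ T (λ u → z (a ∷ u)) w)) (+-identityˡ _))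
      ε⋆ x {S} T e z [] = ≈-trans (⋆-[] S T) (*-congʳ e)
      ε⋆ x T e z (a ∷ w) = ≈-trans (⋆-∷ _ T a w) (≈-trans (+-cong (*-congʳ e) (0⋆ T (z a) w)) (+-identityʳ _))

      charS⋆-∷ : ∀ a T b w → (charS K m (a ∷ []) ⋆ T) (b ∷ w) ≈ [ b Finₚ.≟ a ] * T w
      charS⋆-∷ a T b w = ≈-trans (⋆-∷ _ T b w) (≈-trans (+-congʳ (zeroˡ _)) (≈-trans (+-identityˡ _)
        (ε⋆ _ T (≈-trans (charS-∷ a b []) (*-identityʳ _)) (λ d u → ≈-trans (charS-∷ a b (d ∷ u)) (zeroʳ _)) w)))

    module Existence (E : Fin N → Expr (Fin N)) (aE : ∀ X → AllE Start (E X)) where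
      private
        -- Iteration from 0. After k steps the values at words of length below k are final, because
        -- a leading letter leaves only shorter words to the variables; hence the successor in
        -- `Sol`.
        It : ℕ → Fin N → List (Fin m) → C
        It zero X w = 0#
        It (suc k) X w = valS (It k) (E X) w

        step-cong : ∀ {S S′ : Fin N → List (Fin m) → C} F → AllE Start F → ∀ w →
          (∀ X v → length v ℕ.< length w → S X v ≈ S′ X v) → valS S F w ≈ valS S′ F w
        step-cong [] [] w e = ≈-refl
        step-cong {S} {S′} ((x , inj₁ a ∷ u) ∷ F) (start ∷ s) [] e =
          +-cong (*-congˡ (≈-trans (charS⋆-[] a (evalMon K m S u)) (≈-sym (charS⋆-[] a (evalMon K m S′ u))))) (step-cong F s [] e)
        step-cong {S} {S′} ((x , inj₁ a ∷ u) ∷ F) (start ∷ s) (b ∷ w) e =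
          +-cong (*-congˡ (≈-trans (charS⋆-∷ a (evalMon K m S u) b w) (≈-trans
              (*-congˡ (mon-cong≤ u w λ X v le → e X v (s≤s le))) (≈-sym (charS⋆-∷ a (evalMon K m S′ u) b w)))))
            (step-cong F s (b ∷ w) e)

        It-stable : ∀ k k′ X w → length w ℕ.< k → length w ℕ.< k′ → It k X w ≈ It k′ X w
        It-stable (suc k) (suc k′) X w (s≤s lt) (s≤s lt′) = step-cong (E X) (aE X) w
          λ Y v l → It-stable k k′ Y v (ℕₚ.<-≤-trans l lt) (ℕₚ.<-≤-trans l lt′)

        empty : ∀ (S : Fin N → List (Fin m) → C) F → AllE Start F → valS S F [] ≈ 0#
        empty S [] [] = ≈-refl
        empty S ((x , inj₁ a ∷ u) ∷ F) (start ∷ s) =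
          ≈-trans (+-cong (≈-trans (*-congˡ (charS⋆-[] a (evalMon K m S u))) (zeroʳ _)) (empty S F s)) (+-identityˡ _)

      Sol : Fin N → List (Fin m) → C
      Sol X w = It (suc (length w)) X w

      Sol-eq : ∀ X w → Sol X w ≈ valS Sol (E X) w
      Sol-eq X w = step-cong (E X) (aE X) w λ Y v l → It-stable (length w) (suc (length v)) Y v l ℕₚ.≤-refl

      Sol-[] : ∀ X → Sol X [] ≈ 0#
      Sol-[] X = empty (It 0) (E X) (aE X)

      algebraic : ∀ X S → (∀ w → S w ≈ Sol X w) → Algebraic K m S
      algebraic X S e = N , (λ Y → toPoly (E Y))
        , (λ Y → toPoly-coeff (E Y) [] (λ { start () }) (aE Y) , λ Z → toPoly-coeff (E Y) (inj₂ Z ∷ []) (λ { start () }) (aE Y))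
        , Sol , (λ Y w → ≈-trans (Sol-eq Y w) (≈-sym (evalPoly-toPoly (E Y) Sol w))) , Sol-[] , X , e

      Sol-hat : ∀ X w → hat (Sol X) w ≋ Val.val (lookup w) (λ Y → hat (Sol Y) w) (E X)
      Sol-hat X w i j = ≈-trans (hat-cong (Sol-eq X) w i j) (hat-val Sol (E X) w i j)

-- Nestings as trees, their enumeration and sums over them.

module Tree where
  open import Data.Fin using (_≟_)
  open import Data.List using (map; _++_; concatMap)
  open import Data.List.Membership.Propositional.Properties
  open import Data.List.Relation.Unary.All using ([]; _∷_)
  open import Data.List.Relation.Unary.AllPairs using ([]; _∷_)
  open import Data.Nat using (s≤s; _≤_; _<_)
  open import Data.Vec using ([]; _∷_)
  open import Relation.Binary.PropositionalEquality using (refl; sym; trans; cong; subst)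
  open import Defs using (allFin)
  open FiniteSum

  -- Nest i j: the nestings of the positions between the points i and j; position p leads from the
  -- point inject₁ p to the point suc p.
  data Nest {n : ℕ} (i j : Fin (suc n)) : Set where
    nil  : i ≡ j → Nest i j
    int  : ∀ p → inject₁ p ≡ i → Nest (suc p) j → Nest i j
    call : ∀ p q → inject₁ p ≡ i → Nest (suc p) (inject₁ q) → Nest (suc q) j → Nest i j

  private variable
    n : ℕ
    i j : Fin (suc n)

  positions : Nest {n} i j → List (Fin n)
  positions (nil _) = []
  positions (int p _ t) = p ∷ positions t
  positions (call p q _ t t′) = p ∷ positions t ++ q ∷ positions t′

  from : Fin (suc n) → List (Fin n)
  from {n} zero = allFin n
  from {suc n} (suc i) = map suc (from i)

  from-inject₁ : ∀ (p : Fin n) → from (inject₁ p) ≡ p ∷ from (suc p)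
  from-inject₁ zero = refl
  from-inject₁ (suc p) = cong (map suc) (from-inject₁ p)

  from-fromℕ : ∀ n → from (fromℕ n) ≡ []
  from-fromℕ zero = refl
  from-fromℕ (suc n) = cong (map suc) (from-fromℕ n)

  -- With the positions behind j appended, the pieces of a call fit together by the induction
  -- hypotheses alone, and taking j to be the last point yields `positions-full`.
  positions-from : (t : Nest {n} i j) → positions t ++ from j ≡ from i
  positions-from (nil refl) = refl
  positions-from (int p refl t) = trans (cong (p ∷_) (positions-from t)) (sym (from-inject₁ p))
  positions-from {j = j} (call p q refl t t′) = trans (cong (p ∷_) (trans (Listₚ.++-assoc (positions t) _ (from j))
    (trans (cong (λ x → positions t ++ q ∷ x) (positions-from t′))
    (trans (cong (positions t ++_) (sym (from-inject₁ q))) (positions-from t))))) (sym (from-inject₁ p))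

  positions-full : (t : Nest {n} zero (fromℕ n)) → positions t ≡ allFin n
  positions-full {n} t = trans (sym (Listₚ.++-identityʳ _)) (trans (cong (positions t ++_) (sym (from-fromℕ n))) (positions-from t))

  module _ {p : Fin n} {i : Fin (suc n)} (e : inject₁ p ≡ i) where
    toℕ-src : toℕ p ≡ toℕ i
    toℕ-src = trans (sym (Finₚ.toℕ-inject₁ p)) (cong toℕ e)

  span : Nest {n} i j → toℕ i ≤ toℕ j
  span (nil refl) = ℕₚ.≤-refl
  span (int p e t) = ℕₚ.≤-trans (ℕₚ.≤-reflexive (sym (toℕ-src e))) (ℕₚ.<⇒≤ (span t))
  span (call p q e t t′) = ℕₚ.≤-trans (ℕₚ.≤-reflexive (sym (toℕ-src e))) (ℕₚ.≤-trans (ℕₚ.<⇒≤ (span t))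
    (ℕₚ.≤-trans (ℕₚ.≤-reflexive (Finₚ.toℕ-inject₁ q)) (ℕₚ.<⇒≤ (span t′))))

  call-< : ∀ {p q : Fin n} → Nest (suc p) (inject₁ q) → toℕ p < toℕ q
  call-< {q = q} t = subst (_ <_) (Finₚ.toℕ-inject₁ q) (span t)

  _within_,_ : Fin n → Fin (suc n) → Fin (suc n) → Set
  k within i , j = toℕ i ≤ toℕ k × toℕ k < toℕ j

  within-inner : ∀ {p q k : Fin n} → inject₁ p ≡ i → toℕ q < toℕ j → k within suc p , inject₁ q → k within i , j
  within-inner {q = q} e lt (a , b) = ℕₚ.≤-trans (ℕₚ.≤-reflexive (sym (toℕ-src e))) (ℕₚ.<⇒≤ a) ,
    ℕₚ.<-trans (subst (_ <_) (Finₚ.toℕ-inject₁ q) b) lt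

  within-later : ∀ {p q k : Fin n} → inject₁ p ≡ i → toℕ p ≤ toℕ q → k within suc q , j → k within i , j
  within-later e le (a , b) = ℕₚ.≤-trans (ℕₚ.≤-reflexive (sym (toℕ-src e))) (ℕₚ.≤-trans le (ℕₚ.<⇒≤ a)) , b

  positions-within : (t : Nest {n} i j) → ∀ {k} → k ∈ positions t → k within i , j
  positions-within (int p e t) (here refl) = ℕₚ.≤-reflexive (sym (toℕ-src e)) , span t
  positions-within (int p e t) (there m) = within-later e ℕₚ.≤-refl (positions-within t m)
  positions-within {j = j} (call p q e t t′) (here refl) = ℕₚ.≤-reflexive (sym (toℕ-src e)) , ℕₚ.<-trans (call-< t) (span t′)
  positions-within {j = j} (call p q e t t′) (there m) with ∈-++⁻ (positions t) m
  ... | inj₁ m′ = within-inner {j = j} {q = q} e (span t′) (positions-within t m′)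
  ... | inj₂ (here refl) = ℕₚ.≤-trans (ℕₚ.≤-reflexive (sym (toℕ-src e))) (ℕₚ.<⇒≤ (call-< t)) , span t′
  ... | inj₂ (there m′) = within-later e (ℕₚ.<⇒≤ (call-< t)) (positions-within t′ m′)

  nilL : Dec (i ≡ j) → List (Nest {n} i j)
  nilL (yes e) = nil e ∷ []
  nilL (no _) = []

  branch : ∀ {p : Fin n} → (inject₁ p ≡ i → List (Nest i j)) → Dec (inject₁ p ≡ i) → List (Nest i j)
  branch L (yes e) = L e
  branch L (no _) = []

  -- The fuel bounds the number of positions in the span. The decisions about points are passed as
  -- arguments to `nilL` and `branch`, so that later sums over these lists can be split by the
  -- outcome.
  nests : ℕ → (i j : Fin (suc n)) → List (Nest i j)
  nestsAt : ℕ → (p : Fin n) (i j : Fin (suc n)) → inject₁ p ≡ i → List (Nest i j)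
  nests zero i j = nilL (i ≟ j)
  nests {n} (suc d) i j = nilL (i ≟ j) ++ concatMap (λ p → branch (nestsAt d p i j) (inject₁ p ≟ i)) (allFin n)
  nestsAt {n} d p i j e = map (int p e) (nests d (suc p) j) ++
    concatMap (λ q → concatMap (λ t → map (call p q e t) (nests d (suc q) j)) (nests d (suc p) (inject₁ q))) (allFin n)

  ∈-concatMap⁺′ : ∀ {a b} {A : Set a} {B : Set b} {f : A → List B} {xs x y} → x ∈ xs → y ∈ f x → y ∈ concatMap f xs
  ∈-concatMap⁺′ {f = f} (here refl) m = ∈-++⁺ˡ m
  ∈-concatMap⁺′ {f = f} {x ∷ xs} (there k) m = ∈-++⁺ʳ (f x) (∈-concatMap⁺′ k m)

  private
    nilL-∈ : (d : Dec (i ≡ j)) (e : i ≡ j) → nil e ∈ nilL d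
    nilL-∈ (yes refl) refl = here refl
    nilL-∈ (no ne) e = ⊥-elim (ne e)

    branch-∈ : ∀ {p : Fin n} {L : inject₁ p ≡ i → List (Nest i j)} {t} (d : Dec (inject₁ p ≡ i)) (e : inject₁ p ≡ i) → t ∈ L e → t ∈ branch L d
    branch-∈ (yes refl) refl m = m
    branch-∈ (no ne) e m = ⊥-elim (ne e)

    branch-∈⁻ : ∀ {p : Fin n} {L : inject₁ p ≡ i → List (Nest i j)} {t} (d : Dec (inject₁ p ≡ i)) → t ∈ branch L d → Σ (inject₁ p ≡ i) λ e → t ∈ L e
    branch-∈⁻ (yes e) m = e , m

    fuel-step : ∀ {d} {p : Fin n} {i j : Fin (suc n)} → inject₁ p ≡ i → toℕ j ≤ suc d ℕ.+ toℕ i → toℕ j ≤ d ℕ.+ suc (toℕ p)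
    fuel-step {d = d} e le = ℕₚ.≤-trans le (ℕₚ.≤-reflexive (trans (cong (λ x → suc (d ℕ.+ x)) (sym (toℕ-src e))) (sym (ℕₚ.+-suc d _))))

  nests-complete : ∀ d → (t : Nest {n} i j) → toℕ j ≤ d ℕ.+ toℕ i → t ∈ nests d i j
  nests-complete {i = i} {j} zero (nil e) le = nilL-∈ (i ≟ j) e
  nests-complete zero (int p e t) le = ⊥-elim (ℕₚ.<-irrefl (toℕ-src e) (ℕₚ.<-≤-trans (span t) le))
  nests-complete zero (call p q e t t′) le = ⊥-elim (ℕₚ.<-irrefl (toℕ-src e) (ℕₚ.<-≤-trans (ℕₚ.<-trans (call-< t) (span t′)) le))
  nests-complete {i = i} {j} (suc d) (nil e) le = ∈-++⁺ˡ (nilL-∈ (i ≟ j) e)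
  nests-complete {i = i} {j} (suc d) (int p e t) le =
    ∈-++⁺ʳ (nilL (i ≟ j)) (∈-concatMap⁺′ (allFin-mem p) (branch-∈ (inject₁ p ≟ i) e
      (∈-++⁺ˡ (∈-map⁺ (int p e) (nests-complete d t (fuel-step {j = j} e le))))))
  nests-complete {i = i} {j} (suc d) (call p q e t t′) le =
    ∈-++⁺ʳ (nilL (i ≟ j)) (∈-concatMap⁺′ (allFin-mem p) (branch-∈ (inject₁ p ≟ i) e
      (∈-++⁺ʳ (map (int p e) (nests d (suc p) j)) (∈-concatMap⁺′ (allFin-mem q)
        (∈-concatMap⁺′ (nests-complete d t (ℕₚ.≤-trans (ℕₚ.≤-reflexive (Finₚ.toℕ-inject₁ q)) (ℕₚ.≤-trans (ℕₚ.<⇒≤ (span t′)) le′)))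
          (∈-map⁺ (call p q e t) (nests-complete d t′ (ℕₚ.≤-trans le′ (ℕₚ.+-monoʳ-≤ d (s≤s (ℕₚ.<⇒≤ (call-< t)))))))))) ))
    where le′ = fuel-step {j = j} e le

  nests-unique : ∀ d (i j : Fin (suc n)) → Unique (nests d i j)
  nestsAt-unique : ∀ d (p : Fin n) i j e → Unique (nestsAt d p i j e)

  private
    nilL-unique : (d : Dec (i ≡ j)) → Unique (nilL {n} d)
    nilL-unique (yes _) = [] ∷ []
    nilL-unique (no _) = []

    branch-unique : ∀ {p : Fin n} {L : inject₁ p ≡ i → List (Nest i j)} → (∀ e → Unique (L e)) → (d : Dec (inject₁ p ≡ i)) → Unique (branch L d)
    branch-unique u (yes e) = u e
    branch-unique u (no _) = []

    nil-∈⁻ : (d : Dec (i ≡ j)) → ∀ {t : Nest {n} i j} → t ∈ nilL d → Σ (i ≡ j) λ e → t ≡ nil e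
    nil-∈⁻ (yes e) (here refl) = e , refl

    callL-∈⁻ : ∀ d {p : Fin n} {i j} {e : inject₁ p ≡ i} {q t} →
      t ∈ concatMap (λ s → map (call p q e s) (nests d (suc q) j)) (nests d (suc p) (inject₁ q)) →
      ∃ λ s → ∃ λ s′ → t ≡ call p q e s s′
    callL-∈⁻ d {p} {e = e} {q} m with ∈-concatMap⁻′ (nests d (suc p) (inject₁ q)) m
    ... | s , _ , m′ with ∈-map⁻ (call p q e s) m′
    ...   | s′ , _ , eq = s , s′ , eq

    nestsAt-∈⁻ : ∀ d {p : Fin n} {i j e} {t : Nest i j} → t ∈ nestsAt d p i j e →
      (∃ λ s → t ≡ int p e s) ⊎ (∃ λ q → ∃ λ s → ∃ λ s′ → t ≡ call p q e s s′)
    nestsAt-∈⁻ {n} d {p} {j = j} {e} m with ∈-++⁻ (map (int p e) (nests d (suc p) j)) m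
    ... | inj₁ m′ with ∈-map⁻ (int p e) m′
    ...   | s , _ , eq = inj₁ (s , eq)
    nestsAt-∈⁻ {n} d m | inj₂ m′ with ∈-concatMap⁻′ (allFin n) m′
    ...   | q , _ , m″ with callL-∈⁻ d m″
    ...     | s , s′ , eq = inj₂ (q , s , s′ , eq)

  nests-unique zero i j = nilL-unique (i ≟ j)
  nests-unique {n} (suc d) i j = Uniq.++⁺ (nilL-unique (i ≟ j))
    (concatMap-uniq (allFin-uniq n) (λ p → branch-unique (nestsAt-unique d p i j) (inject₁ p ≟ i))
      λ {p} {p′} m m′ → Finₚ.inject₁-injective (trans (proj₁ (branch-∈⁻ (inject₁ p ≟ i) m)) (sym (proj₁ (branch-∈⁻ (inject₁ p′ ≟ i) m′)))))
    λ { (m , m′) → disj (nil-∈⁻ (i ≟ j) m) (∈-concatMap⁻′ (allFin n) m′) }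
    where
    disj : ∀ {t} → Σ (i ≡ j) (λ e → t ≡ nil e) →
      (∃ λ p → p ∈ allFin n × t ∈ branch (nestsAt d p i j) (inject₁ p ≟ i)) → ⊥
    disj (_ , refl) (p , _ , m) with branch-∈⁻ (inject₁ p ≟ i) m
    ... | e , m′ with nestsAt-∈⁻ d m′
    ...   | inj₁ (_ , ())
    ...   | inj₂ (_ , _ , _ , ())
  nestsAt-unique {n} d p i j e = Uniq.++⁺ (Uniq.map⁺ (λ { refl → refl }) (nests-unique d (suc p) j))
    (concatMap-uniq (allFin-uniq n) (λ q → concatMap-uniq (nests-unique d (suc p) (inject₁ q))
        (λ t → Uniq.map⁺ (λ { refl → refl }) (nests-unique d (suc q) j))
        λ {x} {x′} m m′ → calls (∈-map⁻ (call p q e x) m) (∈-map⁻ (call p q e x′) m′))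
      λ {q} {q′} m m′ → callqs (callL-∈⁻ d m) (callL-∈⁻ d m′))
    λ { (m , m′) → disj (∈-map⁻ (int p e) m) (∈-concatMap⁻′ (allFin n) m′) }
    where
    calls : ∀ {q x x′ y} → (∃ λ z → z ∈ nests d (suc q) j × y ≡ call p q e x z) →
      (∃ λ z → z ∈ nests d (suc q) j × y ≡ call p q e x′ z) → x ≡ x′
    calls (_ , _ , refl) (_ , _ , refl) = refl
    callqs : ∀ {q q′ y} → (∃ λ s → ∃ λ s′ → y ≡ call p q e s s′) → (∃ λ s → ∃ λ s′ → y ≡ call p q′ e s s′) → q ≡ q′
    callqs (_ , _ , refl) (_ , _ , refl) = refl
    disj : ∀ {t} → (∃ λ s → s ∈ nests d (suc p) j × t ≡ int p e s) →
      (∃ λ q → q ∈ allFin n × t ∈ concatMap (λ t → map (call p q e t) (nests d (suc q) j)) (nests d (suc p) (inject₁ q))) → ⊥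
    disj (_ , _ , refl) (q , _ , m) with callL-∈⁻ d m
    ... | _ , _ , ()

  module TreeSum {c ℓ} (R : Semiring c ℓ) where
    open Semiring R hiding (zero) renaming (Carrier to C; refl to ≈-refl; sym to ≈-sym; trans to ≈-trans)
    open Sums R

    ∑ᵗ : (i j : Fin (suc n)) → (Nest i j → C) → C
    ∑ᵗ {n} i j f = ∑ (nests n i j) f

    private
      fuel : ∀ d d′ (i j : Fin (suc n)) (f : Nest i j → C) → toℕ j ≤ d ℕ.+ toℕ i → toℕ j ≤ d′ ℕ.+ toℕ i → ∑ (nests d i j) f ≈ ∑ (nests d′ i j) f
      fuel d d′ i j f le le′ = ∑-same f (nests-unique d i j) (nests-unique d′ i j)
        (λ {t} _ → nests-complete d′ t le′) (λ {t} _ → nests-complete d t le)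

      ∑-nilL : ∀ {c} (d : Dec (i ≡ j)) (f : Nest {n} i j → C) → (∀ e → f (nil e) ≈ c) → ∑ (nilL d) f ≈ [ d ] * c
      ∑-nilL (yes e) f h = ≈-trans (+-identityʳ _) (≈-trans (h e) (≈-sym (*-identityˡ _)))
      ∑-nilL (no _) f h = ≈-sym (zeroˡ _)

      ∑-branch : ∀ {x} {p : Fin n} {L : inject₁ p ≡ i → List (Nest i j)} (f : Nest i j → C) (d : Dec (inject₁ p ≡ i)) →
        (∀ e → ∑ (L e) f ≈ x) → ∑ (branch L d) f ≈ [ d ] * x
      ∑-branch f (yes e) h = ≈-trans (h e) (≈-sym (*-identityˡ _))
      ∑-branch f (no _) h = ≈-sym (zeroˡ _)

    -- Decomposition by what happens at the first position. Only the values of f on the three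
    -- constructors enter, and independently of the equations stored there, which therefore turn
    -- into Kronecker deltas.
    ∑ᵗ-step : ∀ (i j : Fin (suc n)) {f : Nest i j → C} {x} {gi : ∀ p → Nest (suc p) j → C}
      {gc : ∀ p q → Nest (suc p) (inject₁ q) → Nest (suc q) j → C} →
      (∀ e → f (nil e) ≈ x) → (∀ p e t → f (int p e t) ≈ gi p t) → (∀ p q e t t′ → f (call p q e t t′) ≈ gc p q t t′) →
      ∑ᵗ i j f ≈ [ i ≟ j ] * x + ∑ (allFin n) λ p → [ inject₁ p ≟ i ] *
        (∑ᵗ (suc p) j (gi p) + ∑ (allFin n) λ q → ∑ᵗ (suc p) (inject₁ q) λ t → ∑ᵗ (suc q) j λ t′ → gc p q t t′)
    ∑ᵗ-step {zero} i j {f} hn hi hc = ≈-trans (∑-nilL (i ≟ j) f hn) (≈-sym (+-identityʳ _))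
    ∑ᵗ-step {suc d} i j {f} hn hi hc = ≈-trans (∑-++ (nilL (i ≟ j)) _ f) (+-cong (∑-nilL (i ≟ j) f hn)
      (≈-trans (∑-concatMap (λ p → branch (nestsAt d p i j) (inject₁ p ≟ i)) (allFin (suc d)) f) (∑-cong (allFin (suc d)) λ p → ∑-branch {L = nestsAt d p i j} f (inject₁ p ≟ i) λ e →
        ≈-trans (∑-++ (map (int p e) (nests d (suc p) j)) _ f) (+-cong
          (≈-trans (reflexive (∑-map (int p e) (nests d (suc p) j) f)) (≈-trans (∑-cong (nests d (suc p) j) (hi p e)) (refuel p j _)))
          (≈-trans (∑-concatMap (λ q → concatMap (λ t → map (call p q e t) (nests d (suc q) j)) (nests d (suc p) (inject₁ q))) (allFin (suc d)) f) (∑-cong (allFin (suc d)) λ q →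
            ≈-trans (∑-concatMap (λ t → map (call p q e t) (nests d (suc q) j)) (nests d (suc p) (inject₁ q)) f) (≈-trans (refuel p (inject₁ q) _)
              (∑-cong (nests (suc d) (suc p) (inject₁ q)) λ t → ≈-trans (reflexive (∑-map (call p q e t) (nests d (suc q) j) f))
                (≈-trans (∑-cong (nests d (suc q) j) (hc p q e t)) (refuel q j _))))))))))
      where
      -- Here the word has `suc d` positions, and at most `d` of them come after the position p, so
      -- the smaller fuel suffices.
      refuel : ∀ p j (f : Nest (suc p) j → C) → ∑ (nests d (suc p) j) f ≈ ∑ (nests (suc d) (suc p) j) f
      refuel p j f = fuel d (suc d) (suc p) j f
        (ℕₚ.≤-trans (ℕ.s≤s⁻¹ (Finₚ.toℕ<n j)) (ℕₚ.≤-trans (s≤s (ℕₚ.m≤m+n d _)) (ℕₚ.≤-reflexive (sym (ℕₚ.+-suc d _)))))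
        (ℕₚ.≤-trans (ℕ.s≤s⁻¹ (Finₚ.toℕ<n j)) (ℕₚ.m≤m+n (suc d) _))

    ∑ᵗ-below : ∀ {i j : Fin (suc n)} (f : Nest i j → C) → toℕ j < toℕ i → ∑ᵗ i j f ≈ 0#
    ∑ᵗ-below {n} {i} {j} f lt = ∑-0 (nests n i j) λ t → ⊥-elim (ℕₚ.<⇒≱ lt (span t))

-- The correspondence between nesting relations and trees.

module Nesting where
  open import Data.Bool using (T)
  open import Data.Bool.ListAction using (all)
  open import Data.Fin using (_≟_)
  import Data.Fin as F
  open import Data.List using (map; _++_; concatMap)
  open import Data.List.Membership.Propositional.Properties
  open import Data.List.Relation.Unary.AllPairs using ([]; _∷_)
  open import Data.Nat using (s≤s; z≤n; _≤_; _<_)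
  open import Data.Product using (uncurry)
  open import Data.Sum using ([_,_]′) renaming (map to ⊎-map)
  open import Function.Bundles using (Equivalence)
  open import Relation.Binary.PropositionalEquality using (refl; sym; trans; cong; cong₂; subst)
  open import Relation.Nullary.Decidable using (dec-true)
  open import Defs using (allFin; allVecs; bools; Rel; rel; isNestᵇ; guard; _⇒ᵇ_)
  open Booleans
  open FiniteSum
  open Tree

  private variable
    n : ℕ
    i j : Fin (suc n)

  -- ν restricted to the span of t is the nesting t, and no arc of ν crosses the border of the span.
  Fits : (Fin n → Fin n → Bool) → Nest {n} i j → Set
  Fits ν (nil _) = ⊤
  Fits ν (int p _ t) = (∀ k → ν p k ≡ false) × (∀ k → ν k p ≡ false) × Fits ν t
  Fits ν (call p q _ t t′) =
    (ν p q ≡ true × (∀ k → ν p k ≡ true → k ≡ q) × (∀ k → ν k p ≡ false))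
    × ((∀ k → ν q k ≡ false) × (∀ k → ν k q ≡ true → k ≡ p))
    × Fits ν t × Fits ν t′

  private
    ≢true : ∀ {b} → (b ≡ true → ⊥) → b ≡ false
    ≢true = Boolₚ.¬-not

  Fits-⊆ : ∀ {ν ν′} (t : Nest {n} i j) → Fits ν t → Fits ν′ t → ∀ {k x} → k ∈ positions t → ν k x ≡ true → ν′ k x ≡ true
  Fits-⊆ (int p _ t) (a , _ , f) (_ , _ , f′) (here refl) e = absurd e (a _)
  Fits-⊆ (int p _ t) (_ , _ , f) (_ , _ , f′) (there m) e = Fits-⊆ t f f′ m e
  Fits-⊆ {ν′ = ν′} (call p q _ t t′) ((_ , u , _) , _) ((e′ , _) , _) (here refl) e = subst (λ k → ν′ p k ≡ true) (sym (u _ e)) e′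
  Fits-⊆ (call p q _ t t′) (_ , (z , _) , f , g) (_ , _ , f′ , g′) (there m) e with ∈-++⁻ (positions t) m
  ... | inj₁ m′ = Fits-⊆ t f f′ m′ e
  ... | inj₂ (here refl) = absurd e (z _)
  ... | inj₂ (there m′) = Fits-⊆ t′ g g′ m′ e

  ∈-full : ∀ (t : Nest {n} zero (fromℕ n)) k → k ∈ positions t
  ∈-full t k = subst (k ∈_) (sym (positions-full t)) (allFin-mem k)

  Fits-determines-relation : ∀ {ν ν′} (t : Nest {n} zero (fromℕ n)) → Fits ν t → Fits ν′ t → ∀ k x → ν k x ≡ ν′ k x
  Fits-determines-relation {ν = ν} {ν′} t f f′ k x with ν k x in e | ν′ k x in e′
  ... | true | true = refl
  ... | false | false = refl
  ... | true | false = absurd (Fits-⊆ t f f′ (∈-full t k) e) e′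
  ... | false | true = absurd (Fits-⊆ t f′ f (∈-full t k) e′) e

  -- The relation dictates the constructor at each first position, since an internal position has no
  -- partner, and at a call it dictates the return. The helpers `loop` and `loop₂` rule out a
  -- nonempty span that ends where it begins.
  Fits-determines-tree : ∀ {ν} (t t′ : Nest {n} i j) → Fits ν t → Fits ν t′ → t ≡ t′
  private
    loop : ∀ {p : Fin n} {A : Set} → inject₁ p ≡ i → Nest (suc p) i → A
    loop e t = ⊥-elim (ℕₚ.<-irrefl (toℕ-src e) (span t))
    loop₂ : ∀ {p q : Fin n} {A : Set} → inject₁ p ≡ i → Nest (suc p) (inject₁ q) → Nest (suc q) i → A
    loop₂ e t t′ = ⊥-elim (ℕₚ.<-irrefl (toℕ-src e) (ℕₚ.<-trans (call-< t) (span t′)))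
  Fits-determines-tree (nil refl) (nil refl) _ _ = refl
  Fits-determines-tree (nil refl) (int p e t) _ _ = loop e t
  Fits-determines-tree (nil refl) (call p q e t t′) _ _ = loop₂ e t t′
  Fits-determines-tree (int p e t) (nil refl) _ _ = loop e t
  Fits-determines-tree (call p q e t t′) (nil refl) _ _ = loop₂ e t t′
  Fits-determines-tree (int p e t) (int p′ e′ s) (a , _ , f) (_ , _ , g) with Finₚ.inject₁-injective (trans e (sym e′))
  ... | refl with e | e′
  ...   | refl | refl = cong (int p refl) (Fits-determines-tree t s f g)
  Fits-determines-tree (int p e t) (call p′ q e′ s s′) (a , _) ((b , _) , _) with Finₚ.inject₁-injective (trans e (sym e′))
  ... | refl = absurd b (a q)
  Fits-determines-tree (call p′ q e′ s s′) (int p e t) ((b , _) , _) (a , _) with Finₚ.inject₁-injective (trans e (sym e′))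
  ... | refl = absurd b (a q)
  Fits-determines-tree (call p q e t t′) (call p′ q′ e′ s s′) ((a , _) , _ , f , f′) ((_ , u , _) , _ , g , g′) with Finₚ.inject₁-injective (trans e (sym e′))
  ... | refl with u q a
  ...   | refl with e | e′
  ...     | refl | refl = cong₂ (call p q refl) (Fits-determines-tree t s f g) (Fits-determines-tree t′ s′ f′ g′)

  arcs : Nest {n} i j → List (Fin n × Fin n)
  arcs (nil _) = []
  arcs (int p _ t) = arcs t
  arcs (call p q _ t t′) = (p , q) ∷ arcs t ++ arcs t′

  arcs-within : (t : Nest {n} i j) → ∀ {x y} → (x , y) ∈ arcs t → x within i , j × y within i , j × toℕ x < toℕ y
  arcs-within (int p e t) m = let (a , b , c) = arcs-within t m in within-later e ℕₚ.≤-refl a , within-later e ℕₚ.≤-refl b , c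
  arcs-within (call p q e t t′) (here refl) = positions-within (call p q e t t′) (here refl) ,
    positions-within (call p q e t t′) (there (∈-++⁺ʳ (positions t) (here refl))) , call-< t
  arcs-within {j = j} (call p q e t t′) (there m) with ∈-++⁻ (arcs t) m
  ... | inj₁ m′ = let (a , b , c) = arcs-within t m′ in within-inner {j = j} {q = q} e (span t′) a , within-inner {j = j} {q = q} e (span t′) b , c
  ... | inj₂ m′ = let (a , b , c) = arcs-within t′ m′ ; le = ℕₚ.<⇒≤ (call-< t) in within-later e le a , within-later e le b , c

  arc : Nest {n} i j → Fin n → Fin n → Bool
  arc t x y = does (DecMem._∈?_ (Prodₚ.≡-dec _≟_ _≟_) (x , y) (arcs t))

  arc-∈ : (t : Nest {n} i j) → ∀ {x y} → arc t x y ≡ true → (x , y) ∈ arcs t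
  arc-∈ t {x} {y} e with DecMem._∈?_ (Prodₚ.≡-dec _≟_ _≟_) (x , y) (arcs t)
  ... | yes m = m

  ∈-arc : (t : Nest {n} i j) → ∀ {x y} → (x , y) ∈ arcs t → arc t x y ≡ true
  ∈-arc t m = dec-true (DecMem._∈?_ (Prodₚ.≡-dec _≟_ _≟_) _ (arcs t)) m

  Outside : Fin n → Fin (suc n) → Fin (suc n) → Set
  Outside k i j = toℕ k < toℕ i ⊎ toℕ j ≤ toℕ k

  private
    not-within : ∀ {k : Fin n} → k within i , j → Outside k i j → ⊥
    not-within (a , b) (inj₁ c) = ℕₚ.<⇒≱ c a
    not-within (a , b) (inj₂ c) = ℕₚ.<⇒≱ b c

  -- Pairs outside the span are allowed so that the induction can descend: seen from the inner span
  -- of a call, the enclosing arc and everything after it lie outside.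
  fits : ∀ {ν} (t : Nest {n} i j) →
    (∀ {x y} → ν x y ≡ true → (x , y) ∈ arcs t ⊎ (Outside x i j × Outside y i j)) →
    (∀ {x y} → (x , y) ∈ arcs t → ν x y ≡ true) → Fits ν t
  fits (nil _) h h′ = tt
  fits {j = j} {ν} (int p e t) h h′ = (λ k → ≢true (λ r → [ (λ m → ℕₚ.<-irrefl refl (proj₁ (proj₁ (arcs-within t m)))) , (λ o → not-within pw (proj₁ o)) ]′ (h r)))
    , (λ k → ≢true (λ r → [ (λ m → ℕₚ.<-irrefl refl (proj₁ (proj₁ (proj₂ (arcs-within t m))))) , (λ o → not-within pw (proj₂ o)) ]′ (h r)))
    , fits t (λ r → [ inj₁ , (λ (a , b) → inj₂ (later a , later b)) ]′ (h r)) h′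
    where
    pw = positions-within (int p e t) (here refl)
    later : ∀ {k} → Outside k _ j → Outside k (suc p) j
    later (inj₁ a) = inj₁ (ℕₚ.<-trans a (s≤s (ℕₚ.≤-reflexive (sym (toℕ-src e)))))
    later (inj₂ b) = inj₂ b
  fits {i = i} {j = j} {ν} (call p q e t t′) h h′ =
    (h′ (here refl) , (λ k r → out (view r)) , (λ k → ≢true λ r → into-p (view r)))
    , ((λ k → ≢true λ r → from-q (view r)) , λ k r → into-q (view r))
    , fits t (λ r → inner (view r)) (λ m → h′ (there (∈-++⁺ˡ m)))
    , fits t′ (λ r → outer (view r)) (λ m → h′ (there (∈-++⁺ʳ (arcs t) m)))
    where
    p<q = call-< t
    pw = positions-within (call p q e t t′) (here refl)
    qw = positions-within (call p q e t t′) (there (∈-++⁺ʳ (positions t) (here refl)))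
    q≤ : ∀ {x : ℕ} → x < toℕ (inject₁ q) → x < toℕ q
    q≤ = subst (_ <_) (Finₚ.toℕ-inject₁ q)
    data View (x y : Fin _) : Set where
      this : x ≡ p → y ≡ q → View x y
      in₁ : (x , y) ∈ arcs t → View x y
      in₂ : (x , y) ∈ arcs t′ → View x y
      away : Outside x i j → Outside y i j → View x y
    view : ∀ {x y} → ν x y ≡ true → View x y
    view r with h r
    ... | inj₂ (a , b) = away a b
    ... | inj₁ (here refl) = this refl refl
    ... | inj₁ (there m) with ∈-++⁻ (arcs t) m
    ...   | inj₁ m′ = in₁ m′
    ...   | inj₂ m′ = in₂ m′
    out : ∀ {k} → View p k → k ≡ q
    out (this _ e) = e
    out (in₁ m) = ⊥-elim (ℕₚ.<-irrefl refl (proj₁ (proj₁ (arcs-within t m))))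
    out (in₂ m) = ⊥-elim (ℕₚ.<-asym p<q (proj₁ (proj₁ (arcs-within t′ m))))
    out (away a _) = ⊥-elim (not-within pw a)
    into-p : ∀ {k} → View k p → ⊥
    into-p (this _ e) = ℕₚ.<-irrefl (cong toℕ e) p<q
    into-p (in₁ m) = ℕₚ.<-irrefl refl (proj₁ (proj₁ (proj₂ (arcs-within t m))))
    into-p (in₂ m) = ℕₚ.<-asym p<q (proj₁ (proj₁ (proj₂ (arcs-within t′ m))))
    into-p (away _ a) = not-within pw a
    from-q : ∀ {k} → View q k → ⊥
    from-q (this e _) = ℕₚ.<-irrefl (cong toℕ (sym e)) p<q
    from-q (in₁ m) = ℕₚ.<-irrefl refl (q≤ (proj₂ (proj₁ (arcs-within t m))))
    from-q (in₂ m) = ℕₚ.<-irrefl refl (proj₁ (proj₁ (arcs-within t′ m)))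
    from-q (away a _) = not-within qw a
    into-q : ∀ {k} → View k q → k ≡ p
    into-q (this e _) = e
    into-q (in₁ m) = ⊥-elim (ℕₚ.<-irrefl refl (q≤ (proj₂ (proj₁ (proj₂ (arcs-within t m))))))
    into-q (in₂ m) = ⊥-elim (ℕₚ.<-irrefl refl (proj₁ (proj₁ (proj₂ (arcs-within t′ m)))))
    into-q (away _ a) = ⊥-elim (not-within qw a)
    o₁ : ∀ {k} → toℕ k ≤ toℕ p ⊎ toℕ q ≤ toℕ k → Outside k (suc p) (inject₁ q)
    o₁ (inj₁ a) = inj₁ (s≤s a)
    o₁ (inj₂ b) = inj₂ (subst (_≤ _) (sym (Finₚ.toℕ-inject₁ q)) b)
    away₁ : ∀ {k} → Outside k i j → toℕ k ≤ toℕ p ⊎ toℕ q ≤ toℕ k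
    away₁ (inj₁ a) = inj₁ (ℕₚ.≤-trans (ℕₚ.<⇒≤ a) (ℕₚ.≤-reflexive (sym (toℕ-src e))))
    away₁ (inj₂ b) = inj₂ (ℕₚ.≤-trans (ℕₚ.<⇒≤ (proj₂ qw)) b)
    away₂ : ∀ {k} → Outside k i j → Outside k (suc q) j
    away₂ (inj₁ a) = inj₁ (ℕₚ.<-trans a (s≤s (proj₁ qw)))
    away₂ (inj₂ b) = inj₂ b
    inner : ∀ {x y} → View x y → (x , y) ∈ arcs t ⊎ (Outside x (suc p) (inject₁ q) × Outside y (suc p) (inject₁ q))
    inner (this refl refl) = inj₂ (o₁ (inj₁ ℕₚ.≤-refl) , o₁ (inj₂ ℕₚ.≤-refl))
    inner (in₁ m) = inj₁ m
    inner (in₂ m) = let (a , b , _) = arcs-within t′ m in inj₂ (o₁ (inj₂ (ℕₚ.<⇒≤ (proj₁ a))) , o₁ (inj₂ (ℕₚ.<⇒≤ (proj₁ b))))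
    inner (away a b) = inj₂ (o₁ (away₁ a) , o₁ (away₁ b))
    outer : ∀ {x y} → View x y → (x , y) ∈ arcs t′ ⊎ (Outside x (suc q) j × Outside y (suc q) j)
    outer (this refl refl) = inj₂ (inj₁ (s≤s (ℕₚ.<⇒≤ p<q)) , inj₁ ℕₚ.≤-refl)
    outer (in₁ m) = let (a , b , _) = arcs-within t m in inj₂ (inj₁ (ℕₚ.<-trans (q≤ (proj₂ a)) ℕₚ.≤-refl) , inj₁ (ℕₚ.<-trans (q≤ (proj₂ b)) ℕₚ.≤-refl))
    outer (in₂ m) = inj₁ m
    outer (away a b) = inj₂ (away₂ a , away₂ b)

  Fits-arc : (t : Nest {n} i j) → Fits (arc t) t
  Fits-arc t = fits t (inj₁ ∘ arc-∈ t) (∈-arc t)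

  record IsNesting (ν : Fin n → Fin n → Bool) : Set where
    field
      forward : ∀ {x y} → ν x y ≡ true → toℕ x < toℕ y
      functional : ∀ {x y y′} → ν x y ≡ true → ν x y′ ≡ true → y ≡ y′
      injective : ∀ {x x′ y} → ν x y ≡ true → ν x′ y ≡ true → x ≡ x′
      noncrossing : ∀ {x y x′ y′} → ν x y ≡ true → ν x′ y′ ≡ true → toℕ x < toℕ x′ → toℕ y < toℕ x′ ⊎ toℕ y′ < toℕ y

  Fits-functional : ∀ {ν} (t : Nest {n} i j) → Fits ν t → ∀ {x y y′} → x ∈ positions t → ν x y ≡ true → ν x y′ ≡ true → y ≡ y′
  Fits-functional (int p _ t) (a , _ , f) (here refl) e e′ = absurd e (a _)
  Fits-functional (int p _ t) (_ , _ , f) (there m) e e′ = Fits-functional t f m e e′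
  Fits-functional (call p q _ t t′) ((_ , u , _) , _) (here refl) e e′ = trans (u _ e) (sym (u _ e′))
  Fits-functional (call p q _ t t′) (_ , (z , _) , f , g) (there m) e e′ with ∈-++⁻ (positions t) m
  ... | inj₁ m′ = Fits-functional t f m′ e e′
  ... | inj₂ (here refl) = absurd e (z _)
  ... | inj₂ (there m′) = Fits-functional t′ g m′ e e′

  Fits-injective : ∀ {ν} (t : Nest {n} i j) → Fits ν t → ∀ {x x′ y} → y ∈ positions t → ν x y ≡ true → ν x′ y ≡ true → x ≡ x′
  Fits-injective (int p _ t) (_ , a , f) (here refl) e e′ = absurd e (a _)
  Fits-injective (int p _ t) (_ , _ , f) (there m) e e′ = Fits-injective t f m e e′
  Fits-injective (call p q _ t t′) ((_ , _ , z) , _) (here refl) e e′ = absurd e (z _)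
  Fits-injective (call p q _ t t′) (_ , (_ , u) , f , g) (there m) e e′ with ∈-++⁻ (positions t) m
  ... | inj₁ m′ = Fits-injective t f m′ e e′
  ... | inj₂ (here refl) = trans (u _ e) (sym (u _ e′))
  ... | inj₂ (there m′) = Fits-injective t′ g m′ e e′

  arcs-noncrossing : (t : Nest {n} i j) → ∀ {x y x′ y′} → (x , y) ∈ arcs t → (x′ , y′) ∈ arcs t →
    toℕ x < toℕ x′ → toℕ y < toℕ x′ ⊎ toℕ y′ < toℕ y
  arcs-noncrossing (int p _ t) m m′ lt = arcs-noncrossing t m m′ lt
  arcs-noncrossing (call p q e t t′) (here refl) (here refl) lt = ⊥-elim (ℕₚ.<-irrefl refl lt)
  arcs-noncrossing (call p q e t t′) (here refl) (there m′) lt with ∈-++⁻ (arcs t) m′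
  ... | inj₁ k = inj₂ (subst (_ <_) (Finₚ.toℕ-inject₁ q) (proj₂ (proj₁ (proj₂ (arcs-within t k)))))
  ... | inj₂ k = inj₁ (proj₁ (proj₁ (arcs-within t′ k)))
  arcs-noncrossing (call p q e t t′) (there m) (here refl) lt with ∈-++⁻ (arcs t) m
  ... | inj₁ k = ⊥-elim (ℕₚ.<-asym lt (proj₁ (proj₁ (arcs-within t k))))
  ... | inj₂ k = ⊥-elim (ℕₚ.<-asym lt (ℕₚ.<-trans (call-< t) (proj₁ (proj₁ (arcs-within t′ k)))))
  arcs-noncrossing (call p q e t t′) (there m) (there m′) lt with ∈-++⁻ (arcs t) m | ∈-++⁻ (arcs t) m′
  ... | inj₁ k | inj₁ k′ = arcs-noncrossing t k k′ lt
  ... | inj₂ k | inj₂ k′ = arcs-noncrossing t′ k k′ lt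
  ... | inj₁ k | inj₂ k′ = inj₁ (ℕₚ.<-trans (subst (_ <_) (Finₚ.toℕ-inject₁ q) (proj₂ (proj₁ (proj₂ (arcs-within t k))))) (proj₁ (proj₁ (arcs-within t′ k′))))
  ... | inj₂ k | inj₁ k′ = ⊥-elim (ℕₚ.<-asym lt (ℕₚ.<-trans (subst (_ <_) (Finₚ.toℕ-inject₁ q) (proj₂ (proj₁ (arcs-within t k′)))) (proj₁ (proj₁ (arcs-within t′ k)))))

  arc-isNesting : (t : Nest {n} zero (fromℕ n)) → IsNesting (arc t)
  arc-isNesting t = record
    { forward = λ e → proj₂ (proj₂ (arcs-within t (arc-∈ t e)))
    ; functional = λ {x} → Fits-functional t (Fits-arc t) (∈-full t x)
    ; injective = λ {_} {_} {y} → Fits-injective t (Fits-arc t) (∈-full t y)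
    ; noncrossing = λ e e′ → arcs-noncrossing t (arc-∈ t e) (arc-∈ t e′) }

  module Parse {ν : Fin n → Fin n → Bool} (N : IsNesting ν) where
    open IsNesting N

    Closed : Fin (suc n) → Fin (suc n) → Set
    Closed i j = ∀ {x y} → ν x y ≡ true → (x within i , j → y within i , j) × (y within i , j → x within i , j)

    private
      parseAt : ∀ d (p : Fin n) i j → toℕ j ≤ suc d ℕ.+ toℕ i → inject₁ p ≡ i → toℕ i < toℕ j → Closed i j → Σ (Nest i j) (Fits ν)

    -- Recursive descent on the first position of a span that no arc leaves. If it has a partner q,
    -- noncrossing makes both the span up to q and the rest after q closed again.
    parse : ∀ d i j → toℕ j ≤ d ℕ.+ toℕ i → toℕ i ≤ toℕ j → Closed i j → Σ (Nest i j) (Fits ν)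
    parse d i j le le′ cl with i ≟ j
    ... | yes e = nil e , tt
    parse zero i j le le′ cl | no ne = ⊥-elim (ne (Finₚ.toℕ-injective (ℕₚ.≤-antisym le′ le)))
    parse (suc d) i j le le′ cl | no ne = parseAt d (F.lower₁ i i≢n) i j le (Finₚ.inject₁-lower₁ i i≢n) i<j cl
      where
      i<j : toℕ i < toℕ j
      i<j = ℕₚ.≤∧≢⇒< le′ (ne ∘ Finₚ.toℕ-injective)
      i≢n : n ≢ toℕ i
      i≢n e = ℕₚ.<-irrefl (sym e) (ℕₚ.<-≤-trans i<j (ℕ.s≤s⁻¹ (Finₚ.toℕ<n j)))

    parseAt d p i j le e i<j cl with Finₚ.any? (λ q → ν p q Bool.≟ true)
    ... | no none = let (t , f) = parse d (suc p) j le₁ p<j cl′ in int p e t , (λ k → ≢true λ r → none (k , r)) , no-in , f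
      where
      p≡i = toℕ-src e
      p<j : toℕ p < toℕ j
      p<j = subst (_< toℕ j) (sym p≡i) i<j
      le₁ : toℕ j ≤ d ℕ.+ suc (toℕ p)
      le₁ = ℕₚ.≤-trans le (ℕₚ.≤-reflexive (trans (cong (λ x → suc (d ℕ.+ x)) (sym p≡i)) (sym (ℕₚ.+-suc d _))))
      pw : p within i , j
      pw = ℕₚ.≤-reflexive (sym p≡i) , p<j
      no-in : ∀ k → ν k p ≡ false
      no-in k = ≢true λ r → ℕₚ.<⇒≱ (forward r) (subst (_≤ toℕ k) (sym p≡i) (proj₁ (proj₂ (cl r) pw)))
      up : ∀ {x} → toℕ p < toℕ x → toℕ i ≤ toℕ x
      up lt = ℕₚ.≤-trans (ℕₚ.≤-reflexive (sym p≡i)) (ℕₚ.<⇒≤ lt)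
      cl′ : Closed (suc p) j
      cl′ {x} {y} r = (λ (a , b) → ℕₚ.<-trans a (forward r) , proj₂ (proj₁ (cl r) (up a , b)))
        , λ (a , b) → let (c , d) = proj₂ (cl r) (up a , b) in
            ℕₚ.≤∧≢⇒< (subst (_≤ toℕ x) (sym p≡i) c) (λ eq → none (y , subst (λ z → ν z y ≡ true) (sym (Finₚ.toℕ-injective eq)) r)) , d
    ... | yes (q , pq) =
      let (t , f) = parse d (suc p) (inject₁ q) (ℕₚ.≤-trans (ℕₚ.≤-reflexive (Finₚ.toℕ-inject₁ q)) (ℕₚ.≤-trans (ℕₚ.<⇒≤ q<j) le₁)) (subst (toℕ p <_) (sym (Finₚ.toℕ-inject₁ q)) p<q) cl₁
          (t′ , f′) = parse d (suc q) j (ℕₚ.≤-trans le₁ (ℕₚ.+-monoʳ-≤ d (s≤s (ℕₚ.<⇒≤ p<q)))) q<j cl₂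
      in call p q e t t′ , (pq , (λ k r → functional r pq) , no-in) , (no-out , λ k r → injective r pq) , f , f′
      where
      p≡i = toℕ-src e
      p<q = forward pq
      p<j : toℕ p < toℕ j
      p<j = subst (_< toℕ j) (sym p≡i) i<j
      pw : p within i , j
      pw = ℕₚ.≤-reflexive (sym p≡i) , p<j
      q<j : toℕ q < toℕ j
      q<j = proj₂ (proj₁ (cl pq) pw)
      le₁ : toℕ j ≤ d ℕ.+ suc (toℕ p)
      le₁ = ℕₚ.≤-trans le (ℕₚ.≤-reflexive (trans (cong (λ x → suc (d ℕ.+ x)) (sym p≡i)) (sym (ℕₚ.+-suc d _))))
      no-in : ∀ k → ν k p ≡ false
      no-in k = ≢true λ r → ℕₚ.<⇒≱ (forward r) (subst (_≤ toℕ k) (sym p≡i) (proj₁ (proj₂ (cl r) pw)))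
      -- No axiom directly forbids a position to be both a return and a call. It follows from
      -- noncrossing for the arc ending at q and an arc beginning there: one alternative is q < q,
      -- the other contradicts the direction of the second arc.
      no-out : ∀ k → ν q k ≡ false
      no-out k = ≢true λ r → [ ℕₚ.<-irrefl refl , ℕₚ.<-asym (forward r) ]′ (noncrossing pq r p<q)
      up : ∀ {x} → toℕ p < toℕ x → toℕ i ≤ toℕ x
      up lt = ℕₚ.≤-trans (ℕₚ.≤-reflexive (sym p≡i)) (ℕₚ.<⇒≤ lt)
      after-p : ∀ {x y} → ν x y ≡ true → toℕ i ≤ toℕ x → y ≢ q → toℕ p < toℕ x
      after-p {x} {y} r le ne = ℕₚ.≤∧≢⇒< (subst (_≤ toℕ x) (sym p≡i) le)
        λ eq → ne (functional (subst (λ z → ν z y ≡ true) (sym (Finₚ.toℕ-injective eq)) r) pq)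
      iq = Finₚ.toℕ-inject₁ q
      cl₁ : Closed (suc p) (inject₁ q)
      cl₁ {x} {y} r = (λ (a , b) → ℕₚ.<-trans a (forward r) ,
          [ (λ c → ⊥-elim (ℕₚ.<-asym (subst (toℕ x <_) iq b) c)) , subst (toℕ y <_) (sym iq) ]′ (noncrossing pq r a))
        , λ (a , b) → let y<q = subst (toℕ y <_) iq b in
            after-p r (proj₁ (proj₂ (cl r) (up a , ℕₚ.<-trans y<q q<j))) (λ { refl → ℕₚ.<-irrefl refl y<q }) , ℕₚ.<-trans (forward r) b
      cl₂ : Closed (suc q) j
      cl₂ {x} {y} r = (λ (a , b) → ℕₚ.<-trans a (forward r) , proj₂ (proj₁ (cl r) (up (ℕₚ.<-trans p<q a) , b)))
        , λ (a , b) → let (c , d) = proj₂ (cl r) (up (ℕₚ.<-trans p<q a) , b) in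
            [ (λ x → x) , (λ y<q → ⊥-elim (ℕₚ.<-asym a y<q)) ]′ (noncrossing pq r (after-p r c λ { refl → ℕₚ.<-irrefl refl a })) , d

    parse-full : Σ (Nest zero (fromℕ n)) (Fits ν)
    parse-full = parse n zero (fromℕ n) (ℕₚ.≤-reflexive (trans (Finₚ.toℕ-fromℕ n) (sym (ℕₚ.+-identityʳ n)))) z≤n λ r →
        (λ _ → z≤n , all<) , (λ _ → z≤n , all<)
      where
      all< : ∀ {k : Fin n} → toℕ k < toℕ (fromℕ n)
      all< {k} = subst (toℕ k <_) (sym (Finₚ.toℕ-fromℕ n)) (Finₚ.toℕ<n k)

  private
    allᶠ⁺ : ∀ {p : Fin n → Bool} → (∀ k → p k ≡ true) → all p (allFin n) ≡ true
    allᶠ⁺ = all⁺ (allFin _)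

    allᶠ⁻ : ∀ {p : Fin n → Bool} → all p (allFin n) ≡ true → ∀ k → p k ≡ true
    allᶠ⁻ h k = all⁻ h (allFin-mem k)

    ⇒⁺ : ∀ {a b} → (a ≡ true → b ≡ true) → a ⇒ᵇ b ≡ true
    ⇒⁺ {true} h = h refl
    ⇒⁺ {false} h = refl

    ⇒⁻ : ∀ {a b} → a ⇒ᵇ b ≡ true → a ≡ true → b ≡ true
    ⇒⁻ {true} h _ = h

  isNestᵇ⁻ : (M : Rel n) → T (isNestᵇ M) → IsNesting (rel M)
  isNestᵇ⁻ M h = let (a , h₁) = ∧⁻ (Equivalence.to (Boolₚ.T-≡ {isNestᵇ M}) h) ; (b , h₂) = ∧⁻ h₁ ; (c , d) = ∧⁻ h₂ in record
    { forward = λ {x} {y} e → ⌊⌋-true⁻ (x F.<? y) (⇒⁻ (allᶠ⁻ (allᶠ⁻ a x) y) e)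
    ; functional = λ {x} {y} {y′} e e′ → ⌊⌋-true⁻ (y ≟ y′) (⇒⁻ (allᶠ⁻ (allᶠ⁻ (allᶠ⁻ b x) y) y′) (cong₂ _∧_ e e′))
    ; injective = λ {x} {x′} {y} e e′ → ⌊⌋-true⁻ (x ≟ x′) (⇒⁻ (allᶠ⁻ (allᶠ⁻ (allᶠ⁻ c x) x′) y) (cong₂ _∧_ e e′))
    ; noncrossing = λ {x} {y} {x′} {y′} e e′ lt → ⊎-map (⌊⌋-true⁻ (y F.<? x′)) (⌊⌋-true⁻ (y′ F.<? y)) (∨⁻
        (⇒⁻ (allᶠ⁻ (allᶠ⁻ (allᶠ⁻ (allᶠ⁻ d x) y) x′) y′) (cong₂ _∧_ e (cong₂ _∧_ e′ (⌊⌋-true (x F.<? x′) lt))))) }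

  isNestᵇ⁺ : (M : Rel n) → IsNesting (rel M) → T (isNestᵇ M)
  isNestᵇ⁺ {n} M N = Equivalence.from (Boolₚ.T-≡ {isNestᵇ M}) (cong₂ _∧_
    (allᶠ⁺ λ x → allᶠ⁺ λ y → ⇒⁺ λ e → ⌊⌋-true (x F.<? y) (forward e))
    (cong₂ _∧_ (allᶠ⁺ {n} λ x → allᶠ⁺ {n} λ y → allᶠ⁺ {n} λ y′ → ⇒⁺ λ e → let (a , b) = ∧⁻ e in ⌊⌋-true (y ≟ y′) (functional {x} {y} {y′} a b))
    (cong₂ _∧_ (allᶠ⁺ {n} λ x → allᶠ⁺ {n} λ x′ → allᶠ⁺ {n} λ y → ⇒⁺ λ e → let (a , b) = ∧⁻ e in ⌊⌋-true (x ≟ x′) (injective {x} {x′} {y} a b))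
    (allᶠ⁺ λ x → allᶠ⁺ λ y → allᶠ⁺ λ x′ → allᶠ⁺ λ y′ → ⇒⁺ λ e → let (a , bc) = ∧⁻ e ; (b , c) = ∧⁻ bc in
      ∨⁺ (⊎-map (⌊⌋-true (y F.<? x′)) (⌊⌋-true (y′ F.<? y)) (noncrossing a b (⌊⌋-true⁻ (x F.<? x′) c)))))))
    where open IsNesting N

  toRel : Nest {n} zero (fromℕ n) → Rel n
  toRel t = V.tabulate λ x → V.tabulate (arc t x)

  rel-toRel : ∀ (t : Nest {n} zero (fromℕ n)) x y → rel (toRel t) x y ≡ arc t x y
  rel-toRel t x y = trans (cong (λ v → V.lookup v y) (Vecₚ.lookup∘tabulate (λ x → V.tabulate (arc t x)) x)) (Vecₚ.lookup∘tabulate (arc t x) y)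

  private
    lookup-ext : ∀ {a} {A : Set a} {m} {v w : Vec A m} → (∀ k → V.lookup v k ≡ V.lookup w k) → v ≡ w
    lookup-ext {v = v} {w} h = trans (sym (Vecₚ.tabulate∘lookup v)) (trans (Vecₚ.tabulate-cong h) (Vecₚ.tabulate∘lookup w))

  Fits-toRel : (t : Nest {n} zero (fromℕ n)) → Fits (rel (toRel t)) t
  Fits-toRel t = fits t (λ {x} {y} e → inj₁ (arc-∈ t (trans (sym (rel-toRel t x y)) e))) (λ {x} {y} m → trans (rel-toRel t x y) (∈-arc t m))

  toRel-isNest : (t : Nest {n} zero (fromℕ n)) → T (isNestᵇ (toRel t))
  toRel-isNest t = isNestᵇ⁺ (toRel t) record
    { forward = λ {x} {y} e → forward (to x y e)
    ; functional = λ {x} {y} {y′} e e′ → functional (to x y e) (to x y′ e′)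
    ; injective = λ {x} {x′} {y} e e′ → injective (to x y e) (to x′ y e′)
    ; noncrossing = λ {x} {y} {x′} {y′} e e′ → noncrossing (to x y e) (to x′ y′ e′) }
    where
    open IsNesting (arc-isNesting t)
    to : ∀ x y → rel (toRel t) x y ≡ true → arc t x y ≡ true
    to x y = trans (sym (rel-toRel t x y))

  toRel-injective : ∀ {t t′ : Nest {n} zero (fromℕ n)} → toRel t ≡ toRel t′ → t ≡ t′
  toRel-injective {t = t} {t′} e = Fits-determines-tree t t′ (subst (λ M → Fits (rel M) t) e (Fits-toRel t)) (Fits-toRel t′)

  toRel-surjective : (M : Rel n) → T (isNestᵇ M) → ∃ λ t → toRel t ≡ M
  toRel-surjective M h = let (t , f) = Parse.parse-full (isNestᵇ⁻ M h) in
    t , lookup-ext λ x → lookup-ext λ y → Fits-determines-relation t (Fits-toRel t) f x y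

  module _ {c ℓ} (R : Semiring c ℓ) where
    open Semiring R using (0#; +-identityʳ) renaming (Carrier to C; _≈_ to _≈_; refl to ≈-refl; sym to ≈-sym; trans to ≈-trans; reflexive to ≈-reflexive)
    open Sums R
    open TreeSum R

    private
      ∑-guard : ∀ {a} {A : Set a} b {g : T b → C} (h : T b → A) (f : A → C) → (∀ p → g p ≈ f (h p)) →
        guard 0# b g ≈ ∑ (guard [] b λ p → h p ∷ []) f
      ∑-guard true h f e = ≈-trans (e tt) (≈-sym (+-identityʳ _))
      ∑-guard false h f e = ≈-refl

      guard-∈ : ∀ {a} {A : Set a} b {h : T b → A} {x} → x ∈ guard [] b (λ p → h p ∷ []) → ∃ λ p → x ≡ h p
      guard-∈ true (here e) = tt , e

      ∈-guard : ∀ {a} {A : Set a} b {h : T b → A} p → h p ∈ guard [] b (λ p → h p ∷ [])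
      ∈-guard true p = here refl

      guard-unique : ∀ {a} {A : Set a} b {h : T b → A} → Unique (guard [] b (λ p → h p ∷ []))
      guard-unique true = All.[] ∷ []
      guard-unique false = []

    -- Both sides enumerate, without repetition, the pairs of a matrix and a proof that it is a
    -- nesting relation: `toRel` is injective and surjective, and a proof of `T` is unique.
    ∑-nestings : (f : (M : Rel n) → T (isNestᵇ M) → C) →
      ∑ (allVecs (allVecs bools n) n) (λ M → guard 0# (isNestᵇ M) (f M)) ≈ ∑ᵗ zero (fromℕ n) (λ t → f (toRel t) (toRel-isNest t))
    ∑-nestings {n} f = ≈-trans (∑-cong Ms λ M → ∑-guard (isNestᵇ M) (M ,_) (uncurry f) λ p → ≈-refl)
      (≈-trans (≈-sym (∑-concatMap good Ms (uncurry f)))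
      (≈-trans (∑-same (uncurry f) (concatMap-uniq Ms-unique (λ M → guard-unique (isNestᵇ M))
          λ {M} {M′} p q → trans (sym (cong proj₁ (proj₂ (guard-∈ (isNestᵇ M) p)))) (cong proj₁ (proj₂ (guard-∈ (isNestᵇ M′) q))))
        (Uniq.map⁺ (λ e → toRel-injective (cong proj₁ e)) (nests-unique n zero (fromℕ n)))
        (λ m → to (∈-concatMap⁻′ Ms m)) (λ m → back (∈-map⁻ pair m)))
      (≈-reflexive (∑-map pair (nests n zero (fromℕ n)) (uncurry f)))))
      where
      Ms = allVecs (allVecs bools n) n
      Ms-unique : Unique Ms
      Ms-unique = FT.uniq (ft-Vec (ft-Vec ft-Bool n) n)
      good : (M : Rel n) → List (Σ (Rel n) (T ∘ isNestᵇ))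
      good M = guard [] (isNestᵇ M) λ p → (M , p) ∷ []
      pair : Nest zero (fromℕ n) → Σ (Rel n) (T ∘ isNestᵇ)
      pair t = toRel t , toRel-isNest t
      pair-≡ : ∀ {M M′ : Rel n} {p : T (isNestᵇ M)} {p′ : T (isNestᵇ M′)} → M ≡ M′ → _≡_ {A = Σ (Rel n) (T ∘ isNestᵇ)} (M , p) (M′ , p′)
      pair-≡ {M} {p = p} {p′} refl = cong (M ,_) (Boolₚ.T-irrelevant p p′)
      to : ∀ {x} → (∃ λ M → M ∈ Ms × x ∈ good M) → x ∈ map pair (nests n zero (fromℕ n))
      to (M , _ , m) with guard-∈ (isNestᵇ M) m
      ... | p , refl with toRel-surjective M p
      ...   | t , e = subst (_∈ map pair (nests n zero (fromℕ n))) (pair-≡ e) (∈-map⁺ pair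
                (nests-complete n t (ℕₚ.≤-reflexive (trans (Finₚ.toℕ-fromℕ n) (sym (ℕₚ.+-identityʳ n))))))
      back : ∀ {x} → (∃ λ t → t ∈ nests n zero (fromℕ n) × x ≡ pair t) → x ∈ concatMap good Ms
      back (t , _ , refl) = ∈-concatMap⁺′ (FT.mem (ft-Vec (ft-Vec ft-Bool n) n) (toRel t)) (∈-guard (isNestᵇ (toRel t)) (toRel-isNest t))

-- Weighted tree automata and their algebraic systems.

module TreeAutomata {c ℓ} (K : CommutativeSemiring c ℓ) where
  open import Data.Fin using (_≟_)
  open import Data.List using (map; length; lookup; concatMap; _++_)
  open import Data.List.Relation.Unary.All using (All; []; _∷_)
  open import Data.List.Relation.Unary.Any using (index)
  open import Data.List.Relation.Unary.Any.Properties using (lookup-index)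
  open import Level using (_⊔_) renaming (suc to lsuc; zero to 0ℓ)
  open import Defs using (allFin; Algebraic)
  open FiniteSum
  open Matrix
  open Tree

  open CommutativeSemiring K hiding (zero) renaming (Carrier to C; refl to ≈-refl; sym to ≈-sym; trans to ≈-trans)
  open Sums semiring
  open Points K
  open TreeSum semiring

  -- A weighted tree automaton on nestings seen as binary trees: a call has the inner span and the
  -- remainder as its subtrees, and the letters at both ends of the arc are read together.
  record WTA (A : Set) : Set (lsuc 0ℓ ⊔ c) where
    field
      {Q} : Set
      ft : FT Q
      ι e : Q → C
      wi : Q → A → Q → C
      wc : Q → A → Q → A → Q → C

    open FT ft public using (en)

    module _ {n : ℕ} (letter : Fin n → A) where
      W : ∀ {i j : Fin (suc n)} → Nest i j → Q → C
      W (nil _) q = e q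
      W (int p _ t) q = ∑ en λ q′ → wi q (letter p) q′ * W t q′
      W (call p r _ t t′) q = ∑ en λ q₁ → ∑ en λ q₂ → wc q (letter p) q₁ (letter r) q₂ * (W t q₁ * W t′ q₂)

      weight : ∀ {i j : Fin (suc n)} → Nest i j → C
      weight t = ∑ en λ q → ι q * W t q

  ∑-lookup : ∀ {a} {A : Set a} (xs : List A) (f : A → C) → ∑ (allFin (length xs)) (f ∘ lookup xs) ≈ ∑ xs f
  ∑-lookup [] f = ≈-refl
  ∑-lookup (x ∷ xs) f = +-congˡ (≈-trans (reflexive (∑-map suc (allFin (length xs)) (f ∘ lookup (x ∷ xs)))) (∑-lookup xs f))

  module ToSystem {m : ℕ} (𝒜 : WTA (Fin m)) where
    open WTA 𝒜
    open Expression K m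

    var : ∀ {V} → V → Mono V
    var X = inj₂ X ∷ []

    letters : ∀ {V} → (Fin m → Expr V) → Expr V
    letters G = concatMap (λ a → prep a (G a)) (allFin m)

    calls : Q → Fin m → Q → Expr Q
    calls q a q₁ = ((1# , var q₁) ∷ []) ⊗ letters λ b → map (λ q₂ → wc q a q₁ b q₂ , var q₂) en

    body : Q → Fin m → Expr Q
    body q a = map (λ q′ → wi q a q′ , var q′) en ++ concatMap (calls q a) en

    -- The series of a state has the constant term `e q`, whereas the solution of a proper system
    -- must be quasiregular. So the variable stands for the series without its constant term, and σ
    -- restores the series.
    σ : Q → Expr Q
    σ q = (e q , []) ∷ (1# , var q) ∷ []

    E : Q → Expr Q
    E q = sub σ (letters (body q))

    -- The additional variable `nothing` carries the sum over all states with the initial weights,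
    -- which is the series to be represented.
    V′ : Set
    V′ = Maybe Q

    ft′ : FT V′
    ft′ = ft-Maybe ft

    idx : V′ → Fin (length (FT.en ft′))
    idx x = index (FT.mem ft′ x)

    ren : V′ → Expr (Fin (length (FT.en ft′)))
    ren x = (1# , var (idx x)) ∷ []

    E′ : V′ → Expr Q
    E′ nothing = concatMap (λ q → scale (ι q) (E q)) en
    E′ (just q) = E q

    system : Fin (length (FT.en ft′)) → Expr (Fin (length (FT.en ft′)))
    system k = sub (ren ∘ just) (E′ (lookup (FT.en ft′) k))

    private
      start-prep : ∀ {V} a (F : Expr V) → AllE Start (prep a F)
      start-prep a F = Allₚ.map⁺ (All.universal (λ _ → start) F)

      start-letters : ∀ {V} (G : Fin m → Expr V) → AllE Start (letters G)
      start-letters G = Allₚ.concat⁺ (Allₚ.map⁺ (All.universal (λ a → start-prep a (G a)) (allFin m)))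

      start-sub : ∀ {V V′} (σ : V → Expr V′) {F} → AllE Start F → AllE Start (sub σ F)
      start-sub σ = AllE-sub σ λ { {inj₁ a ∷ u} start → start-prep a (subM σ u) }

      start-E : ∀ q → AllE Start (E q)
      start-E q = start-sub σ (start-letters (body q))

      start-E′ : ∀ x → AllE Start (E′ x)
      start-E′ nothing = Allₚ.concat⁺ (Allₚ.map⁺ (All.universal (λ q → Allₚ.map⁺ (start-E q)) en))
      start-E′ (just q) = start-E q

      start-system : ∀ k → AllE Start (system k)
      start-system k = start-sub (ren ∘ just) (start-E′ (lookup (FT.en ft′) k))

    module _ {n : ℕ} (letter : Fin n → Fin m) where
      open Val letter

      N : Q → Mat n
      N q i j = ∑ᵗ i j λ t → W letter t q

      val-letters : ∀ {V} (τ : V → Mat n) G i j → val τ (letters G) i j ≈ ∑ (allFin n) λ p → [ inject₁ p ≟ i ] * val τ (G (letter p)) (suc p) j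
      val-letters τ G i j = ≈-trans (val-concatMap τ (λ a → prep a (G a)) (allFin m) i j)
        (≈-trans (∑-cong (allFin m) λ a → ≈-trans (val-prep τ a (G a) i j) (Λ-⊛ letter a (val τ (G a)) i j))
        (≈-trans (∑-swap (allFin m) (allFin n) _) (∑-cong (allFin n) λ p →
          ≈-trans (≈-sym (∑-*ˡ (allFin m) _ _)) (*-congˡ (∑-δ (ft-Fin m) (letter p) λ a → val τ (G a) (suc p) j)))))

      private
        val-var : ∀ (f : Q → C) i j → val N (map (λ q → f q , var q) en) i j ≈ ∑ en λ q → f q * N q i j
        val-var f i j = ≈-trans (reflexive (∑-map _ en _)) (∑-cong en λ q → *-congˡ (𝕄ₙ.*-identityʳ (N q) i j))

        val-calls : ∀ q a q₁ i j → val N (calls q a q₁) i j ≈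
          ∑ (allFin n) λ r → N q₁ i (inject₁ r) * ∑ en λ q₂ → wc q a q₁ (letter r) q₂ * N q₂ (suc r) j
        val-calls q a q₁ i j = ≈-trans (val-⊗ N ((1# , var q₁) ∷ []) (letters G) i j) (≈-trans
          (𝕄ₙ.*-cong (𝕄ₙ.trans (val-one N (var q₁)) (𝕄ₙ.*-identityʳ (N q₁))) (𝕄ₙ.refl {val N (letters G)}) i j)
          (≈-trans (∑-cong (allFin (suc n)) λ k → ≈-trans (*-congˡ (val-letters N G k j)) (∑-*ˡ (allFin n) _ _))
          (≈-trans (∑-swap (allFin (suc n)) (allFin n) _) (∑-cong (allFin n) λ r →
            ≈-trans (∑-cong (allFin (suc n)) λ k → ≈-trans (≈-sym (*-assoc _ _ _)) (≈-trans (*-congʳ (*-comm _ _)) (*-assoc _ _ _)))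
            (≈-trans (∑-δ (ft-Fin (suc n)) (inject₁ r) λ k → N q₁ i k * val N (G (letter r)) (suc r) j)
              (*-congˡ (val-var (λ q₂ → wc q a q₁ (letter r) q₂) (suc r) j)))))))
          where
          G : Fin m → Expr Q
          G b = map (λ q₂ → wc q a q₁ b q₂ , var q₂) en

      -- The decomposition `∑ᵗ-step` read as an equation of matrices; the choice of a return
      -- position in it becomes the product with the matrix of the return letter.
      N-eq : ∀ q → N q ≋ λ i j → [ i ≟ j ] * e q + val N (letters (body q)) i j
      N-eq q i j = ≈-trans (∑ᵗ-step i j (λ _ → ≈-refl) (λ _ _ _ → ≈-refl) (λ _ _ _ _ _ → ≈-refl))
        (+-congˡ (≈-sym (≈-trans (val-letters N (body q) i j) (∑-cong (allFin n) λ p → *-congˡ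
          (≈-trans (val-++ N (map (λ q′ → wi q (letter p) q′ , var q′) en) (concatMap (calls q (letter p)) en) (suc p) j)
            (+-cong (≈-trans (val-var _ (suc p) j) (≈-trans (∑-cong en λ q′ → ∑-*ˡ (nests n (suc p) j) _ _) (∑-swap en (nests n (suc p) j) _)))
              (≈-trans (val-concatMap N (calls q (letter p)) en (suc p) j) (≈-trans (∑-cong en λ q₁ → val-calls q (letter p) q₁ (suc p) j)
                (≈-trans (∑-swap en (allFin n) _) (∑-cong (allFin n) λ r → pull p r))))))))))
        where
        pull : ∀ p r → (∑ en λ q₁ → N q₁ (suc p) (inject₁ r) * ∑ en λ q₂ → wc q (letter p) q₁ (letter r) q₂ * N q₂ (suc r) j) ≈
          ∑ᵗ (suc p) (inject₁ r) λ t → ∑ᵗ (suc r) j λ t′ → ∑ en λ q₁ → ∑ en λ q₂ → wc q (letter p) q₁ (letter r) q₂ * (W letter t q₁ * W letter t′ q₂)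
        pull p r = ≈-trans
          (∑-cong en λ q₁ → ≈-trans (∑-*ʳ (nests n (suc p) (inject₁ r)) _ _) (∑-cong (nests n (suc p) (inject₁ r)) λ t →
            ≈-trans (∑-*ˡ en _ _) (≈-trans (∑-cong en λ q₂ → ≈-trans (*-congˡ (∑-*ˡ (nests n (suc r) j) _ _))
              (≈-trans (∑-*ˡ (nests n (suc r) j) _ _) (∑-cong (nests n (suc r) j) λ t′ →
                ≈-trans (≈-sym (*-assoc _ _ _)) (≈-trans (*-congʳ (*-comm _ _)) (*-assoc _ _ _)))))
              (∑-swap en (nests n (suc r) j) _))))
          (≈-trans (∑-swap en (nests n (suc p) (inject₁ r)) _) (∑-cong (nests n (suc p) (inject₁ r)) λ t → ∑-swap en (nests n (suc r) j) _))

      T : V′ → Mat n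
      T (just q) = val N (letters (body q))
      T nothing i j = ∑ en λ q → ι q * T (just q) i j

      private
        N-σ : ∀ q → val (T ∘ just) (σ q) ≋ N q
        N-σ q i j = ≈-trans (+-cong (*-comm _ _) (val-one (T ∘ just) (var q) i j)) (≈-trans (+-congˡ (𝕄ₙ.*-identityʳ (T (just q)) i j)) (≈-sym (N-eq q i j)))

        T-eq : ∀ x → T x ≋ val (T ∘ just) (E′ x)
        T-eq (just q) = 𝕄ₙ.sym (val-sub σ N-σ (letters (body q)))
        T-eq nothing i j = ≈-sym (≈-trans (val-concatMap (T ∘ just) (λ q → scale (ι q) (E q)) en i j)
          (∑-cong en λ q → ≈-trans (val-scale (T ∘ just) (ι q) (E q) i j) (*-congˡ (≈-sym (T-eq (just q) i j)))))

        Band-N : ∀ q → Band 0 (N q)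
        Band-N q i j lt = ∑ᵗ-below (λ t → W letter t q) lt

      Band-T : ∀ x → Band 0 (T x)
      Band-T (just q) = Band-val (letters (body q)) Band-N
      Band-T nothing i j lt = ∑-0 en λ q → ≈-trans (*-congˡ (Band-T (just q) i j lt)) (zeroʳ _)

      private
        T″ : Fin (length (FT.en ft′)) → Mat n
        T″ = T ∘ lookup (FT.en ft′)

        T″-idx : ∀ x → T″ (idx x) ≡ T x
        T″-idx x = ≡.cong T (≡.sym (lookup-index (FT.mem ft′ x)))

        T″-eq : ∀ k → T″ k ≋ val T″ (system k)
        T″-eq k = 𝕄ₙ.trans (T-eq (lookup (FT.en ft′) k)) (𝕄ₙ.sym (val-sub (ren ∘ just)
          (λ q i j → ≈-trans (val-one T″ (var (idx (just q))) i j) (≈-trans (𝕄ₙ.*-identityʳ (T″ (idx (just q))) i j)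
            (reflexive (≡.cong (λ M → M i j) (T″-idx (just q)))))) (E′ (lookup (FT.en ft′) k))))

      solution : ∀ {G} → (∀ k → Band 0 (G k)) → (∀ k → G k ≋ val G (system k)) → ∀ x → G (idx x) ≋ T x
      solution bG eG x i j = ≈-trans (solution-unique letter system start-system bG (Band-T ∘ lookup (FT.en ft′)) eG T″-eq (idx x) i j)
        (reflexive (≡.cong (λ M → M i j) (T″-idx x)))

    open Hat K m
    open Existence system start-system

    weight⇒algebraic : ∀ S → S [] ≈ 0# → (∀ a w → S (a ∷ w) ≈ ∑ᵗ zero (fromℕ (suc (length w))) (weight (lookup (a ∷ w)))) →
      Algebraic K m S
    weight⇒algebraic S S[] S∷ = algebraic (idx nothing) S eq
      where
      eq : ∀ w → S w ≈ Sol (idx nothing) w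
      eq [] = ≈-trans S[] (≈-sym (Sol-[] (idx nothing)))
      eq (a ∷ w) = ≈-trans (S∷ a w) (≈-trans (∑-swap (nests n zero (fromℕ n)) en _) (≈-trans
        (∑-cong en λ q → ≈-trans (≈-sym (∑-*ˡ (nests n zero (fromℕ n)) _ _)) (*-congˡ
          -- The word is nonempty, so its first and last points differ and the constant term drops
          -- out.
          (≈-trans (N-eq letter q zero (fromℕ n)) (≈-trans (+-congʳ (zeroˡ _)) (+-identityˡ _)))))
        (≈-trans (≈-sym (solution letter (λ k → hat-Band0 (Sol k) (a ∷ w)) (λ k → Sol-hat k (a ∷ w)) nothing zero (fromℕ n)))
          (reflexive (hat-full (Sol (idx nothing)) (a ∷ w))))))
        where
        n = suc (length w)
        letter = lookup (a ∷ w)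

-- Sums over runs, organized along the tree.

module Runs {c ℓ} (K : CommutativeSemiring c ℓ) (m : ℕ) where
  open import Data.Nat using (s≤s)

  open import Data.Bool using (if_then_else_)
  open import Data.Fin using (_≟_)
  open import Data.List using (map; lookup; _++_)
  open import Data.Vec using ([]; _∷_)
  open import Defs using (allFin; allVecs)
  open FiniteSum
  open Tree
  open Nesting
  open TreeAutomata K

  open CommutativeSemiring K hiding (zero) renaming (Carrier to C; refl to ≈-refl; sym to ≈-sym; trans to ≈-trans)
  open Sums semiring
  open TreeSum semiring

  private variable
    n : ℕ
    i j : Fin (suc n)

  module Run {Q : Set} (en : List Q) (δcall δint : Q → Fin m → Q → C) (δret : Q → Q → Fin m → Q → C) where

    -- The continuation k takes the state at the end of the span. This form lets a call keep its
    -- starting state x until the matching return, where the transition depends on it.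
    runs : (Fin n → Fin m) → Nest {n} i j → Q → (Q → C) → C
    runs w (nil _) x k = k x
    runs w (int p _ t) x k = ∑ en λ y → δint x (w p) y * runs w t y k
    runs w (call p q _ t t′) x k = ∑ en λ y → δcall x (w p) y * runs w t y λ z → ∑ en λ y′ → δret z x (w q) y′ * runs w t′ y′ k

    runs-cong : ∀ (w : Fin n → Fin m) (t : Nest i j) x {k k′} → (∀ y → k y ≈ k′ y) → runs w t x k ≈ runs w t x k′
    runs-cong w (nil _) x e = e x
    runs-cong w (int p _ t) x e = ∑-cong en λ y → *-congˡ (runs-cong w t y e)
    runs-cong w (call p q _ t t′) x e = ∑-cong en λ y → *-congˡ (runs-cong w t y λ z → ∑-cong en λ y′ → *-congˡ (runs-cong w t′ y′ e))

    wt : (Fin n → Fin m) → Nest {n} i j → (Fin (suc n) → Q) → C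
    wt w (nil _) r = 1#
    wt w (int p _ t) r = δint (r (inject₁ p)) (w p) (r (suc p)) * wt w t r
    wt w (call p q _ t t′) r = δcall (r (inject₁ p)) (w p) (r (suc p)) * (wt w t r *
      (δret (r (inject₁ q)) (r (inject₁ p)) (w q) (r (suc q)) * wt w t′ r))

    wt-cong : ∀ (w : Fin n → Fin m) (t : Nest i j) {r r′} → (∀ k → r k ≡ r′ k) → wt w t r ≡ wt w t r′
    wt-cong w (nil _) e = ≡.refl
    wt-cong w (int p _ t) e rewrite e (inject₁ p) | e (suc p) | wt-cong w t e = ≡.refl
    wt-cong w (call p q _ t t′) e rewrite e (inject₁ p) | e (suc p) | e (inject₁ q) | e (suc q) | wt-cong w t e | wt-cong w t′ e = ≡.refl

    upd : (Fin (suc n) → Q) → Fin n → Q → Fin (suc n) → Q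
    upd r p x k = if does (k ≟ suc p) then x else r k

    upd-eq : ∀ (r : Fin (suc n) → Q) p x → upd r p x (suc p) ≡ x
    upd-eq r p x with p ≟ p
    ... | yes _ = ≡.refl
    ... | no ne = ⊥-elim (ne ≡.refl)

    upd-ne : ∀ (r : Fin (suc n) → Q) p x {k} → k ≢ suc p → upd r p x k ≡ r k
    upd-ne r p x {k} ne with k ≟ suc p
    ... | yes e = ⊥-elim (ne e)
    ... | no _ = ≡.refl

    -- r assigns states to the points; the state at the point suc p, reached after the position p, is summed over.
    sumOver : List (Fin n) → (Fin (suc n) → Q) → ((Fin (suc n) → Q) → C) → C
    sumOver [] r g = g r
    sumOver (p ∷ ps) r g = ∑ en λ x → sumOver ps (upd r p x) g

    sumOver-++ : ∀ (ps qs : List (Fin n)) r g → sumOver (ps ++ qs) r g ≈ sumOver ps r λ r′ → sumOver qs r′ g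
    sumOver-++ [] qs r g = ≈-refl
    sumOver-++ (p ∷ ps) qs r g = ∑-cong en λ x → sumOver-++ ps qs (upd r p x) g

    sumOver-* : ∀ (ps : List (Fin n)) r x g → sumOver ps r (λ r → x * g r) ≈ x * sumOver ps r g
    sumOver-* [] r x g = ≈-refl
    sumOver-* (p ∷ ps) r x g = ≈-trans (∑-cong en λ y → sumOver-* ps _ x g) (≈-sym (∑-*ˡ en x _))

    -- r′ may differ from r only at the points after i and up to j, the ones that the positions of
    -- the span lead to.
    Agree : (i j : Fin (suc n)) (r r′ : Fin (suc n) → Q) → Set
    Agree i j r r′ = ∀ k → toℕ k ℕ.≤ toℕ i ⊎ toℕ j ℕ.< toℕ k → r′ k ≡ r k

    Agree-step : ∀ {p : Fin n} {i j r r′ x} → inject₁ p ≡ i → suc (toℕ p) ℕ.≤ toℕ j → Agree (suc p) j (upd r p x) r′ → Agree i j r r′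
    Agree-step {p = p} {i} {j} {r} {r′} {x} e le a k (inj₁ l) = ≡.trans (a k (inj₁ (ℕₚ.m≤n⇒m≤1+n l′)))
        (upd-ne r p x λ { ≡.refl → ℕₚ.<-irrefl ≡.refl l′ })
      where l′ = ℕₚ.≤-trans l (ℕₚ.≤-reflexive (≡.sym (toℕ-src e)))
    Agree-step {p = p} {i} {j} {r} {r′} {x} e le a k (inj₂ l) = ≡.trans (a k (inj₂ l)) (upd-ne r p x λ { ≡.refl → ℕₚ.<⇒≱ l le })

    early : ∀ {q : Fin n} {j r₁ r₂ y} → Agree (suc q) j (upd r₁ q y) r₂ → ∀ κ → toℕ κ ℕ.≤ toℕ (inject₁ q) → r₂ κ ≡ r₁ κ
    early {q = q} {r₁ = r₁} {y = y} a₂ κ le = let le′ = ℕₚ.≤-trans le (ℕₚ.≤-reflexive (Finₚ.toℕ-inject₁ q)) in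
      ≡.trans (a₂ κ (inj₁ (ℕₚ.m≤n⇒m≤1+n le′))) (upd-ne r₁ q y λ { ≡.refl → ℕₚ.<-irrefl ≡.refl le′ })

    Agree-trans : ∀ {p q : Fin n} {i j r r₁ r₂ x y} → inject₁ p ≡ i → Nest (suc p) (inject₁ q) → Nest (suc q) j →
      Agree (suc p) (inject₁ q) (upd r p x) r₁ → Agree (suc q) j (upd r₁ q y) r₂ → Agree i j r r₂
    Agree-trans {p = p} {q} {i} {j} {r} {r₁} {r₂} {x} {y} e t t′ a₁ a₂ = Agree-step e (ℕₚ.<-trans (call-< t) (span t′)) go
      where
      go : ∀ κ → toℕ κ ℕ.≤ suc (toℕ p) ⊎ toℕ j ℕ.< toℕ κ → r₂ κ ≡ upd r p x κ
      go κ (inj₁ l) = ≡.trans (early a₂ κ (ℕₚ.≤-trans l (span t))) (a₁ κ (inj₁ l))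
      go κ (inj₂ l) = ≡.trans (a₂ κ (inj₂ l)) (≡.trans (upd-ne r₁ q y λ { ≡.refl → ℕₚ.<⇒≱ l (span t′) })
        (a₁ κ (inj₂ (ℕₚ.≤-trans (s≤s (ℕₚ.≤-reflexive (Finₚ.toℕ-inject₁ q))) (ℕₚ.<⇒≤ (ℕₚ.≤-<-trans (span t′) l))))))

    wt-local : ∀ (w : Fin n → Fin m) {i j : Fin (suc n)} (s : Nest i j) r₁ r₂ → (∀ κ → toℕ i ℕ.≤ toℕ κ → toℕ κ ℕ.≤ toℕ j → r₂ κ ≡ r₁ κ) → wt w s r₂ ≡ wt w s r₁
    wt-local w (nil _) r₁ r₂ h = ≡.refl
    wt-local w {i} {j} (int p e s) r₁ r₂ h rewrite h (inject₁ p) (ℕₚ.≤-reflexive (≡.cong toℕ (≡.sym e))) (ℕₚ.≤-trans (ℕₚ.≤-trans (ℕₚ.≤-reflexive (Finₚ.toℕ-inject₁ p)) (ℕₚ.n≤1+n _)) (span s))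
      | h (suc p) (ℕₚ.≤-trans (ℕₚ.≤-reflexive (≡.sym (toℕ-src e))) (ℕₚ.n≤1+n _)) (span s)
      | wt-local w s r₁ r₂ (λ κ lo hi → h κ (ℕₚ.≤-trans (ℕₚ.≤-reflexive (≡.sym (toℕ-src e))) (ℕₚ.<⇒≤ lo)) hi) = ≡.refl
    wt-local w {i} {j} (call p q e s s′) r₁ r₂ h = lem (call-< s) (span s′) (ℕₚ.≤-reflexive (≡.sym (toℕ-src e))) (Finₚ.toℕ-inject₁ q)
      where
      lem : toℕ p ℕ.< toℕ q → toℕ q ℕ.< toℕ j → toℕ i ℕ.≤ toℕ p → toℕ (inject₁ q) ≡ toℕ q → wt w (call p q e s s′) r₂ ≡ wt w (call p q e s s′) r₁
      lem p<q q<j i≤p iq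
        rewrite h (inject₁ p) (ℕₚ.≤-reflexive (≡.cong toℕ (≡.sym e))) (ℕₚ.≤-trans (ℕₚ.≤-reflexive (Finₚ.toℕ-inject₁ p)) (ℕₚ.<⇒≤ (ℕₚ.<-trans p<q q<j)))
        | h (suc p) (ℕₚ.≤-trans i≤p (ℕₚ.n≤1+n _)) (ℕₚ.<-trans p<q q<j)
        | h (inject₁ q) (ℕₚ.≤-trans i≤p (ℕₚ.≤-trans (ℕₚ.<⇒≤ p<q) (ℕₚ.≤-reflexive (≡.sym iq)))) (ℕₚ.≤-trans (ℕₚ.≤-reflexive iq) (ℕₚ.<⇒≤ q<j))
        | h (suc q) (ℕₚ.≤-trans i≤p (ℕₚ.<⇒≤ (s≤s (ℕₚ.<⇒≤ p<q)))) q<j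
        | wt-local w s r₁ r₂ (λ κ lo hi → h κ (ℕₚ.≤-trans i≤p (ℕₚ.<⇒≤ lo)) (ℕₚ.≤-trans hi (ℕₚ.≤-trans (ℕₚ.≤-reflexive iq) (ℕₚ.<⇒≤ q<j))))
        | wt-local w s′ r₁ r₂ (λ κ lo hi → h κ (ℕₚ.≤-trans i≤p (ℕₚ.≤-trans (ℕₚ.<⇒≤ p<q) (ℕₚ.<⇒≤ lo))) hi) = ≡.refl

    -- The weight of a span depends only on the states at its own points. Therefore the sums over
    -- later states can be carried past it, and the sum over all assignments splits along the tree.
    sumOver-runs : ∀ (w : Fin n → Fin m) (t : Nest i j) r {G : (Fin (suc n) → Q) → C} {k} →
      (∀ r′ → Agree i j r r′ → G r′ ≈ k (r′ j)) →
      sumOver (positions t) r (λ r′ → wt w t r′ * G r′) ≈ runs w t (r i) k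
    -- The factor x collects weights that no longer change within the span: the transition into it,
    -- or an inner span already traversed.
    sumOver-local : ∀ (w : Fin n → Fin m) (t : Nest i j) r {H : (Fin (suc n) → Q) → C} {x} {G : (Fin (suc n) → Q) → C} {k} →
      (∀ r′ → Agree i j r r′ → H r′ ≈ x * (wt w t r′ * G r′)) → (∀ r′ → Agree i j r r′ → G r′ ≈ k (r′ j)) →
      sumOver (positions t) r H ≈ x * runs w t (r i) k
    private
      sumOver-cong-agree : ∀ (t : Nest {n} i j) r {g g′} → (∀ r′ → Agree i j r r′ → g r′ ≈ g′ r′) → sumOver (positions t) r g ≈ sumOver (positions t) r g′
      sumOver-cong-agree (nil _) r e = e r λ _ _ → ≡.refl
      sumOver-cong-agree (int p eq t) r e = ∑-cong en λ x → sumOver-cong-agree t (upd r p x) λ r′ a → e r′ (Agree-step eq (span t) a)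
      sumOver-cong-agree {i = i} {j} (call p q eq t t′) r e = ∑-cong en λ x →
        ≈-trans (sumOver-++ (positions t) (q ∷ positions t′) (upd r p x) _)
        (≈-trans (sumOver-cong-agree t (upd r p x) λ r₁ a₁ → ∑-cong en λ y → sumOver-cong-agree t′ (upd r₁ q y) λ r₂ a₂ →
          e r₂ (Agree-trans eq t t′ a₁ a₂))
        (≈-sym (sumOver-++ (positions t) (q ∷ positions t′) (upd r p x) _)))

    sumOver-local w t r {x = x} h hG = ≈-trans (sumOver-cong-agree t r h) (≈-trans (sumOver-* (positions t) r x _) (*-congˡ (sumOver-runs w t r hG)))

    sumOver-runs w (nil ≡.refl) r h = ≈-trans (*-identityˡ _) (h r λ _ _ → ≡.refl)
    sumOver-runs {i = i} {j} w (int p e t) r {G} {k} h = ∑-cong en λ x → ≈-trans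
      (sumOver-local w t (upd r p x) {x = δint (r i) (w p) x} {G} {k}
        (λ r′ a → ≈-trans (*-assoc _ _ _) (*-congʳ (reflexive (≡.cong₂ (λ s s′ → δint s (w p) s′)
          (≡.trans (≡.cong r′ e) (Agree-step e (span t) a i (inj₁ ℕₚ.≤-refl)))
          (≡.trans (a (suc p) (inj₁ ℕₚ.≤-refl)) (upd-eq r p x))))))
        λ r′ a → h r′ (Agree-step e (span t) a))
      (*-congˡ (reflexive (≡.cong (λ s → runs w t s k) (upd-eq r p x))))
    sumOver-runs {i = i} {j} w (call p q e t t′) r {G} {k} h = ∑-cong en λ x → ≈-trans (sumOver-++ (positions t) (q ∷ positions t′) (upd r p x) _)
      (≈-trans (sumOver-local w t (upd r p x) {x = δcall (r i) (w p) x}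
          {G = λ r₁ → ∑ en λ y → δret (r₁ (inject₁ q)) (r i) (w q) y * runs w t′ y k}
          {k = λ z → ∑ en λ y → δret z (r i) (w q) y * runs w t′ y k}
        (λ r₁ a₁ → ≈-trans (∑-cong en λ y → ≈-trans (sumOver-local w t′ (upd r₁ q y)
              {x = (δcall (r i) (w p) x * wt w t r₁) * δret (r₁ (inject₁ q)) (r i) (w q) y} {G} {k}
              (λ r₂ a₂ → ≈-trans (*-congʳ (*-cong (reflexive (≡.cong₂ (λ s s′ → δcall s (w p) s′) (atI a₁ a₂) (at-p x a₁ a₂)))
                  (*-cong (reflexive (wt-local w t r₁ r₂ λ κ lo hi → early a₂ κ hi)) (*-congʳ (reflexive (≡.trans (≡.cong₂ (λ s s′ → δret s s′ (w q) (r₂ (suc q)))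
                      (early a₂ (inject₁ q) ℕₚ.≤-refl) (atI a₁ a₂)) (≡.cong (δret _ _ _) (≡.trans (a₂ (suc q) (inj₁ ℕₚ.≤-refl)) (upd-eq r₁ q y)))))))))
                (regroup _ _ _ _ _))
              λ r₂ a₂ → h r₂ (Agree-trans e t t′ a₁ a₂))
            (*-congˡ (reflexive (≡.cong (λ s → runs w t′ s k) (upd-eq r₁ q y)))))
          (≈-trans (∑-cong en λ y → *-assoc _ _ _) (≈-trans (≈-sym (∑-*ˡ en _ _)) (*-assoc _ _ _))))
        λ r₁ a₁ → ≈-refl)
      (*-congˡ (reflexive (≡.cong (λ s → runs w t s _) (upd-eq r p x)))))
      where
      regroup : ∀ a b d f g → (a * (b * (d * f))) * g ≈ ((a * b) * d) * (f * g)
      regroup a b d f g = ≈-trans (*-congʳ (≈-trans (≈-sym (*-assoc a b _)) (≈-sym (*-assoc _ d f)))) (*-assoc _ f g)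
      at-i : ∀ {r₁ x} → Agree (suc p) (inject₁ q) (upd r p x) r₁ → r₁ (inject₁ p) ≡ r i
      at-i {r₁} a₁ = ≡.trans (≡.cong r₁ e) (Agree-step e (span t) a₁ i (inj₁ ℕₚ.≤-refl))
      atI : ∀ {r₁ r₂ x y} → Agree (suc p) (inject₁ q) (upd r p x) r₁ → Agree (suc q) j (upd r₁ q y) r₂ → r₂ (inject₁ p) ≡ r i
      atI a₁ a₂ = ≡.trans (early a₂ (inject₁ p) (ℕₚ.≤-trans (ℕₚ.≤-reflexive (Finₚ.toℕ-inject₁ p)) (ℕₚ.≤-trans (ℕₚ.n≤1+n _) (span t)))) (at-i a₁)
      at-p : ∀ {r₁ r₂ y} x → Agree (suc p) (inject₁ q) (upd r p x) r₁ → Agree (suc q) j (upd r₁ q y) r₂ → r₂ (suc p) ≡ x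
      at-p x a₁ a₂ = ≡.trans (early a₂ (suc p) (span t)) (≡.trans (a₁ (suc p) (inj₁ ℕₚ.≤-refl)) (upd-eq r p x))

    -- The state at the initial point is kept fixed at `r zero`. As the two sides build their
    -- assignments differently, G has to respect pointwise equality.
    sumOver-vecs : ∀ n (r : Fin (suc n) → Q) (G : (Fin (suc n) → Q) → C) → (∀ {f g} → (∀ k → f k ≡ g k) → G f ≈ G g) →
      ∑ (allVecs en n) (λ v → G (V.lookup (r zero ∷ v))) ≈ sumOver (allFin n) r G
    sumOver-vecs zero r G resp = ≈-trans (+-identityʳ _) (resp λ { zero → ≡.refl })
    sumOver-vecs (suc n) r G resp = ≈-trans (∑-concatMap (λ x → map (x ∷_) (allVecs en n)) en _) (∑-cong en λ x →
        ≈-trans (reflexive (∑-map (x ∷_) (allVecs en n) _)) (≈-trans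
          (∑-cong (allVecs en n) λ v → resp λ { zero → ≡.refl ; (suc k) → ≡.refl })
          (≈-trans (sumOver-vecs n (upd r zero x ∘ suc) (λ f → G (cons (r zero) f)) (λ e → resp λ { zero → ≡.refl ; (suc k) → e k }))
            (shift (allFin n) (upd r zero x) ≡.refl))))
      where
      cons : Q → (Fin (suc n) → Q) → Fin (suc (suc n)) → Q
      cons x f zero = x
      cons x f (suc k) = f k
      sumOver-resp : ∀ {n} ps {r r′ : Fin (suc n) → Q} (H : (Fin (suc n) → Q) → C) → (∀ {f g} → (∀ k → f k ≡ g k) → H f ≈ H g) →
        (∀ k → r k ≡ r′ k) → sumOver ps r H ≈ sumOver ps r′ H
      sumOver-resp [] H h e = h e
      sumOver-resp (p ∷ ps) H h e = ∑-cong en λ x → sumOver-resp ps H h λ k → ≡.cong (if does (k ≟ suc p) then x else_) (e k)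
      shift : ∀ ps (r′ : Fin (suc (suc n)) → Q) → r′ zero ≡ r zero →
        sumOver ps (r′ ∘ suc) (λ f → G (cons (r zero) f)) ≈ sumOver (map suc ps) r′ G
      shift [] r′ e = resp λ { zero → ≡.sym e ; (suc k) → ≡.refl }
      shift (p ∷ ps) r′ e = ∑-cong en λ x → ≈-trans
        (sumOver-resp ps _ (λ h → resp λ { zero → ≡.refl ; (suc k) → h k }) λ k → lem k x)
        (shift ps (upd r′ (suc p) x) e)
        where
        lem : ∀ k x → upd (r′ ∘ suc) p x k ≡ upd r′ (suc p) x (suc k)
        lem k x = ≡.refl

-- Nested word automata and tree automata simulate each other.

module Regularity {c ℓ} (K : CommutativeSemiring c ℓ) (m : ℕ) where
  open import Data.Bool using (T)
  open import Data.Bool.ListAction using (any)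
  open import Data.Fin using (_≟_)
  open import Data.List using (map; length; lookup; cartesianProduct)
  open import Data.Vec using ([]; _∷_)
  open import Defs using (allFin; allVecs; bools; rel; findFirst; guard; isNestᵇ; NestedWord; mkNW; WNWA; runWeight; behaviour; prodL; proj; Cond2)
  open Booleans
  open FiniteSum
  open Tree
  open Nesting
  open TreeAutomata K
  open Runs K m

  open CommutativeSemiring K hiding (zero) renaming (Carrier to C; refl to ≈-refl; sym to ≈-sym; trans to ≈-trans)
  open Sums semiring
  open import Algebra.Properties.CommutativeSemigroup *-commutativeSemigroup using () renaming (x∙yz≈y∙xz to comm₃)
  open TreeSum semiring
  open FiniteSum.Fold *-commutativeMonoid using () renaming (fold to ∏; fold-++ to ∏-++)

  private variable
    n : ℕ
    i j : Fin (suc n)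

  private
    findFirst-nothing : ∀ {A : Set} {f : A → Bool} xs → (∀ x → f x ≡ false) → findFirst f xs ≡ nothing
    findFirst-nothing [] h = ≡.refl
    findFirst-nothing (x ∷ xs) h rewrite h x = findFirst-nothing xs h

    findFirst-just : ∀ {A : Set} {f : A → Bool} {xs x} → x ∈ xs → f x ≡ true → (∀ y → f y ≡ true → y ≡ x) → findFirst f xs ≡ just x
    findFirst-just {f = f} {y ∷ xs} m e u with f y in eq
    findFirst-just m e u | true = ≡.cong just (u _ eq)
    findFirst-just (here ≡.refl) e u | false = absurd e eq
    findFirst-just (there m) e u | false = findFirst-just m e u

  module _ {q : ℕ} (A : WNWA K m q) where
    open WNWA A
    open Run (allFin q) δcall δint δret

    module _ {n : ℕ} (w : Fin n → Fin m) (ν : Fin n → Fin n → Bool) (r : Fin (suc n) → Fin q) where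
      step : Bool → Maybe (Fin n) → Fin n → C
      step true _ p = δcall (r (inject₁ p)) (w p) (r (suc p))
      step false (just k) p = δret (r (inject₁ p)) (r (inject₁ k)) (w p) (r (suc p))
      step false nothing p = δint (r (inject₁ p)) (w p) (r (suc p))

      stepAt : Fin n → C
      stepAt p = step (any (λ j → ν p j) (allFin n)) (findFirst (λ i → ν i p) (allFin n)) p

      ∏-stepAt : (t : Nest i j) → Fits ν t → ∏ (positions t) stepAt ≈ wt w t r
      ∏-stepAt (nil _) _ = ≈-refl
      ∏-stepAt (int p _ t) (out , into , f) = *-cong (reflexive (≡.cong₂ (λ x y → step x y p)
        (any-false (allFin n) out) (findFirst-nothing (allFin n) into))) (∏-stepAt t f)
      ∏-stepAt (call p k _ t t′) ((pk , _ , _) , (out , into) , f , f′) = *-cong (reflexive (≡.cong (λ x → step x (findFirst (λ i → ν i p) (allFin n)) p)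
          (any⁺ {f = ν p} (allFin-mem k) pk)))
        (≈-trans (∏-++ (positions t) _ _) (*-cong (∏-stepAt t f) (*-cong (reflexive (≡.cong₂ (λ x y → step x y k)
          (any-false (allFin n) out) (findFirst-just {f = λ i → ν i k} (allFin-mem p) pk into))) (∏-stepAt t′ f′))))

    mutual
      runWeight-step : ∀ nw (r : Vec (Fin q) (suc (length (NestedWord.word nw)))) →
        runWeight K m A nw r ≡ ∏ (allFin _) (stepAt (lookup (NestedWord.word nw)) (rel (NestedWord.nest nw)) (V.lookup r))
      runWeight-step nw r = ≡.cong (prodL K m) (Listₚ.map-cong (step-≡ nw r) (allFin _))

      -- The left-hand side is local to Defs.runWeight and can only be inferred.
      step-≡ : ∀ nw (r : Vec (Fin q) (suc (length (NestedWord.word nw)))) p →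
        _ ≡ stepAt (lookup (NestedWord.word nw)) (rel (NestedWord.nest nw)) (V.lookup r) p
      step-≡ nw r p with any (λ j → rel (NestedWord.nest nw) p j) (allFin _)
                       | findFirst (λ i → rel (NestedWord.nest nw) i p) (allFin _)
      ... | true | _ = ≡.refl
      ... | false | just _ = ≡.refl
      ... | false | nothing = ≡.refl

    private
      last-lookup : ∀ {A : Set} {n} (v : Vec A (suc n)) → V.last v ≡ V.lookup v (fromℕ n)
      last-lookup (x ∷ []) = ≡.refl
      last-lookup (x ∷ y ∷ v) = last-lookup (y ∷ v)

    behaviour-tree : ∀ nw (t : Nest zero (fromℕ (length (NestedWord.word nw)))) → Fits (rel (NestedWord.nest nw)) t →
      behaviour K m A nw ≈ ∑ (allFin q) λ x → ι x * runs (lookup (NestedWord.word nw)) t x κ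
    behaviour-tree nw t f = ≈-trans (∑-concatMap (λ x → map (x ∷_) (allVecs (allFin q) N)) (allFin q) _)
      (∑-cong (allFin q) λ x → ≈-trans (reflexive (∑-map (x ∷_) (allVecs (allFin q) N) _)) (≈-trans
        (∑-cong (allVecs (allFin q) N) λ v → ≈-trans (*-assoc _ _ _) (*-congˡ (*-cong
          (≈-trans (reflexive (runWeight-step nw (x ∷ v))) (≈-trans (reflexive (≡.cong (λ ps → ∏ ps _) (≡.sym (positions-full t))))
            (∏-stepAt w (rel nest) (V.lookup (x ∷ v)) t f)))
          (reflexive (≡.cong κ (last-lookup (x ∷ v)))))))
        (≈-trans (sumOver-vecs N (λ _ → x) (λ r → ι x * (wt w t r * κ (r (fromℕ N))))
          (λ e → reflexive (≡.cong (ι x *_) (≡.cong₂ _*_ (wt-cong w t e) (≡.cong κ (e _))))))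
        (≈-trans (reflexive (≡.cong (λ ps → sumOver ps (λ _ → x) (λ r → ι x * (wt w t r * κ (r (fromℕ N))))) (≡.sym (positions-full t))))
        (≈-trans (sumOver-* (positions t) _ (ι x) _) (*-congˡ (sumOver-runs w t (λ _ → x) λ _ _ → ≈-refl)))))))
      where
      open NestedWord nw
      N = length word
      w = lookup word

    proj-tree : ∀ a as → proj K m (behaviour K m A) (a ∷ as) ≈
      ∑ᵗ zero (fromℕ (suc (length as))) λ t → ∑ (allFin q) λ x → ι x * runs (lookup (a ∷ as)) t x κ
    proj-tree a as = ≈-trans (∑-nestings semiring λ M p → behaviour K m A (mkNW (a ∷ as) tt M p))
      (∑-cong (nests (suc (length as)) zero (fromℕ _)) λ t → behaviour-tree (mkNW (a ∷ as) tt (toRel t) (toRel-isNest t)) t (Fits-toRel t))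

  proj-cong : ∀ {R R′ : NestedWord K m → C} → (∀ nw → R nw ≈ R′ nw) → ∀ w → proj K m R w ≈ proj K m R′ w
  proj-cong e [] = ≈-refl
  proj-cong e (a ∷ as) = ∑-cong (allVecs (allVecs bools (length (a ∷ as))) (length (a ∷ as))) λ M → go (isNestᵇ M) λ p → e (mkNW (a ∷ as) tt M p)
    where
    go : ∀ b {f g : T b → C} → (∀ p → f p ≈ g p) → guard 0# b f ≈ guard 0# b g
    go true h = h tt
    go false h = ≈-refl

  -- State (p , q): read from p and finish the span in q.
  module FromWNWA {q : ℕ} (A : WNWA K m q) where
    open WNWA A renaming (ι to ι′; κ to κ′)
    open Run (allFin q) δcall δint δret

    wta : WTA (Fin m)
    wta = record
      { ft = ft-× (ft-Fin q) (ft-Fin q)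
      ; ι = λ (x , y) → ι′ x * κ′ y
      ; e = λ (x , y) → [ x ≟ y ]
      ; wi = λ (x , y) a (x₁ , y₁) → [ y₁ ≟ y ] * δint x a x₁
      ; wc = λ (x , y) a (x₁ , z) b (x₂ , y₂) → [ y₂ ≟ y ] * (δcall x a x₁ * δret z x b x₂) }

    open WTA wta using (W; weight)
    private
      S = allFin q

      ∑-× : (f : Fin q × Fin q → C) → ∑ (cartesianProduct S S) f ≈ ∑ S λ x → ∑ S λ y → f (x , y)
      ∑-× = ∑-cartesian S S

    module _ {n : ℕ} (w : Fin n → Fin m) where
      W-int : ∀ {i j : Fin (suc n)} p (e : inject₁ p ≡ i) (t : Nest (suc p) j) x y →
        W w (int p e t) (x , y) ≈ ∑ S λ x₁ → δint x (w p) x₁ * W w t (x₁ , y)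
      W-int p e t x y = ≈-trans (∑-× _) (∑-cong S λ x₁ → ≈-trans (∑-cong S λ y₁ → *-assoc _ _ _)
        (∑-δ′ (ft-Fin q) y λ y₁ → δint x (w p) x₁ * W w t (x₁ , y₁)))

      W-call : ∀ {i j : Fin (suc n)} p r (e : inject₁ p ≡ i) (t : Nest (suc p) (inject₁ r)) (t′ : Nest (suc r) j) x y →
        W w (call p r e t t′) (x , y) ≈ ∑ S λ x₁ → δcall x (w p) x₁ * ∑ S λ z → W w t (x₁ , z) * ∑ S λ x₂ → δret z x (w r) x₂ * W w t′ (x₂ , y)
      W-call p r e t t′ x y = ≈-trans (∑-× _) (∑-cong S λ x₁ → ≈-trans (∑-cong S λ z → ≈-trans (∑-× _)
        (≈-trans (∑-cong S λ x₂ → ≈-trans (∑-cong S λ y₂ → *-assoc _ _ _)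
          (≈-trans (∑-δ′ (ft-Fin q) y λ y₂ → (δcall x (w p) x₁ * δret z x (w r) x₂) * (W w t (x₁ , z) * W w t′ (x₂ , y₂)))
          (≈-trans (*-assoc _ _ _) (*-congˡ (comm₃ _ _ _)))))
        (≈-trans (≈-sym (∑-*ˡ S _ _)) (*-congˡ (≈-sym (∑-*ˡ S _ _)))))) (≈-sym (∑-*ˡ S _ _)))

      -- Runs depend linearly on the continuation, and `W w t` is the matrix of this linear map.
      runs-W : ∀ {i j : Fin (suc n)} (t : Nest i j) x k → runs w t x k ≈ ∑ S λ y → W w t (x , y) * k y
      runs-W (nil _) x k = ≈-sym (∑-δ (ft-Fin q) x k)
      runs-W (int p e t) x k = ≈-trans (∑-cong S λ x₁ → ≈-trans (*-congˡ (runs-W t x₁ k)) (∑-*ˡ S _ _))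
        (≈-trans (∑-swap S S _) (∑-cong S λ y → ≈-trans (∑-cong S λ x₁ → ≈-sym (*-assoc _ _ _))
          (≈-trans (≈-sym (∑-*ʳ S _ _)) (*-congʳ (≈-sym (W-int p e t x y))))))
      runs-W (call p r e t t′) x k = ≈-trans (∑-cong S λ x₁ → ≈-trans (*-congˡ (≈-trans (runs-W t x₁ _)
          (≈-trans (∑-cong S λ z → ≈-trans (*-congˡ (≈-trans (∑-cong S λ x₂ → ≈-trans (*-congˡ (runs-W t′ x₂ k)) (∑-*ˡ S _ _))
              (≈-trans (∑-swap S S _) (∑-cong S λ y → ≈-trans (∑-cong S λ x₂ → ≈-sym (*-assoc _ _ _)) (≈-sym (∑-*ʳ S _ _))))))
            (≈-trans (∑-*ˡ S _ _) (∑-cong S λ y → ≈-sym (*-assoc _ _ _))))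
          (≈-trans (∑-swap S S _) (∑-cong S λ y → ≈-sym (∑-*ʳ S _ _)))))) (∑-*ˡ S _ _))
        (≈-trans (∑-swap S S _) (∑-cong S λ y → ≈-trans (∑-cong S λ x₁ → ≈-sym (*-assoc _ _ _))
          (≈-trans (≈-sym (∑-*ʳ S _ _)) (*-congʳ (≈-sym (W-call p r e t t′ x y))))))

      runs-weight : ∀ {i j : Fin (suc n)} (t : Nest i j) → ∑ S (λ x → ι′ x * runs w t x κ′) ≈ weight w t
      runs-weight t = ≈-trans (∑-cong S λ x → ≈-trans (*-congˡ (runs-W t x κ′)) (≈-trans (∑-*ˡ S _ _)
        (∑-cong S λ y → ≈-trans (*-congˡ (*-comm _ _)) (≈-sym (*-assoc _ _ _))))) (≈-sym (∑-× _))

  -- A weighted tree automaton is run top-down; inside a nesting the state remembers the letter of the call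
  -- and the guessed start of the inner span, so that the weight can be paid at the return.
  module ToWNWA (𝒜 : WTA (Fin m)) where
    open WTA 𝒜 renaming (ι to ι₀; e to e₀)

    Ctx : Set
    Ctx = Maybe (Fin m × Q)

    ftC : FT Ctx
    ftC = ft-Maybe (ft-× (ft-Fin m) ft)

    ftS : FT (Q × Ctx)
    ftS = ft-× ft ftC

    δcall δint : Q × Ctx → Fin m → Q × Ctx → C
    δint (x , γ) a (x′ , γ′) = [ FT.dec ftC γ γ′ ] * wi x a x′
    δcall (x , γ) a (x′ , γ′) = [ FT.dec ftC (just (a , x′)) γ′ ]

    pay : Q → Fin m → Ctx → Q → C
    -- The context `nothing` means that no arc is open, and then no return can be paid.
    pay x b nothing x₂ = 0#
    pay x b (just (a , x₁)) x₂ = wc x a x₁ b x₂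

    δret : Q × Ctx → Q × Ctx → Fin m → Q × Ctx → C
    δret (z , γ′) (x , γ) b (x₂ , γ₂) = [ FT.dec ftC γ γ₂ ] * (e₀ z * pay x b γ′ x₂)

    open Run (FT.en ftS) δcall δint δret

    private
      cs = FT.en ftC

    -- At the end of a span the state pays its leaf weight, while the context is what it was at the
    -- beginning; this explains the shape of k. For the inner span of a call, `k′` contains
    -- everything that is paid from the return on.
    runs-W : ∀ {n} (w : Fin n → Fin m) {i j : Fin (suc n)} (t : Nest i j) x γ {k : Q × Ctx → C} {k′ : Ctx → C} →
      (∀ z γ → k (z , γ) ≈ e₀ z * k′ γ) → runs w t (x , γ) k ≈ W w t x * k′ γ
    runs-W w (nil _) x γ h = h x γ
    runs-W w (int p _ t) x γ {k} {k′} h = ≈-trans (∑-cartesian en cs _) (≈-trans (∑-cong en λ x′ →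
        ≈-trans (∑-cong cs λ γ′ → *-assoc _ _ _) (≈-trans (∑-δ ftC γ λ γ′ → wi x (w p) x′ * runs w t (x′ , γ′) k)
          (≈-trans (*-congˡ (runs-W w t x′ γ h)) (≈-sym (*-assoc _ _ _)))))
      (≈-sym (∑-*ʳ en _ _)))
    runs-W w (call p r _ t t′) x γ {k} {k′} h = ≈-trans (∑-cartesian en cs _) (≈-trans (∑-cong en λ x₁ →
        ≈-trans (∑-δ ftC (just (w p , x₁)) λ γ′ → runs w t (x₁ , γ′) _)
        (≈-trans (runs-W w t x₁ (just (w p , x₁)) {k′ = λ γ′ → ∑ en λ x₂ → pay x (w r) γ′ x₂ * (W w t′ x₂ * k′ γ)} λ z γ′ →
          ≈-trans (∑-cartesian en cs _) (≈-trans (∑-cong en λ x₂ → ≈-trans (∑-cong cs λ γ₂ → *-assoc _ _ _)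
            (≈-trans (∑-δ ftC γ λ γ₂ → (e₀ z * pay x (w r) γ′ x₂) * runs w t′ (x₂ , γ₂) k)
              (≈-trans (*-assoc _ _ _) (*-congˡ (*-congˡ (runs-W w t′ x₂ γ h)))))) (≈-sym (∑-*ˡ en _ _))))
        (≈-trans (∑-*ˡ en _ _) (≈-trans (∑-cong en λ x₂ → ≈-trans (≈-sym (*-assoc _ _ _)) (≈-trans (*-congʳ (*-comm _ _))
            (≈-trans (*-assoc _ _ _) (≈-trans (*-congˡ (≈-sym (*-assoc _ _ _))) (≈-sym (*-assoc _ _ _))))))
          (≈-sym (∑-*ʳ en _ _))))))
      (≈-sym (∑-*ʳ en _ _)))

    root : Ctx → C
    root nothing = 1#
    root (just _) = 0#

    private
      st : Fin (length (FT.en ftS)) → Q × Ctx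
      st = lookup (FT.en ftS)

    wnwa : WNWA K m (length (FT.en ftS))
    wnwa = record
      { ι = λ s → ι₀ (proj₁ (st s)) * root (proj₂ (st s))
      ; κ = λ s → e₀ (proj₁ (st s)) * root (proj₂ (st s))
      ; δcall = λ s a s′ → δcall (st s) a (st s′)
      ; δint = λ s a s′ → δint (st s) a (st s′)
      ; δret = λ s s′ a s″ → δret (st s) (st s′) a (st s″) }

    private
      module R′ = Run (allFin (length (FT.en ftS))) (WNWA.δcall wnwa) (WNWA.δint wnwa) (WNWA.δret wnwa)

      runs-lookup : ∀ {n} (w : Fin n → Fin m) {i j : Fin (suc n)} (t : Nest i j) s k → R′.runs w t s (k ∘ st) ≈ runs w t (st s) k
      runs-lookup w (nil _) s k = ≈-refl
      runs-lookup w (int p _ t) s k = ≈-trans (∑-cong (allFin _) λ s′ → *-congˡ (runs-lookup w t s′ k)) (∑-lookup (FT.en ftS) _)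
      runs-lookup w (call p r _ t t′) s k = ≈-trans (∑-cong (allFin _) λ s′ → *-congˡ (≈-trans
          (R′.runs-cong w t s′ λ z → ≈-trans (∑-cong (allFin _) λ s″ → *-congˡ (runs-lookup w t′ s″ k)) (∑-lookup (FT.en ftS) _))
          (runs-lookup w t s′ _)))
        (∑-lookup (FT.en ftS) _)

    weight⇒Cond2 : ∀ S → S [] ≈ 0# → (∀ a w → S (a ∷ w) ≈ ∑ᵗ zero (fromℕ (suc (length w))) (weight (lookup (a ∷ w)))) → Cond2 K m S
    weight⇒Cond2 S S[] S∷ = behaviour K m wnwa , (_ , wnwa , λ _ → ≈-refl) , λ
      { [] → S[]
      ; (a ∷ w) → ≈-trans (S∷ a w) (≈-sym (≈-trans (proj-tree wnwa a w) (∑-cong (nests (suc (length w)) zero (fromℕ _)) λ t →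
          ≈-trans (∑-cong (allFin _) λ s → *-congˡ (runs-lookup (lookup (a ∷ w)) t s (λ (z , γ) → e₀ z * root γ)))
          (≈-trans (∑-lookup (FT.en ftS) (λ (x , γ) → (ι₀ x * root γ) * runs (lookup (a ∷ w)) t (x , γ) (λ (z , γ) → e₀ z * root γ)))
          (≈-trans (∑-cartesian en cs _) (∑-cong en λ x → ≈-trans (+-cong
              (≈-trans (*-cong (*-identityʳ _) (≈-trans (runs-W (lookup (a ∷ w)) t x nothing λ _ _ → ≈-refl) (*-identityʳ _))) ≈-refl)
              (≈-trans (reflexive (∑-map just (FT.en (ft-× (ft-Fin m) ft))
                  (λ γ → (ι₀ x * root γ) * runs (lookup (a ∷ w)) t (x , γ) (λ (z , γ) → e₀ z * root γ)))) (∑-0 (FT.en (ft-× (ft-Fin m) ft)) λ _ → ≈-trans (*-congʳ (zeroʳ _)) (zeroˡ _))))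
            (+-identityʳ _))))))) }

  module _ (S : List (Fin m) → C) where
    Cond2⇒weight : Cond2 K m S → Σ (WTA (Fin m)) λ 𝒜 → S [] ≈ 0# × (∀ a w → S (a ∷ w) ≈ ∑ᵗ zero (fromℕ (suc (length w))) (WTA.weight 𝒜 (lookup (a ∷ w))))
    Cond2⇒weight (R , (q , A , eR) , eS) = FromWNWA.wta A , eS [] , λ a w → ≈-trans (eS (a ∷ w)) (≈-trans (proj-cong eR (a ∷ w))
      (≈-trans (proj-tree A a w) (∑-cong (nests (suc (length w)) zero (fromℕ _)) λ t → FromWNWA.runs-weight A (lookup (a ∷ w)) t)))

-- The semantics of syntactically unambiguous formulas.

module Logic {c ℓ} (K : CommutativeSemiring c ℓ) (m : ℕ) where
  open import Data.Nat using (s≤s; z≤n)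

  open import Data.Bool.ListAction using (any; all)
  open import Data.Fin using (_≤?_)
  open import Data.List using (map; length)
  open import Data.List.Relation.Unary.All using (All; []; _∷_)
  open import Data.List.Relation.Unary.AllPairs using (AllPairs; []; _∷_)
  open import Data.Sum using () renaming (map₁ to ⊎-map₁)
  open import Data.Vec using ([]; _∷_)
  open import Relation.Binary.PropositionalEquality using (refl; cong; cong₂)
  open import Defs hiding (lift; ext; 𝟙; ren; renP; renAtom; shiftUnder; pmWith; pm; ltSet; atomᵇ; ⟦_⟧; notP; orP; andP; atomP;
    _∧ᶜ_; _→ᶜ_; _↔ᶜ_; ∀ᶜ; _<ᶜ_; _⁺; _⁻; Pair)
  open FiniteSum
  open Booleans

  open CommutativeSemiring K hiding (zero) renaming (Carrier to C; refl to ≈-refl; sym to ≈-sym; trans to ≈-trans)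
  open Sums semiring
  open FiniteSum.Fold *-commutativeMonoid using () renaming (fold to ∏; fold-cong to ∏-cong)

  MSO′ WF′ : ℕ → ℕ → Set _
  MSO′ = MSO K m
  WF′ = WF K m

  𝟙 : Bool → C
  𝟙 = Defs.𝟙 K m

  ext : ∀ {a} {A : Set a} {k} → A → (Fin k → A) → Fin (suc k) → A
  ext = Defs.ext K m

  𝟙-∧ : ∀ a b → 𝟙 a * 𝟙 b ≈ 𝟙 (a ∧ b)
  𝟙-∧ true b = *-identityˡ _
  𝟙-∧ false b = zeroˡ _

  𝟙-∨ : ∀ a b → 𝟙 a + 𝟙 (not a) * 𝟙 b ≈ 𝟙 (a ∨ b)
  𝟙-∨ true b = ≈-trans (+-congˡ (zeroˡ _)) (+-identityʳ _)
  𝟙-∨ false b = ≈-trans (+-identityˡ _) (*-identityˡ _)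

  ∏-𝟙 : ∀ {A : Set} (f : A → Bool) xs → ∏ xs (𝟙 ∘ f) ≈ 𝟙 (all f xs)
  ∏-𝟙 f [] = ≈-refl
  ∏-𝟙 f (x ∷ xs) = ≈-trans (*-congˡ (∏-𝟙 f xs)) (𝟙-∧ (f x) (all f xs))

  module Least {A : Set} (before : A → A → Bool) (irr : ∀ x → before x x ≡ false) (P : A → Bool) where
    first : List A → A → Bool
    first xs x = P x ∧ all (λ y → not (before y x) ∨ not (P y)) xs

    -- `first` is the guard in the positive translation of an existential quantifier. At most one
    -- element passes it, so the sum is 0 or 1 even in a semiring where 1 + 1 differs from 1.
    least-ascending : ∀ {xs} → AllPairs (λ x y → before x y ≡ true × before y x ≡ false) xs →
      ∑ xs (𝟙 ∘ first xs) ≈ 𝟙 (any P xs)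
    least-ascending [] = ≈-refl
    least-ascending {x ∷ xs} (a ∷ ap) = ≈-trans (+-cong (reflexive (cong 𝟙 head)) (∑-cong∈ xs λ {y} k → reflexive (cong 𝟙 (tail y k)))) rest
      where
      head : first (x ∷ xs) x ≡ P x
      head rewrite irr x = ≡.trans (cong (P x ∧_) (go xs λ k → proj₂ (All.lookup a k))) (Boolₚ.∧-identityʳ _)
        where
        go : ∀ ys → (∀ {y} → y ∈ ys → before y x ≡ false) → all (λ y → not (before y x) ∨ not (P y)) ys ≡ true
        go [] h = refl
        go (y ∷ ys) h rewrite h (here refl) = go ys (h ∘ there)
      tail : ∀ y → y ∈ xs → first (x ∷ xs) y ≡ not (P x) ∧ first xs y
      tail y k rewrite proj₁ (All.lookup a k) with P x | P y
      ... | true | true = refl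
      ... | true | false = refl
      ... | false | true = refl
      ... | false | false = refl
      rest : 𝟙 (P x) + ∑ xs (λ y → 𝟙 (not (P x) ∧ first xs y)) ≈ 𝟙 (P x ∨ any P xs)
      rest with P x
      ... | true = ≈-trans (+-congˡ (∑-0 xs λ _ → ≈-refl)) (+-identityʳ _)
      ... | false = ≈-trans (+-identityˡ _) (least-ascending ap)

    -- The enumeration of sets puts `true` first and so descends in the lexicographic order: here
    -- the element passing the guard is the last witness in the list.
    least-descending : ∀ {xs} → AllPairs (λ x y → before x y ≡ false × before y x ≡ true) xs →
      ∑ xs (𝟙 ∘ first xs) ≈ 𝟙 (any P xs)
    least-descending [] = ≈-refl
    least-descending {x ∷ xs} (a ∷ ap) = ≈-trans (+-cong (reflexive (cong 𝟙 head)) (≈-trans (∑-cong∈ xs λ {y} k → reflexive (cong 𝟙 (tail y k))) (least-descending ap))) rest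
      where
      head : first (x ∷ xs) x ≡ P x ∧ not (any P xs)
      head rewrite irr x = cong (P x ∧_) (≡.trans (go xs λ k → proj₂ (All.lookup a k)) (≡.sym (not-any P xs)))
        where
        go : ∀ ys → (∀ {y} → y ∈ ys → before y x ≡ true) → all (λ y → not (before y x) ∨ not (P y)) ys ≡ all (not ∘ P) ys
        go [] h = refl
        go (y ∷ ys) h rewrite h (here refl) = cong (not (P y) ∧_) (go ys (h ∘ there))
      tail : ∀ y → y ∈ xs → first (x ∷ xs) y ≡ first xs y
      tail y k rewrite proj₁ (All.lookup a k) = refl
      rest : 𝟙 (P x ∧ not (any P xs)) + 𝟙 (any P xs) ≈ 𝟙 (P x ∨ any P xs)
      rest with P x | any P xs
      ... | true | true = +-identityˡ _
      ... | true | false = +-identityʳ _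
      ... | false | true = +-identityˡ _
      ... | false | false = +-identityʳ _

  infixr 6 _∧ᶜ_
  _∧ᶜ_ _→ᶜ_ _↔ᶜ_ : ∀ {f s} → MSO′ f s → MSO′ f s → MSO′ f s
  _∧ᶜ_ = Defs._∧ᶜ_ K m
  _→ᶜ_ = Defs._→ᶜ_ K m
  _↔ᶜ_ = Defs._↔ᶜ_ K m

  ∀ᶜ : ∀ {f s} → MSO′ (suc f) s → MSO′ f s
  ∀ᶜ = Defs.∀ᶜ K m

  infix 7 _<ᶜ_
  _<ᶜ_ : ∀ {f s} → Fin f → Fin f → MSO′ f s
  _<ᶜ_ = Defs._<ᶜ_ K m

  -- Built with the connectives of `ltSet`, double negations included, so that evaluating that
  -- formula leads to it directly.
  precedes : ∀ {n} → Vec Bool n → Vec Bool n → Bool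
  precedes {n} Y X = any (λ y → V.lookup X y ∧ (not (V.lookup Y y) ∧
    all (λ z → not (not ⌊ y ≤? z ⌋) ∨ ((not (V.lookup Y z) ∨ V.lookup X z) ∧ (not (V.lookup X z) ∨ V.lookup Y z))) (allFin n))) (allFin n)

  private
    Precedes : ∀ {n} → Vec Bool n → Vec Bool n → Set
    Precedes {n} Y X = ∃ λ y → V.lookup X y ≡ true × V.lookup Y y ≡ false × (∀ z → toℕ z ℕ.< toℕ y → V.lookup Y z ≡ V.lookup X z)

    same : ∀ {a b} → a ≡ b → (not a ∨ b) ∧ (not b ∨ a) ≡ true
    same {true} refl = refl
    same {false} refl = refl

    same⁻ : ∀ a b → (not a ∨ b) ∧ (not b ∨ a) ≡ true → a ≡ b
    same⁻ true true e = refl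
    same⁻ false false e = refl

    precedes⁺ : ∀ {n} (Y X : Vec Bool n) → Precedes Y X → precedes Y X ≡ true
    precedes⁺ {n} Y X (y , a , b , h) = any⁺ (allFin-mem y) (cong₂ _∧_ a (cong₂ _∧_ (cong not b) (all⁺ (allFin n) go)))
      where
      go : ∀ z → not (not ⌊ y ≤? z ⌋) ∨ ((not (V.lookup Y z) ∨ V.lookup X z) ∧ (not (V.lookup X z) ∨ V.lookup Y z)) ≡ true
      go z with y ≤? z
      ... | yes _ = refl
      ... | no ne = same (h z (ℕₚ.≰⇒> ne))

    precedes⁻ : ∀ {n} (Y X : Vec Bool n) → precedes Y X ≡ true → Precedes Y X
    precedes⁻ {n} Y X e with any⁻ _ (allFin n) e
    ... | y , _ , e′ with V.lookup X y in eX | V.lookup Y y in eY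
    ...   | true | false = y , eX , eY , go
      where
      go : ∀ z → toℕ z ℕ.< toℕ y → V.lookup Y z ≡ V.lookup X z
      go z lt with all⁻ {xs = allFin n} {x = z} e′ (allFin-mem z)
      ... | e″ with y ≤? z
      ...   | yes y≤z = ⊥-elim (ℕₚ.<⇒≱ lt y≤z)
      ...   | no _ = same⁻ _ _ e″

    desc-cons : ∀ {n} b {X Y : Vec Bool n} → precedes X Y ≡ false × precedes Y X ≡ true →
      precedes (b ∷ X) (b ∷ Y) ≡ false × precedes (b ∷ Y) (b ∷ X) ≡ true
    desc-cons b {X} {Y} (p , q) = Boolₚ.¬-not (λ e → absurd (precedes⁺ X Y (down (precedes⁻ (b ∷ X) (b ∷ Y) e))) p) , precedes⁺ (b ∷ Y) (b ∷ X) (up (precedes⁻ Y X q))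
      where
      up : Precedes Y X → Precedes (b ∷ Y) (b ∷ X)
      up (y , a , b , h) = suc y , a , b , λ { zero _ → refl ; (suc z) (s≤s lt) → h z lt }
      down : Precedes (b ∷ X) (b ∷ Y) → Precedes X Y
      down (zero , a , b , h) = absurd a b
      down (suc y , a , b , h) = y , a , b , λ z lt → h (suc z) (s≤s lt)

    desc-head : ∀ {n} (X Y : Vec Bool n) → precedes (true ∷ X) (false ∷ Y) ≡ false × precedes (false ∷ Y) (true ∷ X) ≡ true
    desc-head X Y = Boolₚ.¬-not (λ e → no-way (precedes⁻ (true ∷ X) (false ∷ Y) e)) , precedes⁺ (false ∷ Y) (true ∷ X) (zero , refl , refl , λ _ ())
      where
      no-way : Precedes (true ∷ X) (false ∷ Y) → ⊥
      no-way (suc y , _ , _ , h) with h zero (s≤s z≤n)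
      ... | ()

    precedes-irrefl : ∀ {n} (X : Vec Bool n) → precedes X X ≡ false
    precedes-irrefl X = Boolₚ.¬-not λ e → let (_ , a , b , _) = precedes⁻ X X e in absurd a b

    allVecs-descending : ∀ n → AllPairs (λ X Y → precedes X Y ≡ false × precedes Y X ≡ true) (allVecs bools n)
    allVecs-descending zero = [] ∷ []
    allVecs-descending (suc n) = AllPairsₚ.++⁺ (AllPairsₚ.map⁺ (AllPairs.map (λ {X} {Y} → desc-cons true {X} {Y}) (allVecs-descending n)))
      (≡.subst (AllPairs _) (≡.sym (Listₚ.++-identityʳ _)) (AllPairsₚ.map⁺ (AllPairs.map (λ {X} {Y} → desc-cons false {X} {Y}) (allVecs-descending n))))
      (Allₚ.map⁺ (All.universal (λ X → ≡.subst (All _) (≡.sym (Listₚ.++-identityʳ _)) (Allₚ.map⁺ (All.universal (λ Y → desc-head X Y) _))) _))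

  allFin-ascending : ∀ n → AllPairs (λ (i j : Fin n) → toℕ i ℕ.< toℕ j) (allFin n)
  allFin-ascending zero = []
  allFin-ascending (suc n) = Allₚ.map⁺ (All.universal (λ _ → s≤s z≤n) _) ∷ AllPairsₚ.map⁺ (AllPairs.map s≤s (allFin-ascending n))

  module Semantics (nw : NestedWord K m) where
    n : ℕ
    n = length (NestedWord.word nw)

    Env₁ Env₂ : ℕ → Set
    Env₁ f = Fin f → Fin n
    Env₂ s = Fin s → Vec Bool n

    ⟦_⟧ : ∀ {f s} → WF′ f s → Env₁ f → Env₂ s → C
    ⟦ φ ⟧ = Defs.⟦_⟧ K m φ nw

    sat : ∀ {f s} → MSO′ f s → Env₁ f → Env₂ s → Bool
    sat (atom α) ρ σ = Defs.atomᵇ K m nw α ρ σ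
    sat (¬ᶜ φ) ρ σ = not (sat φ ρ σ)
    sat (φ ∨ᶜ ψ) ρ σ = sat φ ρ σ ∨ sat ψ ρ σ
    sat (∃₁ φ) ρ σ = any (λ i → sat φ (ext i ρ) σ) (allFin n)
    sat (∃₂ φ) ρ σ = any (λ X → sat φ ρ (ext X σ)) (allVecs bools n)

    sat-∧ : ∀ {f s} (φ ψ : MSO′ f s) ρ σ → sat (φ ∧ᶜ ψ) ρ σ ≡ sat φ ρ σ ∧ sat ψ ρ σ
    sat-∧ φ ψ ρ σ with sat φ ρ σ | sat ψ ρ σ
    ... | true | true = refl
    ... | true | false = refl
    ... | false | _ = refl

    sat-∀ : ∀ {f s} (φ : MSO′ (suc f) s) ρ σ → sat (∀ᶜ φ) ρ σ ≡ all (λ i → sat φ (ext i ρ) σ) (allFin n)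
    sat-∀ φ ρ σ = ≡.trans (not-any _ (allFin n)) (all-cong (allFin n) λ i → Boolₚ.not-involutive _)

    sat-ltSet : ∀ {f s} (ρ : Env₁ f) (σ : Env₂ (suc (suc s))) → sat (Defs.ltSet K m) ρ σ ≡ precedes (σ zero) (σ (suc zero))
    sat-ltSet {f} {s} ρ σ = any-cong (allFin n) λ y → ≡.trans (sat-∧ y∈X (y∉Y ∧ᶜ ∀ᶜ (z<y →ᶜ (z∈Y ↔ᶜ z∈X))) (ext y ρ) σ) (cong (V.lookup (σ (suc zero)) y ∧_)
      (≡.trans (sat-∧ y∉Y (∀ᶜ (z<y →ᶜ (z∈Y ↔ᶜ z∈X))) (ext y ρ) σ) (cong (not (V.lookup (σ zero) y) ∧_)
        (≡.trans (sat-∀ (z<y →ᶜ (z∈Y ↔ᶜ z∈X)) (ext y ρ) σ)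
          (all-cong (allFin n) λ z → cong (not (not ⌊ y ≤? z ⌋) ∨_)
            (sat-∧ (z∈Y →ᶜ z∈X) (z∈X →ᶜ z∈Y) (ext z (ext y ρ)) σ))))))
      where
      y∈X y∉Y : MSO′ (suc f) (suc (suc s))
      y∈X = atom (mem zero (suc zero))
      y∉Y = ¬ᶜ (atom (mem zero zero))
      z<y z∈X z∈Y : MSO′ (suc (suc f)) (suc (suc s))
      z<y = zero <ᶜ suc zero
      z∈X = atom (mem zero (suc zero))
      z∈Y = atom (mem zero zero)

    private
      lift-ext : ∀ {a} {A : Set a} {k k′} {x : A} {ρ : Fin k → A} {ρ′ : Fin k′ → A} {r : Fin k′ → Fin k} →
        (∀ i → ρ′ i ≡ ρ (r i)) → ∀ i → ext x ρ′ i ≡ ext x ρ (Defs.lift K m r i)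
      lift-ext e zero = refl
      lift-ext e (suc i) = e i

      atomᵇ-ren : ∀ {f f′ s s′} (α : Atom K m f s) (a : Fin f → Fin f′) (b : Fin s → Fin s′) {ρ ρ′ σ σ′} →
        (∀ i → ρ′ i ≡ ρ (a i)) → (∀ i → σ′ i ≡ σ (b i)) → Defs.atomᵇ K m nw (Defs.renAtom K m a b α) ρ σ ≡ Defs.atomᵇ K m nw α ρ′ σ′
      atomᵇ-ren (eq x y) a b e h rewrite e x | e y = refl
      atomᵇ-ren (lab d x) a b e h rewrite e x = refl
      atomᵇ-ren (le x y) a b e h rewrite e x | e y = refl
      atomᵇ-ren (nu x y) a b e h rewrite e x | e y = refl
      atomᵇ-ren (mem x X) a b e h rewrite e x | h X = refl

    ren-sem : ∀ {f f′ s s′} (φ : WF′ f s) (a : Fin f → Fin f′) (b : Fin s → Fin s′) {ρ ρ′ σ σ′} →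
      (∀ i → ρ′ i ≡ ρ (a i)) → (∀ i → σ′ i ≡ σ (b i)) → ⟦ Defs.ren K m a b φ ⟧ ρ σ ≈ ⟦ φ ⟧ ρ′ σ′
    ren-sem (const k) a b e h = ≈-refl
    ren-sem (atom α) a b e h = reflexive (cong 𝟙 (atomᵇ-ren α a b e h))
    ren-sem (natom α) a b e h = reflexive (cong (𝟙 ∘ not) (atomᵇ-ren α a b e h))
    ren-sem (φ ∨ʷ ψ) a b e h = +-cong (ren-sem φ a b e h) (ren-sem ψ a b e h)
    ren-sem (φ ∧ʷ ψ) a b e h = *-cong (ren-sem φ a b e h) (ren-sem ψ a b e h)
    ren-sem (∃₁ φ) a b e h = ∑-cong (allFin n) λ i → ren-sem φ _ b (lift-ext e) h
    ren-sem (∃₂ φ) a b e h = ∑-cong (allVecs bools n) λ X → ren-sem φ a _ e (lift-ext h)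
    ren-sem (∀₁ φ) a b e h = ∏-cong (allFin n) λ i → ren-sem φ _ b (lift-ext e) h
    ren-sem (∀₂ φ) a b e h = ∏-cong (allVecs bools n) λ X → ren-sem φ a _ e (lift-ext h)

    Decides : ∀ {f s} → Defs.Pair K m f s → Env₁ f → Env₂ s → Bool → Set _
    Decides (p , q) ρ σ b = ⟦ p ⟧ ρ σ ≈ 𝟙 b × ⟦ q ⟧ ρ σ ≈ 𝟙 (not b)

    SetFree : ∀ {f s} → MSO′ f s → Set
    SetFree (atom α) = ⊤
    SetFree (¬ᶜ φ) = SetFree φ
    SetFree (φ ∨ᶜ ψ) = SetFree φ × SetFree ψ
    SetFree (∃₁ φ) = SetFree φ
    SetFree (∃₂ φ) = ⊥

    private
      shift-ext : ∀ {a} {A : Set a} {k} (x y : A) (ρ : Fin k → A) i → ext y ρ i ≡ ext y (ext x ρ) (Defs.shiftUnder K m i)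
      shift-ext x y ρ zero = refl
      shift-ext x y ρ (suc i) = refl

      𝟙-→ : ∀ b p {x y z} → x ≈ 𝟙 (not b) → y ≈ 𝟙 b → z ≈ 𝟙 (not p) → x + y * z ≈ 𝟙 (not b ∨ not p)
      𝟙-→ b p ex ey ez = ≈-trans (+-cong ex (*-cong (≈-trans ey (reflexive (cong 𝟙 (≡.sym (Boolₚ.not-involutive b))))) ez)) (𝟙-∨ (not b) (not p))

    module _ (lt : ∀ {f s} → Defs.Pair K m f (suc (suc s))) where
      LtCorrect : Set _
      LtCorrect = ∀ {f s} (ρ : Env₁ f) (σ : Env₂ (suc (suc s))) → Decides lt ρ σ (precedes (σ zero) (σ (suc zero)))

      -- The order on sets enters only through set quantifiers. Hence the alternative: `ltSet`
      -- itself has none and is handled with the dummy order, and the outcome is the assumption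
      -- under which all other formulas are handled.
      pmWith-sem : ∀ {f s} (φ : MSO′ f s) → SetFree φ ⊎ LtCorrect → ∀ ρ σ → Decides (Defs.pmWith K m lt φ) ρ σ (sat φ ρ σ)
      pmWith-sem (atom α) c ρ σ = ≈-refl , ≈-refl
      pmWith-sem (¬ᶜ φ) c ρ σ = let (p , q) = pmWith-sem φ c ρ σ in
        q , ≈-trans p (reflexive (cong 𝟙 (≡.sym (Boolₚ.not-involutive (sat φ ρ σ)))))
      pmWith-sem (φ ∨ᶜ ψ) c ρ σ =
        let (p , q) = pmWith-sem φ (⊎-map₁ proj₁ c) ρ σ ; (p′ , q′) = pmWith-sem ψ (⊎-map₁ proj₂ c) ρ σ in
        ≈-trans (+-cong p (*-cong q p′)) (𝟙-∨ (sat φ ρ σ) (sat ψ ρ σ)) ,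
        ≈-trans (*-cong q q′) (≈-trans (𝟙-∧ (not (sat φ ρ σ)) (not (sat ψ ρ σ))) (reflexive (cong 𝟙 (de-morgan (sat φ ρ σ) (sat ψ ρ σ)))))
        where
        de-morgan : ∀ a b → not a ∧ not b ≡ not (a ∨ b)
        de-morgan true b = refl
        de-morgan false b = refl
      pmWith-sem (∃₁ φ) c ρ σ =
        ≈-trans (∑-cong (allFin n) λ i → ≈-trans (*-cong (proj₁ (ih i)) (≈-trans
            (∏-cong (allFin n) λ j → 𝟙-→ (not ⌊ i ≤? j ⌋) (sat φ (ext j ρ) σ)
              (reflexive (cong 𝟙 (≡.sym (Boolₚ.not-involutive ⌊ i ≤? j ⌋)))) ≈-refl
              (≈-trans (ren-sem (proj₂ (Defs.pmWith K m lt φ)) (Defs.shiftUnder K m) (λ X → X) (shift-ext i j ρ) (λ _ → refl)) (proj₂ (ih j))))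
            (∏-𝟙 (λ j → not (not ⌊ i ≤? j ⌋) ∨ not (sat φ (ext j ρ) σ)) (allFin n)))) (𝟙-∧ (sat φ (ext i ρ) σ) _))
          (Least.least-ascending (λ j i → not ⌊ i ≤? j ⌋) (λ i → cong not (⌊⌋-true (i ≤? i) ℕₚ.≤-refl)) (λ i → sat φ (ext i ρ) σ)
            (AllPairs.map (λ {i} {j} i<j → cong not (⌊⌋-false (j ≤? i) (ℕₚ.<⇒≱ i<j)) , cong not (⌊⌋-true (i ≤? j) (ℕₚ.<⇒≤ i<j))) (allFin-ascending n))) ,
        ≈-trans (∏-cong (allFin n) λ i → proj₂ (ih i)) (≈-trans (∏-𝟙 (λ i → not (sat φ (ext i ρ) σ)) (allFin n)) (reflexive (cong 𝟙 (≡.sym (not-any (λ i → sat φ (ext i ρ) σ) (allFin n))))))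
        where
        ih : ∀ i → Decides (Defs.pmWith K m lt φ) (ext i ρ) σ (sat φ (ext i ρ) σ)
        ih i = pmWith-sem φ c (ext i ρ) σ
      pmWith-sem (∃₂ φ) (inj₂ c) ρ σ =
        ≈-trans (∑-cong Xs λ X → ≈-trans (*-cong (proj₁ (ih X)) (≈-trans
            (∏-cong Xs λ Y → 𝟙-→ (precedes Y X) (sat φ ρ (ext Y σ)) (proj₂ (c ρ (ext Y (ext X σ)))) (proj₁ (c ρ (ext Y (ext X σ))))
              (≈-trans (ren-sem (proj₂ (Defs.pmWith K m lt φ)) (λ x → x) (Defs.shiftUnder K m) (λ _ → refl) (shift-ext X Y σ)) (proj₂ (ih Y))))
            (∏-𝟙 (λ Y → not (precedes Y X) ∨ not (sat φ ρ (ext Y σ))) Xs))) (𝟙-∧ (sat φ ρ (ext X σ)) _))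
          (Least.least-descending precedes precedes-irrefl (λ X → sat φ ρ (ext X σ)) (allVecs-descending n)) ,
        ≈-trans (∏-cong Xs λ X → proj₂ (ih X)) (≈-trans (∏-𝟙 (λ X → not (sat φ ρ (ext X σ))) Xs) (reflexive (cong 𝟙 (≡.sym (not-any (λ X → sat φ ρ (ext X σ)) Xs)))))
        where
        Xs = allVecs bools n
        ih : ∀ X → Decides (Defs.pmWith K m lt φ) ρ (ext X σ) (sat φ ρ (ext X σ))
        ih X = pmWith-sem φ (inj₂ c) ρ (ext X σ)

    pm-sem : ∀ {f s} (φ : MSO′ f s) ρ σ → Decides (Defs.pm K m φ) ρ σ (sat φ ρ σ)
    pm-sem φ = pmWith-sem (λ {f} {s} → Defs.pmWith K m (const 0# , const 0#) (Defs.ltSet K m {f} {s})) φ (inj₂ λ {f} {s} ρ σ →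
      ≡.subst (Decides (Defs.pmWith K m (const 0# , const 0#) (Defs.ltSet K m {f} {s})) ρ σ) (sat-ltSet ρ σ)
        (pmWith-sem (const 0# , const 0#) (Defs.ltSet K m {f} {s}) (inj₁ _) ρ σ))

-- Finite tree algebras.

module TreeAlgebra where
  open import Data.Fin using (_≟_)
  open import Data.List.Membership.Propositional.Properties using (∈-++⁺ˡ; ∈-++⁺ʳ)
  open import Data.Nat using (_<_)
  open import Relation.Binary.PropositionalEquality using (refl; sym; cong₂; subst)
  open FiniteSum
  open Tree

  -- A deterministic bottom-up tree automaton with its acceptance left open.
  record Alg (A : Set) : Set₁ where
    field
      {Q} : Set
      ft : FT Q
      e : Q
      di : A → Q → Q
      dc : A → Q → A → Q → Q

    open FT ft public using (en)

    module _ {n : ℕ} where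
      run : (Fin n → A) → ∀ {i j : Fin (suc n)} → Nest i j → Q
      run ℓ (nil _) = e
      run ℓ (int p _ t) = di (ℓ p) (run ℓ t)
      run ℓ (call p r _ t t′) = dc (ℓ p) (run ℓ t) (ℓ r) (run ℓ t′)

      run-cong : ∀ {ℓ ℓ′ : Fin n → A} {i j : Fin (suc n)} (t : Nest i j) → (∀ {k} → k ∈ positions t → ℓ k ≡ ℓ′ k) → run ℓ t ≡ run ℓ′ t
      run-cong (nil _) h = refl
      run-cong (int p _ t) h = cong₂ di (h (here refl)) (run-cong t (h ∘ there))
      run-cong (call p r _ t t′) h rewrite h (here refl) | h (there (∈-++⁺ʳ (positions t) (here refl)))
        | run-cong t (λ m → h (there (∈-++⁺ˡ m))) | run-cong t′ (λ m → h (there (∈-++⁺ʳ (positions t) (there m)))) = refl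

  _⊠_ : ∀ {A} → Alg A → Alg A → Alg A
  D ⊠ D′ = record { ft = ft-× D.ft D′.ft ; e = D.e , D′.e ; di = λ a (x , y) → D.di a x , D′.di a y
                  ; dc = λ a (x , y) b (x′ , y′) → D.dc a x b x′ , D′.dc a y b y′ }
    where module D = Alg D
          module D′ = Alg D′

  module _ {A : Set} (D D′ : Alg A) where
    run-⊠ : ∀ {n} (ℓ : Fin n → A) {i j : Fin (suc n)} (t : Nest i j) → Alg.run (D ⊠ D′) ℓ t ≡ (Alg.run D ℓ t , Alg.run D′ ℓ t)
    run-⊠ ℓ (nil _) = refl
    run-⊠ ℓ (int p _ t) rewrite run-⊠ ℓ t = refl
    run-⊠ ℓ (call p r _ t t′) rewrite run-⊠ ℓ t | run-⊠ ℓ t′ = refl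

  after : ∀ {n} {p : Fin n} {j} (t : Nest (suc p) j) {k} → k ∈ positions t → toℕ p < toℕ k
  after t m = proj₁ (positions-within t m)

  inside : ∀ {n} {i} {r : Fin n} (t : Nest i (inject₁ r)) {k} → k ∈ positions t → toℕ k < toℕ r
  inside {r = r} t m = subst (_ <_) (Finₚ.toℕ-inject₁ r) (proj₂ (positions-within t m))

  <⇒≢ : ∀ {n} {i k : Fin n} → toℕ i < toℕ k → i ≢ k
  <⇒≢ lt refl = ℕₚ.<-irrefl refl lt

  -- `c a b` extends the letter a by a bit b. In `ℓ₁ i` the bit is set exactly at i, which encodes a
  -- first-order variable with value i.
  module Marked {A B : Set} (c : A → Bool → B) {n : ℕ} (ℓ : Fin n → A) where
    ℓ₀ : Fin n → B
    ℓ₀ k = c (ℓ k) false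

    ℓ₁ : Fin n → Fin n → B
    ℓ₁ i k = c (ℓ k) ⌊ i ≟ k ⌋

    at : ∀ i → ℓ₁ i i ≡ c (ℓ i) true
    at i with i ≟ i
    ... | yes _ = refl
    ... | no ne = ⊥-elim (ne refl)

    off : ∀ {i k} → i ≢ k → ℓ₁ i k ≡ ℓ₀ k
    off {i} {k} ne with i ≟ k
    ... | yes e = ⊥-elim (ne e)
    ... | no _ = refl

    off< : ∀ {i k} → toℕ i < toℕ k → ℓ₁ i k ≡ ℓ₀ k
    off< lt = off (<⇒≢ lt)

    off> : ∀ {i k} → toℕ k < toℕ i → ℓ₁ i k ≡ ℓ₀ k
    off> lt = off (<⇒≢ lt ∘ sym)

-- Closure properties of weighted tree automata.

module Closure {c ℓ} (K : CommutativeSemiring c ℓ) where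
  open import Data.List using (map)
  open import Data.List.Membership.Propositional.Properties using (∈-++⁺ˡ; ∈-++⁺ʳ)
  open import Data.Sum using () renaming ([_,_] to [_,_]ₛ)
  open import Function using (id)
  open FiniteSum
  open Tree
  open TreeAlgebra
  open TreeAutomata K

  open CommutativeSemiring K hiding (zero) renaming (Carrier to C; refl to ≈-refl; sym to ≈-sym; trans to ≈-trans)
  open Sums semiring
  open import Algebra.Properties.CommutativeSemigroup *-commutativeSemigroup using () renaming (x∙yz≈y∙xz to comm₃; interchange to exchange)
  open FiniteSum.Fold *-commutativeMonoid using () renaming (fold to ∏; fold-cong to ∏-cong; fold-cong∈ to ∏-cong∈; fold-++ to ∏-++)

  private
    ∑-Bool : (f : Bool → C) → ∑ (true ∷ false ∷ []) f ≈ f true + f false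
    ∑-Bool f = +-congˡ (+-identityʳ _)

  module _ {A : Set} (𝒜 : WTA A) where
    open WTA 𝒜
    W-cong : ∀ {n} {ℓ ℓ′ : Fin n → A} {i j : Fin (suc n)} (t : Nest i j) → (∀ {k} → k ∈ positions t → ℓ k ≡ ℓ′ k) → ∀ q → W ℓ t q ≈ W ℓ′ t q
    W-cong (nil _) h q = ≈-refl
    W-cong (int p _ t) h q = ∑-cong en λ q′ → *-cong (reflexive (≡.cong (λ a → wi q a q′) (h (here ≡.refl)))) (W-cong t (h ∘ there) q′)
    W-cong (call p r _ t t′) h q = ∑-cong en λ q₁ → ∑-cong en λ q₂ → *-cong
      (reflexive (≡.cong₂ (λ a b → wc q a q₁ b q₂) (h (here ≡.refl)) (h (there (∈-++⁺ʳ (positions t) (here ≡.refl))))))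
      (*-cong (W-cong t (λ m → h (there (∈-++⁺ˡ m))) q₁) (W-cong t′ (λ m → h (there (∈-++⁺ʳ (positions t) (there m)))) q₂))

  -- Transitions have weight 0 or 1 and follow the algebra, so a single choice of states survives;
  -- the value at the root receives the weight g.
  module Det {A : Set} (D : Alg A) (g : Alg.Q D → C) where
    open Alg D
    open FT ft using (dec)

    wta : WTA A
    wta = record { ft = ft ; ι = g ; e = λ q → [ dec e q ] ; wi = λ q a q′ → [ dec (di a q′) q ]
                 ; wc = λ q a q₁ b q₂ → [ dec (dc a q₁ b q₂) q ] }

    W-run : ∀ {n} (ℓ : Fin n → A) {i j : Fin (suc n)} (t : Nest i j) q → WTA.W wta ℓ t q ≈ [ dec (run ℓ t) q ]
    W-run ℓ (nil _) q = ≈-refl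
    W-run ℓ (int p _ t) q = ≈-trans (∑-cong en λ q′ → ≈-trans (*-congˡ (W-run ℓ t q′)) (*-comm _ _))
      (∑-δ ft (run ℓ t) λ q′ → [ dec (di (ℓ p) q′) q ])
    W-run ℓ (call p r _ t t′) q = ≈-trans (∑-cong en λ q₁ → ≈-trans (∑-cong en λ q₂ →
        ≈-trans (*-congˡ (*-cong (W-run ℓ t q₁) (W-run ℓ t′ q₂))) (≈-trans (*-comm _ _) (≈-trans (*-assoc _ _ _) (comm₃ _ _ _))))
      (∑-δ ft (run ℓ t′) λ q₂ → [ dec (run ℓ t) q₁ ] * [ dec (dc (ℓ p) q₁ (ℓ r) q₂) q ]))
      (∑-δ ft (run ℓ t) λ q₁ → [ dec (dc (ℓ p) q₁ (ℓ r) (run ℓ t′)) q ])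

    weight-run : ∀ {n} (ℓ : Fin n → A) {i j : Fin (suc n)} (t : Nest i j) → WTA.weight wta ℓ t ≈ g (run ℓ t)
    weight-run ℓ t = ≈-trans (∑-cong en λ q → ≈-trans (*-congˡ (W-run ℓ t q)) (*-comm _ _)) (∑-δ ft (run ℓ t) g)

  module Plus {A : Set} (𝒜 ℬ : WTA A) where
    private
      module 𝒜 = WTA 𝒜
      module ℬ = WTA ℬ

    wta : WTA A
    wta = record
      { ft = ft-⊎ 𝒜.ft ℬ.ft
      ; ι = [ 𝒜.ι , ℬ.ι ]ₛ
      ; e = [ 𝒜.e , ℬ.e ]ₛ
      ; wi = λ { (inj₁ x) a (inj₁ y) → 𝒜.wi x a y ; (inj₂ x) a (inj₂ y) → ℬ.wi x a y ; _ _ _ → 0# }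
      ; wc = λ { (inj₁ x) a (inj₁ y) b (inj₁ z) → 𝒜.wc x a y b z ; (inj₂ x) a (inj₂ y) b (inj₂ z) → ℬ.wc x a y b z ; _ _ _ _ _ → 0# } }

    private
      module 𝒲 = WTA wta

      ∑-⊎ : (f : 𝒜.Q ⊎ ℬ.Q → C) → ∑ 𝒲.en f ≈ ∑ 𝒜.en (f ∘ inj₁) + ∑ ℬ.en (f ∘ inj₂)
      ∑-⊎ f = ≈-trans (∑-++ (map inj₁ 𝒜.en) _ f) (+-cong (reflexive (∑-map inj₁ 𝒜.en f)) (reflexive (∑-map inj₂ ℬ.en f)))

      ∑ˡ : (f : 𝒜.Q ⊎ ℬ.Q → C) → (∀ x → f (inj₂ x) ≈ 0#) → ∑ 𝒲.en f ≈ ∑ 𝒜.en (f ∘ inj₁)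
      ∑ˡ f z = ≈-trans (∑-⊎ f) (≈-trans (+-congˡ (∑-0 ℬ.en z)) (+-identityʳ _))

      ∑ʳ : (f : 𝒜.Q ⊎ ℬ.Q → C) → (∀ x → f (inj₁ x) ≈ 0#) → ∑ 𝒲.en f ≈ ∑ ℬ.en (f ∘ inj₂)
      ∑ʳ f z = ≈-trans (∑-⊎ f) (≈-trans (+-congʳ (∑-0 𝒜.en z)) (+-identityˡ _))

    module _ {n} (ℓ : Fin n → A) where
      W-inj₁ : ∀ {i j : Fin (suc n)} (t : Nest i j) x → 𝒲.W ℓ t (inj₁ x) ≈ 𝒜.W ℓ t x
      W-inj₁ (nil _) x = ≈-refl
      W-inj₁ (int p _ t) x = ≈-trans (∑ˡ _ λ y → zeroˡ _) (∑-cong 𝒜.en λ y → *-congˡ (W-inj₁ t y))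
      W-inj₁ (call p r _ t t′) x = ≈-trans (∑ˡ _ λ y → ∑-0 𝒲.en λ { (inj₁ z) → zeroˡ _ ; (inj₂ z) → zeroˡ _ })
        (∑-cong 𝒜.en λ y → ≈-trans (∑ˡ _ λ z → zeroˡ _) (∑-cong 𝒜.en λ z → *-congˡ (*-cong (W-inj₁ t y) (W-inj₁ t′ z))))

      W-inj₂ : ∀ {i j : Fin (suc n)} (t : Nest i j) x → 𝒲.W ℓ t (inj₂ x) ≈ ℬ.W ℓ t x
      W-inj₂ (nil _) x = ≈-refl
      W-inj₂ (int p _ t) x = ≈-trans (∑ʳ _ λ y → zeroˡ _) (∑-cong ℬ.en λ y → *-congˡ (W-inj₂ t y))
      W-inj₂ (call p r _ t t′) x = ≈-trans (∑ʳ _ λ y → ∑-0 𝒲.en λ { (inj₁ z) → zeroˡ _ ; (inj₂ z) → zeroˡ _ })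
        (∑-cong ℬ.en λ y → ≈-trans (∑ʳ _ λ z → zeroˡ _) (∑-cong ℬ.en λ z → *-congˡ (*-cong (W-inj₂ t y) (W-inj₂ t′ z))))

      weight-+ : ∀ {i j : Fin (suc n)} (t : Nest i j) → 𝒲.weight ℓ t ≈ 𝒜.weight ℓ t + ℬ.weight ℓ t
      weight-+ t = ≈-trans (∑-⊎ _) (+-cong (∑-cong 𝒜.en λ x → *-congˡ (W-inj₁ t x)) (∑-cong ℬ.en λ x → *-congˡ (W-inj₂ t x)))

  -- The two automata run in parallel; commutativity sorts the factors of a joint run into the two
  -- separate weights.
  module Times {A : Set} (𝒜 ℬ : WTA A) where
    private
      module 𝒜 = WTA 𝒜
      module ℬ = WTA ℬ

    wta : WTA A
    wta = record
      { ft = ft-× 𝒜.ft ℬ.ft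
      ; ι = λ (x , y) → 𝒜.ι x * ℬ.ι y
      ; e = λ (x , y) → 𝒜.e x * ℬ.e y
      ; wi = λ (x , y) a (x′ , y′) → 𝒜.wi x a x′ * ℬ.wi y a y′
      ; wc = λ (x , y) a (x₁ , y₁) b (x₂ , y₂) → 𝒜.wc x a x₁ b x₂ * ℬ.wc y a y₁ b y₂ }

    private
      module 𝒲 = WTA wta

      ∑-× : ∀ {f : 𝒜.Q → C} {g : ℬ.Q → C} {h : 𝒜.Q × ℬ.Q → C} → (∀ x y → h (x , y) ≈ f x * g y) → ∑ 𝒲.en h ≈ ∑ 𝒜.en f * ∑ ℬ.en g
      ∑-× {f} {g} e = ≈-trans (∑-cartesian 𝒜.en ℬ.en _) (≈-trans (∑-cong 𝒜.en λ x → ∑-cong ℬ.en λ y → e x y) (∑-*-∑ 𝒜.en ℬ.en f g))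

    module _ {n} (ℓ : Fin n → A) where
      W-* : ∀ {i j : Fin (suc n)} (t : Nest i j) x y → 𝒲.W ℓ t (x , y) ≈ 𝒜.W ℓ t x * ℬ.W ℓ t y
      W-* (nil _) x y = ≈-refl
      W-* (int p _ t) x y = ∑-× λ x′ y′ → ≈-trans (*-congˡ (W-* t x′ y′)) (exchange _ _ _ _)
      W-* (call p r _ t t′) x y = ∑-× λ x₁ y₁ → ∑-× λ x₂ y₂ →
        ≈-trans (*-congˡ (≈-trans (*-cong (W-* t x₁ y₁) (W-* t′ x₂ y₂)) (exchange _ _ _ _))) (exchange _ _ _ _)

      weight-* : ∀ {i j : Fin (suc n)} (t : Nest i j) → 𝒲.weight ℓ t ≈ 𝒜.weight ℓ t * ℬ.weight ℓ t
      weight-* t = ∑-× λ x y → ≈-trans (*-congˡ (W-* t x y)) (exchange _ _ _ _)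

  -- The state (b , q) tells whether the distinguished position lies in the span.
  module SumMarks {A B : Set} (c : A → Bool → B) (𝒜 : WTA B) where
    open WTA 𝒜 renaming (ι to ι₀; e to e₀; wi to wi₀; wc to wc₀; W to W₀; weight to weight₀; ft to ft₀; en to en₀)

    wta : WTA A
    wta = record
      { ft = ft-× ft-Bool ft₀
      ; ι = λ { (true , q) → ι₀ q ; (false , q) → 0# }
      ; e = λ { (true , q) → 0# ; (false , q) → e₀ q }
      ; wi = λ { (true , q) a (true , q′) → wi₀ q (c a false) q′
               ; (true , q) a (false , q′) → wi₀ q (c a true) q′
               ; (false , q) a (false , q′) → wi₀ q (c a false) q′
               ; (false , q) a (true , q′) → 0# }
      ; wc = λ { (false , q) a (false , q₁) b (false , q₂) → wc₀ q (c a false) q₁ (c b false) q₂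
               ; (true , q) a (false , q₁) b (false , q₂) → wc₀ q (c a true) q₁ (c b false) q₂ + wc₀ q (c a false) q₁ (c b true) q₂
               ; (true , q) a (true , q₁) b (false , q₂) → wc₀ q (c a false) q₁ (c b false) q₂
               ; (true , q) a (false , q₁) b (true , q₂) → wc₀ q (c a false) q₁ (c b false) q₂
               ; _ _ _ _ _ → 0# } }

    open WTA wta using (W; weight; en)

    private
      ∑-B× : (f : Bool × Q → C) → ∑ en f ≈ ∑ en₀ (λ q → f (true , q)) + ∑ en₀ (λ q → f (false , q))
      ∑-B× f = ≈-trans (∑-cartesian (true ∷ false ∷ []) en₀ f) (∑-Bool λ b → ∑ en₀ λ q → f (b , q))

      ∑-F : (f : Bool × Q → C) → (∀ q → f (true , q) ≈ 0#) → ∑ en f ≈ ∑ en₀ (λ q → f (false , q))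
      ∑-F f z = ≈-trans (∑-B× f) (≈-trans (+-congʳ (∑-0 en₀ z)) (+-identityˡ _))

      ∑-T : (f : Bool × Q → C) → (∀ q → f (false , q) ≈ 0#) → ∑ en f ≈ ∑ en₀ (λ q → f (true , q))
      ∑-T f z = ≈-trans (∑-B× f) (≈-trans (+-congˡ (∑-0 en₀ z)) (+-identityʳ _))

    module _ {n} (ℓ : Fin n → A) where
      open Marked c ℓ

      W-false : ∀ {i j : Fin (suc n)} (t : Nest i j) q → W ℓ t (false , q) ≈ W₀ ℓ₀ t q
      W-false (nil _) q = ≈-refl
      W-false (int p _ t) q = ≈-trans (∑-F _ λ q′ → zeroˡ _) (∑-cong en₀ λ q′ → *-congˡ (W-false t q′))
      W-false (call p r _ t t′) q = ≈-trans (∑-F _ λ q₁ → ∑-0 en λ { (true , _) → zeroˡ _ ; (false , _) → zeroˡ _ })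
        (∑-cong en₀ λ q₁ → ≈-trans (∑-F _ λ q₂ → zeroˡ _) (∑-cong en₀ λ q₂ → *-congˡ (*-cong (W-false t q₁) (W-false t′ q₂))))

      W-true : ∀ {i j : Fin (suc n)} (t : Nest i j) q → W ℓ t (true , q) ≈ ∑ (positions t) λ k → W₀ (ℓ₁ k) t q
      W-true (nil _) q = ≈-refl
      W-true (int p _ t) q = ≈-trans (∑-B× _) (≈-trans (+-comm _ _) (+-cong
        (∑-cong en₀ λ q′ → *-cong (reflexive (≡.cong (λ a → wi₀ q a q′) (≡.sym (at p))))
          (≈-trans (W-false t q′) (≈-sym (W-cong 𝒜 t (λ m → off< (after t m)) q′))))
        (≈-trans (∑-cong en₀ λ q′ → ≈-trans (*-congˡ (W-true t q′)) (∑-*ˡ (positions t) _ _)) (≈-trans (∑-swap en₀ (positions t) _)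
          (∑-cong∈ (positions t) λ m → ∑-cong en₀ λ q′ → *-congʳ (reflexive (≡.cong (λ a → wi₀ q a q′) (≡.sym (off> (after t m))))))))))
      -- The marked position lies inside the arc, behind it, at the call or at the return; the four
      -- sums correspond to these cases.
      W-true (call p r eq t t′) q = ≈-trans (∑-B× _) (≈-trans
        (+-cong
          (≈-trans (∑-cong en₀ λ q₁ → ∑-F _ λ q₂ → zeroˡ _) inner)
          (≈-trans (∑-cong en₀ λ q₁ → ∑-B× _) (≈-trans (∑-+ en₀ _ _) (+-cong outer
            (≈-trans (∑-cong en₀ λ q₁ → ≈-trans (∑-cong en₀ λ q₂ → distribʳ _ _ _) (∑-+ en₀ _ _)) (≈-trans (∑-+ en₀ _ _) (+-cong atCall atReturn)))))))
        (≈-trans shuffle (+-congˡ (≈-sym (∑-++ (positions t) (r ∷ positions t′) _)))))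
        where
        F : Fin n → C
        F k = W₀ (ℓ₁ k) (call p r eq t t′) q
        p<r = call-< t
        inner : ∑ en₀ (λ q₁ → ∑ en₀ λ q₂ → wc₀ q (c (ℓ p) false) q₁ (c (ℓ r) false) q₂ * (W ℓ t (true , q₁) * W ℓ t′ (false , q₂))) ≈ ∑ (positions t) F
        inner = ≈-trans (∑-cong en₀ λ q₁ → ≈-trans (∑-cong en₀ λ q₂ → ≈-trans (*-congˡ (≈-trans (*-congʳ (W-true t q₁)) (∑-*ʳ (positions t) _ _))) (∑-*ˡ (positions t) _ _))
            (∑-swap en₀ (positions t) _)) (≈-trans (∑-swap en₀ (positions t) _) (∑-cong∈ (positions t) λ {k} m →
            ∑-cong en₀ λ q₁ → ∑-cong en₀ λ q₂ → *-cong (reflexive (≡.cong₂ (λ a b → wc₀ q a q₁ b q₂) (≡.sym (off> (after t m))) (≡.sym (off< (inside t m)))))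
              (*-congˡ (≈-trans (W-false t′ q₂) (≈-sym (W-cong 𝒜 t′ (λ m′ → off< (ℕₚ.<-trans (inside t m) (after t′ m′))) q₂))))))
        outer : ∑ en₀ (λ q₁ → ∑ en₀ λ q₂ → wc₀ q (c (ℓ p) false) q₁ (c (ℓ r) false) q₂ * (W ℓ t (false , q₁) * W ℓ t′ (true , q₂))) ≈ ∑ (positions t′) F
        outer = ≈-trans (∑-cong en₀ λ q₁ → ≈-trans (∑-cong en₀ λ q₂ → ≈-trans (*-congˡ (≈-trans (*-congˡ (W-true t′ q₂)) (∑-*ˡ (positions t′) _ _))) (∑-*ˡ (positions t′) _ _))
            (∑-swap en₀ (positions t′) _)) (≈-trans (∑-swap en₀ (positions t′) _) (∑-cong∈ (positions t′) λ {k} m →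
            ∑-cong en₀ λ q₁ → ∑-cong en₀ λ q₂ → *-cong (reflexive (≡.cong₂ (λ a b → wc₀ q a q₁ b q₂) (≡.sym (off> (ℕₚ.<-trans p<r (after t′ m)))) (≡.sym (off> (after t′ m)))))
              (*-congʳ (≈-trans (W-false t q₁) (≈-sym (W-cong 𝒜 t (λ m′ → off> (ℕₚ.<-trans (inside t m′) (after t′ m))) q₁))))))
        atCall : ∑ en₀ (λ q₁ → ∑ en₀ λ q₂ → wc₀ q (c (ℓ p) true) q₁ (c (ℓ r) false) q₂ * (W ℓ t (false , q₁) * W ℓ t′ (false , q₂))) ≈ F p
        atCall = ∑-cong en₀ λ q₁ → ∑-cong en₀ λ q₂ → *-cong (reflexive (≡.cong₂ (λ a b → wc₀ q a q₁ b q₂) (≡.sym (at p)) (≡.sym (off< p<r))))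
          (*-cong (≈-trans (W-false t q₁) (≈-sym (W-cong 𝒜 t (λ m → off< (after t m)) q₁)))
                  (≈-trans (W-false t′ q₂) (≈-sym (W-cong 𝒜 t′ (λ m → off< (ℕₚ.<-trans p<r (after t′ m))) q₂))))
        atReturn : ∑ en₀ (λ q₁ → ∑ en₀ λ q₂ → wc₀ q (c (ℓ p) false) q₁ (c (ℓ r) true) q₂ * (W ℓ t (false , q₁) * W ℓ t′ (false , q₂))) ≈ F r
        atReturn = ∑-cong en₀ λ q₁ → ∑-cong en₀ λ q₂ → *-cong (reflexive (≡.cong₂ (λ a b → wc₀ q a q₁ b q₂) (≡.sym (off> p<r)) (≡.sym (at r))))
          (*-cong (≈-trans (W-false t q₁) (≈-sym (W-cong 𝒜 t (λ m → off> (inside t m)) q₁)))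
                  (≈-trans (W-false t′ q₂) (≈-sym (W-cong 𝒜 t′ (λ m → off< (after t′ m)) q₂))))
        shuffle : ∀ {w x y z} → w + (x + (y + z)) ≈ y + (w + (z + x))
        shuffle {w} {x} {y} {z} = ≈-trans (+-congˡ (≈-trans (+-comm _ _) (+-assoc _ _ _)))
          (≈-trans (≈-sym (+-assoc _ _ _)) (≈-trans (+-congʳ (+-comm _ _)) (+-assoc _ _ _)))

      weight-∑ : ∀ {i j : Fin (suc n)} (t : Nest i j) → weight ℓ t ≈ ∑ (positions t) λ k → weight₀ (ℓ₁ k) t
      weight-∑ t = ≈-trans (∑-T _ λ q → zeroˡ _) (≈-trans (∑-cong en₀ λ q → ≈-trans (*-congˡ (W-true t q)) (∑-*ˡ (positions t) _ _))
        (∑-swap en₀ (positions t) _))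

  -- The state (d , κ) consists of the value d of the unmarked span and of the map κ from the values of
  -- the span to the values of the whole tree.
  module ProductMarks {A B : Set} (c : A → Bool → B) (D : Alg B) (g : Alg.Q D → C) where
    open Alg D renaming (ft to ft₀; e to e₀; en to en₀)
    open Table ft₀
    open FT ft₀ using (dec)

    ftT : FT (Table Q)
    ftT = ft-Vec ft₀ _

    decT = FT.dec ftT

    κi : Table Q → A → Table Q
    κi κ a = tab λ x → app κ (di (c a false) x)

    κ₁ : Table Q → A → A → Q → Table Q
    κ₁ κ a b d₂ = tab λ x → app κ (dc (c a false) x (c b false) d₂)

    κ₂ : Table Q → A → Q → A → Table Q
    κ₂ κ a d₁ b = tab λ x → app κ (dc (c a false) d₁ (c b false) x)

    wta : WTA A
    wta = record
      { ft = ft-× ft₀ ftT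
      ; ι = λ (d , κ) → [ decT (tab id) κ ]
      ; e = λ (d , κ) → [ dec e₀ d ]
      ; wi = λ (d , κ) a (d′ , κ′) → [ decT (κi κ a) κ′ ] * ([ dec (di (c a false) d′) d ] * g (app κ (di (c a true) d′)))
      ; wc = λ (d , κ) a (d₁ , κ′) b (d₂ , κ″) → [ decT (κ₁ κ a b d₂) κ′ ] * ([ decT (κ₂ κ a d₁ b) κ″ ] *
          ([ dec (dc (c a false) d₁ (c b false) d₂) d ] *
            (g (app κ (dc (c a true) d₁ (c b false) d₂)) * g (app κ (dc (c a false) d₁ (c b true) d₂))))) }

    open WTA wta using (W; weight; en)

    private
      ts = FT.en ftT

    module _ {n} (ℓ : Fin n → A) where
      open Marked c ℓ

      prod : ∀ {i j : Fin (suc n)} → Nest i j → Table Q → C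
      prod t κ = ∏ (positions t) λ k → g (app κ (run (ℓ₁ k) t))

      -- Every position contributes its factor at its own node: d gives the unmarked values of the
      -- subtrees, and κ carries the value of the node with the mark to the value of the whole tree.
      -- Since d is fixed from below and κ from above, only one choice of states can have nonzero
      -- weight.
      W-prod : ∀ {i j : Fin (suc n)} (t : Nest i j) d κ → W ℓ t (d , κ) ≈ [ dec (run ℓ₀ t) d ] * prod t κ
      W-prod (nil _) d κ = ≈-sym (*-identityʳ _)
      W-prod (int p _ t) d κ = ≈-trans (∑-cartesian en₀ ts _) (≈-trans (∑-cong en₀ λ d′ →
          ≈-trans (∑-cong ts λ κ′ → *-assoc _ _ _) (≈-trans (∑-δ ftT (κi κ (ℓ p)) λ κ′ → ([ dec (di (c (ℓ p) false) d′) d ] * g (app κ (di (c (ℓ p) true) d′))) * W ℓ t (d′ , κ′))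
          (≈-trans (*-congˡ (W-prod t d′ (κi κ (ℓ p)))) (comm₃ _ _ _))))
        (≈-trans (∑-δ ft₀ (run ℓ₀ t) λ d′ → ([ dec (di (c (ℓ p) false) d′) d ] * g (app κ (di (c (ℓ p) true) d′))) * prod t (κi κ (ℓ p)))
        (≈-trans (*-assoc _ _ _) (*-congˡ (*-cong
          (reflexive (≡.cong (g ∘ app κ) (≡.cong₂ di (≡.sym (at p)) (run-cong t λ m → ≡.sym (off< (after t m))))))
          (∏-cong∈ (positions t) λ {k} m → reflexive (≡.cong g (≡.trans (app-tab (λ x → app κ (di (c (ℓ p) false) x)) _) (≡.cong (app κ) (≡.cong (λ a → di a (run (ℓ₁ k) t)) (≡.sym (off> (after t m)))))))))))))
      W-prod (call p r _ t t′) d κ = ≈-trans (∑-cartesian en₀ ts _) (≈-trans (∑-cong en₀ λ d₁ →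
          ≈-trans (∑-cong ts λ κ′ → ≈-trans (∑-cartesian en₀ ts _) (∑-cong en₀ λ d₂ →
            ≈-trans (∑-cong ts λ κ″ → ≈-trans (≈-trans (*-assoc _ _ _) (*-congˡ (*-assoc _ _ _))) (comm₃ _ _ _))
            (∑-δ ftT (κ₂ κ a d₁ b) λ κ″ → [ decT (κ₁ κ a b d₂) κ′ ] * (G d₁ d₂ * (W ℓ t (d₁ , κ′) * W ℓ t′ (d₂ , κ″))))))
          (≈-trans (∑-swap ts en₀ _) (≈-trans (∑-cong en₀ λ d₂ →
            ≈-trans (∑-δ ftT (κ₁ κ a b d₂) λ κ′ → G d₁ d₂ * (W ℓ t (d₁ , κ′) * W ℓ t′ (d₂ , κ₂ κ a d₁ b)))
            (≈-trans (*-congˡ (≈-trans (*-cong (W-prod t d₁ (κ₁ κ a b d₂)) (W-prod t′ d₂ (κ₂ κ a d₁ b))) (≈-trans (exchange _ _ _ _)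
              (≈-trans (*-congʳ (*-comm _ _)) (*-assoc _ _ _)))))
              (comm₃ _ _ _)))
          (∑-δ ft₀ (run ℓ₀ t′) λ d₂ → G d₁ d₂ * ([ dec (run ℓ₀ t) d₁ ] * (prod t (κ₁ κ a b d₂) * prod t′ (κ₂ κ a d₁ b)))))))
        (≈-trans (∑-cong en₀ λ d₁ → comm₃ _ _ _)
        (≈-trans (∑-δ ft₀ (run ℓ₀ t) λ d₁ → G d₁ (run ℓ₀ t′) * (prod t (κ₁ κ a b (run ℓ₀ t′)) * prod t′ (κ₂ κ a d₁ b)))
        (≈-trans (*-assoc _ _ _) (*-congˡ (≈-trans (*-assoc _ _ _) (*-cong
          (reflexive (≡.cong (g ∘ app κ) (dc-cong (≡.sym (at p)) (run-cong t λ m → ≡.sym (off< (after t m)))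
            (≡.sym (off< p<r)) (run-cong t′ λ m → ≡.sym (off< (ℕₚ.<-trans p<r (after t′ m)))))))
          (≈-trans (≈-trans (≈-sym (*-assoc _ _ _)) (≈-trans (*-congʳ (*-comm _ _)) (*-assoc _ _ _)))
            (≈-trans (*-cong
              (∏-cong∈ (positions t) λ {k} m → reflexive (≡.cong g (≡.trans (app-tab (λ x → app κ (dc (c a false) x (c b false) (run ℓ₀ t′))) _) (≡.cong (app κ)
                (dc-cong (≡.sym (off> (after t m))) ≡.refl (≡.sym (off< (inside t m))) (run-cong t′ λ m′ → ≡.sym (off< (ℕₚ.<-trans (inside t m) (after t′ m′)))))))))
              (*-cong (reflexive (≡.cong (g ∘ app κ) (dc-cong (≡.sym (off> p<r)) (run-cong t λ m → ≡.sym (off> (inside t m)))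
                  (≡.sym (at r)) (run-cong t′ λ m → ≡.sym (off< (after t′ m))))))
                (∏-cong∈ (positions t′) λ {k} m → reflexive (≡.cong g (≡.trans (app-tab (λ x → app κ (dc (c a false) (run ℓ₀ t) (c b false) x)) _) (≡.cong (app κ)
                  (dc-cong (≡.sym (off> (ℕₚ.<-trans p<r (after t′ m)))) (run-cong t λ m′ → ≡.sym (off> (ℕₚ.<-trans (inside t m′) (after t′ m))))
                    (≡.sym (off> (after t′ m))) ≡.refl)))))))
            (≈-sym (∏-++ (positions t) (r ∷ positions t′) _)))))))))))
        where
        a = ℓ p
        b = ℓ r
        p<r = call-< t
        G : Q → Q → C
        G d₁ d₂ = [ dec (dc (c a false) d₁ (c b false) d₂) d ] * (g (app κ (dc (c a true) d₁ (c b false) d₂)) * g (app κ (dc (c a false) d₁ (c b true) d₂)))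
        dc-cong : ∀ {a a′ x x′ b b′ y y′} → a ≡ a′ → x ≡ x′ → b ≡ b′ → y ≡ y′ → dc a x b y ≡ dc a′ x′ b′ y′
        dc-cong ≡.refl ≡.refl ≡.refl ≡.refl = ≡.refl

      weight-∏ : ∀ {i j : Fin (suc n)} (t : Nest i j) → weight ℓ t ≈ ∏ (positions t) λ k → g (run (ℓ₁ k) t)
      weight-∏ t = ≈-trans (∑-cartesian en₀ ts _) (≈-trans (∑-cong en₀ λ d → ≈-trans (∑-δ ftT (tab id) λ κ → W ℓ t (d , κ)) (W-prod t d (tab id)))
        (≈-trans (∑-δ ft₀ (run ℓ₀ t) λ d → prod t (tab id)) (∏-cong (positions t) λ k → reflexive (≡.cong g (app-tab id _)))))

-- Formulas of sRFO are recognized by weighted tree automata.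

module Recognizable {c ℓ} (K : CommutativeSemiring c ℓ) (m : ℕ) where
  open import Data.Bool using (if_then_else_)
  open import Data.Bool.ListAction using (any)
  open import Data.Fin using (_≟_; _≤?_; _<?_)
  open import Data.List using (length; lookup; _++_)
  open import Data.List.Relation.Unary.All using (All; []; _∷_)
  open import Data.List.Relation.Unary.AllPairs using (AllPairs; []; _∷_)
  open import Data.Vec using ([]; _∷_)
  open import Level using (_⊔_) renaming (suc to lsuc; zero to 0ℓ)
  open import Relation.Binary.PropositionalEquality using (refl; cong; cong₂; sym; trans; subst₂)
  open import Defs using (allFin; allVecs; bools; rel; NestedWord; mkNW; Atom; eq; lab; le; nu; mem; atom; natom; const; ¬ᶜ; _∨ᶜ_; ∃₁; ∃₂; ∀₁; aUMSO; sRFO; su; _∧ᵘ_; _∨ᵘ_; _∨ʳ_; _∧ʳ_; Cond3)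
  open Booleans
  open FiniteSum
  open Tree
  open Nesting
  open TreeAlgebra
  open TreeAutomata K
  open Logic K m

  open CommutativeSemiring K hiding (zero) renaming (Carrier to C; refl to ≈-refl; sym to ≈-sym; trans to ≈-trans)
  open Sums semiring
  open FiniteSum.Fold *-commutativeMonoid using () renaming (fold to ∏; fold-cong to ∏-cong)
  open TreeSum semiring

  -- Over the Booleans weighted tree automata are ordinary ones, and the sum over marked positions
  -- becomes a first-order existential quantifier. So the closure constructions serve classical
  -- formulas as well.
  𝔹 : CommutativeSemiring 0ℓ 0ℓ
  𝔹 = Boolₚ.∨-∧-commutativeSemiring

  private
    module 𝔹 where
      open TreeAutomata 𝔹 public
      open Closure 𝔹 public
      open Sums (CommutativeSemiring.semiring 𝔹) public using (∑-++; ∑-concatMap)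

  any-++ : ∀ {A : Set} (f : A → Bool) xs ys → any f (xs ++ ys) ≡ any f xs ∨ any f ys
  any-++ f xs ys = 𝔹.∑-++ xs ys f

  module _ {n : ℕ} (t : Nest {n} zero (fromℕ n)) where
    any-full : ∀ f → any f (positions t) ≡ any f (allFin n)
    any-full f = cong (any f) (positions-full t)

    ∑-full : ∀ f → ∑ (positions t) f ≈ ∑ (allFin n) f
    ∑-full f = reflexive (cong (λ ps → ∑ ps f) (positions-full t))

    ∏-full : ∀ f → ∏ (positions t) f ≈ ∏ (allFin n) f
    ∏-full f = reflexive (cong (λ ps → ∏ ps f) (positions-full t))

  -- The subset construction: the value of a tree is the set of states from which it has a run,
  -- stored as a table of Booleans.
  module Determinize {A : Set} (𝒜 : 𝔹.WTA A) where
    open 𝔹.WTA 𝒜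
    open Table ft

    alg : Alg A
    alg = record
      { ft = ft-Vec ft-Bool _
      ; e = tab e
      ; di = λ a v → tab λ q → any (λ q′ → wi q a q′ ∧ app v q′) en
      ; dc = λ a v b v′ → tab λ q → any (λ q₁ → any (λ q₂ → wc q a q₁ b q₂ ∧ (app v q₁ ∧ app v′ q₂)) en) en }

    accept : Table Bool → Bool
    accept v = any (λ q → ι q ∧ app v q) en

    module _ {n : ℕ} (ℓ : Fin n → A) where
      run-W : ∀ {i j : Fin (suc n)} (t : Nest i j) q → app (Alg.run alg ℓ t) q ≡ W ℓ t q
      run-W (nil _) q = app-tab e q
      run-W (int p _ t) q = trans (app-tab (λ q → any (λ q′ → wi q (ℓ p) q′ ∧ app (Alg.run alg ℓ t) q′) en) q)
        (any-cong en λ q′ → cong (wi q (ℓ p) q′ ∧_) (run-W t q′))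
      run-W (call p r _ t t′) q = trans (app-tab (λ q → any (λ q₁ → any (λ q₂ → wc q (ℓ p) q₁ (ℓ r) q₂ ∧ (app (Alg.run alg ℓ t) q₁ ∧ app (Alg.run alg ℓ t′) q₂)) en) en) q)
        (any-cong en λ q₁ → any-cong en λ q₂ → cong (wc q (ℓ p) q₁ (ℓ r) q₂ ∧_) (cong₂ _∧_ (run-W t q₁) (run-W t′ q₂)))

      accept-weight : ∀ {i j : Fin (suc n)} (t : Nest i j) → accept (Alg.run alg ℓ t) ≡ weight ℓ t
      accept-weight t = any-cong en λ q → cong (ι q ∧_) (run-W t q)

  -- The automaton for a set quantifier guesses the bit of the set at each position while it reads
  -- the tree.
  module Project {A B : Set} (c : A → Bool → B) (D : Alg B) (acc : Alg.Q D → Bool) where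
    open Alg D
    open FT ft using (dec) renaming (mem to ∈-en)

    wta : 𝔹.WTA A
    wta = record
      { ft = ft ; ι = acc ; e = λ q → ⌊ dec e q ⌋
      ; wi = λ q a q′ → any (λ b → ⌊ dec (di (c a b) q′) q ⌋) bools
      ; wc = λ q a q₁ b q₂ → any (λ x → any (λ y → ⌊ dec (dc (c a x) q₁ (c b y) q₂) q ⌋) bools) bools }

    open 𝔹.WTA wta using (W; weight)

    private
      mem-bool : ∀ b → b ∈ bools
      mem-bool = FT.mem ft-Bool

    module _ {n : ℕ} (ℓ : Fin n → A) where
      lab′ : (Fin n → Bool) → Fin n → B
      lab′ X k = c (ℓ k) (X k)

      W⁺ : ∀ {i j : Fin (suc n)} (t : Nest i j) X → W ℓ t (run (lab′ X) t) ≡ true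
      W⁺ (nil _) X = ⌊⌋-true (dec _ _) refl
      W⁺ (int p _ t) X = any⁺ (∈-en (run (lab′ X) t)) (∧⁺
        (any⁺ {f = λ b → ⌊ dec (di (c (ℓ p) b) (run (lab′ X) t)) (di (c (ℓ p) (X p)) (run (lab′ X) t)) ⌋} (mem-bool (X p)) (⌊⌋-true (dec _ _) refl)) (W⁺ t X))
      W⁺ (call p r _ t t′) X = any⁺ (∈-en (run (lab′ X) t)) (any⁺ (∈-en (run (lab′ X) t′)) (∧⁺
        (any⁺ {f = λ x → any (λ y → ⌊ dec (dc (c (ℓ p) x) (run (lab′ X) t) (c (ℓ r) y) (run (lab′ X) t′)) (dc (c (ℓ p) (X p)) (run (lab′ X) t) (c (ℓ r) (X r)) (run (lab′ X) t′)) ⌋) bools} (mem-bool (X p))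
          (any⁺ {f = λ y → ⌊ dec (dc (c (ℓ p) (X p)) (run (lab′ X) t) (c (ℓ r) y) (run (lab′ X) t′)) (dc (c (ℓ p) (X p)) (run (lab′ X) t) (c (ℓ r) (X r)) (run (lab′ X) t′)) ⌋} (mem-bool (X r)) (⌊⌋-true (dec _ _) refl)))
        (∧⁺ (W⁺ t X) (W⁺ t′ X))))

      private
        -- The ends of an arc, its inner span and the remainder have no position in common, so that
        -- guesses made separately for them combine into one set.
        glue : (p r : Fin n) (x y : Bool) (X Y : Fin n → Bool) → Fin n → Bool
        glue p r x y X Y k = if does (k ≟ p) then x else if does (k ≟ r) then y else if ⌊ k <? r ⌋ then X k else Y k

        glue-p : ∀ p r x y X Y → glue p r x y X Y p ≡ x
        glue-p p r x y X Y with p ≟ p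
        ... | yes _ = refl
        ... | no ne = ⊥-elim (ne refl)

        glue-r : ∀ p r x y X Y → toℕ p ℕ.< toℕ r → glue p r x y X Y r ≡ y
        glue-r p r x y X Y lt with r ≟ p | r ≟ r
        ... | yes refl | _ = ⊥-elim (ℕₚ.<-irrefl refl lt)
        ... | no _ | yes _ = refl
        ... | no _ | no ne = ⊥-elim (ne refl)

        glue-in : ∀ p r x y X Y k → toℕ p ℕ.< toℕ k → toℕ k ℕ.< toℕ r → glue p r x y X Y k ≡ X k
        glue-in p r x y X Y k lt lt′ with k ≟ p | k ≟ r | k <? r
        ... | yes refl | _ | _ = ⊥-elim (ℕₚ.<-irrefl refl lt)
        ... | no _ | yes refl | _ = ⊥-elim (ℕₚ.<-irrefl refl lt′)
        ... | no _ | no _ | yes _ = refl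
        ... | no _ | no _ | no ne = ⊥-elim (ne lt′)

        glue-out : ∀ p r x y X Y k → toℕ p ℕ.< toℕ r → toℕ r ℕ.< toℕ k → glue p r x y X Y k ≡ Y k
        glue-out p r x y X Y k lt lt′ with k ≟ p | k ≟ r | k <? r
        ... | yes refl | _ | _ = ⊥-elim (ℕₚ.<-asym lt lt′)
        ... | no _ | yes refl | _ = ⊥-elim (ℕₚ.<-irrefl refl lt′)
        ... | no _ | no _ | yes l = ⊥-elim (ℕₚ.<-asym l lt′)
        ... | no _ | no _ | no _ = refl

      W⁻ : ∀ {i j : Fin (suc n)} (t : Nest i j) q → W ℓ t q ≡ true → ∃ λ X → run (lab′ X) t ≡ q
      W⁻ (nil _) q e = (λ _ → false) , ⌊⌋-true⁻ (dec _ q) e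
      W⁻ (int p _ t) q h with any⁻ _ en h
      ... | q′ , _ , h′ with any⁻ _ bools (proj₁ (∧⁻ h′)) | W⁻ t q′ (proj₂ (∧⁻ h′))
      ...   | x , _ , h″ | X , e = glue p p x x X X , trans (cong₂ di (cong (c (ℓ p)) (glue-p p p x x X X))
                (trans (run-cong t λ {k} m → cong (c (ℓ k)) (skip k (after t m))) e)) (⌊⌋-true⁻ (dec _ q) h″)
        where
        skip : ∀ k → toℕ p ℕ.< toℕ k → glue p p x x X X k ≡ X k
        skip k lt with k ≟ p | k <? p
        ... | yes refl | _ = ⊥-elim (ℕₚ.<-irrefl refl lt)
        ... | no _ | yes l = ⊥-elim (ℕₚ.<-asym l lt)
        ... | no _ | no _ = refl
      W⁻ (call p r _ t t′) q h with any⁻ _ en h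
      ... | q₁ , _ , h₁ with any⁻ (λ q₂ → any (λ x → any (λ y → ⌊ dec (dc (c (ℓ p) x) q₁ (c (ℓ r) y) q₂) q ⌋) bools) bools ∧ (W ℓ t q₁ ∧ W ℓ t′ q₂)) en h₁
      ...   | q₂ , _ , h₂ with ∧⁻ {any (λ x → any (λ y → ⌊ dec (dc (c (ℓ p) x) q₁ (c (ℓ r) y) q₂) q ⌋) bools) bools} {W ℓ t q₁ ∧ W ℓ t′ q₂} h₂
      ...     | h₂′ , h₂″ with any⁻ (λ x → any (λ y → ⌊ dec (dc (c (ℓ p) x) q₁ (c (ℓ r) y) q₂) q ⌋) bools) bools h₂′ | ∧⁻ {W ℓ t q₁} h₂″
      ...     | x , _ , h₃ | hX , hY with any⁻ (λ y → ⌊ dec (dc (c (ℓ p) x) q₁ (c (ℓ r) y) q₂) q ⌋) bools h₃ | W⁻ t q₁ hX | W⁻ t′ q₂ hY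
      ...       | y , _ , h₄ | X , e | Y , e′ = glue p r x y X Y , trans (dc-cong (cong (c (ℓ p)) (glue-p p r x y X Y))
                    (trans (run-cong t λ {k} m → cong (c (ℓ k)) (glue-in p r x y X Y k (after t m) (inside t m))) e)
                    (cong (c (ℓ r)) (glue-r p r x y X Y (call-< t)))
                    (trans (run-cong t′ λ {k} m → cong (c (ℓ k)) (glue-out p r x y X Y k (call-< t) (after t′ m))) e′))
                  (⌊⌋-true⁻ (dec _ q) h₄)
        where
        dc-cong : ∀ {a a′ x x′ b b′ y y′} → a ≡ a′ → x ≡ x′ → b ≡ b′ → y ≡ y′ → dc a x b y ≡ dc a′ x′ b′ y′
        dc-cong refl refl refl refl = refl

      weight-any : ∀ {i j : Fin (suc n)} (t : Nest i j) → weight ℓ t ≡ any (λ X → acc (run (lab′ (V.lookup X)) t)) (allVecs bools n)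
      weight-any t = bool-ext to back
        where
        to : weight ℓ t ≡ true → any (λ X → acc (run (lab′ (V.lookup X)) t)) (allVecs bools n) ≡ true
        to h = let (q , _ , h′) = any⁻ _ en h ; (a , b) = ∧⁻ h′ ; (X , e) = W⁻ t q b in
          any⁺ (FT.mem (ft-Vec ft-Bool n) (V.tabulate X)) (trans (cong acc (trans
            (run-cong t λ {k} _ → cong (c (ℓ k)) (Vecₚ.lookup∘tabulate X k)) e)) a)
        back : any (λ X → acc (run (lab′ (V.lookup X)) t)) (allVecs bools n) ≡ true → weight ℓ t ≡ true
        back h = let (X , _ , h′) = any⁻ _ (allVecs bools n) h in
          any⁺ (∈-en _) (cong₂ _∧_ h′ (W⁺ t (V.lookup X)))

  module Atoms {A : Set} (P R : A → Bool) where
    some : Alg A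
    some = record { ft = ft-Bool ; e = false ; di = λ a q → P a ∨ q ; dc = λ a q b q′ → P a ∨ (q ∨ (P b ∨ q′)) }

    linked : Alg A
    linked = record { ft = ft-Bool ; e = false ; di = λ a q → q ; dc = λ a q b q′ → (P a ∧ R b) ∨ (q ∨ q′) }

    -- The three Booleans tell whether P occurs, whether R occurs, and whether some P stands at or
    -- before some R; `⊙` computes them for a concatenation.
    letter : A → Bool × Bool × Bool → Bool × Bool × Bool
    letter a (x , y , o) = P a ∨ x , R a ∨ y , (P a ∧ (R a ∨ y)) ∨ o

    _⊙_ : Bool × Bool × Bool → Bool × Bool × Bool → Bool × Bool × Bool
    (x , y , o) ⊙ (x′ , y′ , o′) = x ∨ x′ , y ∨ y′ , o ∨ (o′ ∨ (x ∧ y′))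

    ordered : Alg A
    ordered = record { ft = ft-× ft-Bool (ft-× ft-Bool ft-Bool) ; e = false , false , false
                     ; di = letter ; dc = λ a s b s′ → letter a (s ⊙ letter b s′) }

    module _ {n : ℕ} (ℓ : Fin n → A) where
      run-some : ∀ {i j : Fin (suc n)} (t : Nest i j) → Alg.run some ℓ t ≡ any (P ∘ ℓ) (positions t)
      run-some (nil _) = refl
      run-some (int p _ t) = cong (P (ℓ p) ∨_) (run-some t)
      run-some (call p r _ t t′) = cong (P (ℓ p) ∨_) (trans (cong₂ (λ x y → x ∨ (P (ℓ r) ∨ y)) (run-some t) (run-some t′))
        (sym (any-++ (P ∘ ℓ) (positions t) (r ∷ positions t′))))

      run-linked : ∀ {i j : Fin (suc n)} (t : Nest i j) → Alg.run linked ℓ t ≡ any (λ (p , r) → P (ℓ p) ∧ R (ℓ r)) (arcs t)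
      run-linked (nil _) = refl
      run-linked (int p _ t) = run-linked t
      run-linked (call p r _ t t′) = cong ((P (ℓ p) ∧ R (ℓ r)) ∨_) (trans (cong₂ _∨_ (run-linked t) (run-linked t′))
        (sym (any-++ (λ (p , r) → P (ℓ p) ∧ R (ℓ r)) (arcs t) (arcs t′))))

      leq : List (Fin n) → Bool
      leq [] = false
      leq (k ∷ ks) = (P (ℓ k) ∧ any (R ∘ ℓ) (k ∷ ks)) ∨ leq ks

      private
        bool-lemma : ∀ p r rx ry ox oy px → (p ∧ (r ∨ (rx ∨ ry))) ∨ (ox ∨ (oy ∨ (px ∧ ry))) ≡ ((p ∧ (r ∨ rx)) ∨ ox) ∨ (oy ∨ ((p ∨ px) ∧ ry))
        bool-lemma false r rx ry ox oy px = refl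
        bool-lemma true true rx ry ox oy px = refl
        bool-lemma true false true ry ox oy px = refl
        bool-lemma true false false true true oy px = refl
        bool-lemma true false false true false true px = refl
        bool-lemma true false false true false false px = refl
        bool-lemma true false false false true oy px = refl
        bool-lemma true false false false false oy true = refl
        bool-lemma true false false false false oy false = refl

        leq-++ : ∀ xs ys → leq (xs ++ ys) ≡ leq xs ∨ (leq ys ∨ (any (P ∘ ℓ) xs ∧ any (R ∘ ℓ) ys))
        leq-++ [] ys = sym (Boolₚ.∨-identityʳ _)
        leq-++ (x ∷ xs) ys = trans (cong₂ (λ u v → (P (ℓ x) ∧ (R (ℓ x) ∨ u)) ∨ v) (any-++ (R ∘ ℓ) xs ys) (leq-++ xs ys))
          (bool-lemma (P (ℓ x)) (R (ℓ x)) _ _ _ _ _)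

        summary : List (Fin n) → Bool × Bool × Bool
        summary ps = any (P ∘ ℓ) ps , any (R ∘ ℓ) ps , leq ps

        summary-++ : ∀ xs ys → summary (xs ++ ys) ≡ summary xs ⊙ summary ys
        summary-++ xs ys = cong₂ _,_ (any-++ (P ∘ ℓ) xs ys) (cong₂ _,_ (any-++ (R ∘ ℓ) xs ys) (leq-++ xs ys))

      run-ordered : ∀ {i j : Fin (suc n)} (t : Nest i j) → Alg.run ordered ℓ t ≡ summary (positions t)
      run-ordered (nil _) = refl
      run-ordered (int p _ t) rewrite run-ordered t = refl
      run-ordered (call p r _ t t′) rewrite run-ordered t | run-ordered t′ = cong (letter (ℓ p)) (sym (summary-++ (positions t) (r ∷ positions t′)))

      Ascending : List (Fin n) → Set
      Ascending = AllPairs λ a b → toℕ a ℕ.< toℕ b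

      leq⁻ : ∀ {ks} → Ascending ks → leq ks ≡ true → ∃ λ a → ∃ λ b → P (ℓ a) ≡ true × R (ℓ b) ≡ true × toℕ a ℕ.≤ toℕ b
      leq⁻ {k ∷ ks} (a ∷ as) h with ∨⁻ {P (ℓ k) ∧ any (R ∘ ℓ) (k ∷ ks)} h
      ... | inj₂ h′ = leq⁻ as h′
      ... | inj₁ h′ with ∧⁻ {P (ℓ k)} h′
      ...   | pk , h″ with any⁻ (R ∘ ℓ) (k ∷ ks) h″
      ...     | b , here refl , rb = k , b , pk , rb , ℕₚ.≤-refl
      ...     | b , there l , rb = k , b , pk , rb , ℕₚ.<⇒≤ (All.lookup a l)

      leq⁺ : ∀ {ks} → Ascending ks → ∀ {a b} → a ∈ ks → b ∈ ks → P (ℓ a) ≡ true → R (ℓ b) ≡ true → toℕ a ℕ.≤ toℕ b → leq ks ≡ true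
      leq⁺ {k ∷ ks} (_ ∷ as) {b = b} (here refl) l pa rb a≤b = cong (_∨ leq ks) (∧⁺ {P (ℓ k)} {any (R ∘ ℓ) (k ∷ ks)} pa (any⁺ {f = R ∘ ℓ} l rb))
      leq⁺ (al ∷ as) (there k) (here refl) pa rb a≤b = ⊥-elim (ℕₚ.<⇒≱ (All.lookup al k) a≤b)
      leq⁺ {k ∷ ks} (_ ∷ as) (there l) (there l′) pa rb a≤b = trans (cong (P (ℓ k) ∧ any (R ∘ ℓ) (k ∷ ks) ∨_) (leq⁺ as l l′ pa rb a≤b)) (Boolₚ.∨-zeroʳ _)

  any-at : ∀ {n} (i : Fin n) (f : Fin n → Bool) → any (λ k → ⌊ i ≟ k ⌋ ∧ f k) (allFin n) ≡ f i
  any-at {n} i f = bool-ext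
    (λ h → let (k , _ , h′) = any⁻ _ (allFin n) h ; (a , b) = ∧⁻ h′ in trans (cong f (⌊⌋-true⁻ (i ≟ k) a)) b)
    (λ h → any⁺ {f = λ k → ⌊ i ≟ k ⌋ ∧ f k} (allFin-mem i) (cong₂ _∧_ (⌊⌋-true (i ≟ i) refl) h))

  Letter : ℕ → ℕ → Set
  Letter f s = Fin m × Vec Bool f × Vec Bool s

  add₁ : ∀ {f s} → Letter f s → Bool → Letter (suc f) s
  add₁ (a , x , y) b = a , b ∷ x , y

  add₂ : ∀ {f s} → Letter f s → Bool → Letter f (suc s)
  add₂ (a , x , y) b = a , x , b ∷ y

  module _ (nw : NestedWord K m) where
    open Semantics nw
    mark : ∀ {f s} → Env₁ f → Env₂ s → Fin n → Letter f s
    mark ρ σ k = lookup (NestedWord.word nw) k , V.tabulate (λ x → ⌊ ρ x ≟ k ⌋) , V.tabulate (λ X → V.lookup (σ X) k)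

    ForestOf : Set
    ForestOf = Σ (Nest zero (fromℕ n)) (Fits (rel (NestedWord.nest nw)))

  -- Only the labellings `mark nw ρ σ` matter, in which each first-order variable marks exactly one
  -- position; on other labellings the algebra may answer anything.
  record Recognizes {f s} (φ : MSO′ f s) : Set₁ where
    field
      alg : Alg (Letter f s)
      acc : Alg.Q alg → Bool
      correct : ∀ nw ((t , _) : ForestOf nw) ρ σ → acc (Alg.run alg (mark nw ρ σ) t) ≡ Semantics.sat nw φ ρ σ

  private
    module _ {f s : ℕ} where
      fo : Fin f → Letter f s → Bool
      fo x (_ , v , _) = V.lookup v x

      so : Fin s → Letter f s → Bool
      so X (_ , _ , v) = V.lookup v X

      is : Fin m → Letter f s → Bool
      is a (b , _) = ⌊ a ≟ b ⌋

      module _ (nw : NestedWord K m) (ρ : Semantics.Env₁ nw f) (σ : Semantics.Env₂ nw s) where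
        open Semantics nw

        fo-mark : ∀ x k → fo x (mark nw ρ σ k) ≡ ⌊ ρ x ≟ k ⌋
        fo-mark x k = Vecₚ.lookup∘tabulate _ x

        so-mark : ∀ X k → so X (mark nw ρ σ k) ≡ V.lookup (σ X) k
        so-mark X k = Vecₚ.lookup∘tabulate (λ X → V.lookup (σ X) k) X

        some-at : ∀ {P : Letter f s → Bool} x (g : Fin n → Bool) → (∀ k → P (mark nw ρ σ k) ≡ g k) → (t : Nest zero (fromℕ n)) →
          Alg.run (Atoms.some (λ a → fo x a ∧ P a) (λ _ → true)) (mark nw ρ σ) t ≡ g (ρ x)
        some-at {P} x g h t = trans (Atoms.run-some _ (λ _ → true) (mark nw ρ σ) t) (trans (any-full t _)
          (trans (any-cong (allFin n) λ k → cong₂ _∧_ (fo-mark x k) (h k)) (any-at (ρ x) g)))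

  recognize-atom : ∀ {f s} (α : Atom K m f s) → Recognizes (atom α)
  recognize-atom (eq x y) = record { alg = Atoms.some (λ a → fo x a ∧ fo y a) (λ _ → true) ; acc = λ q → q
    ; correct = λ nw (t , _) ρ σ → trans (some-at nw ρ σ x (λ k → ⌊ ρ y ≟ k ⌋) (fo-mark nw ρ σ y) t)
        (bool-ext (λ h → ⌊⌋-true (ρ x ≟ ρ y) (sym (⌊⌋-true⁻ (ρ y ≟ ρ x) h))) (λ h → ⌊⌋-true (ρ y ≟ ρ x) (sym (⌊⌋-true⁻ (ρ x ≟ ρ y) h)))) }
  recognize-atom (lab a x) = record { alg = Atoms.some (λ b → fo x b ∧ is a b) (λ _ → true) ; acc = λ q → q
    ; correct = λ nw (t , _) ρ σ → some-at nw ρ σ x (λ k → ⌊ a ≟ lookup (NestedWord.word nw) k ⌋) (λ _ → refl) t }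
  recognize-atom (mem x X) = record { alg = Atoms.some (λ b → fo x b ∧ so X b) (λ _ → true) ; acc = λ q → q
    ; correct = λ nw (t , _) ρ σ → some-at nw ρ σ x (V.lookup (σ X)) (so-mark nw ρ σ X) t }
  recognize-atom (le x y) = record { alg = Atoms.ordered (fo x) (fo y) ; acc = λ (_ , _ , o) → o
    ; correct = λ nw (t , _) ρ σ → let open Semantics nw in let open Atoms (fo x) (fo y) ; ℓ = mark nw ρ σ in
        trans (cong (λ (_ , _ , o) → o) (run-ordered ℓ t)) (trans (cong (leq ℓ) (positions-full t)) (bool-ext
          (λ h → let (a , b , pa , rb , a≤b) = leq⁻ ℓ (allFin-ascending n) h in ⌊⌋-true (ρ x ≤? ρ y) (subst₂ (λ u v → toℕ u ℕ.≤ toℕ v)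
             (sym (⌊⌋-true⁻ (ρ x ≟ a) (trans (sym (fo-mark nw ρ σ x a)) pa))) (sym (⌊⌋-true⁻ (ρ y ≟ b) (trans (sym (fo-mark nw ρ σ y b)) rb))) a≤b))
          (λ h → leq⁺ ℓ (allFin-ascending n) (allFin-mem (ρ x)) (allFin-mem (ρ y)) (trans (fo-mark nw ρ σ x (ρ x)) (⌊⌋-true (ρ x ≟ ρ x) refl))
             (trans (fo-mark nw ρ σ y (ρ y)) (⌊⌋-true (ρ y ≟ ρ y) refl)) (⌊⌋-true⁻ (ρ x ≤? ρ y) h)))) }
  recognize-atom (nu x y) = record { alg = Atoms.linked (fo x) (fo y) ; acc = λ q → q
    ; correct = λ nw (t , f) ρ σ → let ν = rel (NestedWord.nest nw) in
        trans (Atoms.run-linked (fo x) (fo y) (mark nw ρ σ) t) (bool-ext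
          (λ h → let ((p , r) , k , h′) = any⁻ _ (arcs t) h ; (a , b) = ∧⁻ h′ in
            trans (cong₂ ν (⌊⌋-true⁻ (ρ x ≟ p) (trans (sym (fo-mark nw ρ σ x p)) a)) (⌊⌋-true⁻ (ρ y ≟ r) (trans (sym (fo-mark nw ρ σ y r)) b)))
              (trans (Fits-determines-relation t f (Fits-arc t) p r) (∈-arc t k)))
          (λ h → any⁺ (arc-∈ t (trans (Fits-determines-relation t (Fits-arc t) f (ρ x) (ρ y)) h)) (cong₂ _∧_
            (trans (fo-mark nw ρ σ x (ρ x)) (⌊⌋-true (ρ x ≟ ρ x) refl)) (trans (fo-mark nw ρ σ y (ρ y)) (⌊⌋-true (ρ y ≟ ρ y) refl))))) }

  recognize : ∀ {f s} (φ : MSO′ f s) → Recognizes φ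
  recognize (atom α) = recognize-atom α
  recognize (¬ᶜ φ) = record { alg = alg ; acc = not ∘ acc ; correct = λ nw t ρ σ → cong not (correct nw t ρ σ) }
    where open Recognizes (recognize φ)
  recognize (φ ∨ᶜ ψ) = record { alg = Φ.alg ⊠ Ψ.alg ; acc = λ (x , y) → Φ.acc x ∨ Ψ.acc y
    ; correct = λ nw (t , f) ρ σ → trans (cong (λ (x , y) → Φ.acc x ∨ Ψ.acc y) (run-⊠ Φ.alg Ψ.alg (mark nw ρ σ) t))
        (cong₂ _∨_ (Φ.correct nw (t , f) ρ σ) (Ψ.correct nw (t , f) ρ σ)) }
    where module Φ = Recognizes (recognize φ)
          module Ψ = Recognizes (recognize ψ)
  recognize (∃₁ φ) = record { alg = alg ; acc = accept
    ; correct = λ nw (t , f) ρ σ → let open Semantics nw ; ℓ = mark nw ρ σ in trans (accept-weight ℓ t) (trans (S.weight-∑ ℓ t)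
        (trans (any-full t _) (any-cong (allFin n) λ k →
          trans (D.weight-run (Marked.ℓ₁ add₁ ℓ k) t) (Φ.correct nw (t , f) (ext k ρ) σ)))) }
    where module Φ = Recognizes (recognize φ)
          module D = 𝔹.Det Φ.alg Φ.acc
          module S = 𝔹.SumMarks add₁ D.wta
          open Determinize S.wta
  recognize (∃₂ φ) = record { alg = alg ; acc = accept
    ; correct = λ nw (t , f) ρ σ → let open Semantics nw ; ℓ = mark nw ρ σ in trans (accept-weight ℓ t) (trans (P.weight-any ℓ t)
        (any-cong (allVecs bools n) λ X → Φ.correct nw (t , f) ρ (ext X σ))) }
    where module Φ = Recognizes (recognize φ)
          module P = Project add₂ Φ.alg Φ.acc
          open Determinize P.wta

  -- A recognizable step function: a weight that depends only on the value of the tree in a finite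
  -- algebra. The formulas of `aUMSO` have this form, and `ProductMarks` turns the product of such
  -- functions over all positions into an automaton.
  record Step {f s} (φ : WF′ f s) : Set (lsuc 0ℓ ⊔ c ⊔ ℓ) where
    field
      alg : Alg (Letter f s)
      value : Alg.Q alg → C
      correct : ∀ nw ((t , _) : ForestOf nw) ρ σ → Semantics.⟦_⟧ nw φ ρ σ ≈ value (Alg.run alg (mark nw ρ σ) t)

  trivial : ∀ {A} → Alg A
  trivial = record { ft = ft-Fin 1 ; e = zero ; di = λ _ _ → zero ; dc = λ _ _ _ _ → zero }

  step : ∀ {f s} {φ : WF′ f s} → aUMSO K m φ → Step φ
  step (const k) = record { alg = trivial ; value = λ _ → k ; correct = λ _ _ _ _ → ≈-refl }
  step (su (ψ , inj₁ refl)) = record { alg = alg ; value = 𝟙 ∘ acc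
    ; correct = λ nw t ρ σ → ≈-trans (proj₁ (Semantics.pm-sem nw ψ ρ σ)) (reflexive (cong 𝟙 (sym (correct nw t ρ σ)))) }
    where open Recognizes (recognize ψ)
  step (su (ψ , inj₂ refl)) = record { alg = alg ; value = 𝟙 ∘ not ∘ acc
    ; correct = λ nw t ρ σ → ≈-trans (proj₂ (Semantics.pm-sem nw ψ ρ σ)) (reflexive (cong (𝟙 ∘ not) (sym (correct nw t ρ σ)))) }
    where open Recognizes (recognize ψ)
  step (a ∧ᵘ b) = record { alg = Φ.alg ⊠ Ψ.alg ; value = λ (x , y) → Φ.value x * Ψ.value y
    ; correct = λ nw t ρ σ → ≈-trans (*-cong (Φ.correct nw t ρ σ) (Ψ.correct nw t ρ σ))
        (reflexive (cong (λ (x , y) → Φ.value x * Ψ.value y) (sym (run-⊠ Φ.alg Ψ.alg (mark nw ρ σ) (proj₁ t))))) }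
    where module Φ = Step (step a)
          module Ψ = Step (step b)
  step (a ∨ᵘ b) = record { alg = Φ.alg ⊠ Ψ.alg ; value = λ (x , y) → Φ.value x + Ψ.value y
    ; correct = λ nw t ρ σ → ≈-trans (+-cong (Φ.correct nw t ρ σ) (Ψ.correct nw t ρ σ))
        (reflexive (cong (λ (x , y) → Φ.value x + Ψ.value y) (sym (run-⊠ Φ.alg Ψ.alg (mark nw ρ σ) (proj₁ t))))) }
    where module Φ = Step (step a)
          module Ψ = Step (step b)

  record Weighted {f s} (φ : WF′ f s) : Set (lsuc 0ℓ ⊔ c ⊔ ℓ) where
    field
      wta : WTA (Letter f s)
      correct : ∀ nw ((t , _) : ForestOf nw) ρ σ → Semantics.⟦_⟧ nw φ ρ σ ≈ WTA.weight wta (mark nw ρ σ) t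

  open Closure K

  step⇒weighted : ∀ {f s} {φ : WF′ f s} → Step φ → Weighted φ
  step⇒weighted S = record { wta = D.wta ; correct = λ nw t ρ σ → ≈-trans (correct nw t ρ σ) (≈-sym (D.weight-run (mark nw ρ σ) (proj₁ t))) }
    where open Step S
          module D = Det alg value

  weighted : ∀ {f s} {φ : WF′ f s} → sRFO K m φ → Weighted φ
  weighted (const k) = step⇒weighted (step (const k))
  weighted (atom α) = step⇒weighted (step (su (atom α , inj₁ refl)))
  weighted (natom α) = step⇒weighted (step (su (atom α , inj₂ refl)))
  weighted (a ∨ʳ b) = record { wta = P.wta ; correct = λ nw t ρ σ → ≈-trans (+-cong (Φ.correct nw t ρ σ) (Ψ.correct nw t ρ σ))
      (≈-sym (P.weight-+ (mark nw ρ σ) (proj₁ t))) }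
    where module Φ = Weighted (weighted a)
          module Ψ = Weighted (weighted b)
          module P = Plus Φ.wta Ψ.wta
  weighted (a ∧ʳ b) = record { wta = P.wta ; correct = λ nw t ρ σ → ≈-trans (*-cong (Φ.correct nw t ρ σ) (Ψ.correct nw t ρ σ))
      (≈-sym (P.weight-* (mark nw ρ σ) (proj₁ t))) }
    where module Φ = Weighted (weighted a)
          module Ψ = Weighted (weighted b)
          module P = Times Φ.wta Ψ.wta
  weighted (∃₁ a) = record { wta = S.wta ; correct = λ nw t ρ σ → let open Semantics nw in
      ≈-trans (∑-cong (allFin n) λ k → Φ.correct nw t (ext k ρ) σ) (≈-sym (≈-trans (S.weight-∑ (mark nw ρ σ) (proj₁ t))
        (∑-full (proj₁ t) _))) }
    where module Φ = Weighted (weighted a)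
          module S = SumMarks add₁ Φ.wta
  weighted (∀₁ u a) = record { wta = P.wta ; correct = λ nw t ρ σ → let open Semantics nw in
      ≈-trans (∏-cong (allFin n) λ k → Φ.correct nw t (ext k ρ) σ) (≈-sym (≈-trans (P.weight-∏ (mark nw ρ σ) (proj₁ t))
        (∏-full (proj₁ t) _))) }
    where module Φ = Step (step u)
          module P = ProductMarks add₁ Φ.alg Φ.value

  relabel : ∀ {A B} → (A → B) → WTA B → WTA A
  relabel g 𝒜 = record { ft = ft ; ι = ι ; e = e ; wi = λ q a → wi q (g a) ; wc = λ q a q₁ b → wc q (g a) q₁ (g b) }
    where open WTA 𝒜

  weight-relabel : ∀ {A B} (g : A → B) (𝒜 : WTA B) {n} (ℓ : Fin n → A) {i j : Fin (suc n)} (t : Nest i j) → WTA.weight (relabel g 𝒜) ℓ t ≈ WTA.weight 𝒜 (g ∘ ℓ) t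
  weight-relabel g 𝒜 ℓ t = ∑-cong en λ q → *-congˡ (go t q)
    where
    open WTA 𝒜
    go : ∀ {i j} (t : Nest i j) q → WTA.W (relabel g 𝒜) ℓ t q ≈ W (g ∘ ℓ) t q
    go (nil _) q = ≈-refl
    go (int p _ t) q = ∑-cong en λ q′ → *-congˡ (go t q′)
    go (call p r _ t t′) q = ∑-cong en λ q₁ → ∑-cong en λ q₂ → *-congˡ (*-cong (go t q₁) (go t′ q₂))

  Cond3⇒weight : ∀ S → Cond3 K m S → Σ (WTA (Fin m)) λ 𝒜 → S [] ≈ 0# × (∀ a w → S (a ∷ w) ≈ ∑ᵗ zero (fromℕ (suc (length w))) (WTA.weight 𝒜 (lookup (a ∷ w))))
  Cond3⇒weight S (φ , φ-sRFO , eS) = relabel (λ a → a , [] , []) wta , ≈-sym (eS []) , λ a w →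
    ≈-trans (≈-sym (eS (a ∷ w))) (≈-trans (∑-nestings semiring λ M p → Semantics.⟦_⟧ (mkNW (a ∷ w) tt M p) φ (λ ()) (λ ()))
      (∑-cong (nests (suc (length w)) zero (fromℕ _)) λ t → ≈-trans
        (correct (mkNW (a ∷ w) tt (toRel t) (toRel-isNest t)) (t , Fits-toRel t) (λ ()) (λ ()))
        (≈-sym (weight-relabel (λ a → a , [] , []) wta (lookup (a ∷ w)) t))))
    where open Weighted (weighted φ-sRFO)

-- A first-order formula that weighs a nesting arc by arc.

module Definable {c ℓ} (K : CommutativeSemiring c ℓ) (m : ℕ) where
  open import Data.Nat using (s≤s; z≤n)

  open import Data.Bool using (if_then_else_)
  open import Data.Fin using (_≟_; _≤?_)
  import Data.Fin as F
  open import Data.List using (map; length; lookup)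
  open import Data.List.Membership.Propositional.Properties using (∈-++⁻)
  open import Data.List.Relation.Unary.All using (All; []; _∷_)
  open import Data.List.Relation.Unary.AllPairs using ([]; _∷_)
  import Data.Sum
  open import Function using (id)
  open import Relation.Binary.PropositionalEquality using (refl; cong; cong₂; sym; trans; subst)
  open import Defs using (allFin; rel; NestedWord; mkNW; Atom; eq; lab; le; nu; mem; atom; natom; const; ¬ᶜ; _∨ᶜ_; ∃₁; ∃₂; ∀₁; _∨ʷ_; _∧ʷ_; aUMSO; sRFO; su; _∧ᵘ_; _∨ᵘ_; _∨ʳ_; _∧ʳ_; _⁺; _⁻; ∀₂; Cond3)
  open Booleans using (absurd; bool-ext; ⌊⌋-true; ⌊⌋-false; ⌊⌋-true⁻; any⁺; any⁻)
  open FiniteSum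
  open Tree
  open Nesting
  open TreeAlgebra
  open Logic K m

  open CommutativeSemiring K hiding (zero) renaming (Carrier to C; refl to ≈-refl; sym to ≈-sym; trans to ≈-trans)
  open Sums semiring
  open FiniteSum.Fold *-commutativeMonoid using () renaming (fold to ∏; fold-++ to ∏-++; fold-ε to ∏-1; fold-map to ∏-map)
  open TreeSum semiring

  -- A nesting is read as a word over items: a single internal position, an arc around nothing, or an arc around a
  -- nonempty nesting, of which only the tag is recorded.
  Item : Set
  Item = Fin m ⊎ (Fin m × Fin m) ⊎ Maybe ℕ

  pattern letter′ a = inj₁ a
  pattern mark a b = inj₂ (inj₁ (a , b))
  pattern hole i = inj₂ (inj₂ i)

  Hedge : Set
  Hedge = List Item

  -- The number of letters before the first empty arc, defined only if nothing but letters precedes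
  -- that arc. It serves as the name of a variable.
  tag : Hedge → Maybe ℕ
  tag [] = nothing
  tag (letter′ _ ∷ ν) = Maybe.map suc (tag ν)
  tag (mark _ _ ∷ _) = just 0
  tag (hole _ ∷ _) = nothing

  -- A nonempty arc appears in the surrounding word by its tag alone: its end letters and its
  -- contents are accounted for by its own price.
  enclose : Fin m → Hedge → Fin m → Item
  enclose a [] b = mark a b
  enclose a (i ∷ ν) b = hole (tag (i ∷ ν))

  infix 4 _≟ᴴ_
  _≟ᴴ_ : (μ ν : Hedge) → Dec (μ ≡ ν)
  _≟ᴴ_ = Listₚ.≡-dec (Sumₚ.≡-dec _≟_ (Sumₚ.≡-dec (Prodₚ.≡-dec _≟_ _≟_) (Maybeₚ.≡-dec ℕ._≟_)))

  hedge : ∀ {n} (letter : Fin n → Fin m) {i j : Fin (suc n)} → Nest i j → Hedge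
  hedge letter (nil _) = []
  hedge letter (int p _ t) = letter′ (letter p) ∷ hedge letter t
  hedge letter (call p q _ t t′) = enclose (letter p) (hedge letter t) (letter q) ∷ hedge letter t′

  Entry : Set c
  Entry = C × Fin m × Hedge × Fin m

  module Weight (entries : List Entry) (root : List (C × Hedge)) where
    -- An empty arc is only a mark and costs nothing. At a nonempty one all matching entries are
    -- added up, so that different derivation steps with the same appearance are summed at the arc
    -- itself.
    price : Fin m → Hedge → Fin m → C
    price a [] b = 1#
    price a ν@(_ ∷ _) b = ∑ entries λ (x , a′ , μ , b′) → ([ a′ ≟ a ] * ([ μ ≟ᴴ ν ] * [ b′ ≟ b ])) * x

    final : Hedge → C
    final ν = ∑ root λ (x , μ) → [ μ ≟ᴴ ν ] * x

    weight : ∀ {n} (letter : Fin n → Fin m) {i j : Fin (suc n)} → Nest i j → C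
    weight letter (nil _) = 1#
    weight letter (int p _ t) = weight letter t
    weight letter (call p q _ t t′) = price (letter p) (hedge letter t) (letter q) * (weight letter t * weight letter t′)

  -- The guard of (∃x.ψ)⁺ renames the variables of ψ⁻, so the induction is over all renamings of a formula at once.
  module SetFree where
    rename : ∀ {f f′ s s′} → (Fin f → Fin f′) → (Fin s → Fin s′) → MSO′ f s → MSO′ f′ s′
    rename a b (atom α) = atom (Defs.renAtom K m a b α)
    rename a b (¬ᶜ φ) = ¬ᶜ (rename a b φ)
    rename a b (φ ∨ᶜ ψ) = rename a b φ ∨ᶜ rename a b ψ
    rename a b (∃₁ φ) = ∃₁ (rename (Defs.lift K m a) b φ)
    rename a b (∃₂ φ) = ∃₂ (rename a (Defs.lift K m b) φ)

    Free : ∀ {f s} → MSO′ f s → Set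
    Free (atom α) = ⊤
    Free (¬ᶜ φ) = Free φ
    Free (φ ∨ᶜ ψ) = Free φ × Free ψ
    Free (∃₁ φ) = Free φ
    Free (∃₂ φ) = ⊥

    private
      ren = Defs.ren K m
      lift : ∀ {k k′} → (Fin k → Fin k′) → Fin (suc k) → Fin (suc k′)
      lift = Defs.lift K m

      lift-cong : ∀ {k k′} {a b : Fin k → Fin k′} → (∀ x → a x ≡ b x) → ∀ x → lift a x ≡ lift b x
      lift-cong e zero = refl
      lift-cong e (suc x) = cong suc (e x)

      lift-∘ : ∀ {k k′ k″} (a : Fin k′ → Fin k″) (b : Fin k → Fin k′) x → lift a (lift b x) ≡ lift (a ∘ b) x
      lift-∘ a b zero = refl
      lift-∘ a b (suc x) = refl

      renAtom-cong : ∀ {f f′ s s′} (α : Atom K m f s) {a a′ : Fin f → Fin f′} {b b′ : Fin s → Fin s′} → (∀ x → a x ≡ a′ x) → (∀ x → b x ≡ b′ x) →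
        Defs.renAtom K m a b α ≡ Defs.renAtom K m a′ b′ α
      renAtom-cong (eq x y) e h = cong₂ eq (e x) (e y)
      renAtom-cong (lab d x) e h = cong (lab d) (e x)
      renAtom-cong (le x y) e h = cong₂ le (e x) (e y)
      renAtom-cong (nu x y) e h = cong₂ nu (e x) (e y)
      renAtom-cong (mem x X) e h = cong₂ mem (e x) (h X)

      ren-cong : ∀ {f f′ s s′} (φ : WF′ f s) {a a′ : Fin f → Fin f′} {b b′ : Fin s → Fin s′} → (∀ x → a x ≡ a′ x) → (∀ x → b x ≡ b′ x) → ren a b φ ≡ ren a′ b′ φ
      ren-cong (const k) e h = refl
      ren-cong (atom α) e h = cong atom (renAtom-cong α e h)
      ren-cong (natom α) e h = cong natom (renAtom-cong α e h)
      ren-cong (φ ∨ʷ ψ) e h = cong₂ _∨ʷ_ (ren-cong φ e h) (ren-cong ψ e h)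
      ren-cong (φ ∧ʷ ψ) e h = cong₂ _∧ʷ_ (ren-cong φ e h) (ren-cong ψ e h)
      ren-cong (∃₁ φ) e h = cong ∃₁ (ren-cong φ (lift-cong e) h)
      ren-cong (∃₂ φ) e h = cong ∃₂ (ren-cong φ e (lift-cong h))
      ren-cong (∀₁ φ) e h = cong ∀₁ (ren-cong φ (lift-cong e) h)
      ren-cong (∀₂ φ) e h = cong ∀₂ (ren-cong φ e (lift-cong h))

      renAtom-∘ : ∀ {f f′ f″ s s′ s″} (α : Atom K m f s) {a : Fin f′ → Fin f″} {a′ : Fin f → Fin f′} {b : Fin s′ → Fin s″} {b′ : Fin s → Fin s′} →
        Defs.renAtom K m a b (Defs.renAtom K m a′ b′ α) ≡ Defs.renAtom K m (a ∘ a′) (b ∘ b′) α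
      renAtom-∘ (eq x y) = refl
      renAtom-∘ (lab d x) = refl
      renAtom-∘ (le x y) = refl
      renAtom-∘ (nu x y) = refl
      renAtom-∘ (mem x X) = refl

      ren-∘ : ∀ {f f′ f″ s s′ s″} (φ : WF′ f s) (a : Fin f′ → Fin f″) (a′ : Fin f → Fin f′) (b : Fin s′ → Fin s″) (b′ : Fin s → Fin s′) →
        ren a b (ren a′ b′ φ) ≡ ren (a ∘ a′) (b ∘ b′) φ
      ren-∘ (const k) a a′ b b′ = refl
      ren-∘ (atom α) a a′ b b′ = cong atom (renAtom-∘ α)
      ren-∘ (natom α) a a′ b b′ = cong natom (renAtom-∘ α)
      ren-∘ (φ ∨ʷ ψ) a a′ b b′ = cong₂ _∨ʷ_ (ren-∘ φ a a′ b b′) (ren-∘ ψ a a′ b b′)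
      ren-∘ (φ ∧ʷ ψ) a a′ b b′ = cong₂ _∧ʷ_ (ren-∘ φ a a′ b b′) (ren-∘ ψ a a′ b b′)
      ren-∘ (∃₁ φ) a a′ b b′ = cong ∃₁ (trans (ren-∘ φ _ _ b b′) (ren-cong φ (lift-∘ a a′) λ _ → refl))
      ren-∘ (∃₂ φ) a a′ b b′ = cong ∃₂ (trans (ren-∘ φ a a′ _ _) (ren-cong φ (λ _ → refl) (lift-∘ b b′)))
      ren-∘ (∀₁ φ) a a′ b b′ = cong ∀₁ (trans (ren-∘ φ _ _ b b′) (ren-cong φ (lift-∘ a a′) λ _ → refl))
      ren-∘ (∀₂ φ) a a′ b b′ = cong ∀₂ (trans (ren-∘ φ a a′ _ _) (ren-cong φ (λ _ → refl) (lift-∘ b b′)))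

      shift-lift : ∀ {k k′} (a : Fin k → Fin k′) x → Defs.shiftUnder K m (lift a x) ≡ lift (lift a) (Defs.shiftUnder K m x)
      shift-lift a zero = refl
      shift-lift a (suc x) = refl

    pm-rename : ∀ {f f′ s s′} (φ : MSO′ f s) → Free φ → (a : Fin f → Fin f′) (b : Fin s → Fin s′) →
      ren a b (_⁺ K m φ) ≡ _⁺ K m (rename a b φ) × ren a b (_⁻ K m φ) ≡ _⁻ K m (rename a b φ)
    pm-rename (atom α) _ a b = refl , refl
    pm-rename (¬ᶜ φ) φf a b = let (p , q) = pm-rename φ φf a b in q , p
    pm-rename (φ ∨ᶜ ψ) (φf , ψf) a b = let (p , q) = pm-rename φ φf a b ; (p′ , q′) = pm-rename ψ ψf a b in
      cong₂ _∨ʷ_ p (cong₂ _∧ʷ_ q p′) , cong₂ _∧ʷ_ q q′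
    pm-rename (∃₁ φ) φf a b = let (p , q) = pm-rename φ φf (lift a) b in
      cong₂ (λ u v → ∃₁ (u ∧ʷ ∀₁ (atom (le (suc zero) zero) ∨ʷ (natom (le (suc zero) zero) ∧ʷ v)))) p
        (trans (ren-∘ (_⁻ K m φ) (lift (lift a)) (Defs.shiftUnder K m) b id) (trans (ren-cong (_⁻ K m φ) (λ x → sym (shift-lift a x)) λ _ → refl)
          (trans (sym (ren-∘ (_⁻ K m φ) (Defs.shiftUnder K m) (lift a) id b)) (cong (ren (Defs.shiftUnder K m) id) q)))) , cong ∀₁ q

    private
      sRFO-ren : ∀ {f f′ s s′} (φ : MSO′ f s) → Free φ → (a : Fin f → Fin f′) (b : Fin s → Fin s′) →
        sRFO K m (_⁺ K m (rename a b φ)) × sRFO K m (_⁻ K m (rename a b φ))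

      sRFO-ren (atom α) _ a b = atom _ , natom _
      sRFO-ren (¬ᶜ φ) h a b = let (p , q) = sRFO-ren φ h a b in q , p
      sRFO-ren (φ ∨ᶜ ψ) (h , h′) a b = let (p , q) = sRFO-ren φ h a b ; (p′ , q′) = sRFO-ren ψ h′ a b in (p ∨ʳ (q ∧ʳ p′)) , (q ∧ʳ q′)
      sRFO-ren (∃₁ φ) h a b =
        let (p , q) = sRFO-ren φ h (lift a) b
            (_ , q′) = sRFO-ren φ h (Defs.shiftUnder K m ∘ lift a) b
            φ′ = rename (lift a) b φ
            eq′ : ren (Defs.shiftUnder K m) id (_⁻ K m φ′) ≡ _⁻ K m (rename (Defs.shiftUnder K m ∘ lift a) b φ)
            eq′ = trans (cong (ren (Defs.shiftUnder K m) id) (sym (proj₂ (pm-rename φ h (lift a) b))))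
              (trans (ren-∘ (_⁻ K m φ) (Defs.shiftUnder K m) (lift a) id b) (proj₂ (pm-rename φ h (Defs.shiftUnder K m ∘ lift a) b)))
            L = le (suc zero) zero
        in ∃₁ (p ∧ʳ ∀₁ (su (atom L , inj₁ refl) ∨ᵘ (su (atom L , inj₂ refl) ∧ᵘ su (rename (Defs.shiftUnder K m ∘ lift a) b φ , inj₂ eq′)))
               (atom L ∨ʳ (natom L ∧ʳ subst (sRFO K m) (sym eq′) q′)))
           , ∀₁ (su (φ′ , inj₂ refl)) q

      Free-id : ∀ {f s} (φ : MSO′ f s) (a : Fin f → Fin f) (b : Fin s → Fin s) → (∀ x → a x ≡ x) → (∀ x → b x ≡ x) → Free φ → rename a b φ ≡ φ
      Free-id (atom (eq x y)) a b e h _ = cong atom (cong₂ eq (e x) (e y))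
      Free-id (atom (lab d x)) a b e h _ = cong atom (cong (lab d) (e x))
      Free-id (atom (le x y)) a b e h _ = cong atom (cong₂ le (e x) (e y))
      Free-id (atom (nu x y)) a b e h _ = cong atom (cong₂ nu (e x) (e y))
      Free-id (atom (mem x X)) a b e h _ = cong atom (cong₂ mem (e x) (h X))
      Free-id (¬ᶜ φ) a b e h φf = cong ¬ᶜ (Free-id φ a b e h φf)
      Free-id (φ ∨ᶜ ψ) a b e h (φf , ψf) = cong₂ _∨ᶜ_ (Free-id φ a b e h φf) (Free-id ψ a b e h ψf)
      Free-id (∃₁ φ) a b e h φf = cong ∃₁ (Free-id φ (lift a) b (λ { zero → refl ; (suc x) → cong suc (e x) }) h φf)

    sRFO⁺ : ∀ {f s} (φ : MSO′ f s) → Free φ → sRFO K m (_⁺ K m φ)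
    sRFO⁺ φ h = subst (λ φ → sRFO K m (_⁺ K m φ)) (Free-id φ id id (λ _ → refl) (λ _ → refl) h) (proj₁ (sRFO-ren φ h id id))

  open SetFree using (Free; sRFO⁺)

  module Sat (nw : NestedWord K m) where
    open Semantics nw

    -- A record instead of a bare equation: the formula and the assignment then remain visible in
    -- the type, however far the truth value computes.
    record Sat {f s} (φ : MSO′ f s) (ρ : Env₁ f) (σ : Env₂ s) : Set where
      constructor holds
      field true! : sat φ ρ σ ≡ true
    open Sat public

    module _ {f s : ℕ} {ρ : Env₁ f} {σ : Env₂ s} where
      ¬⁺ : ∀ (φ : MSO′ f s) → ¬ Sat φ ρ σ → Sat (¬ᶜ φ) ρ σ
      ¬⁺ φ h = holds (cong not (Boolₚ.¬-not (h ∘ holds)))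

      ¬⁻ : ∀ (φ : MSO′ f s) → Sat (¬ᶜ φ) ρ σ → ¬ Sat φ ρ σ
      ¬⁻ φ (holds h) (holds e) with sat φ ρ σ
      ¬⁻ φ (holds ()) (holds refl) | true

      ∨⁺ : ∀ (φ ψ : MSO′ f s) → Sat φ ρ σ ⊎ Sat ψ ρ σ → Sat (φ ∨ᶜ ψ) ρ σ
      ∨⁺ φ ψ (inj₁ (holds e)) = holds (cong (_∨ sat ψ ρ σ) e)
      ∨⁺ φ ψ (inj₂ (holds e)) = holds (trans (cong (sat φ ρ σ ∨_) e) (Boolₚ.∨-zeroʳ _))

      ∨⁻ : ∀ (φ ψ : MSO′ f s) → Sat (φ ∨ᶜ ψ) ρ σ → Sat φ ρ σ ⊎ Sat ψ ρ σ
      ∨⁻ φ ψ (holds e) with sat φ ρ σ in eq′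
      ... | true = inj₁ (holds eq′)
      ... | false = inj₂ (holds e)

      ∧⁺ : ∀ (φ ψ : MSO′ f s) → Sat φ ρ σ → Sat ψ ρ σ → Sat (φ ∧ᶜ ψ) ρ σ
      ∧⁺ φ ψ (holds e) (holds e′) = holds (trans (sat-∧ φ ψ ρ σ) (cong₂ _∧_ e e′))

      ∧⁻ : ∀ (φ ψ : MSO′ f s) → Sat (φ ∧ᶜ ψ) ρ σ → Sat φ ρ σ × Sat ψ ρ σ
      ∧⁻ φ ψ (holds e) with sat φ ρ σ in eφ | sat ψ ρ σ in eψ
      ∧⁻ φ ψ (holds refl) | true | true = holds eφ , holds eψ

      ∃⁺ : ∀ (φ : MSO′ (suc f) s) k → Sat φ (ext k ρ) σ → Sat (∃₁ φ) ρ σ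
      ∃⁺ φ k (holds e) = holds (any⁺ {f = λ i → sat φ (ext i ρ) σ} (allFin-mem k) e)

      ∃⁻ : ∀ (φ : MSO′ (suc f) s) → Sat (∃₁ φ) ρ σ → ∃ λ k → Sat φ (ext k ρ) σ
      ∃⁻ φ (holds e) = let (k , _ , e′) = any⁻ _ (allFin n) e in k , holds e′

      false! : ∀ (φ : MSO′ f s) → ¬ Sat φ ρ σ → sat φ ρ σ ≡ false
      false! φ h = Boolₚ.¬-not (h ∘ holds)

    module _ {f s : ℕ} (ρ : Env₁ f) (σ : Env₂ s) where
      <⁺ : ∀ x y → toℕ (ρ x) ℕ.< toℕ (ρ y) → Sat (x <ᶜ y) ρ σ
      <⁺ x y lt = holds (cong not (⌊⌋-false (ρ y ≤? ρ x) (ℕₚ.<⇒≱ lt)))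

      <⁻ : ∀ x y → Sat (x <ᶜ y) ρ σ → toℕ (ρ x) ℕ.< toℕ (ρ y)
      <⁻ x y (holds e) with ρ y ≤? ρ x
      ... | no ne = ℕₚ.≰⇒> ne

  module _ {n : ℕ} (letter : Fin n → Fin m) where
    -- f assigns to each point the word of items from there to the end of the innermost arc around
    -- it; this word is empty just before a return.
    Good : (Fin (suc n) → Hedge) → ∀ {i j : Fin (suc n)} → Nest i j → Set
    Good f (nil _) = ⊤
    Good f (int p _ t) = f (inject₁ p) ≡ letter′ (letter p) ∷ f (suc p) × Good f t
    Good f (call p q _ t t′) = f (inject₁ p) ≡ enclose (letter p) (f (suc p)) (letter q) ∷ f (suc q) × f (inject₁ q) ≡ [] × Good f t × Good f t′

    Good-hedge : ∀ {f} {i j : Fin (suc n)} (t : Nest i j) → Good f t → f j ≡ [] → f i ≡ hedge letter t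
    Good-hedge (nil refl) g e = e
    Good-hedge (int p refl t) (h , g) e = trans h (cong (letter′ (letter p) ∷_) (Good-hedge t g e))
    Good-hedge (call p q refl t t′) (h , z , g , g′) e = trans h (cong₂ (λ x y → enclose (letter p) x (letter q) ∷ y) (Good-hedge t g z) (Good-hedge t′ g′ e))

    Good-cong : ∀ {f f′} {i j : Fin (suc n)} (t : Nest i j) → (∀ k → toℕ i ℕ.≤ toℕ k → toℕ k ℕ.≤ toℕ j → f k ≡ f′ k) → Good f t → Good f′ t
    Good-cong (nil _) h g = tt
    Good-cong {f} {f′} {i} {j} (int p e t) h (g , gs) =
      trans (sym (h (inject₁ p) (ℕₚ.≤-reflexive (cong toℕ (sym e))) (ℕₚ.≤-trans (ℕₚ.≤-reflexive (Finₚ.toℕ-inject₁ p)) (ℕₚ.<⇒≤ (span t)))))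
        (trans g (cong (letter′ (letter p) ∷_) (h (suc p) up (span t)))) ,
      Good-cong t (λ k lo hi → h k (ℕₚ.≤-trans up lo) hi) gs
      where
      up : toℕ i ℕ.≤ suc (toℕ p)
      up = ℕₚ.≤-trans (ℕₚ.≤-reflexive (sym (toℕ-src e))) (ℕₚ.n≤1+n _)
    Good-cong {f} {f′} {i} {j} (call p q e t t′) h (g , z , gs , gs′) =
      trans (sym (h (inject₁ p) (ℕₚ.≤-reflexive (cong toℕ (sym e))) (ℕₚ.≤-trans (ℕₚ.≤-reflexive (Finₚ.toℕ-inject₁ p)) (ℕₚ.<⇒≤ (ℕₚ.<-trans p<q (span t′))))))
        (trans g (cong₂ (λ x y → enclose (letter p) x (letter q) ∷ y) (h (suc p) up (ℕₚ.<-trans p<q (span t′))) (h (suc q) (ℕₚ.≤-trans up (s≤s (ℕₚ.<⇒≤ p<q))) (span t′)))) ,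
      trans (sym (h (inject₁ q) (ℕₚ.≤-trans up (span t)) q≤j)) z ,
      Good-cong t (λ k lo hi → h k (ℕₚ.≤-trans up lo) (ℕₚ.≤-trans hi q≤j)) gs ,
      Good-cong t′ (λ k lo hi → h k (ℕₚ.≤-trans up (ℕₚ.≤-trans (s≤s (ℕₚ.<⇒≤ p<q)) lo)) hi) gs′
      where
      p<q = call-< t
      up : toℕ i ℕ.≤ suc (toℕ p)
      up = ℕₚ.≤-trans (ℕₚ.≤-reflexive (sym (toℕ-src e))) (ℕₚ.n≤1+n _)
      q≤j : toℕ (inject₁ q) ℕ.≤ toℕ j
      q≤j = ℕₚ.≤-trans (ℕₚ.≤-reflexive (Finₚ.toℕ-inject₁ q)) (ℕₚ.<⇒≤ (span t′))

    -- The witness that such a labelling exists: a point receives the hedge of the subtree that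
    -- begins there. This is the labelling which the formulas below read.
    label : ∀ {i j : Fin (suc n)} → Nest i j → Fin (suc n) → Hedge
    label (nil _) k = []
    label (int p e t) k = if does (k ≟ inject₁ p) then hedge letter (int p e t) else label t k
    label (call p q e t t′) k = if does (k ≟ inject₁ p) then hedge letter (call p q e t t′) else if ⌊ toℕ k ℕ.≤? toℕ q ⌋ then label t k else label t′ k

    private
      skip : ∀ {p k : Fin (suc n)} {A : Set} {x y : A} → toℕ p ℕ.< toℕ k → (if does (k ≟ p) then x else y) ≡ y
      skip {p} {k} lt with k ≟ p
      ... | yes refl = ⊥-elim (ℕₚ.<-irrefl refl lt)
      ... | no _ = refl

      hit : ∀ {p k : Fin (suc n)} {A : Set} {x y : A} → k ≡ p → (if does (k ≟ p) then x else y) ≡ x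
      hit {p} {k} e with k ≟ p
      ... | yes _ = refl
      ... | no ne = ⊥-elim (ne e)

      low : ∀ {q : Fin n} {k : Fin (suc n)} {A : Set} {x y : A} → toℕ k ℕ.≤ toℕ q → (if ⌊ toℕ k ℕ.≤? toℕ q ⌋ then x else y) ≡ x
      low {q} {k} le′ rewrite ⌊⌋-true (toℕ k ℕ.≤? toℕ q) le′ = refl

      high : ∀ {q : Fin n} {k : Fin (suc n)} {A : Set} {x y : A} → toℕ q ℕ.< toℕ k → (if ⌊ toℕ k ℕ.≤? toℕ q ⌋ then x else y) ≡ y
      high {q} {k} lt rewrite ⌊⌋-false (toℕ k ℕ.≤? toℕ q) (ℕₚ.<⇒≱ lt) = refl

      src< : ∀ {p : Fin n} {k : Fin (suc n)} → toℕ p ℕ.< toℕ k → toℕ (inject₁ p) ℕ.< toℕ k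
      src< {p} lt = subst (ℕ._< _) (sym (Finₚ.toℕ-inject₁ p)) lt

      label-inner : ∀ {i j : Fin (suc n)} p q e (t : Nest (suc p) (inject₁ q)) (t′ : Nest (suc q) j) {k} →
        toℕ p ℕ.< toℕ k → toℕ k ℕ.≤ toℕ q → label {i} (call p q e t t′) k ≡ label t k
      label-inner p q e t t′ lo hi = trans (skip (src< lo)) (low hi)

      label-later : ∀ {i j : Fin (suc n)} p q e (t : Nest (suc p) (inject₁ q)) (t′ : Nest (suc q) j) {k} →
        toℕ q ℕ.< toℕ k → label {i} (call p q e t t′) k ≡ label t′ k
      label-later p q e t t′ lt = trans (skip (src< (ℕₚ.<-trans (call-< t) lt))) (high lt)

    label-start : ∀ {i j : Fin (suc n)} (t : Nest i j) → label t i ≡ hedge letter t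
    label-start (nil _) = refl
    label-start (int p e t) = hit (sym e)
    label-start (call p q e t t′) = hit (sym e)

    label-end : ∀ {i j : Fin (suc n)} (t : Nest i j) → label t j ≡ []
    label-end (nil _) = refl
    label-end (int p e t) = trans (skip (src< (span t))) (label-end t)
    label-end (call p q e t t′) = trans (label-later p q e t t′ (span t′)) (label-end t′)

    label-Good : ∀ {i j : Fin (suc n)} (t : Nest i j) → Good (label t) t
    label-Good (nil _) = tt
    label-Good (int p e t) = trans (hit {inject₁ p} {inject₁ p} refl) (cong (letter′ (letter p) ∷_) (sym (trans (skip {inject₁ p} {suc p} (src< {p} {suc p} ℕₚ.≤-refl)) (label-start t)))) ,
      Good-cong t (λ k lo hi → sym (skip {inject₁ p} {k} (src< {p} {k} lo))) (label-Good t)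
    label-Good (call p q e t t′) = trans (hit {inject₁ p} {inject₁ p} refl) (cong₂ (λ x y → enclose (letter p) x (letter q) ∷ y)
        (sym (trans (label-inner p q e t t′ ℕₚ.≤-refl p<q) (label-start t))) (sym (trans (label-later p q e t t′ ℕₚ.≤-refl) (label-start t′)))) ,
      trans (label-inner p q e t t′ (subst (toℕ p ℕ.<_) (sym iq) p<q) (ℕₚ.≤-reflexive iq)) (label-end t) ,
      Good-cong t (λ k lo hi → sym (label-inner p q e t t′ lo (ℕₚ.≤-trans hi (ℕₚ.≤-reflexive iq)))) (label-Good t) ,
      Good-cong t′ (λ k lo hi → sym (label-later p q e t t′ lo)) (label-Good t′)
      where
      p<q = call-< t
      iq = Finₚ.toℕ-inject₁ q

  module _ {f s : ℕ} where
    isLast isRet isCall isInt isFirst : Fin f → MSO′ f s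
    isLast x = ¬ᶜ (∃₁ (suc x <ᶜ zero))
    isRet x = ∃₁ (atom (nu zero (suc x)))
    isCall x = ∃₁ (atom (nu (suc x) zero))
    isInt x = ¬ᶜ (isRet x) ∧ᶜ ¬ᶜ (isCall x)
    isFirst x = ¬ᶜ (∃₁ (zero <ᶜ suc x))

  isSucc : ∀ {f s} → Fin f → Fin f → MSO′ f s
  isSucc x y = (x <ᶜ y) ∧ᶜ ¬ᶜ (∃₁ ((suc x <ᶜ zero) ∧ᶜ (zero <ᶜ suc y)))

  isMark : ∀ {f s} → Fin f → MSO′ f s
  isMark x = ∃₁ (atom (nu (suc x) zero) ∧ᶜ isSucc (suc x) zero)

  tagAfter : ∀ {f s} → ℕ → Fin f → MSO′ f s
  tagAfter zero x = ∃₁ (isSucc (suc x) zero ∧ᶜ isMark zero)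
  tagAfter (suc i) x = ∃₁ (isSucc (suc x) zero ∧ᶜ isInt zero ∧ᶜ tagAfter i zero)

  -- A given hedge is read in first-order logic by following successors and arcs. `hedgeFrom`
  -- describes the point before x and `hedgeAfter` the one behind it; no position follows the last
  -- point, so only the latter reaches it.
  hedgeFrom hedgeAfter : ∀ {f s} → Hedge → Fin f → MSO′ f s
  hedgeFrom [] x = isRet x
  hedgeFrom (letter′ a ∷ ν) x = isInt x ∧ᶜ atom (lab a x) ∧ᶜ hedgeAfter ν x
  hedgeFrom (mark a b ∷ ν) x = ∃₁ (atom (nu (suc x) zero) ∧ᶜ isSucc (suc x) zero ∧ᶜ atom (lab a (suc x)) ∧ᶜ atom (lab b zero) ∧ᶜ hedgeAfter ν zero)
  hedgeFrom (hole (just i) ∷ ν) x = ∃₁ (atom (nu (suc x) zero) ∧ᶜ tagAfter i (suc x) ∧ᶜ hedgeAfter ν zero)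
  -- An unsatisfiable formula. `Plain` keeps arcs without a tag out of the hedges of the entries and
  -- of the root.
  hedgeFrom (hole nothing ∷ ν) x = x <ᶜ x
  hedgeAfter [] x = isLast x ∨ᶜ ∃₁ (isSucc (suc x) zero ∧ᶜ isRet zero)
  hedgeAfter ν@(_ ∷ _) x = ∃₁ (isSucc (suc x) zero ∧ᶜ hedgeFrom ν zero)

  Plain : Hedge → Set
  Plain [] = ⊤
  Plain (hole nothing ∷ ν) = ⊥
  Plain (_ ∷ ν) = Plain ν

  private
    tagAfter-Free : ∀ {f s} i (x : Fin f) → Free (tagAfter {s = s} i x)
    tagAfter-Free zero x = _
    tagAfter-Free (suc i) x = (_ , (_ , tagAfter-Free i zero))

    hedgeFrom-Free : ∀ {f s} ν (x : Fin f) → Free (hedgeFrom {s = s} ν x)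
    hedgeAfter-Free : ∀ {f s} ν (x : Fin f) → Free (hedgeAfter {s = s} ν x)
    hedgeFrom-Free [] x = _
    hedgeFrom-Free (letter′ a ∷ ν) x = (_ , (_ , hedgeAfter-Free ν x))
    hedgeFrom-Free (mark a b ∷ ν) x = (_ , (_ , (_ , (_ , hedgeAfter-Free ν zero))))
    hedgeFrom-Free (hole (just i) ∷ ν) x = (_ , (tagAfter-Free i (suc x) , hedgeAfter-Free ν zero))
    hedgeFrom-Free (hole nothing ∷ ν) x = _
    hedgeAfter-Free [] x = _
    hedgeAfter-Free (i ∷ ν) x = (_ , hedgeFrom-Free (i ∷ ν) zero)

  private
    ∷≢[] : ∀ {i : Item} {μ : Hedge} → _≡_ {A = Hedge} (i ∷ μ) [] → ⊥
    ∷≢[] ()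

    hedge-empty⁻ : ∀ {n} (letter : Fin n → Fin m) {i j : Fin (suc n)} (s : Nest i j) → hedge letter s ≡ [] → i ≡ j
    hedge-empty⁻ letter (nil e) _ = e

    hedge-empty⁺ : ∀ {n} (letter : Fin n → Fin m) {i j : Fin (suc n)} (s : Nest i j) → toℕ j ≡ toℕ i → hedge letter s ≡ []
    hedge-empty⁺ letter (nil _) _ = refl
    hedge-empty⁺ letter (int p e s) eq′ = ⊥-elim (ℕₚ.<-irrefl (trans (toℕ-src e) (sym eq′)) (span s))
    hedge-empty⁺ letter (call p q e s s′) eq′ = ⊥-elim (ℕₚ.<-irrefl (trans (toℕ-src e) (sym eq′)) (ℕₚ.<-trans (call-< s) (span s′)))

    enclose-letter : ∀ {a b d} μ → enclose a μ b ≡ letter′ d → ⊥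
    enclose-letter [] ()
    enclose-letter (_ ∷ _) ()

    enclose-mark : ∀ {a b a′ b′} μ → enclose a μ b ≡ mark a′ b′ → μ ≡ [] × a ≡ a′ × b ≡ b′
    enclose-mark [] refl = refl , refl , refl

    enclose-hole⁻ : ∀ {a b i} μ → enclose a μ b ≡ hole i → tag μ ≡ i
    enclose-hole⁻ (_ ∷ _) refl = refl

    enclose-hole⁺ : ∀ {a b i} μ → tag μ ≡ just i → enclose a μ b ≡ hole (just i)
    enclose-hole⁺ (_ ∷ _) e = cong hole′ e
      where
      hole′ : Maybe ℕ → Item
      hole′ i = hole i

    tag-enclose : ∀ {a b ν i} μ → tag (enclose a μ b ∷ ν) ≡ just i → i ≡ 0 × μ ≡ []
    tag-enclose [] refl = refl , refl

    map-suc⁻ : ∀ {x : Maybe ℕ} {i} → Maybe.map suc x ≡ just i → ∃ λ k → i ≡ suc k × x ≡ just k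
    map-suc⁻ {just k} refl = k , refl , refl

  module Correct (nw : NestedWord K m) (t : Nest zero (fromℕ (Semantics.n nw))) (fit : Fits (rel (NestedWord.nest nw)) t) where
    open Semantics nw
    open Sat nw

    letter : Fin n → Fin m
    letter = lookup (NestedWord.word nw)

    ν : Fin n → Fin n → Bool
    ν = rel (NestedWord.nest nw)

    pst : Fin (suc n) → Hedge
    pst = label letter t

    -- The last two components of `at-call` say that the arc is empty exactly if its ends are
    -- neighbours. This is how `isMark` recognizes it.
    data At (p : Fin n) : Set where
      at-ret : ∀ i → ν i p ≡ true → (∀ k → ν p k ≡ false) → pst (inject₁ p) ≡ [] → At p
      at-int : (∀ k → ν p k ≡ false) → (∀ k → ν k p ≡ false) → pst (inject₁ p) ≡ letter′ (letter p) ∷ pst (suc p) → At p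
      at-call : ∀ q → ν p q ≡ true → (∀ k → ν p k ≡ true → k ≡ q) → (∀ k → ν k p ≡ false) →
        pst (inject₁ p) ≡ enclose (letter p) (pst (suc p)) (letter q) ∷ pst (suc q) →
        (toℕ q ≡ suc (toℕ p) → pst (suc p) ≡ []) → (pst (suc p) ≡ [] → toℕ q ≡ suc (toℕ p)) → At p

    mkCall : ∀ {p q} → ν p q ≡ true → (∀ k → ν p k ≡ true → k ≡ q) → (∀ k → ν k p ≡ false) →
        pst (inject₁ p) ≡ enclose (letter p) (pst (suc p)) (letter q) ∷ pst (suc q) →
        (s : Nest (suc p) (inject₁ q)) → pst (suc p) ≡ hedge letter s → At p
    mkCall {p} {q} a u b g s h = at-call q a u b g
      (λ e → trans h (hedge-empty⁺ letter s (trans (Finₚ.toℕ-inject₁ q) e)))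
      (λ e → trans (sym (Finₚ.toℕ-inject₁ q)) (cong toℕ (sym (hedge-empty⁻ letter s (trans (sym h) e)))))

    viewIn : ∀ {i j} (s : Nest i j) → Fits ν s → Good letter pst s → ∀ {p} → p ∈ positions s → At p
    viewIn (int p _ s) (a , b , f) (g , gs) (here refl) = at-int a b g
    viewIn (int p _ s) (_ , _ , f) (_ , gs) (there k) = viewIn s f gs k
    viewIn (call p q _ s s′) ((a , u , b) , _) (g , z , gs , _) (here refl) = mkCall a u b g s (Good-hedge letter s gs z)
    viewIn (call p q _ s s′) ((a , _) , (b , _) , f , f′) (_ , z , gs , gs′) (there k) with ∈-++⁻ (positions s) k
    ... | inj₁ k′ = viewIn s f gs k′
    ... | inj₂ (here refl) = at-ret p a b z
    ... | inj₂ (there k′) = viewIn s′ f′ gs′ k′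

    view : ∀ p → At p
    view p = viewIn t fit (label-Good letter t) (∈-full t p)

    next : ∀ p → (∃ λ p′ → inject₁ p′ ≡ suc p) ⊎ suc p ≡ fromℕ n
    next p with suc (toℕ p) ℕ.<? n
    ... | yes lt = inj₁ (F.fromℕ< lt , Finₚ.toℕ-injective (trans (Finₚ.toℕ-inject₁ _) (Finₚ.toℕ-fromℕ< lt)))
    ... | no ge = inj₂ (Finₚ.toℕ-injective (trans (ℕₚ.≤-antisym (Finₚ.toℕ<n p) (ℕₚ.≮⇒≥ ge)) (sym (Finₚ.toℕ-fromℕ n))))

    pst-end : pst (fromℕ n) ≡ []
    pst-end = label-end letter t

    module _ {f s} (ρ : Env₁ f) (σ : Env₂ s) where
      private
        between : Fin f → Fin f → MSO′ (suc f) s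
        between x y = (suc x <ᶜ zero) ∧ᶜ (zero <ᶜ suc y)

      succ⁻ : ∀ x y → Sat (isSucc x y) ρ σ → toℕ (ρ y) ≡ suc (toℕ (ρ x))
      succ⁻ x y h = ℕₚ.≤-antisym (ℕₚ.≮⇒≥ λ lt → let lt′ = ℕₚ.<-trans lt (Finₚ.toℕ<n (ρ y)) in
          ¬⁻ (∃₁ (between x y)) (proj₂ h′) (∃⁺ (between x y) (F.fromℕ< lt′)
            (∧⁺ (suc x <ᶜ zero) (zero <ᶜ suc y) (<⁺ (ext (F.fromℕ< lt′) ρ) σ (suc x) zero (ℕₚ.≤-reflexive (sym (Finₚ.toℕ-fromℕ< lt′))))
              (<⁺ (ext (F.fromℕ< lt′) ρ) σ zero (suc y) (ℕₚ.≤-trans (s≤s (ℕₚ.≤-reflexive (Finₚ.toℕ-fromℕ< lt′))) lt)))))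
        (<⁻ ρ σ x y (proj₁ h′))
        where h′ = ∧⁻ (x <ᶜ y) (¬ᶜ (∃₁ (between x y))) h

      succ⁺ : ∀ x y → toℕ (ρ y) ≡ suc (toℕ (ρ x)) → Sat (isSucc x y) ρ σ
      succ⁺ x y e = ∧⁺ (x <ᶜ y) (¬ᶜ (∃₁ (between x y))) (<⁺ ρ σ x y (ℕₚ.≤-reflexive (sym e))) (¬⁺ (∃₁ (between x y)) λ h →
        let (k , h′) = ∃⁻ (between x y) h ; (a , b) = ∧⁻ (suc x <ᶜ zero) (zero <ᶜ suc y) h′ in
        ℕₚ.<⇒≱ (<⁻ (ext k ρ) σ zero (suc y) b) (ℕₚ.≤-trans (ℕₚ.≤-reflexive e) (<⁻ (ext k ρ) σ (suc x) zero a)))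

      last⁻ : ∀ x → Sat (isLast x) ρ σ → suc (ρ x) ≡ fromℕ n
      last⁻ x h = Finₚ.toℕ-injective (trans (ℕₚ.≤-antisym (Finₚ.toℕ<n (ρ x)) (ℕₚ.≮⇒≥ λ lt →
        ¬⁻ (∃₁ (suc x <ᶜ zero)) h (∃⁺ (suc x <ᶜ zero) (F.fromℕ< lt)
          (<⁺ (ext (F.fromℕ< lt) ρ) σ (suc x) zero (ℕₚ.≤-reflexive (sym (Finₚ.toℕ-fromℕ< lt))))))) (sym (Finₚ.toℕ-fromℕ n)))

      last⁺ : ∀ x → suc (ρ x) ≡ fromℕ n → Sat (isLast x) ρ σ
      last⁺ x e = ¬⁺ (∃₁ (suc x <ᶜ zero)) λ h → let (k , h′) = ∃⁻ (suc x <ᶜ zero) h in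
        ℕₚ.<⇒≱ (Finₚ.toℕ<n k) (ℕₚ.≤-trans (ℕₚ.≤-reflexive (sym (trans (cong toℕ e) (Finₚ.toℕ-fromℕ n)))) (<⁻ (ext k ρ) σ (suc x) zero h′))

      ret⁻ : ∀ x → Sat (isRet x) ρ σ → pst (inject₁ (ρ x)) ≡ []
      ret⁻ x h with ∃⁻ (atom (nu zero (suc x))) h | view (ρ x)
      ... | _ | at-ret _ _ _ e = e
      ... | k , holds e | at-int _ b _ = absurd e (b k)
      ... | k , holds e | at-call _ _ _ b _ _ _ = absurd e (b k)

      ret⁺ : ∀ x → pst (inject₁ (ρ x)) ≡ [] → Sat (isRet x) ρ σ
      ret⁺ x h with view (ρ x)
      ... | at-ret i e _ _ = ∃⁺ (atom (nu zero (suc x))) i (holds e)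
      ... | at-int _ _ e = ⊥-elim (∷≢[] (trans (sym e) h))
      ... | at-call _ _ _ _ e _ _ = ⊥-elim (∷≢[] (trans (sym e) h))

      int⁻ : ∀ x → Sat (isInt x) ρ σ → pst (inject₁ (ρ x)) ≡ letter′ (letter (ρ x)) ∷ pst (suc (ρ x))
      int⁻ x h with ∧⁻ (¬ᶜ (isRet x)) (¬ᶜ (isCall x)) h | view (ρ x)
      ... | hr , hc | at-ret i e _ _ = ⊥-elim (¬⁻ (isRet x) hr (∃⁺ (atom (nu zero (suc x))) i (holds e)))
      ... | hr , hc | at-int _ _ e = e
      ... | hr , hc | at-call q e _ _ _ _ _ = ⊥-elim (¬⁻ (isCall x) hc (∃⁺ (atom (nu (suc x) zero)) q (holds e)))

      int⁺ : ∀ x → (∀ k → ν (ρ x) k ≡ false) → (∀ k → ν k (ρ x) ≡ false) → Sat (isInt x) ρ σ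
      int⁺ x a b = ∧⁺ (¬ᶜ (isRet x)) (¬ᶜ (isCall x)) (¬⁺ (isRet x) λ h → let (k , holds e) = ∃⁻ (atom (nu zero (suc x))) h in absurd e (b k))
        (¬⁺ (isCall x) λ h → let (k , holds e) = ∃⁻ (atom (nu (suc x) zero)) h in absurd e (a k))

    after-point : ∀ {p p′ : Fin n} → toℕ p′ ≡ suc (toℕ p) → inject₁ p′ ≡ suc p
    after-point {p′ = p′} e = Finₚ.toℕ-injective (trans (Finₚ.toℕ-inject₁ p′) e)

    point-after : ∀ {p p′ : Fin n} → inject₁ p′ ≡ suc p → toℕ p′ ≡ suc (toℕ p)
    point-after {p′ = p′} e = trans (sym (Finₚ.toℕ-inject₁ p′)) (cong toℕ e)

    mark⁻ : ∀ {f s} (ρ : Env₁ f) (σ : Env₂ s) x → Sat (isMark x) ρ σ → ∃ λ q → ν (ρ x) q ≡ true × pst (suc (ρ x)) ≡ []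
    mark⁻ ρ σ x h with ∃⁻ (atom (nu (suc x) zero) ∧ᶜ isSucc (suc x) zero) h
    ... | k , h′ with ∧⁻ (atom (nu (suc x) zero)) (isSucc (suc x) zero) h′
    ...   | holds e , hs with view (ρ x)
    ...     | at-ret _ _ z _ = absurd e (z k)
    ...     | at-int z _ _ = absurd e (z k)
    ...     | at-call q e′ u _ _ adj _ with u k e
    ...       | refl = k , e , adj (succ⁻ (ext k ρ) σ (suc x) zero hs)

    mark⁺ : ∀ {f s} (ρ : Env₁ f) (σ : Env₂ s) x {q} → ν (ρ x) q ≡ true → toℕ q ≡ suc (toℕ (ρ x)) → Sat (isMark x) ρ σ
    mark⁺ ρ σ x {q} e adj = ∃⁺ (atom (nu (suc x) zero) ∧ᶜ isSucc (suc x) zero) q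
      (∧⁺ (atom (nu (suc x) zero)) (isSucc (suc x) zero) (holds e) (succ⁺ (ext q ρ) σ (suc x) zero adj))

    tag⁻ : ∀ {f s} i (ρ : Env₁ f) (σ : Env₂ s) x → Sat (tagAfter i x) ρ σ → tag (pst (suc (ρ x))) ≡ just i
    tag⁻ zero ρ σ x h with ∃⁻ (isSucc (suc x) zero ∧ᶜ isMark zero) h
    ... | z , h′ with ∧⁻ (isSucc (suc x) zero) (isMark zero) h′
    ...   | hs , hm with mark⁻ (ext z ρ) σ zero hm | view z
    ...     | q , e , _ | at-ret _ _ a _ = absurd e (a q)
    ...     | q , e , _ | at-int a _ _ = absurd e (a q)
    ...     | q , e , empty | at-call q′ _ u _ eq′ _ _ =
                trans (cong (λ k → tag (pst k)) (sym (after-point (succ⁻ (ext z ρ) σ (suc x) zero hs))))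
                  (trans (cong tag eq′) (cong (λ μ → tag (enclose (letter z) μ (letter q′) ∷ pst (suc q′))) empty))
    tag⁻ (suc i) ρ σ x h with ∃⁻ (isSucc (suc x) zero ∧ᶜ isInt zero ∧ᶜ tagAfter i zero) h
    ... | z , h₁ with ∧⁻ (isSucc (suc x) zero) (isInt zero ∧ᶜ tagAfter i zero) h₁
    ...   | hs , h₂ with ∧⁻ (isInt zero) (tagAfter i zero) h₂
    ...     | hi , ht = trans (cong (λ k → tag (pst k)) (sym (after-point (succ⁻ (ext z ρ) σ (suc x) zero hs))))
                (trans (cong tag (int⁻ (ext z ρ) σ zero hi)) (cong (Maybe.map suc) (tag⁻ i (ext z ρ) σ zero ht)))

    tag⁺ : ∀ {f s} i (ρ : Env₁ f) (σ : Env₂ s) x → tag (pst (suc (ρ x))) ≡ just i → Sat (tagAfter i x) ρ σ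
    tag⁺ i ρ σ x h with next (ρ x)
    ... | inj₂ e with trans (sym (cong tag (trans (cong pst e) pst-end))) h
    ...   | ()
    tag⁺ i ρ σ x h | inj₁ (z , e) with view z
    ... | at-ret _ _ _ e′ with trans (sym (cong tag (trans (cong pst (sym e)) e′))) h
    ...   | ()
    tag⁺ i ρ σ x h | inj₁ (z , e) | at-int a b e′ with map-suc⁻ {tag (pst (suc z))} (trans (sym (cong tag (trans (cong pst (sym e)) e′))) h)
    ... | k , refl , h′ = ∃⁺ (isSucc (suc x) zero ∧ᶜ isInt zero ∧ᶜ tagAfter k zero) z
            (∧⁺ (isSucc (suc x) zero) (isInt zero ∧ᶜ tagAfter k zero) (succ⁺ (ext z ρ) σ (suc x) zero (point-after e))
              (∧⁺ (isInt zero) (tagAfter k zero) (int⁺ (ext z ρ) σ zero a b) (tag⁺ k (ext z ρ) σ zero h′)))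
    tag⁺ i ρ σ x h | inj₁ (z , e) | at-call q zq _ _ e′ _ adj′ with tag-enclose (pst (suc z)) (trans (sym (cong tag (trans (cong pst (sym e)) e′))) h)
    ... | refl , empty = ∃⁺ (isSucc (suc x) zero ∧ᶜ isMark zero) z
            (∧⁺ (isSucc (suc x) zero) (isMark zero) (succ⁺ (ext z ρ) σ (suc x) zero (point-after e)) (mark⁺ (ext z ρ) σ zero zq (adj′ empty)))

    from⁻ : ∀ {f s} μ → Plain μ → ∀ (ρ : Env₁ f) (σ : Env₂ s) x → Sat (hedgeFrom μ x) ρ σ → pst (inject₁ (ρ x)) ≡ μ
    after⁻ : ∀ {f s} μ → Plain μ → ∀ (ρ : Env₁ f) (σ : Env₂ s) x → Sat (hedgeAfter μ x) ρ σ → pst (suc (ρ x)) ≡ μ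
    from⁻ [] _ ρ σ x h = ret⁻ ρ σ x h
    from⁻ (letter′ a ∷ μ) pl ρ σ x h with ∧⁻ (isInt x) (atom (lab a x) ∧ᶜ hedgeAfter μ x) h
    ... | hi , h₁ with ∧⁻ (atom (lab a x)) (hedgeAfter μ x) h₁
    ...   | holds hl , ha = trans (int⁻ ρ σ x hi) (cong₂ (λ a μ → letter′ a ∷ μ) (sym (⌊⌋-true⁻ (a ≟ letter (ρ x)) hl)) (after⁻ μ pl ρ σ x ha))
    from⁻ (mark a b ∷ μ) pl ρ σ x h with ∃⁻ (atom (nu (suc x) zero) ∧ᶜ isSucc (suc x) zero ∧ᶜ atom (lab a (suc x)) ∧ᶜ atom (lab b zero) ∧ᶜ hedgeAfter μ zero) h
    ... | k , h₀ with ∧⁻ (atom (nu (suc x) zero)) (isSucc (suc x) zero ∧ᶜ atom (lab a (suc x)) ∧ᶜ atom (lab b zero) ∧ᶜ hedgeAfter μ zero) h₀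
    ...   | holds e , h₁ with ∧⁻ (isSucc (suc x) zero) (atom (lab a (suc x)) ∧ᶜ atom (lab b zero) ∧ᶜ hedgeAfter μ zero) h₁
    ...     | hs , h₂ with ∧⁻ (atom (lab a (suc x))) (atom (lab b zero) ∧ᶜ hedgeAfter μ zero) h₂
    ...       | holds hl , h₃ with ∧⁻ (atom (lab b zero)) (hedgeAfter μ zero) h₃ | view (ρ x)
    ...         | hl′ , ha | at-ret _ _ z _ = absurd e (z k)
    ...         | hl′ , ha | at-int z _ _ = absurd e (z k)
    ...         | holds hl′ , ha | at-call q _ u _ eq′ adj _ with u k e
    ...           | refl = trans eq′ (cong₂ _∷_ (trans (cong (λ μ → enclose (letter (ρ x)) μ (letter k)) (adj (succ⁻ (ext k ρ) σ (suc x) zero hs)))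
                      (cong₂ (λ a b → mark a b) (sym (⌊⌋-true⁻ (a ≟ letter (ρ x)) hl)) (sym (⌊⌋-true⁻ (b ≟ letter k) hl′))))
                      (after⁻ μ pl (ext k ρ) σ zero ha))
    from⁻ (hole (just i) ∷ μ) pl ρ σ x h with ∃⁻ (atom (nu (suc x) zero) ∧ᶜ tagAfter i (suc x) ∧ᶜ hedgeAfter μ zero) h
    ... | k , h₀ with ∧⁻ (atom (nu (suc x) zero)) (tagAfter i (suc x) ∧ᶜ hedgeAfter μ zero) h₀
    ...   | holds e , h₁ with ∧⁻ (tagAfter i (suc x)) (hedgeAfter μ zero) h₁ | view (ρ x)
    ...     | ht , ha | at-ret _ _ z _ = absurd e (z k)
    ...     | ht , ha | at-int z _ _ = absurd e (z k)
    ...     | ht , ha | at-call q _ u _ eq′ _ _ with u k e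
    ...       | refl = trans eq′ (cong₂ _∷_ (enclose-hole⁺ (pst (suc (ρ x))) (tag⁻ i (ext k ρ) σ (suc x) ht)) (after⁻ μ pl (ext k ρ) σ zero ha))
    after⁻ [] pl ρ σ x h with ∨⁻ (isLast x) (∃₁ (isSucc (suc x) zero ∧ᶜ isRet zero)) h
    ... | inj₁ hl = trans (cong pst (last⁻ ρ σ x hl)) pst-end
    ... | inj₂ h′ = let (z , h″) = ∃⁻ (isSucc (suc x) zero ∧ᶜ isRet zero) h′ ; (a , b) = ∧⁻ (isSucc (suc x) zero) (isRet zero) h″ in
      trans (cong pst (sym (after-point (succ⁻ (ext z ρ) σ (suc x) zero a)))) (ret⁻ (ext z ρ) σ zero b)
    after⁻ (i ∷ μ) pl ρ σ x h = let (z , h″) = ∃⁻ (isSucc (suc x) zero ∧ᶜ hedgeFrom (i ∷ μ) zero) h ; (a , b) = ∧⁻ (isSucc (suc x) zero) (hedgeFrom (i ∷ μ) zero) h″ in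
      trans (cong pst (sym (after-point (succ⁻ (ext z ρ) σ (suc x) zero a)))) (from⁻ (i ∷ μ) pl (ext z ρ) σ zero b)

    -- The statement for `hedgeFrom` at the same hedge is taken as an argument, since `from⁺` in
    -- turn calls this lemma on shorter hedges.
    after⁺ : ∀ {f s} μ → (∀ {f s} (ρ : Env₁ f) (σ : Env₂ s) x → pst (inject₁ (ρ x)) ≡ μ → Sat (hedgeFrom μ x) ρ σ) →
      ∀ (ρ : Env₁ f) (σ : Env₂ s) x → pst (suc (ρ x)) ≡ μ → Sat (hedgeAfter μ x) ρ σ
    after⁺ [] hf ρ σ x h with next (ρ x)
    ... | inj₂ e = ∨⁺ (isLast x) (∃₁ (isSucc (suc x) zero ∧ᶜ isRet zero)) (inj₁ (last⁺ ρ σ x e))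
    ... | inj₁ (z , e) = ∨⁺ (isLast x) (∃₁ (isSucc (suc x) zero ∧ᶜ isRet zero)) (inj₂ (∃⁺ (isSucc (suc x) zero ∧ᶜ isRet zero) z
            (∧⁺ (isSucc (suc x) zero) (isRet zero) (succ⁺ (ext z ρ) σ (suc x) zero (point-after e)) (ret⁺ (ext z ρ) σ zero (trans (cong pst e) h)))))
    after⁺ (i ∷ μ) hf ρ σ x h with next (ρ x)
    ... | inj₁ (z , e) = ∃⁺ (isSucc (suc x) zero ∧ᶜ hedgeFrom (i ∷ μ) zero) z
            (∧⁺ (isSucc (suc x) zero) (hedgeFrom (i ∷ μ) zero) (succ⁺ (ext z ρ) σ (suc x) zero (point-after e)) (hf (ext z ρ) σ zero (trans (cong pst e) h)))
    ... | inj₂ e with trans (sym (trans (cong pst e) pst-end)) h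
    ...   | ()

    from⁺ : ∀ {f s} μ → Plain μ → ∀ (ρ : Env₁ f) (σ : Env₂ s) x → pst (inject₁ (ρ x)) ≡ μ → Sat (hedgeFrom μ x) ρ σ
    from⁺ [] _ ρ σ x h = ret⁺ ρ σ x h
    from⁺ (i ∷ μ) pl ρ σ x h with view (ρ x)
    from⁺ (i ∷ μ) pl ρ σ x h | at-ret _ _ _ e with trans (sym e) h
    ... | ()
    from⁺ (i ∷ μ) pl ρ σ x h | at-int a b e with trans (sym e) h
    ... | refl = ∧⁺ (isInt x) (atom (lab (letter (ρ x)) x) ∧ᶜ hedgeAfter μ x) (int⁺ ρ σ x a b)
            (∧⁺ (atom (lab (letter (ρ x)) x)) (hedgeAfter μ x) (holds (⌊⌋-true (letter (ρ x) ≟ letter (ρ x)) refl)) (after⁺ μ (from⁺ μ pl) ρ σ x refl))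
    from⁺ (letter′ a ∷ μ) pl ρ σ x h | at-call q xq _ _ e adj adj′ = ⊥-elim (enclose-letter (pst (suc (ρ x))) (Listₚ.∷-injectiveˡ (trans (sym e) h)))
    from⁺ (mark a b ∷ μ) pl ρ σ x h | at-call q xq _ _ e adj adj′ with enclose-mark (pst (suc (ρ x))) (Listₚ.∷-injectiveˡ (trans (sym e) h))
    ... | empty , refl , refl = ∃⁺ (A ∧ᶜ S ∧ᶜ L ∧ᶜ L′ ∧ᶜ H) q (∧⁺ A (S ∧ᶜ L ∧ᶜ L′ ∧ᶜ H) (holds xq) (∧⁺ S (L ∧ᶜ L′ ∧ᶜ H) (succ⁺ (ext q ρ) σ (suc x) zero (adj′ empty))
            (∧⁺ L (L′ ∧ᶜ H) (holds (⌊⌋-true (letter (ρ x) ≟ letter (ρ x)) refl)) (∧⁺ L′ H (holds (⌊⌋-true (letter q ≟ letter q) refl))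
              (after⁺ μ (from⁺ μ pl) (ext q ρ) σ zero (Listₚ.∷-injectiveʳ (trans (sym e) h)))))))
      where
      A = atom (nu (suc x) zero)
      S = isSucc (suc x) zero
      L = atom (lab a (suc x))
      L′ = atom (lab b zero)
      H = hedgeAfter μ zero
    from⁺ (hole (just i) ∷ μ) pl ρ σ x h | at-call q xq _ _ e adj adj′ = ∃⁺ (A ∧ᶜ T ∧ᶜ H) q (∧⁺ A (T ∧ᶜ H) (holds xq) (∧⁺ T H
        (tag⁺ i (ext q ρ) σ (suc x) (enclose-hole⁻ (pst (suc (ρ x))) (Listₚ.∷-injectiveˡ (trans (sym e) h))))
        (after⁺ μ (from⁺ μ pl) (ext q ρ) σ zero (Listₚ.∷-injectiveʳ (trans (sym e) h)))))
      where
      A = atom (nu (suc x) zero)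
      T = tagAfter i (suc x)
      H = hedgeAfter μ zero

  module Formula (entries : List Entry) (root : List (C × Hedge))
    (entries-plain : All (λ (_ , _ , μ , _) → Plain μ × μ ≢ []) entries) (root-plain : All (Plain ∘ proj₂) root) where
    open Weight entries root

    choice : ∀ {A : Set c} {f s} → List A → (A → C) → (A → MSO′ f s) → WF′ f s
    choice [] g φ = const 0#
    choice (a ∷ as) g φ = (const (g a) ∧ʷ _⁺ K m (φ a)) ∨ʷ choice as g φ

    choice-aUMSO : ∀ {A : Set c} {f s} as (g : A → C) (φ : A → MSO′ f s) → aUMSO K m (choice as g φ)
    choice-aUMSO [] g φ = const 0#
    choice-aUMSO (a ∷ as) g φ = (const (g a) ∧ᵘ su (φ a , inj₁ refl)) ∨ᵘ choice-aUMSO as g φ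

    choice-sRFO : ∀ {A : Set c} {f s} as (g : A → C) (φ : A → MSO′ f s) → (∀ a → Free (φ a)) → sRFO K m (choice as g φ)
    choice-sRFO [] g φ h = const 0#
    choice-sRFO (a ∷ as) g φ h = (const (g a) ∧ʳ sRFO⁺ (φ a) (h a)) ∨ʳ choice-sRFO as g φ h

    entryAt : ∀ {f s} → Entry → Fin f → MSO′ f s
    entryAt (_ , a , μ , b) x = ∃₁ (atom (nu (suc x) zero) ∧ᶜ atom (lab a (suc x)) ∧ᶜ hedgeAfter μ (suc x) ∧ᶜ atom (lab b zero))

    notCall notFirst : MSO′ 1 0
    notCall = ¬ᶜ (isCall zero)
    notFirst = ¬ᶜ (isFirst zero)

    startAt : C × Hedge → MSO′ 1 0
    startAt (_ , μ) = isFirst zero ∧ᶜ hedgeFrom μ zero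

    -- The main alternatives exclude one another, so each sum is a single factor: the price at the
    -- call of a nonempty arc, the weight of the root word at the first position, and 1 elsewhere.
    -- The products over all positions then give the weight of the whole nesting.
    atPosition atStart : WF′ 1 0
    atPosition = _⁺ K m notCall ∨ʷ (_⁺ K m (isMark zero) ∨ʷ choice entries proj₁ (λ E → entryAt E zero))
    atStart = _⁺ K m notFirst ∨ʷ choice root proj₁ startAt

    formula : WF′ 0 0
    formula = ∀₁ atPosition ∧ʷ ∀₁ atStart

    formula-sRFO : sRFO K m formula
    formula-sRFO =
      ∀₁ (su (notCall , inj₁ refl) ∨ᵘ (su (isMark zero , inj₁ refl) ∨ᵘ choice-aUMSO entries proj₁ _))
         (sRFO⁺ notCall _ ∨ʳ (sRFO⁺ (isMark zero) _ ∨ʳ choice-sRFO entries proj₁ _ λ (_ , a , μ , b) → _ , (_ , (hedgeAfter-Free μ (suc zero) , _))))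
      ∧ʳ ∀₁ (su (notFirst , inj₁ refl) ∨ᵘ choice-aUMSO root proj₁ startAt)
         (sRFO⁺ notFirst _ ∨ʳ choice-sRFO root proj₁ startAt λ (_ , μ) → _ , hedgeFrom-Free μ zero)

    module _ (nw : NestedWord K m) (t : Nest zero (fromℕ (Semantics.n nw))) (fit : Fits (rel (NestedWord.nest nw)) t) where
      open Semantics nw
      open Correct nw t fit
      open Sat nw

      private
        choice-sem : ∀ {A : Set c} {f s} as (g : A → C) (φ : A → MSO′ f s) (h : A → C) ρ σ → (∀ {a} → a ∈ as → 𝟙 (sat (φ a) ρ σ) ≈ h a) →
          ⟦ choice as g φ ⟧ ρ σ ≈ ∑ as λ a → h a * g a
        choice-sem [] g φ h ρ σ e = ≈-refl
        choice-sem (a ∷ as) g φ h ρ σ e = +-cong (≈-trans (*-congˡ (≈-trans (proj₁ (pm-sem (φ a) ρ σ)) (e (here refl)))) (*-comm _ _))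
          (choice-sem as g φ h ρ σ (e ∘ there))

        true⁺ : ∀ {f s} (φ : MSO′ f s) ρ σ → Sat φ ρ σ → ⟦ _⁺ K m φ ⟧ ρ σ ≈ 1#
        true⁺ φ ρ σ (holds e) = ≈-trans (proj₁ (pm-sem φ ρ σ)) (reflexive (cong 𝟙 e))

        false⁺ : ∀ {f s} (φ : MSO′ f s) ρ σ → ¬ Sat φ ρ σ → ⟦ _⁺ K m φ ⟧ ρ σ ≈ 0#
        false⁺ φ ρ σ e = ≈-trans (proj₁ (pm-sem φ ρ σ)) (reflexive (cong 𝟙 (false! φ e)))

        𝟙-dec : ∀ {P : Set} b (d : Dec P) → (b ≡ true → P) → (P → b ≡ true) → 𝟙 b ≈ [ d ]
        𝟙-dec true (yes _) f g = ≈-refl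
        𝟙-dec false (yes p) f g with g p
        ... | ()
        𝟙-dec true (no ¬p) f g = ⊥-elim (¬p (f refl))
        𝟙-dec false (no _) f g = ≈-refl

        [×] : ∀ {P Q : Set} (d : Dec P) (e : Dec Q) → 𝟙 (does d ∧ does e) ≈ [ d ] * [ e ]
        [×] (yes _) (yes _) = ≈-sym (*-identityˡ _)
        [×] (yes _) (no _) = ≈-sym (*-identityˡ _)
        [×] (no _) _ = ≈-sym (zeroˡ _)

        noCall : ∀ p → (∀ k → ν p k ≡ false) → ∀ ρ σ → ⟦ atPosition ⟧ (ext p ρ) σ ≈ 1#
        noCall p out ρ σ = ≈-trans (+-cong
            (true⁺ notCall (ext p ρ) σ (¬⁺ (isCall zero) λ h → let (k , holds e) = ∃⁻ (atom (nu (suc zero) zero)) h in absurd e (out k)))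
            (≈-trans (+-cong
              (false⁺ (isMark zero) (ext p ρ) σ λ h → let (k , e , _) = mark⁻ (ext p ρ) σ zero h in absurd e (out k))
              (≈-trans (choice-sem entries proj₁ _ (λ _ → 0#) (ext p ρ) σ λ {(_ , a , μ , b)} _ → reflexive (cong 𝟙 (false! _ λ h →
                  let (k , h′) = ∃⁻ (atom (nu (suc zero) zero) ∧ᶜ atom (lab a (suc zero)) ∧ᶜ hedgeAfter μ (suc zero) ∧ᶜ atom (lab b zero)) h
                      (holds e , _) = ∧⁻ (atom (nu (suc zero) zero)) (atom (lab a (suc zero)) ∧ᶜ hedgeAfter μ (suc zero) ∧ᶜ atom (lab b zero)) h′ in absurd e (out k))))
                (∑-0 entries λ _ → zeroˡ _))) (+-identityˡ _)))
          (+-identityʳ _)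

        module _ p q (pq : ν p q ≡ true) (u : ∀ k → ν p k ≡ true → k ≡ q) {ρ : Env₁ 0} {σ : Env₂ 0} where
          entry-sem : ∀ x a μ b → Plain μ → 𝟙 (sat (entryAt (x , a , μ , b) zero) (ext p ρ) σ) ≈
            [ a ≟ letter p ] * ([ μ ≟ᴴ pst (suc p) ] * [ b ≟ letter q ])
          entry-sem x a μ b pl = ≈-trans (reflexive (cong 𝟙 (bool-ext
              (λ h → let (k , h₀) = ∃⁻ body (holds h) ; (holds e , h₁) = ∧⁻ A (L ∧ᶜ H ∧ᶜ L′) h₀ ; (holds l , h₂) = ∧⁻ L (H ∧ᶜ L′) h₁
                         (ha , holds l′) = ∧⁻ H L′ h₂ in
                cong₂ _∧_ (does⁺ (a ≟ letter p) (⌊⌋-true⁻ (a ≟ letter p) l)) (cong₂ _∧_ (does⁺ (μ ≟ᴴ pst (suc p)) (sym (after⁻ μ pl (ext k (ext p ρ)) σ (suc zero) ha)))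
                  (does⁺ (b ≟ letter q) (trans (⌊⌋-true⁻ (b ≟ letter k) l′) (cong letter (u k e))))))
              (λ h → let (a≡ , h₁) = ∧-true h ; (μ≡ , b≡) = ∧-true h₁ in true! (∃⁺ {ρ = ext p ρ} {σ} body q (∧⁺ A (L ∧ᶜ H ∧ᶜ L′) (holds pq)
                (∧⁺ L (H ∧ᶜ L′) (holds (⌊⌋-true (a ≟ letter p) (does⁻ (a ≟ letter p) a≡))) (∧⁺ H L′
                  (after⁺ μ (from⁺ μ pl) (ext q (ext p ρ)) σ (suc zero) (sym (does⁻ (μ ≟ᴴ pst (suc p)) μ≡)))
                  (holds (⌊⌋-true (b ≟ letter q) (does⁻ (b ≟ letter q) b≡))))))))))) 
              (≈-trans (≈-sym (𝟙-∧ (does (a ≟ letter p)) _)) (*-cong (𝟙-ind (a ≟ letter p)) ([×] (μ ≟ᴴ pst (suc p)) (b ≟ letter q))))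
            where
            A L L′ H body : MSO′ 2 0
            A = atom (nu (suc zero) zero)
            L = atom (lab a (suc zero))
            L′ = atom (lab b zero)
            H = hedgeAfter μ (suc zero)
            body = A ∧ᶜ L ∧ᶜ H ∧ᶜ L′
            does⁻ : ∀ {P : Set} (d : Dec P) → does d ≡ true → P
            does⁻ (yes p) _ = p
            does⁺ : ∀ {P : Set} (d : Dec P) → P → does d ≡ true
            does⁺ (yes _) _ = refl
            does⁺ (no ne) p = ⊥-elim (ne p)
            ∧-true : ∀ {a b} → a ∧ b ≡ true → a ≡ true × b ≡ true
            ∧-true {true} e = refl , e
            𝟙-ind : ∀ {P : Set} (d : Dec P) → 𝟙 (does d) ≈ [ d ]
            𝟙-ind (yes _) = ≈-refl
            𝟙-ind (no _) = ≈-refl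

          entries-sem : ⟦ choice entries proj₁ (λ E → entryAt E zero) ⟧ (ext p ρ) σ ≈
            ∑ entries λ (x , a , μ , b) → ([ a ≟ letter p ] * ([ μ ≟ᴴ pst (suc p) ] * [ b ≟ letter q ])) * x
          entries-sem = choice-sem entries proj₁ _ (λ (_ , a , μ , b) → [ a ≟ letter p ] * ([ μ ≟ᴴ pst (suc p) ] * [ b ≟ letter q ])) (ext p ρ) σ
            λ {(x , a , μ , b)} k → entry-sem x a μ b (proj₁ (All.lookup entries-plain k))

          call-sem : (∀ k → ν k p ≡ false) → (toℕ q ≡ suc (toℕ p) → pst (suc p) ≡ []) → (pst (suc p) ≡ [] → toℕ q ≡ suc (toℕ p)) →
            ⟦ atPosition ⟧ (ext p ρ) σ ≈ price (letter p) (pst (suc p)) (letter q)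
          call-sem into adj adj′ = ≈-trans (+-cong (false⁺ notCall (ext p ρ) σ λ h → ¬⁻ (isCall zero) h (∃⁺ (atom (nu (suc zero) zero)) q (holds pq)))
              (go (pst (suc p)) refl)) (+-identityˡ _)
            where
            go : ∀ μ → pst (suc p) ≡ μ → ⟦ _⁺ K m (isMark zero) ⟧ (ext p ρ) σ + ⟦ choice entries proj₁ (λ E → entryAt E zero) ⟧ (ext p ρ) σ ≈ price (letter p) μ (letter q)
            -- Every entry has a nonempty hedge, so at an empty arc only `isMark` contributes.
            go [] e = ≈-trans (+-cong (true⁺ (isMark zero) (ext p ρ) σ (mark⁺ (ext p ρ) σ zero pq (adj′ e)))
                (≈-trans entries-sem (∑-0∈ entries λ {(x , a , μ , b)} k → ≈-trans (*-congʳ (≈-trans (*-congˡ (≈-trans (*-congʳ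
                  (reflexive ([]-no (μ ≟ᴴ pst (suc p)) λ eq′ → proj₂ (All.lookup entries-plain k) (trans eq′ e)))) (zeroˡ _))) (zeroʳ _))) (zeroˡ _))))
              (+-identityʳ _)
            go μ@(_ ∷ _) e = ≈-trans (+-cong (false⁺ (isMark zero) (ext p ρ) σ λ h → ∷≢[] (trans (sym e) (proj₂ (proj₂ (mark⁻ (ext p ρ) σ zero h)))))
                (≈-trans entries-sem (reflexive (cong (λ μ → ∑ entries λ (x , a′ , μ′ , b′) → ([ a′ ≟ letter p ] * ([ μ′ ≟ᴴ μ ] * [ b′ ≟ letter q ])) * x) e))))
              (+-identityˡ _)

      -- The whole price of an arc is paid at its call; returns and internal positions contribute 1.
      product : ∀ {i j} (s : Nest i j) → Fits ν s → Good letter pst s → pst j ≡ [] → ∀ {ρ σ} →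
        ∏ (positions s) (λ p → ⟦ atPosition ⟧ (ext p ρ) σ) ≈ weight letter s
      product (nil _) _ _ _ = ≈-refl
      product (int p _ s) (a , b , f) (g , gs) e {ρ} {σ} = ≈-trans (*-cong (noCall p a ρ σ) (product s f gs e)) (*-identityˡ _)
      product (call p q _ s s′) ((a , u , b) , (d , _) , f , f′) (g , z , gs , gs′) e {ρ} {σ} = *-cong
        (≈-trans (callAt (mkCall a u b g s (Good-hedge letter s gs z)))
          (reflexive (cong (λ μ → price (letter p) μ (letter q)) (Good-hedge letter s gs z))))
        (≈-trans (∏-++ (positions s) _ _) (*-cong (product s f gs z)
          (≈-trans (*-cong (noCall q d ρ σ) (product s′ f′ gs′ e)) (*-identityˡ _))))
        where
        callAt : At p → ⟦ atPosition ⟧ (ext p ρ) σ ≈ price (letter p) (pst (suc p)) (letter q)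
        callAt (at-ret _ _ h _) = absurd a (h q)
        callAt (at-int h _ _) = absurd a (h q)
        callAt (at-call q′ pq′ u′ _ _ adj adj′) with u′ q a
        ... | refl = call-sem p q a u b adj adj′

      private
        first⁺ : ∀ {f} (ρ : Env₁ f) (σ : Env₂ 0) x → toℕ (ρ x) ≡ 0 → Sat (isFirst x) ρ σ
        first⁺ ρ σ x e = ¬⁺ (∃₁ (zero <ᶜ suc x)) λ h → let (k , h′) = ∃⁻ (zero <ᶜ suc x) h in
          ℕₚ.n≮0 (subst (toℕ k ℕ.<_) e (<⁻ (ext k ρ) σ zero (suc x) h′))

        first⁻ : ∀ {f} (ρ : Env₁ f) (σ : Env₂ 0) x (k : Fin n) → toℕ k ℕ.< toℕ (ρ x) → ¬ Sat (isFirst x) ρ σ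
        first⁻ ρ σ x k lt h = ¬⁻ (∃₁ (zero <ᶜ suc x)) h (∃⁺ (zero <ᶜ suc x) k (<⁺ (ext k ρ) σ zero (suc x) lt))

      atStart-first : ∀ p → toℕ p ≡ 0 → ∀ {ρ σ} → ⟦ atStart ⟧ (ext p ρ) σ ≈ final (pst (inject₁ p))
      atStart-first p e {ρ} {σ} = ≈-trans (+-cong
          (false⁺ notFirst (ext p ρ) σ λ h → ¬⁻ (isFirst zero) h (first⁺ (ext p ρ) σ zero e))
          (choice-sem root proj₁ startAt (λ (_ , μ) → [ μ ≟ᴴ pst (inject₁ p) ]) (ext p ρ) σ λ {(_ , μ)} k →
            let pl = All.lookup root-plain k in 𝟙-dec _ (μ ≟ᴴ pst (inject₁ p))
              (λ h → sym (from⁻ μ pl (ext p ρ) σ zero (proj₂ (∧⁻ (isFirst zero) (hedgeFrom μ zero) (holds h)))))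
              (λ h → true! (∧⁺ (isFirst zero) (hedgeFrom μ zero) (first⁺ (ext p ρ) σ zero e) (from⁺ μ pl (ext p ρ) σ zero (sym h))))))
        (+-identityˡ _)

      atStart-later : ∀ p (k : Fin n) → toℕ k ℕ.< toℕ p → ∀ {ρ σ} → ⟦ atStart ⟧ (ext p ρ) σ ≈ 1#
      atStart-later p k lt {ρ} {σ} = ≈-trans (+-cong
          (true⁺ notFirst (ext p ρ) σ (¬⁺ (isFirst zero) (first⁻ (ext p ρ) σ zero k lt)))
          (≈-trans (choice-sem root proj₁ startAt (λ _ → 0#) (ext p ρ) σ λ {(_ , μ)} _ → reflexive (cong 𝟙 (false! _ λ h →
            first⁻ (ext p ρ) σ zero k lt (proj₁ (∧⁻ (isFirst zero) (hedgeFrom μ zero) h))))) (∑-0 root λ _ → zeroˡ _)))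
        (+-identityʳ _)

    formula-sem : ∀ a w M pr → let nw = mkNW (a ∷ w) tt M pr in (t : Nest zero (fromℕ (suc (length w)))) → Fits (rel M) t → ∀ ρ σ →
      Semantics.⟦_⟧ nw formula ρ σ ≈ final (hedge (lookup (a ∷ w)) t) * weight (lookup (a ∷ w)) t
    formula-sem a w M pr t fit ρ σ = ≈-trans (*-comm _ _) (*-cong
        (≈-trans (*-cong (≈-trans (atStart-first nw t fit zero refl) (reflexive (cong final (label-start letter t))))
          (≈-trans (reflexive (∏-map suc (allFin (length w)) _)) (∏-1 (allFin (length w)) λ k → atStart-later nw t fit (suc k) zero (s≤s z≤n))))
          (*-identityʳ _))
        (≈-trans (reflexive (cong (λ ps → ∏ ps (λ p → Semantics.⟦_⟧ nw atPosition (ext p ρ) σ)) (sym (positions-full t))))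
          (product nw t fit t fit (label-Good letter t) (label-end letter t))))
      where
      nw = mkNW (a ∷ w) tt M pr
      letter = lookup (a ∷ w)

    weight⇒Cond3 : ∀ S → S [] ≈ 0# →
      (∀ a w → S (a ∷ w) ≈ ∑ᵗ zero (fromℕ (suc (length w))) λ t → final (hedge (lookup (a ∷ w)) t) * weight (lookup (a ∷ w)) t) → Cond3 K m S
    weight⇒Cond3 S S[] S∷ = formula , formula-sRFO , λ
      { [] → ≈-sym S[]
      ; (a ∷ w) → ≈-trans (∑-nestings semiring λ M p → Semantics.⟦_⟧ (mkNW (a ∷ w) tt M p) formula (λ ()) (λ ()))
          (≈-trans (∑-cong (nests (suc (length w)) zero (fromℕ _)) λ t → formula-sem a w (toRel t) (toRel-isNest t) t (Fits-toRel t) (λ ()) (λ ())) (≈-sym (S∷ a w))) }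

-- Coding derivations by nestings.

module Coding {c ℓ} (K : CommutativeSemiring c ℓ) (m : ℕ) where
  open import Data.Nat using (s≤s; z≤n)

  open import Data.Fin using (_≟_)
  open import Data.List using (map; length; lookup; _++_; concatMap)
  open import Data.List.Relation.Unary.All using (All; []; _∷_)
  open import Relation.Binary.PropositionalEquality using (refl; cong; cong₂; sym; trans)
  open import Defs using (allFin; Cond3)
  open FiniteSum
  open Matrix
  open Tree
  open Expression K m
  open Definable K m using (Item; letter′; mark; hole; Hedge; tag; enclose; _≟ᴴ_; hedge; Entry; module Weight; Plain; module Formula)

  open CommutativeSemiring K hiding (zero) renaming (Carrier to C; refl to ≈-refl; sym to ≈-sym; trans to ≈-trans)
  open Sums semiring
  open import Algebra.Properties.CommutativeSemigroup *-commutativeSemigroup using () renaming (x∙yz≈y∙xz to comm₃; interchange to exchange)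
  open Points K
  open TreeSum semiring

  data Full {V : Set} : ℕ → Mono V → Set where
    full-zero : ∀ {u} → Full zero u
    full-suc : ∀ {k a u} → Full k u → Full (suc k) (inj₁ a ∷ u)

  Full-weaken : ∀ {V : Set} {k l} {u : Mono V} → k ℕ.≤ l → Full l u → Full k u
  Full-weaken z≤n f = full-zero
  Full-weaken (s≤s le) (full-suc f) = full-suc (Full-weaken le f)

  -- The outer letters a and b become the ends of the arc that spans a factor derived from the
  -- variable, and u is what the arc encloses.
  Framed : Set → Set c
  Framed V = C × Fin m × Mono V × Fin m

  unframe : ∀ {V} → Framed V → C × Mono V
  unframe (x , a , u , b) = x , inj₁ a ∷ (u ++ inj₁ b ∷ [])

  module _ {N : ℕ} where
    plain : Mono (Fin N) → Hedge
    plain [] = []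
    plain (inj₁ a ∷ u) = letter′ a ∷ plain u
    plain (inj₂ X ∷ u) = hole (just (toℕ X)) ∷ plain u

    -- The two letters after the first i become the ends of an empty arc. The word that is read
    -- stays the same, while its tag becomes i. The last clause covers monomials with too few
    -- leading letters, which `Full` excludes.
    insert : ℕ → Mono (Fin N) → Hedge
    insert zero (inj₁ a ∷ inj₁ b ∷ u) = mark a b ∷ plain u
    insert (suc i) (inj₁ a ∷ u) = letter′ a ∷ insert i u
    insert _ u = plain u

    tag-insert : ∀ i {u} → Full (suc (suc i)) u → tag (insert i u) ≡ just i
    tag-insert zero (full-suc (full-suc f)) = refl
    tag-insert (suc i) (full-suc f) = cong (Maybe.map suc) (tag-insert i f)

    insert-nonempty : ∀ i {u} → Full (suc (suc i)) u → insert i u ≢ []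
    insert-nonempty zero (full-suc (full-suc f)) ()
    insert-nonempty (suc i) (full-suc f) ()

    plain-Plain : ∀ u → Plain (plain u)
    plain-Plain [] = tt
    plain-Plain (inj₁ a ∷ u) = plain-Plain u
    plain-Plain (inj₂ X ∷ u) = plain-Plain u

    insert-Plain : ∀ i {u} → Full (suc (suc i)) u → Plain (insert i u)
    insert-Plain zero {_ ∷ _ ∷ u} (full-suc (full-suc f)) = plain-Plain u
    insert-Plain (suc i) (full-suc f) = insert-Plain i f

  module Code {N : ℕ} (E : Fin N → List (Framed (Fin N))) (E₀ : Expr (Fin N))
    (E-full : ∀ X → All (λ (_ , _ , u , _) → Full (suc N) u) (E X)) where

    private
      -- The mark of variable i takes i + 2 letters, which is at most N + 1.
      E-full′ : ∀ X → All (λ (_ , _ , u , _) → Full (suc (suc (toℕ X))) u) (E X)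
      E-full′ X = All.map (Full-weaken (s≤s (Finₚ.toℕ<n X))) (E-full X)

    code : Fin N → Framed (Fin N) → Entry
    code X (x , a , u , b) = x , a , insert (toℕ X) u , b

    entries : List Entry
    entries = concatMap (λ X → map (code X) (E X)) (allFin N)

    root : List (C × Hedge)
    root = map (λ (x , u) → x , plain u) E₀

    entries-plain : All (λ (_ , _ , μ , _) → Plain μ × μ ≢ []) entries
    entries-plain = Allₚ.concat⁺ (Allₚ.map⁺ (All.universal (λ X → Allₚ.map⁺ (All.map (λ f → insert-Plain (toℕ X) f , insert-nonempty (toℕ X) f) (E-full′ X))) (allFin N)))

    root-plain : All (Plain ∘ proj₂) root
    root-plain = Allₚ.map⁺ (All.universal (λ (_ , u) → plain-Plain u) E₀)

    open Weight entries root

    private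
      ft-N = ft-Fin N

      case : ∀ {P Q R : Set} (d : Dec P) (e : Dec Q) (f : Dec R) → (P → Q × R) → (Q → R → P) → [ d ] ≈ [ e ] * [ f ]
      case (yes p) (yes q) (yes r) to from = ≈-sym (*-identityˡ _)
      case (yes p) (no q) _ to from = ⊥-elim (q (proj₁ (to p)))
      case (yes p) (yes _) (no r) to from = ⊥-elim (r (proj₂ (to p)))
      case (no p) (yes q) (yes r) to from = ⊥-elim (p (from q r))
      case (no p) (yes q) (no r) to from = ≈-sym (*-identityˡ _)
      case (no p) (no q) _ to from = ≈-sym (zeroˡ _)

      never : ∀ {P : Set} (d : Dec P) x → (P → ⊥) → [ d ] * x ≈ 0#
      never d x ne = ≈-trans (*-congʳ (reflexive ([]-no d ne))) (zeroˡ _)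

      letter-injective : ∀ {a b} → _≡_ {A = Item} (letter′ a) (letter′ b) → a ≡ b
      letter-injective refl = refl

      hole-injective : ∀ {i j} → _≡_ {A = Item} (hole i) (hole j) → i ≡ j
      hole-injective refl = refl

    -- The tag of the contents of an arc determines the variable: by `tag-insert`, entries of other
    -- variables have other tags, so the sum over all entries shrinks to those of X.
    hole-price : ∀ X a μ b → [ hole (just (toℕ X)) ∷ [] ≟ᴴ enclose a μ b ∷ [] ] * price a μ b ≈
      ∑ (E X) λ (x , a′ , u , b′) → ([ a′ ≟ a ] * ([ insert (toℕ X) u ≟ᴴ μ ] * [ b′ ≟ b ])) * x
    hole-price X a [] b = ≈-trans (never (hole (just (toℕ X)) ∷ [] ≟ᴴ mark a b ∷ []) _ λ ()) (≈-sym (∑-0∈ (E X) λ {(x , a′ , u , b′)} k →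
      ≈-trans (*-congʳ (≈-trans (*-congˡ (never (insert (toℕ X) u ≟ᴴ []) _ (insert-nonempty (toℕ X) (All.lookup (E-full′ X) k)))) (zeroʳ _))) (zeroˡ _)))
    hole-price X a μ@(_ ∷ _) b = ≈-trans (*-congˡ (≈-trans (∑-concatMap (λ Y → map (code Y) (E Y)) (allFin N) _)
        (∑-cong (allFin N) λ Y → reflexive (∑-map (code Y) (E Y) _))))
      (≈-trans (∑-*ˡ (allFin N) _ _) (≈-trans (∑-only (allFin-uniq N) (allFin-mem X) _ λ Y ne → ≈-trans (∑-*ˡ (E Y) _ _)
          (∑-0∈ (E Y) λ {(x , a′ , u , b′)} k → ≈-trans (≈-sym (*-assoc _ _ _)) (≈-trans (*-congʳ (other Y u ne (All.lookup (E-full′ Y) k))) (zeroˡ _))))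
        (≈-trans (∑-*ˡ (E X) _ _) (∑-cong∈ (E X) λ {(x , a′ , u , b′)} k → ≈-trans (≈-sym (*-assoc _ _ _)) (*-congʳ (same u (All.lookup (E-full′ X) k)))))))
      where
      d = hole (just (toℕ X)) ∷ [] ≟ᴴ enclose a μ b ∷ []
      tag≡ : hole (just (toℕ X)) ∷ [] ≡ enclose a μ b ∷ [] → just (toℕ X) ≡ tag μ
      tag≡ h = hole-injective (Listₚ.∷-injectiveˡ h)
      other : ∀ Y u {p q : C} → X ≢ Y → Full (suc (suc (toℕ Y))) u → [ d ] * (p * ([ insert (toℕ Y) u ≟ᴴ μ ] * q)) ≈ 0#
      other Y u ne f with insert (toℕ Y) u ≟ᴴ μ
      ... | no _ = ≈-trans (*-congˡ (≈-trans (*-congˡ (zeroˡ _)) (zeroʳ _))) (zeroʳ _)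
      ... | yes e = never d _ λ h → ne (Finₚ.toℕ-injective (Maybeₚ.just-injective (trans (tag≡ h) (trans (cong tag (sym e)) (tag-insert (toℕ Y) f)))))
      same : ∀ u {p q : C} → Full (suc (suc (toℕ X))) u → [ d ] * (p * ([ insert (toℕ X) u ≟ᴴ μ ] * q)) ≈ p * ([ insert (toℕ X) u ≟ᴴ μ ] * q)
      same u f with insert (toℕ X) u ≟ᴴ μ
      ... | no _ = let z = ≈-trans (*-congˡ (zeroˡ _)) (zeroʳ _) in ≈-trans (*-congˡ z) (≈-trans (zeroʳ _) (≈-sym z))
      ... | yes e = ≈-trans (*-congʳ (reflexive ([]-yes d (cong (λ τ → hole τ ∷ []) (trans (sym (tag-insert (toℕ X) f)) (cong tag e)))))) (*-identityˡ _)

    module _ {n : ℕ} (letter : Fin n → Fin m) where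
      open Val letter

      -- The total weight of the nestings of each span whose top-level word is ν. The lemmas below
      -- show that it is multiplicative in ν, so that hedges behave like monomials.
      H : Hedge → Mat n
      H ν i j = ∑ᵗ i j λ t → [ ν ≟ᴴ hedge letter t ] * weight letter t

      private
        P = allFin n

        ⊛-Λ-⊛ : ∀ (M : Mat n) b (R : Mat n) i j → (M ⊛ (Λ letter b ⊛ R)) i j ≈ ∑ P λ q → M i (inject₁ q) * ([ letter q ≟ b ] * R (suc q) j)
        ⊛-Λ-⊛ M b R i j = ≈-trans (∑-cong (allFin (suc n)) λ k → ≈-trans (*-congˡ (Λ-⊛ letter b R k j)) (∑-*ˡ P _ _))
          (≈-trans (∑-swap (allFin (suc n)) P _) (∑-cong P λ q → ≈-trans (∑-cong (allFin (suc n)) λ k → comm₃ _ _ _)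
            (∑-δ (ft-Fin (suc n)) (inject₁ q) λ k → M i k * ([ letter q ≟ b ] * R (suc q) j))))

        no-sum : ∀ {a} {A : Set a} (xs : List A) → ∑ xs (λ _ → 0#) ≈ 0#
        no-sum xs = ∑-0 xs λ _ → ≈-refl

        nothing-there : ∀ (i j : Fin (suc n)) → ∑ P (λ p → [ inject₁ p ≟ i ] * (∑ᵗ (suc p) j (λ _ → 0#) + ∑ P λ q → ∑ᵗ (suc p) (inject₁ q) λ _ → ∑ᵗ (suc q) j λ _ → 0#)) ≈ 0#
        nothing-there i j = ∑-0 P λ p → ≈-trans (*-congˡ (≈-trans (+-cong (no-sum (nests n (suc p) j))
          (∑-0 P λ q → ∑-0 (nests n (suc p) (inject₁ q)) λ _ → no-sum (nests n (suc q) j))) (+-identityˡ _))) (zeroʳ _)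

      H-[] : H [] ≋ 𝕄ₙ.1#
      H-[] i j = ≈-trans (∑ᵗ-step i j (λ _ → *-identityˡ _) (λ p e t → zeroˡ _) (λ p q e t t′ → zeroˡ _))
        (≈-trans (+-cong (*-identityʳ _) (nothing-there i j)) (+-identityʳ _))

      H-letter : ∀ a ν → H (letter′ a ∷ ν) ≋ Λ letter a ⊛ H ν
      H-letter a ν i j = ≈-trans (∑ᵗ-step i j (λ _ → zeroˡ _)
          (λ p e t → ≈-trans (*-congʳ (case (letter′ a ∷ ν ≟ᴴ letter′ (letter p) ∷ hedge letter t) (letter p ≟ a) (ν ≟ᴴ hedge letter t)
            (λ h → sym (letter-injective (Listₚ.∷-injectiveˡ h)) , Listₚ.∷-injectiveʳ h) (λ h h′ → cong₂ (λ a ν → letter′ a ∷ ν) (sym h) h′))) (*-assoc _ _ _))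
          (λ p q e t t′ → never (letter′ a ∷ ν ≟ᴴ enclose (letter p) (hedge letter t) (letter q) ∷ hedge letter t′) _
            λ h → not-letter (hedge letter t) (Listₚ.∷-injectiveˡ h)))
        (≈-trans (+-congʳ (zeroʳ _)) (≈-trans (+-identityˡ _) (≈-trans (∑-cong P λ p → *-congˡ (≈-trans
            (+-cong (≈-sym (∑-*ˡ (nests n (suc p) j) _ _)) (∑-0 P λ q → ∑-0 (nests n (suc p) (inject₁ q)) λ _ → no-sum (nests n (suc q) j))) (+-identityʳ _)))
          (≈-sym (Λ-⊛ letter a (H ν) i j)))))
        where
        not-letter : ∀ {a b d} μ → letter′ d ≡ enclose a μ b → ⊥
        not-letter [] ()
        not-letter (_ ∷ _) ()

      private
        -- An item that is no letter is read off the arc at the beginning of the span.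
        H-arc : ∀ item ν {A : Set c} (xs : List A) (x : A → C) (a b : A → Fin m) (μ : A → Hedge) → (∀ {a} → item ≢ letter′ a) →
          (∀ a′ κ b′ → [ item ∷ [] ≟ᴴ enclose a′ κ b′ ∷ [] ] * price a′ κ b′ ≈ ∑ xs λ y → ([ a y ≟ a′ ] * ([ μ y ≟ᴴ κ ] * [ b y ≟ b′ ])) * x y) →
          ∀ i j → H (item ∷ ν) i j ≈ ∑ xs λ y → x y * (Λ letter (a y) ⊛ (H (μ y) ⊛ (Λ letter (b y) ⊛ H ν))) i j
        H-arc item ν xs x a b μ notLetter pays i j = ≈-trans (∑ᵗ-step i j (λ _ → zeroˡ _)
            (λ p e t → never (item ∷ ν ≟ᴴ letter′ (letter p) ∷ hedge letter t) _ λ h → notLetter (Listₚ.∷-injectiveˡ h))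
            (λ p q e t t′ → ≈-trans (*-congʳ (case (item ∷ ν ≟ᴴ enclose (letter p) (hedge letter t) (letter q) ∷ hedge letter t′)
                (item ∷ [] ≟ᴴ enclose (letter p) (hedge letter t) (letter q) ∷ []) (ν ≟ᴴ hedge letter t′)
                (λ h → cong (_∷ []) (Listₚ.∷-injectiveˡ h) , Listₚ.∷-injectiveʳ h) (λ h h′ → cong₂ _∷_ (Listₚ.∷-injectiveˡ h) h′)))
              (≈-trans (exchange _ _ _ _) (≈-trans (*-congʳ (≈-trans (pays (letter p) (hedge letter t) (letter q)) (∑-cong xs λ y → *-congʳ (*-cong (flip (a y) (letter p)) (*-congˡ (flip (b y) (letter q)))))))
                (≈-trans (∑-*ʳ xs _ _)
                (∑-cong xs λ y → rearrange _ _ _ _ _ _ _))))))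
          (≈-trans (+-congʳ (zeroʳ _)) (≈-trans (+-identityˡ _) (≈-trans (∑-cong P λ p → *-congˡ (≈-trans (+-cong (no-sum (nests n (suc p) j))
              (≈-trans (∑-cong P λ q → ≈-trans (∑-cong (nests n (suc p) (inject₁ q)) λ t → ∑-swap (nests n (suc q) j) xs _)
                  (≈-trans (∑-swap (nests n (suc p) (inject₁ q)) xs _) (∑-cong xs λ y →
                    ≈-trans (∑-cong (nests n (suc p) (inject₁ q)) λ t → ≈-sym (∑-*ˡ (nests n (suc q) j) _ _)) (≈-trans (≈-sym (∑-*ˡ (nests n (suc p) (inject₁ q)) _ _))
                      (*-congˡ (≈-trans (∑-*-∑ (nests n (suc p) (inject₁ q)) (nests n (suc q) j) _ _)
                        (*-congˡ (≈-sym (∑-*ˡ (nests n (suc q) j) _ _)))))))))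
                (≈-trans (∑-swap P xs _) (∑-cong xs λ y → ≈-sym (∑-*ˡ P _ _))))) (+-identityˡ _)))
            (≈-trans (∑-cong P λ p → ∑-*ˡ xs _ _) (≈-trans (∑-swap P xs _) (∑-cong xs λ y →
              ≈-trans (∑-cong P λ p → ≈-trans (*-congˡ (≈-trans (*-assoc _ _ _) (*-congˡ (*-congˡ (≈-sym (⊛-Λ-⊛ (H (μ y)) (b y) (H ν) (suc p) j)))))) 
                (shift _ _ _ _))
              (≈-trans (≈-sym (∑-*ˡ P _ _)) (*-congˡ (≈-sym (Λ-⊛ letter (a y) (H (μ y) ⊛ (Λ letter (b y) ⊛ H ν)) i j))))))))))
          where
          flip : ∀ a a′ → [ a ≟ a′ ] ≈ [ a′ ≟ a ]
          flip a a′ = reflexive ([]-iff (a ≟ a′) (a′ ≟ a) sym sym)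
          shift : ∀ s x a r → s * (x * (a * r)) ≈ x * (s * (a * r))
          shift s x a r = comm₃ s x (a * r)
          rearrange : ∀ (A M B x D w w′ : C) → ((A * (M * B)) * x) * (D * (w * w′)) ≈ (x * A) * ((M * w) * (B * (D * w′)))
          rearrange A M B x D w w′ = begin
            ((A * (M * B)) * x) * (D * (w * w′))     ≈⟨ *-congʳ (*-comm _ _) ⟩
            (x * (A * (M * B))) * (D * (w * w′))     ≈⟨ *-congʳ (≈-sym (*-assoc _ _ _)) ⟩
            ((x * A) * (M * B)) * (D * (w * w′))     ≈⟨ *-assoc _ _ _ ⟩
            (x * A) * ((M * B) * (D * (w * w′)))     ≈⟨ *-congˡ (*-congˡ (comm₃ D w w′)) ⟩
            (x * A) * ((M * B) * (w * (D * w′)))     ≈⟨ *-congˡ (exchange M B w _) ⟩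
            (x * A) * ((M * w) * (B * (D * w′)))     ∎
            where open import Relation.Binary.Reasoning.Setoid setoid

      G : Fin N → Mat n
      G X i j = ∑ (E X) λ (x , a , u , b) → x * (Λ letter a ⊛ (H (insert (toℕ X) u) ⊛ Λ letter b)) i j

      H-mark : ∀ a b ν → H (mark a b ∷ ν) ≋ Λ letter a ⊛ (Λ letter b ⊛ H ν)
      -- An empty arc is handled as a single entry with empty contents and coefficient 1, for which
      -- `H-[]` supplies the identity matrix.
      H-mark a b ν i j = ≈-trans (H-arc (mark a b) ν {A = Entry} ((1# , a , [] , b) ∷ []) proj₁ (λ (_ , a , _) → a) (λ (_ , _ , _ , b) → b) (λ (_ , _ , μ , _) → μ) (λ ()) pays i j)
        (≈-trans (+-identityʳ _) (≈-trans (*-identityˡ _) (𝕄ₙ.*-congˡ {Λ letter a} (𝕄ₙ.trans (𝕄ₙ.*-congʳ {Λ letter b ⊛ H ν} H-[]) (𝕄ₙ.*-identityˡ (Λ letter b ⊛ H ν))) i j)))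
        where
        pays : ∀ a′ κ b′ → [ mark a b ∷ [] ≟ᴴ enclose a′ κ b′ ∷ [] ] * price a′ κ b′ ≈ ([ a ≟ a′ ] * ([ [] ≟ᴴ κ ] * [ b ≟ b′ ])) * 1# + 0#
        pays a′ [] b′ = ≈-trans (*-identityʳ _) (≈-trans (case (mark a b ∷ [] ≟ᴴ mark a′ b′ ∷ []) (a ≟ a′) (b ≟ b′) (λ { refl → refl , refl }) (λ { refl refl → refl }))
          (≈-sym (≈-trans (+-identityʳ _) (≈-trans (*-identityʳ _) (*-congˡ (*-identityˡ _))))))
        pays a′ (_ ∷ _) b′ = ≈-trans (zeroˡ _) (≈-sym (≈-trans (+-identityʳ _) (≈-trans (*-identityʳ _) (≈-trans (*-congˡ (zeroˡ _)) (zeroʳ _)))))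

      H-hole : ∀ X ν → H (hole (just (toℕ X)) ∷ ν) ≋ G X ⊛ H ν
      H-hole X ν i j = ≈-trans (H-arc (hole (just (toℕ X))) ν (E X) proj₁ (λ (_ , a , _) → a) (λ (_ , _ , _ , b) → b) (λ (_ , _ , u , _) → insert (toℕ X) u) (λ ()) (hole-price X) i j)
        (≈-sym (≈-trans (∑-cong (allFin (suc n)) λ k → ≈-trans (∑-*ʳ (E X) _ _) (∑-cong (E X) λ _ → *-assoc _ _ _))
          (≈-trans (∑-swap (allFin (suc n)) (E X) _) (∑-cong (E X) λ (x , a , u , b) → ≈-trans (≈-sym (∑-*ˡ (allFin (suc n)) _ _))
            (*-congˡ (𝕄ₙ.trans (𝕄ₙ.*-assoc (Λ letter a) (H (insert (toℕ X) u) ⊛ Λ letter b) (H ν))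
              (𝕄ₙ.*-congˡ {Λ letter a} (𝕄ₙ.*-assoc (H (insert (toℕ X) u)) (Λ letter b) (H ν))) i j))))))

      H-plain : ∀ u → H (plain u) ≋ mon G u
      H-plain [] = H-[]
      H-plain (inj₁ a ∷ u) = 𝕄ₙ.trans (H-letter a (plain u)) (𝕄ₙ.*-congˡ {Λ letter a} (H-plain u))
      H-plain (inj₂ X ∷ u) = 𝕄ₙ.trans (H-hole X (plain u)) (𝕄ₙ.*-congˡ {G X} (H-plain u))

      H-insert : ∀ i {u} → Full (suc (suc i)) u → H (insert i u) ≋ mon G u
      H-insert zero {inj₁ a ∷ inj₁ b ∷ u} (full-suc (full-suc f)) = 𝕄ₙ.trans (H-mark a b (plain u)) (𝕄ₙ.*-congˡ {Λ letter a} (𝕄ₙ.*-congˡ {Λ letter b} (H-plain u)))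
      H-insert (suc i) {inj₁ a ∷ u} (full-suc f) = 𝕄ₙ.trans (H-letter a (insert i u)) (𝕄ₙ.*-congˡ {Λ letter a} (H-insert i f))

      system : Fin N → Expr (Fin N)
      system X = map unframe (E X)

      -- Reading the mark back as two letters shows the arcs of X to be the derivation steps of X.
      -- So `G` solves the system, and the uniqueness of triangular solutions identifies it with any
      -- other solution.
      G-eq : ∀ X → G X ≋ val G (system X)
      G-eq X i j = ≈-trans (∑-cong∈ (E X) λ {(x , a , u , b)} k → *-congˡ (𝕄ₙ.*-congˡ {Λ letter a}
          (𝕄ₙ.trans (𝕄ₙ.*-cong (H-insert (toℕ X) (All.lookup (E-full′ X) k)) (𝕄ₙ.sym (𝕄ₙ.*-identityʳ (Λ letter b)))) (𝕄ₙ.sym (mon-++ G u (inj₁ b ∷ [])))) i j))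
        (≈-sym (reflexive (∑-map unframe (E X) _)))

      Band-H : ∀ ν → Band 0 (H ν)
      Band-H ν i j lt = ∑ᵗ-below (λ t → [ ν ≟ᴴ hedge letter t ] * weight letter t) lt

      Band-G : ∀ X → Band 0 (G X)
      Band-G X i j lt = ∑-0 (E X) λ (x , a , u , b) → ≈-trans (*-congˡ
        (Band-⊛ {k = 0} {0} {Λ letter a} {H (insert (toℕ X) u) ⊛ Λ letter b} (Λ-Band₀ a)
          (Band-⊛ {k = 0} {0} {H (insert (toℕ X) u)} {Λ letter b} (Band-H (insert (toℕ X) u)) (Λ-Band₀ b)) i j lt)) (zeroʳ _)
        where
        Λ-Band₀ : ∀ a → Band 0 (Λ letter a)
        Λ-Band₀ a = Band-weaken {k = 1} {M = Λ letter a} z≤n (Λ-Band letter a)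

      sum-final : ∀ {T : Fin N → Mat n} → (∀ X → Band 0 (T X)) → (∀ X → T X ≋ val T (system X)) → ∀ i j →
        (∑ᵗ i j λ t → final (hedge letter t) * weight letter t) ≈ val T E₀ i j
      sum-final {T} bT eT i j = ≈-trans (∑-cong (nests n i j) λ t → ≈-trans (∑-*ʳ root _ _) (reflexive (∑-map _ E₀ _)))
        (≈-trans (∑-swap (nests n i j) E₀ _) (∑-cong E₀ λ (x , u) → ≈-trans (∑-cong (nests n i j) λ t → ≈-trans (*-congʳ (*-comm _ _)) (*-assoc _ _ _))
          (≈-trans (≈-sym (∑-*ˡ (nests n i j) _ _)) (*-congˡ (≈-trans (H-plain u i j) (mon-cong G≋T u i j))))))
        where
        G≋T : ∀ X → G X ≋ T X
        G≋T = solution-unique letter system (λ X → Allₚ.map⁺ (All.universal (λ _ → start) (E X))) Band-G bT G-eq eT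

    open Formula entries root entries-plain root-plain

    -- The solution of the normal form may be given on each word separately, as a family of
    -- matrices; the new variables need not come from series chosen beforehand.
    normal-form⇒Cond3 : ∀ S → S [] ≈ 0# →
      (∀ a w → Σ (Fin N → Mat (suc (length w))) λ T → (∀ X → Band 0 (T X)) × (∀ X → T X ≋ Val.val (lookup (a ∷ w)) T (map unframe (E X))) ×
        S (a ∷ w) ≈ Val.val (lookup (a ∷ w)) T E₀ zero (fromℕ (suc (length w)))) → Cond3 K m S
    normal-form⇒Cond3 S S[] h = weight⇒Cond3 S S[] λ a w → let (T , bT , eT , e) = h a w in
      ≈-trans e (≈-sym (sum-final (lookup (a ∷ w)) bT eT zero (fromℕ (suc (length w)))))

-- The normal form of algebraic systems.

module NormalForm {c ℓ} (K : CommutativeSemiring c ℓ) (m : ℕ) where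
  open import Data.Nat using (z≤n)

  open import Data.Bool using (if_then_else_)
  open import Data.Fin using (_≟_)
  open import Data.List using (map; length; lookup; _++_; concatMap; _∷ʳ_; initLast; _∷ʳ′_)
  open import Data.List.Relation.Unary.All using (All; []; _∷_)
  open import Data.List.Relation.Unary.Any using (index)
  open import Data.List.Relation.Unary.Any.Properties using (lookup-index)
  open import Relation.Binary.PropositionalEquality using (refl; cong; cong₂; sym; trans; subst)
  open import Defs using (allFin; Polynomial; Algebraic; Cond3)
  open FiniteSum
  open Matrix
  open Expression K m
  open Coding K m using (Full; full-zero; full-suc; Framed; unframe; module Code)

  open CommutativeSemiring K hiding (zero) renaming (Carrier to C; refl to ≈-refl; sym to ≈-sym; trans to ≈-trans)
  open Sums semiring
  open Points K

  private variable
    V V′ : Set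

  var : V → Mono V
  var X = inj₂ X ∷ []

  single : V → Expr V
  single X = (1# , var X) ∷ []

  data NonEmpty {V : Set} : Mono V → Set where
    nonEmpty : ∀ {x u} → NonEmpty (x ∷ u)

  data End {V : Set} : Mono V → Set where
    end : ∀ {a} → End (inj₁ a ∷ [])
    _∷_ : ∀ x {u} → End u → End (x ∷ u)

  -- Substitution puts letters only where a variable stands, so a word of letters keeps its length;
  -- `lead-nil` admits it although it is short.
  data Lead {V : Set} : ℕ → Mono V → Set where
    lead-zero : ∀ {u} → Lead zero u
    lead-nil : ∀ {k} → Lead k []
    lead-suc : ∀ {k a u} → Lead k u → Lead (suc k) (inj₁ a ∷ u)

  AllE-prep : ∀ {p q} {P : Mono V → Set p} {Q : Mono V → Set q} {a E} → (∀ {u} → P u → Q (inj₁ a ∷ u)) → AllE P E → AllE Q (prep a E)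
  AllE-prep f aE = Allₚ.map⁺ (All.map f aE)

  private
    any-mono : (E : Expr V) → AllE (λ _ → ⊤) E
    any-mono E = All.universal (λ _ → tt) E

  Start-++ : ∀ {u v : Mono V} → Start u → Start (u ++ v)
  Start-++ start = start

  End-++ : ∀ {u : Mono V} v → End u → End (v ++ u)
  End-++ [] e = e
  End-++ (x ∷ v) e = x ∷ End-++ v e

  Start-subM : ∀ (σ : V → Expr V′) {u} → Start u → AllE Start (subM σ u)
  Start-subM σ {inj₁ a ∷ u} start = AllE-prep {P = λ _ → ⊤} (λ _ → start) (any-mono (subM σ u))

  Start-subM′ : ∀ (σ : V → Expr V′) → (∀ X → AllE Start (σ X)) → ∀ {u} → NonEmpty u → AllE Start (subM σ u)
  Start-subM′ σ h {inj₁ a ∷ u} nonEmpty = Start-subM σ {inj₁ a ∷ u} start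
  Start-subM′ σ h {inj₂ X ∷ u} nonEmpty = AllE-⊗ {Q = λ _ → ⊤} (λ s _ → Start-++ s) (h X) (any-mono (subM σ u))

  End-subM : ∀ (σ : V → Expr V′) {u} → End u → AllE End (subM σ u)
  End-subM σ end = end ∷ []
  End-subM σ (inj₁ a ∷ e) = AllE-prep (inj₁ a ∷_) (End-subM σ e)
  End-subM σ (inj₂ X ∷ e) = AllE-⊗ {P = λ _ → ⊤} (λ {u} _ → End-++ u) (any-mono (σ X)) (End-subM σ e)

  End-subM′ : ∀ (σ : V → Expr V′) → (∀ X → AllE End (σ X)) → ∀ {u} → NonEmpty u → AllE End (subM σ u)
  End-subM′ σ h {inj₁ a ∷ []} nonEmpty = end ∷ []
  End-subM′ σ h {inj₂ X ∷ []} nonEmpty = AllE-⊗ {Q = λ u → u ≡ []} (λ { {u} e refl → subst End (sym (Listₚ.++-identityʳ u)) e }) (h X) (refl ∷ [])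
  End-subM′ σ h {inj₁ a ∷ y ∷ u} nonEmpty = AllE-prep (inj₁ a ∷_) (End-subM′ σ h {y ∷ u} nonEmpty)
  End-subM′ σ h {inj₂ X ∷ y ∷ u} nonEmpty = AllE-⊗ {P = λ _ → ⊤} (λ {u} _ → End-++ u) (any-mono (σ X)) (End-subM′ σ h {y ∷ u} nonEmpty)

  Full-subM : ∀ (σ : V → Expr V′) {k u} → Full k u → AllE (Full k) (subM σ u)
  Full-subM σ full-zero = All.universal (λ _ → full-zero) _
  Full-subM σ (full-suc f) = AllE-prep full-suc (Full-subM σ f)

  -- The first variable after the leading letters is replaced by an expression that begins with a
  -- letter, which adds one to their number.
  Lead-subM : ∀ (σ : V → Expr V′) → (∀ X → AllE Start (σ X)) → ∀ {k u} → Lead k u → AllE (Lead (suc k)) (subM σ u)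
  Lead-subM σ h {u = []} l = lead-nil ∷ []
  Lead-subM σ h {zero} {inj₁ a ∷ u} l = AllE-prep {P = λ _ → ⊤} (λ _ → lead-suc lead-zero) (any-mono (subM σ u))
  Lead-subM σ h {suc k} {inj₁ a ∷ u} (lead-suc l) = AllE-prep lead-suc (Lead-subM σ h l)
  Lead-subM σ h {zero} {inj₂ X ∷ u} l = AllE-⊗ {Q = λ _ → ⊤} (λ { start _ → lead-suc lead-zero }) (h X) (any-mono (subM σ u))

  Terminal : Mono V → Set
  Terminal [] = ⊤
  Terminal (inj₁ a ∷ u) = Terminal u
  Terminal (inj₂ X ∷ u) = ⊥

  terminal? : (u : Mono V) → Dec (Terminal u)
  terminal? [] = yes tt
  terminal? (inj₁ a ∷ u) = terminal? u
  terminal? (inj₂ X ∷ u) = no λ ()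

  Lead⇒Full : ∀ {k} {u : Mono V} → Lead k u → (Terminal u → ⊥) → Full k u
  Lead⇒Full lead-zero n = full-zero
  Lead⇒Full lead-nil n = ⊥-elim (n tt)
  Lead⇒Full (lead-suc l) n = full-suc (Lead⇒Full l n)

  letterPart variablePart : Expr V → Expr V
  letterPart [] = []
  letterPart ((x , u) ∷ E) with terminal? u
  ... | yes _ = (x , u) ∷ letterPart E
  ... | no _ = letterPart E
  variablePart [] = []
  variablePart ((x , u) ∷ E) with terminal? u
  ... | yes _ = variablePart E
  ... | no _ = (x , u) ∷ variablePart E

  letterPart-Terminal : ∀ (E : Expr V) → AllE Terminal (letterPart E)
  letterPart-Terminal [] = []
  letterPart-Terminal ((x , u) ∷ E) with terminal? u
  ... | yes t = t ∷ letterPart-Terminal E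
  ... | no _ = letterPart-Terminal E

  variablePart-All : ∀ {p} {P : Mono V → Set p} (E : Expr V) → AllE P E → AllE (λ u → P u × (Terminal u → ⊥)) (variablePart E)
  variablePart-All [] [] = []
  variablePart-All ((x , u) ∷ E) (p ∷ ps) with terminal? u
  ... | yes _ = variablePart-All E ps
  ... | no n = (p , n) ∷ variablePart-All E ps

  module _ {n : ℕ} (letter : Fin n → Fin m) where
    open Val letter

    val-parts : ∀ (τ : V → Mat n) E → val τ E ≋ λ i j → val τ (letterPart E) i j + val τ (variablePart E) i j
    val-parts τ [] i j = ≈-sym (+-identityˡ _)
    val-parts τ ((x , u) ∷ E) i j with terminal? u
    ... | yes _ = ≈-trans (+-congˡ (val-parts τ E i j)) (≈-sym (+-assoc _ _ _))
    ... | no _ = ≈-trans (+-congˡ (val-parts τ E i j)) (≈-trans (≈-sym (+-assoc _ _ _)) (≈-trans (+-congʳ (+-comm _ _)) (+-assoc _ _ _)))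

    mon-Terminal : ∀ (τ τ′ : V → Mat n) u → Terminal u → mon τ u ≋ mon τ′ u
    mon-Terminal τ τ′ [] t i j = ≈-refl
    mon-Terminal τ τ′ (inj₁ a ∷ u) t = 𝕄ₙ.*-congˡ {Λ letter a} (mon-Terminal τ τ′ u t)

    val-Terminal : ∀ (τ τ′ : V → Mat n) {E} → AllE Terminal E → val τ E ≋ val τ′ E
    val-Terminal τ τ′ [] i j = ≈-refl
    val-Terminal τ τ′ {(x , u) ∷ E} (t ∷ ts) i j = +-cong (*-congˡ (mon-Terminal τ τ′ u t i j)) (val-Terminal τ τ′ ts i j)

    val-single : ∀ (τ : V → Mat n) X → val τ (single X) ≋ τ X
    val-single τ X = 𝕄ₙ.trans (val-one τ (var X)) (𝕄ₙ.*-identityʳ (τ X))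

  -- A monomial Y u belongs to Y · u in the splitting of a sum along its first variables, and a monomial u Y to
  -- u · Y in the splitting along its last ones; the monomials Y themselves have coefficient 0 and are dropped.
  leftVar rightVar : ∀ {N} → Fin N → C × Mono (Fin N) → Expr (Fin N)
  leftVar Y (x , inj₂ Z ∷ y ∷ u) = if does (Y ≟ Z) then (x , y ∷ u) ∷ [] else []
  leftVar Y _ = []
  rightVar Y (x , u) with initLast u
  ... | [] = []
  ... | [] ∷ʳ′ z = []
  ... | (y ∷ v) ∷ʳ′ inj₁ a = []
  ... | (y ∷ v) ∷ʳ′ inj₂ Z = if does (Y ≟ Z) then (x , y ∷ v) ∷ [] else []

  leftLetter rightLetter : C × Mono V → Expr V
  leftLetter (x , inj₁ a ∷ u) = (x , inj₁ a ∷ u) ∷ []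
  leftLetter _ = []
  rightLetter (x , u) with initLast u
  ... | [] = []
  ... | v ∷ʳ′ inj₁ a = (x , v ∷ʳ inj₁ a) ∷ []
  ... | v ∷ʳ′ inj₂ Z = []

  data Improper {V : Set} : Mono V → Set where
    empty : Improper []
    unit : ∀ {X} → Improper (inj₂ X ∷ [])

  private
    NonEmpty-if : ∀ b {x y} {u : Mono V} → AllE NonEmpty (if b then (x , y ∷ u) ∷ [] else [])
    NonEmpty-if true = nonEmpty ∷ []
    NonEmpty-if false = []

  leftVar-NonEmpty : ∀ {N} (Y : Fin N) e → AllE NonEmpty (leftVar Y e)
  leftVar-NonEmpty Y (x , []) = []
  leftVar-NonEmpty Y (x , inj₁ a ∷ u) = []
  leftVar-NonEmpty Y (x , inj₂ Z ∷ []) = []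
  leftVar-NonEmpty Y (x , inj₂ Z ∷ y ∷ u) = NonEmpty-if (does (Y ≟ Z))

  rightVar-NonEmpty : ∀ {N} (Y : Fin N) e → AllE NonEmpty (rightVar Y e)
  rightVar-NonEmpty Y (x , u) with initLast u
  ... | [] = []
  ... | [] ∷ʳ′ z = []
  ... | (y ∷ v) ∷ʳ′ inj₁ a = []
  ... | (y ∷ v) ∷ʳ′ inj₂ Z = NonEmpty-if (does (Y ≟ Z))

  leftLetter-Start : ∀ (e : C × Mono V) → AllE Start (leftLetter e)
  leftLetter-Start (x , []) = []
  leftLetter-Start (x , inj₁ a ∷ u) = start ∷ []
  leftLetter-Start (x , inj₂ Z ∷ u) = []

  rightLetter-End : ∀ (e : C × Mono V) → AllE End (rightLetter e)
  rightLetter-End (x , u) with initLast u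
  ... | [] = []
  ... | v ∷ʳ′ inj₁ a = End-++ v end ∷ []
  ... | v ∷ʳ′ inj₂ Z = []

  module Split {N : ℕ} {n : ℕ} (letter : Fin n → Fin m) (s : Fin N → Mat n) where
    open Val letter

    private
      pick : ∀ (Z : Fin N) x u (f : Fin N → Mat n → Mat n) (i j : Fin (suc n)) → (∀ Y {M M′} → M ≋ M′ → f Y M ≋ f Y M′) → (∀ Y → f Y 𝕄ₙ.0# ≋ 𝕄ₙ.0#) →
        ∑ (allFin N) (λ Y → f Y (val s (if does (Y ≟ Z) then (x , u) ∷ [] else [])) i j) ≈ f Z (x • mon s u) i j
      pick Z x u f i j resp zer = ≈-trans (∑-only (allFin-uniq N) (allFin-mem Z) _ λ Y ne → off Y ne)
          here!
        where
        off : ∀ Y → Z ≢ Y → f Y (val s (if does (Y ≟ Z) then (x , u) ∷ [] else [])) i j ≈ 0#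
        off Y ne with Y ≟ Z
        ... | yes e = ⊥-elim (ne (sym e))
        ... | no _ = zer Y i j
        here! : f Z (val s (if does (Z ≟ Z) then (x , u) ∷ [] else [])) i j ≈ f Z (x • mon s u) i j
        here! with Z ≟ Z
        ... | yes _ = resp Z (λ i j → +-identityʳ _) i j
        ... | no ne = ⊥-elim (ne refl)

      none : ∀ (f : Fin N → Mat n → Mat n) i j → (∀ Y → f Y 𝕄ₙ.0# ≋ 𝕄ₙ.0#) → ∑ (allFin N) (λ Y → f Y 𝕄ₙ.0# i j) ≈ 0#
      none f i j z = ∑-0 (allFin N) λ Y → z Y i j

      left right : Fin N → Mat n → Mat n
      left Y M = s Y ⊛ M
      right Y M = M ⊛ s Y

      leftZero : ∀ Y → left Y 𝕄ₙ.0# ≋ 𝕄ₙ.0#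
      leftZero Y = 𝕄ₙ.zeroʳ (s Y)

      rightZero : ∀ Y → right Y 𝕄ₙ.0# ≋ 𝕄ₙ.0#
      rightZero Y = 𝕄ₙ.zeroˡ (s Y)

      gone : ∀ {x y : C} → x ≈ 0# → x * y ≈ 0#
      gone z = ≈-trans (*-congʳ z) (zeroˡ _)

      both-zero : ∀ {x y z : C} → x ≈ 0# → y ≈ 0# → z ≈ 0# → z ≈ x + y
      both-zero a b d = ≈-trans d (≈-sym (≈-trans (+-cong a b) (+-identityˡ _)))

    left-term : ∀ x u → (Improper u → x ≈ 0#) → ∀ i j → x * mon s u i j ≈
      val s (leftLetter (x , u)) i j + ∑ (allFin N) λ Y → (s Y ⊛ val s (leftVar Y (x , u))) i j
    left-term x [] imp i j = both-zero ≈-refl (none left i j leftZero) (gone (imp empty))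
    left-term x (inj₁ a ∷ u) imp i j = ≈-sym (≈-trans (+-congˡ (none left i j leftZero)) (≈-trans (+-identityʳ _) (+-identityʳ _)))
    left-term x (inj₂ Z ∷ []) imp i j = both-zero ≈-refl (none left i j leftZero) (gone (imp unit))
    left-term x (inj₂ Z ∷ y ∷ u) imp i j = ≈-sym (≈-trans (+-identityˡ _) (≈-trans
      (pick Z x (y ∷ u) left i j (λ Y → 𝕄ₙ.*-congˡ {s Y}) leftZero) (•-⊛ʳ x (s Z) (mon s (y ∷ u)) i j)))

    right-term : ∀ x u → (Improper u → x ≈ 0#) → ∀ i j → x * mon s u i j ≈
      val s (rightLetter (x , u)) i j + ∑ (allFin N) λ Y → (val s (rightVar Y (x , u)) ⊛ s Y) i j
    right-term x u imp i j with initLast u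
    ... | [] = both-zero ≈-refl (none right i j rightZero) (gone (imp empty))
    ... | [] ∷ʳ′ inj₂ Z = both-zero ≈-refl (none right i j rightZero) (gone (imp unit))
    ... | [] ∷ʳ′ inj₁ a = ≈-sym (≈-trans (+-congˡ (none right i j rightZero)) (≈-trans (+-identityʳ _) (+-identityʳ _)))
    ... | (y ∷ v) ∷ʳ′ inj₁ a = ≈-sym (≈-trans (+-congˡ (none right i j rightZero)) (≈-trans (+-identityʳ _) (+-identityʳ _)))
    ... | (y ∷ v) ∷ʳ′ inj₂ Z = ≈-sym (≈-trans (+-identityˡ _) (≈-trans
      (pick Z x (y ∷ v) right i j (λ Y e → 𝕄ₙ.*-congʳ {s Y} e) rightZero) (≈-trans (≈-sym (•-⊛ˡ x (mon s (y ∷ v)) (s Z) i j))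
        (*-congˡ (≈-sym (𝕄ₙ.trans (mon-++ s (y ∷ v) (var Z)) (𝕄ₙ.*-congˡ {mon s (y ∷ v)} (𝕄ₙ.*-identityʳ (s Z))) i j))))))

    left-split : ∀ E → All (λ (x , u) → Improper u → x ≈ 0#) E → ∀ i j → val s E i j ≈
      val s (concatMap leftLetter E) i j + ∑ (allFin N) λ Y → (s Y ⊛ val s (concatMap (leftVar Y) E)) i j
    left-split E imp i j = ≈-trans (∑-cong∈ E λ {(x , u)} k → left-term x u (All.lookup imp k) i j)
      (≈-trans (∑-+ E _ _) (+-cong (≈-sym (val-concatMap s leftLetter E i j)) (≈-trans (∑-swap E (allFin N) _) (∑-cong (allFin N) λ Y →
        ≈-sym (≈-trans (∑-cong (allFin (suc n)) λ k → ≈-trans (*-congˡ (val-concatMap s (leftVar Y) E k j)) (∑-*ˡ E _ _)) (∑-swap (allFin (suc n)) E _))))))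

    right-split : ∀ E → All (λ (x , u) → Improper u → x ≈ 0#) E → ∀ i j → val s E i j ≈
      val s (concatMap rightLetter E) i j + ∑ (allFin N) λ Y → (val s (concatMap (rightVar Y) E) ⊛ s Y) i j
    right-split E imp i j = ≈-trans (∑-cong∈ E λ {(x , u)} k → right-term x u (All.lookup imp k) i j)
      (≈-trans (∑-+ E _ _) (+-cong (≈-sym (val-concatMap s rightLetter E i j)) (≈-trans (∑-swap E (allFin N) _) (∑-cong (allFin N) λ Y →
        ≈-sym (≈-trans (∑-cong (allFin (suc n)) λ k → ≈-trans (*-congʳ (val-concatMap s (rightVar Y) E i k)) (∑-*ʳ E _ _)) (∑-swap (allFin (suc n)) E _))))))

  -- Corner matrices are indexed by the variables and have matrices over the points as entries. If
  -- these are strictly triangular, the power n + 1 of the whole vanishes, whatever N is.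
  module Blocks {N n : ℕ} where
    private
      module 𝕄ₙ = Semiring (𝕄 n)
    module ∑ᴹ = Sums (𝕄 n)

    block : Semiring c ℓ
    block = mat (𝕄 n) (ft-Fin N)

    module B = Semiring block
    open Star block using (pow; plus)

    ∑-at : ∀ {A : Set} (xs : List A) (f : A → Mat n) i j → ∑ᴹ.∑ xs f i j ≈ ∑ xs λ x → f x i j
    ∑-at [] f i j = ≈-refl
    ∑-at (x ∷ xs) f i j = +-congˡ (∑-at xs f i j)

    Band-∑ᴹ : ∀ {k} {A : Set} (xs : List A) {f : A → Mat n} → (∀ x → Band k (f x)) → Band k (∑ᴹ.∑ xs f)
    Band-∑ᴹ [] b i j lt = ≈-refl
    Band-∑ᴹ (x ∷ xs) b i j lt = ≈-trans (+-cong (b x i j lt) (Band-∑ᴹ xs b i j lt)) (+-identityˡ _)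

    module _ {a : B.Carrier} (band : ∀ Y X → Band 1 (a Y X)) where
      Band-pow : ∀ k Y X → Band k (pow a k Y X)
      Band-pow zero Y X with does (Y ≟ X)
      ... | true = Band-1
      ... | false = λ _ _ _ → ≈-refl
      Band-pow (suc k) Y X = Band-∑ᴹ (allFin N) λ Z → Band-⊛ {k = 1} {k} {a Y Z} {pow a k Z X} (band Y Z) (Band-pow k Z X)

      nilpotent : pow a (suc n) B.≈ B.0#
      nilpotent Y X = Band-all (Band-pow (suc n) Y X)

      Band-plus : ∀ k Y X → Band 0 (plus a k Y X)
      Band-plus zero Y X i j lt = ≈-refl
      Band-plus (suc k) Y X i j lt = ≈-trans (+-cong (Band-weaken {k = 1} {M = a Y X} z≤n (band Y X) i j lt)
        (Band-∑ᴹ (allFin N) {λ Z → a Y Z ⊛ plus a k Z X} (λ Z → Band-⊛ {k = 0} {0} {a Y Z} {plus a k Z X} (Band-weaken {k = 1} {M = a Y Z} z≤n (band Y Z)) (Band-plus k Z X)) i j lt))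
        (+-identityˡ _)

  module Normal {N : ℕ} (E : Fin N → Expr (Fin N)) where
    -- The variables stand for the series of X, for the star of the left-corner matrix A and for that of the
    -- right-corner matrix B, where S = ℓ + S A and S = r + B S.
    Var : Set
    Var = Fin N ⊎ (Fin N × Fin N) ⊎ (Fin N × Fin N)

    pattern series X = inj₁ X
    pattern left* Y X = inj₂ (inj₁ (Y , X))
    pattern right* X Y = inj₂ (inj₂ (X , Y))

    A B : Fin N → Fin N → Expr (Fin N)
    A Y X = concatMap (leftVar Y) (E X)
    B X Y = concatMap (rightVar Y) (E X)

    lefts rights : Fin N → Expr (Fin N)
    lefts X = concatMap leftLetter (E X)
    rights X = concatMap rightLetter (E X)

    embed : Fin N → Expr Var
    embed X = single (series X)

    -- `startS` is S = ℓ + ℓ A⁺, the solution of S = ℓ + S A, and its monomials begin with the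
    -- letters that begin those of ℓ. Dually, `endS` is S = r + B⁺ r, whose monomials end like those
    -- of r.
    startS endS : Fin N → Expr Var
    startS X = sub embed (lefts X) ++ concatMap (λ Y → sub embed (lefts Y) ⊗ single (left* Y X)) (allFin N)
    endS X = sub embed (rights X) ++ concatMap (λ Y → single (right* X Y) ⊗ sub embed (rights Y)) (allFin N)

    -- A⁺ is unfolded as A + A A⁺ to gain a letter at the beginning and as A + A⁺ A to gain one at
    -- the end, with the series inside A rewritten by `startS` or `endS`; likewise for B⁺.
    -- Substituting `Φᵉ` into `Φˢ` keeps the first letter and makes every monomial end with a
    -- letter.
    Φˢ Φᵉ Φ : Var → Expr Var
    Φˢ (series X) = startS X
    Φˢ (left* Y X) = sub startS (A Y X) ++ concatMap (λ Z → sub startS (A Y Z) ⊗ single (left* Z X)) (allFin N)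
    Φˢ (right* X Y) = sub startS (B X Y) ++ concatMap (λ Z → sub startS (B X Z) ⊗ single (right* Z Y)) (allFin N)
    Φᵉ (series X) = endS X
    Φᵉ (left* Y X) = sub endS (A Y X) ++ concatMap (λ Z → single (left* Y Z) ⊗ sub endS (A Z X)) (allFin N)
    Φᵉ (right* X Y) = sub endS (B X Y) ++ concatMap (λ Z → single (right* X Z) ⊗ sub endS (B Z Y)) (allFin N)
    Φ Z = sub Φᵉ (Φˢ Z)

    private
      A-NonEmpty : ∀ Y X → AllE NonEmpty (A Y X)
      A-NonEmpty Y X = Allₚ.concat⁺ (Allₚ.map⁺ (All.universal (leftVar-NonEmpty Y) (E X)))

      B-NonEmpty : ∀ X Y → AllE NonEmpty (B X Y)
      B-NonEmpty X Y = Allₚ.concat⁺ (Allₚ.map⁺ (All.universal (rightVar-NonEmpty Y) (E X)))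

      All-concatMap : ∀ {p} {P : Mono Var → Set p} (f : Fin N → Expr Var) → (∀ X → AllE P (f X)) → AllE P (concatMap f (allFin N))
      All-concatMap f h = Allₚ.concat⁺ (Allₚ.map⁺ (All.universal h (allFin N)))

      startˡ : ∀ {E F : Expr Var} → AllE Start E → AllE Start (E ⊗ F)
      startˡ {F = F} aE = AllE-⊗ {Q = λ _ → ⊤} (λ s _ → Start-++ s) aE (any-mono F)

      endʳ : ∀ {E F : Expr Var} → AllE End F → AllE End (E ⊗ F)
      endʳ {E} aF = AllE-⊗ {P = λ _ → ⊤} (λ {u} _ → End-++ u) (any-mono E) aF

      lefts-Start : ∀ X → AllE Start (sub embed (lefts X))
      lefts-Start X = AllE-sub embed (Start-subM embed) (Allₚ.concat⁺ (Allₚ.map⁺ (All.universal leftLetter-Start (E X))))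

      rights-End : ∀ X → AllE End (sub embed (rights X))
      rights-End X = AllE-sub embed (End-subM embed) (Allₚ.concat⁺ (Allₚ.map⁺ (All.universal rightLetter-End (E X))))

    startS-Start : ∀ X → AllE Start (startS X)
    startS-Start X = Allₚ.++⁺ (lefts-Start X) (All-concatMap _ λ Y → startˡ (lefts-Start Y))

    endS-End : ∀ X → AllE End (endS X)
    endS-End X = Allₚ.++⁺ (rights-End X) (All-concatMap _ λ Y → endʳ {single (right* X Y)} (rights-End Y))

    private
      sub-Start : ∀ {F} → AllE NonEmpty F → AllE Start (sub startS F)
      sub-Start = AllE-sub startS (Start-subM′ startS startS-Start)

      sub-End : ∀ {F} → AllE NonEmpty F → AllE End (sub endS F)
      sub-End = AllE-sub endS (End-subM′ endS endS-End)

    Φˢ-Start : ∀ Z → AllE Start (Φˢ Z)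
    Φˢ-Start (series X) = startS-Start X
    Φˢ-Start (left* Y X) = Allₚ.++⁺ (sub-Start (A-NonEmpty Y X)) (All-concatMap _ λ Z → startˡ (sub-Start (A-NonEmpty Y Z)))
    Φˢ-Start (right* X Y) = Allₚ.++⁺ (sub-Start (B-NonEmpty X Y)) (All-concatMap _ λ Z → startˡ (sub-Start (B-NonEmpty X Z)))

    Φᵉ-End : ∀ Z → AllE End (Φᵉ Z)
    Φᵉ-End (series X) = endS-End X
    Φᵉ-End (left* Y X) = Allₚ.++⁺ (sub-End (A-NonEmpty Y X)) (All-concatMap _ λ Z → endʳ {single (left* Y Z)} (sub-End (A-NonEmpty Z X)))
    Φᵉ-End (right* X Y) = Allₚ.++⁺ (sub-End (B-NonEmpty X Y)) (All-concatMap _ λ Z → endʳ {single (right* X Z)} (sub-End (B-NonEmpty Z Y)))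

    Φ-Start : ∀ Z → AllE Start (Φ Z)
    Φ-Start Z = AllE-sub Φᵉ (Start-subM Φᵉ) (Φˢ-Start Z)

    Φ-End : ∀ Z → AllE End (Φ Z)
    Φ-End Z = AllE-sub Φᵉ (λ { {inj₁ a ∷ u} start → End-subM′ Φᵉ Φᵉ-End {inj₁ a ∷ u} nonEmpty }) (Φˢ-Start Z)

    iterate : ℕ → Var → Expr Var
    iterate zero = Φ
    iterate (suc k) Z = sub Φ (iterate k Z)

    iterate-Lead : ∀ k Z → AllE (Lead (suc k)) (iterate k Z)
    iterate-Lead zero Z = All.map (λ { start → lead-suc lead-zero }) (Φ-Start Z)
    iterate-Lead (suc k) Z = AllE-sub Φ (Lead-subM Φ Φ-Start) (iterate-Lead k Z)

    iterate-End : ∀ k Z → AllE End (iterate k Z)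
    iterate-End zero Z = Φ-End Z
    iterate-End (suc k) Z = AllE-sub Φ (End-subM Φ) (iterate-End k Z)

    ft-Var : FT Var
    ft-Var = ft-⊎ (ft-Fin N) (ft-⊎ (ft-× (ft-Fin N) (ft-Fin N)) (ft-× (ft-Fin N) (ft-Fin N)))

    N′ : ℕ
    N′ = length (FT.en ft-Var)

    private
      depth : ℕ
      -- Unless a monomial has letters only, `iterate depth` gives it N′ + 3 leading letters. The
      -- frame takes the first of them, and its last letter is allowed for by one more, so N′ + 1
      -- remain as the coding requires.
      depth = suc (suc N′)

    short long : Var → Expr Var
    short Z = letterPart (iterate depth Z)
    long Z = variablePart (iterate depth Z)

    -- The words of letters among the alternatives for Z may be too short for a mark. The new
    -- variable omits them, and each occurrence of Z is replaced by these words plus the variable.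
    withShort : Var → Expr Var
    withShort Z = short Z ++ single Z

    long-good : ∀ Z → AllE (λ u → Full (suc depth) u × End u) (long Z)
    long-good Z = All.map (λ ((l , e) , n) → Lead⇒Full l n , e) (variablePart-All (iterate depth Z) (All.zip (iterate-Lead depth Z , iterate-End depth Z)))

    idx : Var → Fin N′
    idx Z = index (FT.mem ft-Var Z)

    rename : Var → Expr (Fin N′)
    rename = single ∘ idx

    normal : Fin N′ → Expr (Fin N′)
    normal k = sub rename (sub withShort (long (lookup (FT.en ft-Var) k)))

    root : Fin N → Expr (Fin N′)
    root X = sub rename (withShort (series X))

    normal-good : ∀ k → AllE (λ u → Full (suc depth) u × End u) (normal k)
    normal-good k = AllE-sub rename (λ (f , e) → All.zip (Full-subM rename f , End-subM rename e))
      (AllE-sub withShort (λ (f , e) → All.zip (Full-subM withShort f , End-subM withShort e)) (long-good (lookup (FT.en ft-Var) k)))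

    frame : ∀ (F : Expr (Fin N′)) → AllE (λ u → Full (suc depth) u × End u) F →
      Σ (List (Framed (Fin N′))) λ G → map unframe G ≡ F × All (λ (_ , _ , u , _) → Full (suc N′) u) G
    frame [] [] = [] , refl , []
    frame ((x , inj₁ a ∷ u) ∷ F) ((full-suc f , _ ∷ e) ∷ h) =
      let (v , b , eq) = unsnoc e ; (G , eqs , g) = frame F h in
      (x , a , v , b) ∷ G , cong₂ _∷_ (cong (λ u → x , inj₁ a ∷ u) (sym eq)) eqs , init-Full v (subst (Full _) eq f) ∷ g
      where
      unsnoc : ∀ {u : Mono (Fin N′)} → End u → Σ (Mono (Fin N′)) λ v → Σ (Fin m) λ b → u ≡ v ++ inj₁ b ∷ []
      unsnoc (end {b}) = [] , b , refl
      unsnoc (y ∷ e) = let (v , b , eq) = unsnoc e in y ∷ v , b , cong (y ∷_) eq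
      init-Full : ∀ {k} (v : Mono (Fin N′)) {y} → Full (suc k) (v ++ y ∷ []) → Full k v
      init-Full {zero} v f = full-zero
      init-Full {suc k} [] (full-suc ())
      init-Full {suc k} (_ ∷ v) (full-suc f) = full-suc (init-Full v f)
    frame ((x , inj₁ a ∷ []) ∷ F) ((full-suc () , end) ∷ h)

    framed : ∀ k → Σ (List (Framed (Fin N′))) λ G → map unframe G ≡ normal k × All (λ (_ , _ , u , _) → Full (suc N′) u) G
    framed k = frame (normal k) (normal-good k)

    module Solution {n : ℕ} (letter : Fin n → Fin m) (s : Fin N → Mat n) (s-Band : ∀ X → Band 1 (s X))
      (proper : ∀ X → All (λ (x , u) → Improper u → x ≈ 0#) (E X)) (s-eq : ∀ X → s X ≋ Val.val letter s (E X)) where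
      open Val letter
      open Blocks {N} {n}
      open Star block
      open Split letter s

      a b : B.Carrier
      a Y X = val s (A Y X)
      b X Y = val s (B X Y)

      private
        Band-nonEmpty : ∀ {F} → AllE NonEmpty F → Band 1 (val s F)
        Band-nonEmpty {F} ne i j lt = ∑-0∈ F λ {(x , u)} k → ≈-trans (*-congˡ (go u (All.lookup ne k) i j lt)) (zeroʳ _)
          where
          rest : ∀ u → Band 0 (mon s u)
          rest = mon-Band λ X → Band-weaken {k = 1} {M = s X} z≤n (s-Band X)
          go : ∀ u → NonEmpty u → Band 1 (mon s u)
          go (inj₁ d ∷ u) nonEmpty = Band-⊛ {k = 1} {0} {Λ letter d} {mon s u} (Λ-Band letter d) (rest u)
          go (inj₂ X ∷ u) nonEmpty = Band-⊛ {k = 1} {0} {s X} {mon s u} (s-Band X) (rest u)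

        a-Band : ∀ Y X → Band 1 (a Y X)
        a-Band Y X = Band-nonEmpty (A-NonEmpty Y X)

        b-Band : ∀ X Y → Band 1 (b X Y)
        b-Band X Y = Band-nonEmpty (B-NonEmpty X Y)

        a⁺ b⁺ : B.Carrier
        a⁺ = plus a n
        b⁺ = plus b n

        row-eq : ∀ X → s X ≋ λ i j → val s (lefts X) i j + ∑ (allFin N) λ Y → (val s (lefts Y) ⊛ a⁺ Y X) i j
        -- `solveʳ` works with square block matrices, so the rows ℓ and S are repeated in every row.
        row-eq X i j = ≈-trans (solveʳ {a} {n} (nilpotent {a} a-Band) {λ _ X → val s (lefts X)} {λ _ X → s X}
            (λ _ X i j → ≈-trans (s-eq X i j) (≈-trans (left-split (E X) (proper X) i j) (+-congˡ (≈-sym (∑-at (allFin N) _ i j))))) X X i j)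
          (+-congˡ (∑-at (allFin N) _ i j))

        column-eq : ∀ X → s X ≋ λ i j → val s (rights X) i j + ∑ (allFin N) λ Y → (b⁺ X Y ⊛ val s (rights Y)) i j
        column-eq X i j = ≈-trans (solveˡ {b} {n} (nilpotent {b} b-Band) {λ X _ → val s (rights X)} {λ X _ → s X}
            (λ X _ i j → ≈-trans (s-eq X i j) (≈-trans (right-split (E X) (proper X) i j) (+-congˡ (≈-sym (∑-at (allFin N) _ i j))))) X X i j)
          (+-congˡ (∑-at (allFin N) _ i j))

      τ : Var → Mat n
      τ (series X) = s X
      τ (left* Y X) = a⁺ Y X
      τ (right* X Y) = b⁺ X Y

      private
        val-embed : ∀ F → val τ (sub embed F) ≋ val s F
        val-embed F = val-sub embed (λ X → val-single letter τ (series X)) F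

        ⊗-single : ∀ F Z → val τ (F ⊗ single Z) ≋ val τ F ⊛ τ Z
        ⊗-single F Z = 𝕄ₙ.trans (val-⊗ τ F (single Z)) (𝕄ₙ.*-congˡ {val τ F} (val-single letter τ Z))

        single-⊗ : ∀ F Z → val τ (single Z ⊗ F) ≋ τ Z ⊛ val τ F
        single-⊗ F Z = 𝕄ₙ.trans (val-⊗ τ (single Z) F) (𝕄ₙ.*-congʳ {val τ F} (val-single letter τ Z))

        shape : ∀ F (G : Fin N → Expr Var) {M : Mat n} {R : Fin N → Mat n} → val τ F ≋ M → (∀ Y → val τ (G Y) ≋ R Y) → ∀ i j →
          val τ (F ++ concatMap G (allFin N)) i j ≈ M i j + ∑ (allFin N) λ Y → R Y i j
        shape F G e h i j = ≈-trans (val-++ τ F (concatMap G (allFin N)) i j) (+-cong (e i j)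
          (≈-trans (val-concatMap τ G (allFin N) i j) (∑-cong (allFin N) λ Y → h Y i j)))

        startS-val : ∀ X → val τ (startS X) ≋ s X
        startS-val X i j = ≈-trans (shape (sub embed (lefts X)) (λ Y → sub embed (lefts Y) ⊗ single (left* Y X)) (val-embed (lefts X))
            (λ Y → 𝕄ₙ.trans (⊗-single (sub embed (lefts Y)) (left* Y X)) (𝕄ₙ.*-congʳ {a⁺ Y X} (val-embed (lefts Y)))) i j)
          (≈-sym (row-eq X i j))

        endS-val : ∀ X → val τ (endS X) ≋ s X
        endS-val X i j = ≈-trans (shape (sub embed (rights X)) (λ Y → single (right* X Y) ⊗ sub embed (rights Y)) (val-embed (rights X))
            (λ Y → 𝕄ₙ.trans (single-⊗ (sub embed (rights Y)) (right* X Y)) (𝕄ₙ.*-congˡ {b⁺ X Y} (val-embed (rights Y)))) i j)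
          (≈-sym (column-eq X i j))

        val-startS : ∀ F → val τ (sub startS F) ≋ val s F
        val-startS F = val-sub startS startS-val F

        val-endS : ∀ F → val τ (sub endS F) ≋ val s F
        val-endS F = val-sub endS endS-val F

        Φˢ-val : ∀ Z → val τ (Φˢ Z) ≋ τ Z
        Φˢ-val (series X) = startS-val X
        Φˢ-val (left* Y X) i j = ≈-trans (shape (sub startS (A Y X)) (λ Z → sub startS (A Y Z) ⊗ single (left* Z X)) (val-startS (A Y X))
            (λ Z → 𝕄ₙ.trans (⊗-single (sub startS (A Y Z)) (left* Z X)) (𝕄ₙ.*-congʳ {a⁺ Z X} (val-startS (A Y Z)))) i j)
          (≈-sym (≈-trans (plus-fixˡ {a} {n} (nilpotent {a} a-Band) Y X i j) (+-congˡ (∑-at (allFin N) _ i j))))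
        Φˢ-val (right* X Y) i j = ≈-trans (shape (sub startS (B X Y)) (λ Z → sub startS (B X Z) ⊗ single (right* Z Y)) (val-startS (B X Y))
            (λ Z → 𝕄ₙ.trans (⊗-single (sub startS (B X Z)) (right* Z Y)) (𝕄ₙ.*-congʳ {b⁺ Z Y} (val-startS (B X Z)))) i j)
          (≈-sym (≈-trans (plus-fixˡ {b} {n} (nilpotent {b} b-Band) X Y i j) (+-congˡ (∑-at (allFin N) _ i j))))

        Φᵉ-val : ∀ Z → val τ (Φᵉ Z) ≋ τ Z
        Φᵉ-val (series X) = endS-val X
        Φᵉ-val (left* Y X) i j = ≈-trans (shape (sub endS (A Y X)) (λ Z → single (left* Y Z) ⊗ sub endS (A Z X)) (val-endS (A Y X))
            (λ Z → 𝕄ₙ.trans (single-⊗ (sub endS (A Z X)) (left* Y Z)) (𝕄ₙ.*-congˡ {a⁺ Y Z} (val-endS (A Z X)))) i j)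
          (≈-sym (≈-trans (plus-fixʳ {a} {n} (nilpotent {a} a-Band) Y X i j) (+-congˡ (∑-at (allFin N) _ i j))))
        Φᵉ-val (right* X Y) i j = ≈-trans (shape (sub endS (B X Y)) (λ Z → single (right* X Z) ⊗ sub endS (B Z Y)) (val-endS (B X Y))
            (λ Z → 𝕄ₙ.trans (single-⊗ (sub endS (B Z Y)) (right* X Z)) (𝕄ₙ.*-congˡ {b⁺ X Z} (val-endS (B Z Y)))) i j)
          (≈-sym (≈-trans (plus-fixʳ {b} {n} (nilpotent {b} b-Band) X Y i j) (+-congˡ (∑-at (allFin N) _ i j))))

        Φ-val : ∀ Z → val τ (Φ Z) ≋ τ Z
        Φ-val Z = 𝕄ₙ.trans (val-sub Φᵉ Φᵉ-val (Φˢ Z)) (Φˢ-val Z)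

        iterate-val : ∀ k Z → val τ (iterate k Z) ≋ τ Z
        iterate-val zero Z = Φ-val Z
        iterate-val (suc k) Z = 𝕄ₙ.trans (val-sub Φ Φ-val (iterate k Z)) (iterate-val k Z)

        τ-Band : ∀ Z → Band 0 (τ Z)
        τ-Band (series X) = Band-weaken {k = 1} {M = s X} z≤n (s-Band X)
        τ-Band (left* Y X) = Band-plus {a} a-Band n Y X
        τ-Band (right* X Y) = Band-plus {b} b-Band n X Y

        T₀ : Var → Mat n
        T₀ Z = val τ (long Z)

        -- A word of letters has the same value under every assignment, so the two parts together
        -- give the value of the unsplit expression.
        withShort-val : ∀ Z → val T₀ (withShort Z) ≋ τ Z
        withShort-val Z i j = ≈-trans (val-++ T₀ (short Z) (single Z) i j) (≈-trans (+-cong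
            (val-Terminal letter T₀ τ (letterPart-Terminal (iterate depth Z)) i j) (val-single letter T₀ Z i j))
          (≈-trans (≈-sym (val-parts letter τ (iterate depth Z) i j)) (iterate-val depth Z i j)))

      T : Fin N′ → Mat n
      T k = T₀ (lookup (FT.en ft-Var) k)

      private
        rename-val : ∀ F → val T (sub rename F) ≋ val T₀ F
        rename-val F = val-sub rename (λ Z → 𝕄ₙ.trans (val-single letter T (idx Z))
          (λ i j → reflexive (cong (λ Z → T₀ Z i j) (sym (lookup-index (FT.mem ft-Var Z)))))) F

      T-Band : ∀ k → Band 0 (T k)
      T-Band k = Band-val (long (lookup (FT.en ft-Var) k)) τ-Band

      T-eq : ∀ k → T k ≋ val T (map unframe (proj₁ (framed k)))
      T-eq k = 𝕄ₙ.trans (𝕄ₙ.sym (𝕄ₙ.trans (rename-val (sub withShort (long Z))) (val-sub withShort withShort-val (long Z))))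
        (λ i j → reflexive (cong (λ F → val T F i j) (sym (proj₁ (proj₂ (framed k))))))
        where Z = lookup (FT.en ft-Var) k

      root-eq : ∀ X → val T (root X) ≋ s X
      root-eq X = 𝕄ₙ.trans (rename-val (withShort (series X))) (withShort-val (series X))

  module _ (S : List (Fin m) → C) where
    open Hat K m

    Algebraic⇒Cond3 : Algebraic K m S → Cond3 K m S
    Algebraic⇒Cond3 (N , P , proper , Sol , isSol , quasi , X₀ , eS) =
      Code.normal-form⇒Cond3 (proj₁ ∘ framed) (root X₀) (proj₂ ∘ proj₂ ∘ framed) S (≈-trans (eS []) (quasi X₀)) λ x v →
        let open Solution (lookup (x ∷ v)) (λ X → hat (Sol X) (x ∷ v)) (λ X → hat-Band1 (Sol X) (x ∷ v) (quasi X)) improper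
              (λ X i j → ≈-trans (hat-cong (sol X) (x ∷ v) i j) (hat-val Sol (E X) (x ∷ v) i j))
        in T , T-Band , T-eq , ≈-trans (eS (x ∷ v)) (≈-trans (reflexive (sym (hat-full (Sol X₀) (x ∷ v)))) (≈-sym (root-eq X₀ zero (fromℕ (suc (length v))))))
      where
      E : Fin N → Expr (Fin N)
      E X = map (λ u → Polynomial.coeff (P X) u , u) (Polynomial.supp (P X))
      open Normal E
      sol : ∀ X w → Sol X w ≈ valS Sol (E X) w
      sol X w = ≈-trans (isSol X w) (reflexive (sym (∑-map _ (Polynomial.supp (P X)) _)))
      improper : ∀ X → All (λ (x , u) → Improper u → x ≈ 0#) (E X)
      improper X = Allₚ.map⁺ (All.universal (λ { _ empty → proj₁ (proper X) ; _ (unit {Y}) → proj₂ (proper X) Y }) _)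

-- The equivalences.

open import Defs

theorem6p9 : ∀ {c ℓ} (K : CommutativeSemiring c ℓ) →
    ¬ (CommutativeSemiring._≈_ K (CommutativeSemiring.0# K) (CommutativeSemiring.1# K)) →
    (m : ℕ) (S : Series K m) →
    (Cond1 K m S ⇔ Cond2 K m S) × (Cond1 K m S ⇔ Cond3 K m S)
-- Conditions (2) and (3) both lead to a weighted tree automaton, from which (1) and (2) follow. Out
-- of a system only the formula is constructed, so (1) implies (2) by way of (3).
theorem6p9 K _ m S = mk⇔ (weight⇒2 ∘ Cond3⇒weight S ∘ Algebraic⇒Cond3 S) (weight⇒1 ∘ Cond2⇒weight S) ,
    mk⇔ (Algebraic⇒Cond3 S) (weight⇒1 ∘ Cond3⇒weight S)
  where
  open TreeAutomata K
  open Regularity K m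
  open Recognizable K m
  open NormalForm K m
  weight⇒1 = λ (𝒜 , S[] , S∷) → ToSystem.weight⇒algebraic 𝒜 S S[] S∷
  weight⇒2 = λ (𝒜 , S[] , S∷) → ToWNWA.weight⇒Cond2 𝒜 S S[] S∷
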